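{- The cycle index sum of the class $\mathcal D$ of unlabeled (unrooted) dissections is $$Z(\mathcal D)=-\frac12\sum_{d\ge1}\frac{\varphi(d)}{d}\log\Big(\frac34-\frac14 s_d+\frac14\sqrt{s_d^2-6s_d+1}\Big)+\frac{s_2+s_1^2-4s_1-2}{16}+\frac{s_1^2-3s_1^2s_2+2s_1s_2}{16s_2^2}+\frac{3-s_1}{16}\sqrt{s_1^2-6s_1+1}-\frac1{16}\Big(1+\frac{s_1^2}{s_2^2}+\frac{2s_1}{s_2}\Big)\sqrt{s_2^2-6s_2+1},$$ where $\varphi$ is Euler's totient function.
   Context: For a group $A$ of permutations of $\{1,\dots,n\}$, its cycle index is $Z(A)=\frac1{|A|}\sum_{\alpha\in A}\prod_{k=1}^n s_k^{j_k(\alpha)}$, where $j_k(\alpha)$ is the number of $k$-cycles of $\alpha$ and $s_1,s_2,\dots$ are formal variables. For a graph $G$, $Z(G)$ is the cycle index of its automorphism group acting on its vertices, and for a class $\mathcal K$ of unlabeled graphs (one representative per isomorphism class) the cycle index sum is $Z(\mathcal K)=\sum_{K\in\mathcal K}Z(K)$. A dissection is a two-connected outerplanar graph with at least three vertices (equivalently a convex polygon together with non-crossing diagonals, the polygon being the unique Hamiltonian cycle). By convention the class $\mathcal D$ also contains the single edge $K_2$, but not the single vertex. -}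

module Defs where

open import Data.Bool using (Bool; true; false; _∧_; _∨_; not; if_then_else_)
open import Data.Nat as ℕ using (ℕ; zero; suc; _∸_; _≡ᵇ_; _<ᵇ_)
open import Data.Nat.GCD using (gcd)
open import Data.Integer as ℤ using (ℤ; +_)
open import Data.Rational as ℚ using (ℚ; 0ℚ; 1ℚ; _/_)
open import Data.Fin using (Fin; toℕ)
open import Data.Vec as Vec using (Vec; lookup)
open import Data.List using (List; []; _∷_; [_]; _++_; map; concatMap; upTo; allFin; filterᵇ; length; foldr; replicate)
open import Data.Bool.ListAction using (all; any)
open import Data.Product using (_×_; _,_)

-- Formal power series in the infinitely many variables s_1, s_2, ...
-- over ℚ.  A monomial s_1^{j_1} s_2^{j_2} ... s_r^{j_r} is written as the
-- exponent list [j_1, ..., j_r]; lists differing only by trailing zeros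
-- denote the same monomial.  A series is its coefficient function.

Mono : Set
Mono = List ℕ

allZero : Mono → Bool
allZero = all (λ k → k ≡ᵇ 0)

sameMono : Mono → Mono → Bool
sameMono []      b       = allZero b
sameMono (x ∷ a) []      = allZero (x ∷ a)
sameMono (x ∷ a) (y ∷ b) = (x ≡ᵇ y) ∧ sameMono a b

totDeg : Mono → ℕ
totDeg = foldr ℕ._+_ 0

-- weight  1*j_1 + 2*j_2 + ...  (= number of points permuted)
weightFrom : ℕ → Mono → ℕ
weightFrom i []      = 0
weightFrom i (x ∷ m) = suc i ℕ.* x ℕ.+ weightFrom (suc i) m

weight : Mono → ℕ
weight = weightFrom 0

boxes : Mono → List Mono
boxes []      = [ [] ]
boxes (k ∷ m) = concatMap (λ i → map (i ∷_) (boxes m)) (upTo (suc k))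

-- componentwise quotient of monomials m / a (a divides m)
_∸ₘ_ : Mono → Mono → Mono
[]      ∸ₘ _       = []
(x ∷ a) ∸ₘ []      = x ∷ a
(x ∷ a) ∸ₘ (y ∷ b) = (x ∸ y) ∷ (a ∸ₘ b)

Series : Set
Series = Mono → ℚ

ΣQ : List ℚ → ℚ
ΣQ = foldr ℚ._+_ 0ℚ

constS : ℚ → Series
constS c m = if allZero m then c else 0ℚ

-- sv e is the variable s_{e+1}
sv : ℕ → Series
sv e m = if sameMono m (replicate e 0 ++ [ 1 ]) then 1ℚ else 0ℚ

addS : Series → Series → Series
addS f g m = f m ℚ.+ g m

scaleS : ℚ → Series → Series
scaleS c f m = c ℚ.* f m

mulS : Series → Series → Series
mulS f g m = ΣQ (map (λ a → f a ℚ.* g (m ∸ₘ a)) (boxes m))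

powS : Series → ℕ → Series
powS f zero    = constS 1ℚ
powS f (suc k) = mulS f (powS f k)

sumS : List Series → Series
sumS = foldr addS (constS 0ℚ)

-- Substitution of a series u WITH ZERO CONSTANT TERM into the univariate
-- power series  Σ_k c k x^k.  (u^k only has monomials of total degree ≥ k,
-- so the coefficient of m only receives contributions from k ≤ totDeg m.)
compose : (ℕ → ℚ) → Series → Series
compose c u m = ΣQ (map (λ k → c k ℚ.* powS u k m) (upTo (suc (totDeg m))))

binomHalf : ℕ → ℚ
binomHalf zero    = 1ℚ
binomHalf (suc k) =
  binomHalf k ℚ.* ((+ 1 ℤ.- + (2 ℕ.* k)) / suc (suc (2 ℕ.* k)))

sgn : ℕ → ℤ
sgn zero    = + 1
sgn (suc k) = ℤ.- sgn k

logCoeff : ℕ → ℚ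
logCoeff zero    = 0ℚ
logCoeff (suc k) = sgn k / suc k

-- √(1+u) and log(1+u) for u with zero constant term
sqrt1p : Series → Series
sqrt1p = compose binomHalf

log1p : Series → Series
log1p = compose logCoeff

-- √f and log f for a series f with constant term 1
sqrtS : Series → Series
sqrtS f = sqrt1p (addS f (constS (ℚ.- 1ℚ)))

logS : Series → Series
logS f = log1p (addS f (constS (ℚ.- 1ℚ)))

totient : ℕ → ℕ
totient d = length (filterᵇ (λ k → gcd k d ≡ᵇ 1) (map suc (upTo d)))

_==_ : ∀ {n} → Fin n → Fin n → Bool
i == j = toℕ i ≡ᵇ toℕ j

_⇔ᵇ_ : Bool → Bool → Bool
true  ⇔ᵇ b = b
false ⇔ᵇ b = not b

pairs : (n : ℕ) → List (Fin n × Fin n)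
pairs n = concatMap (λ i → map (i ,_) (filterᵇ (λ j → toℕ i <ᵇ toℕ j) (allFin n))) (allFin n)

sublists : ∀ {A : Set} → List A → List (List A)
sublists []      = [ [] ]
sublists (x ∷ xs) = let r = sublists xs in r ++ map (x ∷_) r

-- a simple graph on Fin n is given by its edge set, a sublist of pairs n
Graph : ℕ → Set
Graph n = List (Fin n × Fin n)

graphs : (n : ℕ) → List (Graph n)
graphs n = sublists (pairs n)

adj : ∀ {n} → Graph n → Fin n → Fin n → Bool
adj G i j = any (λ { (a , b) → ((a == i) ∧ (b == j)) ∨ ((a == j) ∧ (b == i)) }) G

forallFin : ∀ {n} → (Fin n → Bool) → Bool
forallFin {n} p = all p (allFin n)

allVecs : (n k : ℕ) → List (Vec (Fin n) k)
allVecs n zero    = [ Vec.[] ]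
allVecs n (suc k) = concatMap (λ i → map (i Vec.∷_) (allVecs n k)) (allFin n)

isPerm : ∀ {n} → Vec (Fin n) n → Bool
isPerm σ = forallFin (λ i → forallFin (λ j → not (lookup σ i == lookup σ j) ∨ (i == j)))

perms : (n : ℕ) → List (Vec (Fin n) n)
perms n = filterᵇ isPerm (allVecs n n)

isIso : ∀ {n} → Graph n → Graph n → Vec (Fin n) n → Bool
isIso H G σ = forallFin (λ i → forallFin (λ j →
  adj H i j ⇔ᵇ adj G (lookup σ i) (lookup σ j)))

autos : ∀ {n} → Graph n → List (Vec (Fin n) n)
autos {n} G = filterᵇ (isIso G G) (perms n)

-- Dissections: K_2, or (n ≥ 3) a graph having a Hamiltonian cycle
-- π_0 π_1 ... π_{n-1} π_0 (the polygon) such that no two edges cross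
-- with respect to this cyclic order (non-crossing diagonals).
isDissection : (n : ℕ) → Graph n → Bool
isDissection zero G = false
isDissection (suc zero) G = false
isDissection (suc (suc zero)) G = adj G Fin.zero (Fin.suc Fin.zero)
  where import Data.Fin as Fin
isDissection n@(suc (suc (suc k))) G = any polygon (perms n)
  where
  consecutive : Fin n → Fin n → Bool
  consecutive i j = (toℕ j ≡ᵇ suc (toℕ i)) ∨ ((suc (toℕ i) ≡ᵇ n) ∧ (toℕ j ≡ᵇ 0))
  polygon : Vec (Fin n) n → Bool
  polygon π =
    forallFin (λ i → forallFin (λ j →
      not (consecutive i j) ∨ adj G (lookup π i) (lookup π j)))
    ∧ forallFin (λ a → forallFin (λ b → forallFin (λ c → forallFin (λ d →
      not ((toℕ a <ᵇ toℕ b) ∧ (toℕ b <ᵇ toℕ c) ∧ (toℕ c <ᵇ toℕ d)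
           ∧ adj G (lookup π a) (lookup π c) ∧ adj G (lookup π b) (lookup π d))))))

iter : ∀ {n} → Vec (Fin n) n → ℕ → Fin n → Fin n
iter σ zero    x = x
iter σ (suc k) x = lookup σ (iter σ k x)

hasPeriod : ∀ {n} → Vec (Fin n) n → ℕ → Fin n → Bool
hasPeriod σ k x = (iter σ k x == x) ∧ all (λ k' → not (iter σ (suc k') x == x)) (upTo (k ∸ 1))

numCycles : ∀ {n} → Vec (Fin n) n → ℕ → ℕ
numCycles σ zero    = 0
numCycles {n} σ (suc k) = length (filterᵇ (hasPeriod σ (suc k)) (allFin n)) ℕ./ suc k

cycleType : ∀ {n} → Vec (Fin n) n → Mono
cycleType {n} σ = map (λ e → numCycles σ (suc e)) (upTo n)

-- a / b in ℚ (only used with b ≥ 1)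
frac : ℕ → ℕ → ℚ
frac a zero    = 0ℚ
frac a (suc b) = + a / suc b

cycleIndex : ∀ {n} → Graph n → Series
cycleIndex G m =
  frac (length (filterᵇ (λ σ → sameMono (cycleType σ) m) (autos G))) (length (autos G))

classSize : ∀ {n} → Graph n → ℕ
classSize {n} G = length (filterᵇ (λ H → any (isIso H G) (perms n)) (graphs n))

-- Cycle index sum Z(𝒟) over unlabeled dissections (one representative per
-- isomorphism class): summing Z(G)/|class of G| over all labeled
-- dissections G on Fin n counts each isomorphism class exactly once.
-- Only graphs with n = weight m vertices contribute to the coefficient of m;
-- we sum over all n ≤ weight m.
ZD : Series
ZD m = ΣQ (map (λ n → ΣQ (map (λ G → cycleIndex G m ℚ.* frac 1 (classSize G))
                               (filterᵇ (isDissection n) (graphs n))))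
               (upTo (suc (weight m))))

s1 s2 : Series
s1 = sv 0
s2 = sv 1

q : ℤ → ℚ
q z = z / 1

Lterm : Series → Series
Lterm s = logS (addS (constS (+ 3 / 4))
                 (addS (scaleS (ℤ.- + 1 / 4) s)
                       (scaleS (+ 1 / 4) (sqrtS (addS (powS s 2) (addS (scaleS (q (ℤ.- + 6)) s) (constS 1ℚ)))))))

partialSum : ℕ → Series
partialSum N = sumS (map (λ e → scaleS (ℤ.- + 1 / 2) (scaleS (+ totient (suc e) / suc e) (Lterm (sv e)))) (upTo N))

sqrtA : Series → Series
sqrtA s = sqrtS (addS (powS s 2) (addS (scaleS (q (ℤ.- + 6)) s) (constS 1ℚ)))

restTimes16s2² : Series
restTimes16s2² =
  sumS ( mulS (powS s2 2) (sumS (s2 ∷ powS s1 2 ∷ scaleS (q (ℤ.- + 4)) s1 ∷ constS (q (ℤ.- + 2)) ∷ []))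
       ∷ sumS (powS s1 2 ∷ scaleS (q (ℤ.- + 3)) (mulS (powS s1 2) s2) ∷ scaleS (q (+ 2)) (mulS s1 s2) ∷ [])
       ∷ mulS (mulS (powS s2 2) (addS (constS (q (+ 3))) (scaleS (q (ℤ.- + 1)) s1))) (sqrtA s1)
       ∷ scaleS (q (ℤ.- + 1)) (mulS (sumS (powS s2 2 ∷ powS s1 2 ∷ scaleS (q (+ 2)) (mulS s1 s2) ∷ [])) (sqrtA s2))
       ∷ [])

rhsTimes16s2² : ℕ → Series
rhsTimes16s2² N = addS (scaleS (q (+ 16)) (mulS (powS s2 2) (partialSum N))) restTimes16s2²

lhsTimes16s2² : Series
lhsTimes16s2² = scaleS (q (+ 16)) (mulS (powS s2 2) ZD)

-- Weighting labelled graphs by 1 / |class| and expanding Z(G), the orbit–stabiliser theorem turns n! times the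
-- n-vertex part of Z(𝒟) into the sum of s^(cycle type of σ) over all pairs of a labelled dissection and an automorphism σ.
-- No diagonal can lie on a Hamiltonian cycle, so every dissection has exactly one; moving it to the standard polygon
-- leaves 1 / 2n times the sum over the dihedral group of the cycle type monomials, weighted by the number of fixed dissections.
-- Dissections with a root edge are Schröder trees, counted by w = x + w² / (1 - w).  Those fixed by a rotation with g cycles
-- correspond to a forest with g leaves and a marked leaf of its last tree, read off from the longest arc over a fixed edge;
-- those fixed by a reflection correspond to the trees obtained by folding the polygon along the axis.
-- On the analytic side √(s² - 6s + 1) = 1 + s - 4w, and logarithms are recognised by applying the Euler derivation θ,
-- which annihilates constants only and satisfies θ (log f) = θ f / f.

module Submission where

open import Defs
open import Data.Bool using (Bool; true; false; _∧_; _∨_; not; if_then_else_; T)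
open import Data.Bool.Properties using (T?; T-∧; T-∨; T-≡)
open import Data.Bool.ListAction using (any)
open import Data.Nat using (ℕ; zero; suc; _+_; _*_; _∸_; _≤_; _<_; z≤n; s≤s; s≤s⁻¹; _≡ᵇ_; _<ᵇ_; _≤?_; _<?_; NonZero; >-nonZero)
open import Data.Nat.Properties
open import Data.Nat.Divisibility
open import Data.Nat.GCD
open import Data.Nat.DivMod hiding (_div_; _divMod_)
open import Data.Integer using (ℤ)
import Data.Integer as ℤ
import Data.Integer.Properties as ℤP
open import Data.Rational using (ℚ; 0ℚ; 1ℚ)
import Data.Rational as ℚ
import Data.Rational.Properties as ℚP
import Data.Rational.Unnormalised as ℚᵘ
import Data.Rational.Unnormalised.Properties as ℚᵘP
open import Data.Rational.Solver using (module +-*-Solver)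
open import Data.Fin using (Fin; toℕ)
import Data.Fin as F
import Data.Fin.Properties as FP
open import Data.Vec using (Vec; lookup; tabulate)
import Data.Vec as Vec
import Data.Vec.Properties as VP
open import Data.List using (List; []; _∷_; [_]; _++_; map; concatMap; upTo; applyUpTo; allFin; filterᵇ; filter; length; foldr; replicate; cartesianProduct; cartesianProductWith)
open import Data.Nat.ListAction using (sum)
open import Data.List.Properties using (map-∘; map-cong; length-map; length-++; length-upTo; length-tabulate)
open import Data.List.Membership.Propositional using (_∈_; find; lose)
open import Data.List.Membership.Propositional.Properties
open import Data.List.Relation.Unary.Any using (here; there)
import Data.List.Relation.Unary.Any.Properties as AnyP
open import Data.List.Relation.Unary.All using (All; []; _∷_)
import Data.List.Relation.Unary.All as All
import Data.List.Relation.Unary.All.Properties as AllP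
open import Data.List.Relation.Unary.AllPairs using ([]; _∷_)
open import Data.List.Relation.Unary.Unique.Propositional using (Unique)
import Data.List.Relation.Unary.Unique.Propositional.Properties as UP
open import Data.Product using (_×_; _,_; proj₁; proj₂; ∃-syntax)
open import Data.Sum using (_⊎_; inj₁; inj₂)
open import Data.Empty using (⊥; ⊥-elim)
open import Data.Unit using (tt)
open import Function using (_∘_; id; Equivalence)
open import Relation.Nullary using (¬_; yes; no; Dec)
open import Relation.Nullary.Decidable using (⌊_⌋; toWitness; fromWitness; _×-dec_; _⊎-dec_)
open import Relation.Binary.Definitions using (tri<; tri≈; tri>)
open import Relation.Binary.PropositionalEquality hiding ([_])
open import Relation.Binary.Structures using (IsEquivalence)
open import Data.Maybe using (Maybe; just; nothing)
import Data.Nat.Solver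
open import Algebra.Bundles using (CommutativeRing)
import Algebra.Solver.Ring as RingSolver
open import Algebra.Solver.Ring.AlmostCommutativeRing using (AlmostCommutativeRing; fromCommutativeRing; _-Raw-AlmostCommutative⟶_)

-- The obstacle is the denominator s₂²: the right-hand side is not visibly a power series. So Z(𝒟)
-- is identified with a series `Sch.target` that involves no division, and the factor 16 s₂² enters
-- only afterwards. Its summands are dihedral contributions divided by 2n. A rotation of order d ≥ 2
-- with g = n/d cycles fixes as many dissections as the coefficient of s^g in θw/(1 - w) says; the
-- φ(d) such rotations therefore contribute φ(d)/2d times the coefficient of -log(1 - w). The
-- identity fixes w_{n-1} dissections, which is not what d = 1 would give in this pattern; the
-- difference is an integral of w, elementary up to the same logarithm, and yields the terms in s₁
-- alone. A reflection with c fixed vertices and j transpositions fixes w_{j+c} dissections, and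
-- this shift of the index by c = 1, 2 is the origin of the divisions by s₂ and s₂². For n = 2
-- rotations and reflections coincide, so K₂ is computed separately; it nevertheless fits the
-- general formula, as a polygon with two sides whose two automorphisms are each counted twice.

module ℕS = Data.Nat.Solver.+-*-Solver

-- Rational numbers

opaque
  ⟪_⟫ : ℕ → ℚ
  ⟪ n ⟫ = ℤ.+ n ℚ./ 1

  ⟪⟫-def : ∀ n → ⟪ n ⟫ ≡ ℤ.+ n ℚ./ 1
  ⟪⟫-def n = refl

/-≃ : ∀ i d → ℚ.toℚᵘ (i ℚ./ suc d) ℚᵘ.≃ ℚᵘ.mkℚᵘ i d
/-≃ i d = ℚP.toℚᵘ-fromℚᵘ (ℚᵘ.mkℚᵘ i d)

/1-+ : ∀ i j → (i ℚ./ 1) ℚ.+ (j ℚ./ 1) ≡ (i ℤ.+ j) ℚ./ 1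
/1-+ i j = ℚP.toℚᵘ-injective (ℚᵘP.≃-trans (ℚP.toℚᵘ-homo-+ (i ℚ./ 1) (j ℚ./ 1))
  (ℚᵘP.≃-trans (ℚᵘP.+-cong (/-≃ i 0) (/-≃ j 0))
  (ℚᵘP.≃-trans (ℚᵘ.*≡* (cong₂ ℤ._*_ (cong₂ ℤ._+_ (ℤP.*-identityʳ i) (ℤP.*-identityʳ j)) refl)) (ℚᵘP.≃-sym (/-≃ (i ℤ.+ j) 0)))))

/-* : ∀ i j d → (i ℚ./ suc d) ℚ.* (j ℚ./ 1) ≡ (i ℤ.* j) ℚ./ suc d
/-* i j d = ℚP.toℚᵘ-injective (ℚᵘP.≃-trans (ℚP.toℚᵘ-homo-* (i ℚ./ suc d) (j ℚ./ 1))
  (ℚᵘP.≃-trans (ℚᵘP.*-cong (/-≃ i d) (/-≃ j 0))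
  (ℚᵘP.≃-trans (ℚᵘ.*≡* (cong (λ e → (i ℤ.* j) ℤ.* ℤ.+ suc e) (sym (*-identityʳ d)))) (ℚᵘP.≃-sym (/-≃ (i ℤ.* j) d)))))

/-cancel : ∀ i d → (i ℚ./ suc d) ℚ.* ⟪ suc d ⟫ ≡ i ℚ./ 1
/-cancel i d = trans (cong ((i ℚ./ suc d) ℚ.*_) (⟪⟫-def (suc d))) (trans (/-* i (ℤ.+ suc d) d) (ℚP.toℚᵘ-injective (ℚᵘP.≃-trans (/-≃ (i ℤ.* ℤ.+ suc d) d)
  (ℚᵘP.≃-trans (ℚᵘ.*≡* (ℤP.*-identityʳ _)) (ℚᵘP.≃-sym (/-≃ i 0))))))

⟪⟫-+ : ∀ m n → ⟪ m + n ⟫ ≡ ⟪ m ⟫ ℚ.+ ⟪ n ⟫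
⟪⟫-+ m n = trans (⟪⟫-def _) (sym (trans (cong₂ ℚ._+_ (⟪⟫-def m) (⟪⟫-def n)) (/1-+ (ℤ.+ m) (ℤ.+ n))))

⟪⟫-* : ∀ m n → ⟪ m * n ⟫ ≡ ⟪ m ⟫ ℚ.* ⟪ n ⟫
⟪⟫-* m n = trans (⟪⟫-def _) (trans (cong (ℚ._/ 1) (ℤP.pos-* m n)) (sym (trans (cong₂ ℚ._*_ (⟪⟫-def m) (⟪⟫-def n)) (/-* (ℤ.+ m) (ℤ.+ n) 0))))

*-cancelʳ-⟪⟫ : ∀ d {x y} → x ℚ.* ⟪ suc d ⟫ ≡ y ℚ.* ⟪ suc d ⟫ → x ≡ y
*-cancelʳ-⟪⟫ d {x} {y} e = trans (sym (h x)) (trans (cong (ℚ._* (ℤ.+ 1 ℚ./ suc d)) e) (h y))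
  where
  h : ∀ x → x ℚ.* ⟪ suc d ⟫ ℚ.* (ℤ.+ 1 ℚ./ suc d) ≡ x
  h x = trans (ℚP.*-assoc x _ _) (trans (cong (x ℚ.*_) (trans (ℚP.*-comm ⟪ suc d ⟫ _) (/-cancel (ℤ.+ 1) d))) (ℚP.*-identityʳ x))

-- Finite sums

opaque
  Σ< : ℕ → (ℕ → ℚ) → ℚ
  Σ< zero    f = 0ℚ
  Σ< (suc n) f = f 0 ℚ.+ Σ< n (f ∘ suc)

  ΣL : {A : Set} → List A → (A → ℚ) → ℚ
  ΣL xs f = ΣQ (map f xs)

  Σ<-0 : ∀ f → Σ< 0 f ≡ 0ℚ
  Σ<-0 f = refl

  Σ<-suc : ∀ n f → Σ< (suc n) f ≡ f 0 ℚ.+ Σ< n (f ∘ suc)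
  Σ<-suc n f = refl

  ΣL-def : ∀ {A : Set} (xs : List A) f → ΣL xs f ≡ ΣQ (map f xs)
  ΣL-def xs f = refl

  ΣL-[] : ∀ {A : Set} (f : A → ℚ) → ΣL [] f ≡ 0ℚ
  ΣL-[] f = refl

  ΣL-∷ : ∀ {A : Set} (x : A) xs f → ΣL (x ∷ xs) f ≡ f x ℚ.+ ΣL xs f
  ΣL-∷ x xs f = refl

ΣL-map : ∀ {A B : Set} (h : A → B) xs f → ΣL (map h xs) f ≡ ΣL xs (f ∘ h)
ΣL-map h []       f = trans (ΣL-[] f) (sym (ΣL-[] (f ∘ h)))
ΣL-map h (x ∷ xs) f = trans (ΣL-∷ (h x) (map h xs) f) (trans (cong (f (h x) ℚ.+_) (ΣL-map h xs f)) (sym (ΣL-∷ x xs (f ∘ h))))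

ΣL-applyUpTo : ∀ (g : ℕ → ℕ) n f → ΣL (applyUpTo g n) f ≡ Σ< n (f ∘ g)
ΣL-applyUpTo g zero    f = trans (ΣL-[] f) (sym (Σ<-0 (f ∘ g)))
ΣL-applyUpTo g (suc n) f = trans (ΣL-∷ (g 0) (applyUpTo (g ∘ suc) n) f)
  (trans (cong (f (g 0) ℚ.+_) (ΣL-applyUpTo (g ∘ suc) n f)) (sym (Σ<-suc n (f ∘ g))))

ΣL-upTo : ∀ n f → ΣL (upTo n) f ≡ Σ< n f
ΣL-upTo n f = ΣL-applyUpTo id n f

ΣL-++ : ∀ {A : Set} (xs ys : List A) f → ΣL (xs ++ ys) f ≡ ΣL xs f ℚ.+ ΣL ys f
ΣL-++ []       ys f = sym (trans (cong (ℚ._+ ΣL ys f) (ΣL-[] f)) (ℚP.+-identityˡ _))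
ΣL-++ (x ∷ xs) ys f = trans (ΣL-∷ x (xs ++ ys) f) (trans (cong (f x ℚ.+_) (ΣL-++ xs ys f))
  (trans (sym (ℚP.+-assoc (f x) _ _)) (cong (ℚ._+ ΣL ys f) (sym (ΣL-∷ x xs f)))))

ΣL-concatMap : ∀ {A B : Set} (h : A → List B) xs f → ΣL (concatMap h xs) f ≡ ΣL xs (λ x → ΣL (h x) f)
ΣL-concatMap h []       f = trans (ΣL-[] f) (sym (ΣL-[] (λ x → ΣL (h x) f)))
ΣL-concatMap h (x ∷ xs) f = trans (ΣL-++ (h x) (concatMap h xs) f) (trans (cong (ΣL (h x) f ℚ.+_) (ΣL-concatMap h xs f))
  (sym (ΣL-∷ x xs (λ x → ΣL (h x) f))))

Σ<-cong : ∀ n {f g} → (∀ i → i < n → f i ≡ g i) → Σ< n f ≡ Σ< n g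
Σ<-cong zero    {f} {g} e = trans (Σ<-0 f) (sym (Σ<-0 g))
Σ<-cong (suc n) {f} {g} e = trans (Σ<-suc n f) (trans (cong₂ ℚ._+_ (e 0 (s≤s z≤n)) (Σ<-cong n (λ i i<n → e (suc i) (s≤s i<n)))) (sym (Σ<-suc n g)))

Σ<-zero : ∀ n {f} → (∀ i → i < n → f i ≡ 0ℚ) → Σ< n f ≡ 0ℚ
Σ<-zero zero    {f} e = Σ<-0 f
Σ<-zero (suc n) {f} e = trans (Σ<-suc n f) (trans (cong₂ ℚ._+_ (e 0 (s≤s z≤n)) (Σ<-zero n (λ i i<n → e (suc i) (s≤s i<n)))) (ℚP.+-identityˡ 0ℚ))

+-interchange : ∀ a b c d → (a ℚ.+ b) ℚ.+ (c ℚ.+ d) ≡ (a ℚ.+ c) ℚ.+ (b ℚ.+ d)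
+-interchange = solve 4 (λ a b c d → (a :+ b) :+ (c :+ d) := (a :+ c) :+ (b :+ d)) refl
  where open +-*-Solver

Σ<-+ : ∀ n f g → Σ< n (λ i → f i ℚ.+ g i) ≡ Σ< n f ℚ.+ Σ< n g
Σ<-+ zero    f g = trans (Σ<-0 _) (sym (trans (cong₂ ℚ._+_ (Σ<-0 f) (Σ<-0 g)) (ℚP.+-identityˡ 0ℚ)))
Σ<-+ (suc n) f g = trans (Σ<-suc n _) (trans (cong (f 0 ℚ.+ g 0 ℚ.+_) (Σ<-+ n (f ∘ suc) (g ∘ suc)))
  (trans (+-interchange (f 0) (g 0) _ _) (sym (cong₂ ℚ._+_ (Σ<-suc n f) (Σ<-suc n g)))))

Σ<-*ˡ : ∀ n c f → Σ< n (λ i → c ℚ.* f i) ≡ c ℚ.* Σ< n f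
Σ<-*ˡ zero    c f = trans (Σ<-0 _) (sym (trans (cong (c ℚ.*_) (Σ<-0 f)) (ℚP.*-zeroʳ c)))
Σ<-*ˡ (suc n) c f = trans (Σ<-suc n _) (trans (cong (c ℚ.* f 0 ℚ.+_) (Σ<-*ˡ n c (f ∘ suc)))
  (trans (sym (ℚP.*-distribˡ-+ c (f 0) _)) (cong (c ℚ.*_) (sym (Σ<-suc n f)))))

Σ<-snoc : ∀ n f → Σ< (suc n) f ≡ Σ< n f ℚ.+ f n
Σ<-snoc zero    f = trans (Σ<-suc 0 f) (trans (cong (f 0 ℚ.+_) (Σ<-0 (f ∘ suc))) (trans (ℚP.+-comm (f 0) 0ℚ) (cong (ℚ._+ f 0) (sym (Σ<-0 f)))))
Σ<-snoc (suc n) f = trans (Σ<-suc (suc n) f) (trans (cong (f 0 ℚ.+_) (Σ<-snoc n (f ∘ suc)))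
  (trans (sym (ℚP.+-assoc (f 0) _ _)) (cong (ℚ._+ f (suc n)) (sym (Σ<-suc n f)))))

Σ<-reverse : ∀ k f → Σ< (suc k) f ≡ Σ< (suc k) (λ i → f (k ∸ i))
Σ<-reverse zero    f = Σ<-cong 1 (λ { zero _ → refl ; (suc i) (s≤s ()) })
Σ<-reverse (suc k) f = trans (Σ<-snoc (suc k) f) (trans (ℚP.+-comm _ (f (suc k))) (trans (cong (f (suc k) ℚ.+_) (Σ<-reverse k f))
  (sym (Σ<-suc (suc k) (λ i → f (suc k ∸ i))))))

-- Both sides run over the triples of naturals with sum `k`, grouped by the last or by the first
-- entry; this reindexing is what associativity of the product of series needs. The induction splits
-- off the triples whose first entry is 0.
Σ<-triangle : ∀ k (T : ℕ → ℕ → ℕ → ℚ) →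
  Σ< (suc k) (λ i → Σ< (suc i) (λ j → T j (i ∸ j) (k ∸ i))) ≡
  Σ< (suc k) (λ j → Σ< (suc (k ∸ j)) (λ l → T j l (k ∸ j ∸ l)))
Σ<-triangle zero    T = Σ<-cong 1 (λ { zero _ → Σ<-cong 1 (λ { zero _ → refl ; (suc i) (s≤s ()) }) ; (suc i) (s≤s ()) })
Σ<-triangle (suc k) T = begin
  Σ< (2 + k) (λ i → Σ< (suc i) (λ j → T j (i ∸ j) (suc k ∸ i)))
    ≡⟨ trans (Σ<-cong (2 + k) (λ i _ → Σ<-suc i _)) (Σ<-+ (2 + k) (λ i → T 0 i (suc k ∸ i)) (λ i → Σ< i (λ j → T (suc j) (i ∸ suc j) (suc k ∸ i)))) ⟩
  Σ< (2 + k) (λ i → T 0 i (suc k ∸ i)) ℚ.+ Σ< (2 + k) (λ i → Σ< i (λ j → T (suc j) (i ∸ suc j) (suc k ∸ i)))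
    ≡⟨ cong (Σ< (2 + k) (λ i → T 0 i (suc k ∸ i)) ℚ.+_) (trans (Σ<-suc (suc k) _) (trans (cong₂ ℚ._+_ (Σ<-0 _) (Σ<-triangle k (λ j → T (suc j)))) (ℚP.+-identityˡ _))) ⟩
  Σ< (2 + k) (λ i → T 0 i (suc k ∸ i)) ℚ.+ Σ< (suc k) (λ j → Σ< (suc (k ∸ j)) (λ l → T (suc j) l (k ∸ j ∸ l)))
    ≡⟨ sym (Σ<-suc (suc k) _) ⟩
  Σ< (2 + k) (λ j → Σ< (suc (suc k ∸ j)) (λ l → T j l (suc k ∸ j ∸ l))) ∎
  where open ≡-Reasoning

-- The ring of power series

infix 4 _≈_
_≈_ : Series → Series → Set
f ≈ g = ∀ m → f m ≡ g m

infixl 6 _⊕_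
infixl 7 _⊛_
infix 8 ⊖_

opaque
  unfolding ΣL

  _⊕_ _⊛_ : Series → Series → Series
  _⊕_ = addS
  _⊛_ = mulS

  ⊖_ : Series → Series
  ⊖_ f m = ℚ.- f m

  κ : ℚ → Series
  κ = constS

  mulS≡ : ∀ f g → mulS f g ≡ f ⊛ g
  mulS≡ f g = refl

  κ-def : ∀ c → κ c ≡ constS c
  κ-def c = refl

  ⊕-at : ∀ f g m → (f ⊕ g) m ≡ f m ℚ.+ g m
  ⊕-at f g m = refl

  ⊖-at : ∀ f m → (⊖ f) m ≡ ℚ.- f m
  ⊖-at f m = refl

  κ-[] : ∀ c → κ c [] ≡ c
  κ-[] c = refl

  κ-0∷ : ∀ c m → κ c (0 ∷ m) ≡ κ c m
  κ-0∷ c m = refl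

  κ-suc∷ : ∀ c k m → κ c (suc k ∷ m) ≡ 0ℚ
  κ-suc∷ c k m = refl

  ⊛-[] : ∀ f g → (f ⊛ g) [] ≡ f [] ℚ.* g []
  ⊛-[] f g = ℚP.+-identityʳ (f [] ℚ.* g [])

  -- The product is a Cauchy product in the first variable whose coefficients are series in the
  -- remaining ones. The laws of multiplication below follow by induction on the monomial through
  -- this equation.
  ⊛-∷ : ∀ f g k m → (f ⊛ g) (k ∷ m) ≡ Σ< (suc k) (λ i → ((f ∘ (i ∷_)) ⊛ (g ∘ (k ∸ i ∷_))) m)
  ⊛-∷ f g k m = trans (ΣL-concatMap (λ i → map (i ∷_) (boxes m)) (upTo (suc k)) (λ a → f a ℚ.* g ((k ∷ m) ∸ₘ a)))
    (trans (ΣL-upTo (suc k) (λ i → ΣL (map (i ∷_) (boxes m)) (λ a → f a ℚ.* g ((k ∷ m) ∸ₘ a))))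
    (Σ<-cong (suc k) (λ i _ → ΣL-map (i ∷_) (boxes m) (λ a → f a ℚ.* g ((k ∷ m) ∸ₘ a)))))

-- A coefficient of a product only sees pairs of complementary total degree. Truncations and
-- inductions on the degree both rest on this.
⊛-cong-deg : ∀ m {f f′ g g′} → (∀ a b → totDeg a + totDeg b ≡ totDeg m → f a ℚ.* g b ≡ f′ a ℚ.* g′ b) →
  (f ⊛ g) m ≡ (f′ ⊛ g′) m
⊛-cong-deg []      {f} {f′} {g} {g′} h = trans (⊛-[] f g) (trans (h [] [] refl) (sym (⊛-[] f′ g′)))
⊛-cong-deg (k ∷ m) {f} {f′} {g} {g′} h = trans (⊛-∷ f g k m) (trans
  (Σ<-cong (suc k) (λ { i (s≤s i≤k) → ⊛-cong-deg m (λ a b e → h (i ∷ a) (k ∸ i ∷ b) (eq i i≤k (totDeg a) (totDeg b) e)) }))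
  (sym (⊛-∷ f′ g′ k m)))
  where
  eq : ∀ i → i ≤ k → ∀ x y → x + y ≡ totDeg m → i + x + (k ∸ i + y) ≡ k + totDeg m
  eq i i≤k x y e = begin
    i + x + (k ∸ i + y)   ≡⟨ +-assoc i x _ ⟩
    i + (x + (k ∸ i + y)) ≡⟨ cong (i +_) (trans (sym (+-assoc x _ y)) (trans (cong (_+ y) (+-comm x (k ∸ i))) (+-assoc (k ∸ i) x y))) ⟩
    i + (k ∸ i + (x + y)) ≡⟨ sym (+-assoc i _ _) ⟩
    i + (k ∸ i) + (x + y) ≡⟨ cong₂ _+_ (m+[n∸m]≡n i≤k) e ⟩
    k + totDeg m ∎
    where open ≡-Reasoning

⊕-cong : ∀ {f f′ g g′} → f ≈ f′ → g ≈ g′ → f ⊕ g ≈ f′ ⊕ g′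
⊕-cong {f} {f′} {g} {g′} ef eg m = trans (⊕-at f g m) (trans (cong₂ ℚ._+_ (ef m) (eg m)) (sym (⊕-at f′ g′ m)))

⊛-cong : ∀ {f f′ g g′} → f ≈ f′ → g ≈ g′ → f ⊛ g ≈ f′ ⊛ g′
⊛-cong ef eg m = ⊛-cong-deg m (λ a b _ → cong₂ ℚ._*_ (ef a) (eg b))

⊖-cong : ∀ {f g} → f ≈ g → ⊖ f ≈ ⊖ g
⊖-cong {f} {g} e m = trans (⊖-at f m) (trans (cong ℚ.-_ (e m)) (sym (⊖-at g m)))

⊛-zeroˡ : ∀ f g → (∀ m → f m ≡ 0ℚ) → ∀ m → (f ⊛ g) m ≡ 0ℚ
⊛-zeroˡ f g z []      = trans (⊛-[] f g) (trans (cong (ℚ._* g []) (z [])) (ℚP.*-zeroˡ (g [])))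
⊛-zeroˡ f g z (k ∷ m) = trans (⊛-∷ f g k m) (Σ<-zero (suc k) (λ i _ → ⊛-zeroˡ _ _ (λ m → z (i ∷ m)) m))

⊛-comm : ∀ f g → f ⊛ g ≈ g ⊛ f
⊛-comm f g []      = trans (⊛-[] f g) (trans (ℚP.*-comm (f []) _) (sym (⊛-[] g f)))
⊛-comm f g (k ∷ m) = trans (⊛-∷ f g k m) (trans (Σ<-reverse k _) (trans
  (Σ<-cong (suc k) (λ { i (s≤s i≤k) → trans (⊛-comm _ _ m)
     (cong (λ j → ((g ∘ (j ∷_)) ⊛ (f ∘ ((k ∸ i) ∷_))) m) (m∸[m∸n]≡n i≤k)) }))
  (sym (⊛-∷ g f k m))))

⊛-distribˡ : ∀ f g h → f ⊛ (g ⊕ h) ≈ f ⊛ g ⊕ f ⊛ h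
⊛-distribˡ f g h []      = trans (⊛-[] f _) (trans (cong (f [] ℚ.*_) (⊕-at g h [])) (trans (ℚP.*-distribˡ-+ (f []) _ _)
  (sym (trans (⊕-at _ _ []) (cong₂ ℚ._+_ (⊛-[] f g) (⊛-[] f h))))))
⊛-distribˡ f g h (k ∷ m) = trans (⊛-∷ f _ k m) (trans (Σ<-cong (suc k) (λ i _ →
    trans (⊛-cong {f = f ∘ (i ∷_)} (λ _ → refl) (λ m′ → trans (⊕-at g h (k ∸ i ∷ m′)) (sym (⊕-at (g ∘ (k ∸ i ∷_)) (h ∘ (k ∸ i ∷_)) m′))) m)
    (trans (⊛-distribˡ (f ∘ (i ∷_)) (g ∘ (k ∸ i ∷_)) (h ∘ (k ∸ i ∷_)) m) (⊕-at _ _ m))))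
  (trans (Σ<-+ (suc k) (λ i → ((f ∘ (i ∷_)) ⊛ (g ∘ (k ∸ i ∷_))) m) (λ i → ((f ∘ (i ∷_)) ⊛ (h ∘ (k ∸ i ∷_))) m))
  (sym (trans (⊕-at _ _ (k ∷ m)) (cong₂ ℚ._+_ (⊛-∷ f g k m) (⊛-∷ f h k m))))))

⊛-distribʳ : ∀ f g h → (g ⊕ h) ⊛ f ≈ g ⊛ f ⊕ h ⊛ f
⊛-distribʳ f g h m = trans (⊛-comm _ f m) (trans (⊛-distribˡ f g h m) (⊕-cong (⊛-comm f g) (⊛-comm f h) m))

⊛-Σ<ˡ : ∀ n (F : ℕ → Series) g m → ((λ m → Σ< n (λ i → F i m)) ⊛ g) m ≡ Σ< n (λ i → (F i ⊛ g) m)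
⊛-Σ<ˡ zero    F g m = trans (⊛-zeroˡ _ g (λ m → Σ<-0 _) m) (sym (Σ<-0 _))
⊛-Σ<ˡ (suc n) F g m = trans (⊛-cong {f′ = F 0 ⊕ (λ m → Σ< n (λ i → F (suc i) m))} {g = g} (λ m → trans (Σ<-suc n (λ i → F i m)) (sym (⊕-at _ _ m))) (λ _ → refl) m)
  (trans (⊛-distribʳ g (F 0) _ m) (trans (⊕-at _ _ m) (trans (cong ((F 0 ⊛ g) m ℚ.+_) (⊛-Σ<ˡ n (F ∘ suc) g m)) (sym (Σ<-suc n (λ i → (F i ⊛ g) m))))))

⊛-Σ<ʳ : ∀ n (F : ℕ → Series) g m → (g ⊛ (λ m → Σ< n (λ i → F i m))) m ≡ Σ< n (λ i → (g ⊛ F i) m)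
⊛-Σ<ʳ n F g m = trans (⊛-comm g _ m) (trans (⊛-Σ<ˡ n F g m) (Σ<-cong n (λ i _ → ⊛-comm (F i) g m)))

⊛-assoc : ∀ f g h → (f ⊛ g) ⊛ h ≈ f ⊛ (g ⊛ h)
⊛-assoc f g h [] = trans (⊛-[] _ h) (trans (cong (ℚ._* h []) (⊛-[] f g)) (trans (ℚP.*-assoc (f []) _ _)
  (sym (trans (⊛-[] f _) (cong (f [] ℚ.*_) (⊛-[] g h))))))
⊛-assoc f g h (k ∷ m) = begin
  ((f ⊛ g) ⊛ h) (k ∷ m)
    ≡⟨ ⊛-∷ _ h k m ⟩
  Σ< (suc k) (λ i → (((f ⊛ g) ∘ (i ∷_)) ⊛ (h ∘ (k ∸ i ∷_))) m)
    ≡⟨ Σ<-cong (suc k) (λ i _ → trans (⊛-cong {g = h ∘ (k ∸ i ∷_)} (⊛-∷ f g i) (λ _ → refl) m) (⊛-Σ<ˡ (suc i) (λ j → (f ∘ (j ∷_)) ⊛ (g ∘ (i ∸ j ∷_))) _ m)) ⟩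
  Σ< (suc k) (λ i → Σ< (suc i) (λ j → (((f ∘ (j ∷_)) ⊛ (g ∘ (i ∸ j ∷_))) ⊛ (h ∘ (k ∸ i ∷_))) m))
    ≡⟨ Σ<-triangle k (λ j l r → (((f ∘ (j ∷_)) ⊛ (g ∘ (l ∷_))) ⊛ (h ∘ (r ∷_))) m) ⟩
  Σ< (suc k) (λ j → Σ< (suc (k ∸ j)) (λ l → (((f ∘ (j ∷_)) ⊛ (g ∘ (l ∷_))) ⊛ (h ∘ (k ∸ j ∸ l ∷_))) m))
    ≡⟨ Σ<-cong (suc k) (λ j _ → trans (Σ<-cong (suc (k ∸ j)) (λ l _ → ⊛-assoc (f ∘ (j ∷_)) (g ∘ (l ∷_)) (h ∘ (k ∸ j ∸ l ∷_)) m))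
         (sym (trans (⊛-cong {f = f ∘ (j ∷_)} (λ _ → refl) (⊛-∷ g h (k ∸ j)) m) (⊛-Σ<ʳ (suc (k ∸ j)) (λ l → (g ∘ (l ∷_)) ⊛ (h ∘ (k ∸ j ∸ l ∷_))) (f ∘ (j ∷_)) m)))) ⟩
  Σ< (suc k) (λ j → ((f ∘ (j ∷_)) ⊛ ((g ⊛ h) ∘ (k ∸ j ∷_))) m)
    ≡⟨ sym (⊛-∷ f _ k m) ⟩
  (f ⊛ (g ⊛ h)) (k ∷ m) ∎
  where open ≡-Reasoning

κ-0 : ∀ m → κ 0ℚ m ≡ 0ℚ
κ-0 []          = κ-[] 0ℚ
κ-0 (zero ∷ m)  = trans (κ-0∷ 0ℚ m) (κ-0 m)
κ-0 (suc k ∷ m) = κ-suc∷ 0ℚ k m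

κ-⊛ : ∀ c f m → (κ c ⊛ f) m ≡ c ℚ.* f m
κ-⊛ c f []      = trans (⊛-[] _ f) (cong (ℚ._* f []) (κ-[] c))
κ-⊛ c f (k ∷ m) = trans (⊛-∷ _ f k m) (trans (Σ<-suc k _) (trans (cong₂ ℚ._+_
    (trans (⊛-cong {g = f ∘ (k ∷_)} (κ-0∷ c) (λ _ → refl) m) (κ-⊛ c (f ∘ (k ∷_)) m))
    (Σ<-zero k (λ i _ → ⊛-zeroˡ _ _ (κ-suc∷ c i) m))) (ℚP.+-identityʳ _)))

-- Off the trivial monomial constants vanish, hence the condition at 0. Negation is obtained from an
-- operation that ignores its second argument.
κ-lift : ∀ (_∙_ : ℚ → ℚ → ℚ) → 0ℚ ∙ 0ℚ ≡ 0ℚ → ∀ a b m → κ (a ∙ b) m ≡ κ a m ∙ κ b m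
κ-lift _∙_ e a b []          = trans (κ-[] _) (sym (cong₂ _∙_ (κ-[] a) (κ-[] b)))
κ-lift _∙_ e a b (zero ∷ m)  = trans (κ-0∷ _ m) (trans (κ-lift _∙_ e a b m) (sym (cong₂ _∙_ (κ-0∷ a m) (κ-0∷ b m))))
κ-lift _∙_ e a b (suc k ∷ m) = trans (κ-suc∷ _ k m) (sym (trans (cong₂ _∙_ (κ-suc∷ a k m) (κ-suc∷ b k m)) e))

≈-isEquivalence : IsEquivalence _≈_
≈-isEquivalence = record { refl = λ _ → refl ; sym = λ e m → sym (e m) ; trans = λ e e′ m → trans (e m) (e′ m) }

⊛-identityˡ : ∀ f → κ 1ℚ ⊛ f ≈ f
⊛-identityˡ f m = trans (κ-⊛ 1ℚ f m) (ℚP.*-identityˡ _)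

⊕-comm : ∀ f g → f ⊕ g ≈ g ⊕ f
⊕-comm f g m = trans (⊕-at f g m) (trans (ℚP.+-comm (f m) (g m)) (sym (⊕-at g f m)))

⊕-assoc : ∀ f g h → (f ⊕ g) ⊕ h ≈ f ⊕ (g ⊕ h)
⊕-assoc f g h m = trans (⊕-at _ h m) (trans (cong (ℚ._+ h m) (⊕-at f g m)) (trans (ℚP.+-assoc (f m) (g m) (h m))
  (sym (trans (⊕-at f _ m) (cong (f m ℚ.+_) (⊕-at g h m))))))

⊕-identityˡ : ∀ f → κ 0ℚ ⊕ f ≈ f
⊕-identityˡ f m = trans (⊕-at _ f m) (trans (cong (ℚ._+ f m) (κ-0 m)) (ℚP.+-identityˡ (f m)))

⊖-inverseˡ : ∀ f → ⊖ f ⊕ f ≈ κ 0ℚ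
⊖-inverseˡ f m = trans (⊕-at _ f m) (trans (cong (ℚ._+ f m) (⊖-at f m)) (trans (ℚP.+-inverseˡ (f m)) (sym (κ-0 m))))

seriesRing : CommutativeRing _ _
seriesRing = record
  { isCommutativeRing = record
    { isRing = record
      { +-isAbelianGroup = record
        { isGroup = record
          { isMonoid = record
            { isSemigroup = record
              { isMagma = record { isEquivalence = ≈-isEquivalence ; ∙-cong = ⊕-cong }
              ; assoc = ⊕-assoc }
            ; identity = ⊕-identityˡ , λ f m → trans (⊕-comm f _ m) (⊕-identityˡ f m) }
          ; inverse = ⊖-inverseˡ , λ f m → trans (⊕-comm f _ m) (⊖-inverseˡ f m)
          ; ⁻¹-cong = ⊖-cong }
        ; comm = ⊕-comm }
      ; *-cong = ⊛-cong
      ; *-assoc = ⊛-assoc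
      ; *-identity = ⊛-identityˡ , λ f m → trans (⊛-comm f _ m) (⊛-identityˡ f m)
      ; distrib = ⊛-distribˡ , ⊛-distribʳ }
    ; *-comm = ⊛-comm } }

seriesACR : AlmostCommutativeRing _ _
seriesACR = fromCommutativeRing seriesRing

κ-hom : CommutativeRing.rawRing ℚP.+-*-commutativeRing -Raw-AlmostCommutative⟶ seriesACR
κ-hom = record
  { ⟦_⟧ = κ
  ; +-homo = λ a b m → trans (κ-lift ℚ._+_ refl a b m) (sym (⊕-at _ _ m))
  ; *-homo = λ a b m → trans (κ-scale a b m) (sym (κ-⊛ a (κ b) m))
  ; -‿homo = λ a m → trans (κ-lift (λ x _ → ℚ.- x) refl a a m) (sym (⊖-at _ m))
  ; 0-homo = λ _ → refl
  ; 1-homo = λ _ → refl }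
  where
  κ-scale : ∀ a b m → κ (a ℚ.* b) m ≡ a ℚ.* κ b m
  κ-scale a b []          = trans (κ-[] _) (cong (a ℚ.*_) (sym (κ-[] b)))
  κ-scale a b (zero ∷ m)  = trans (κ-0∷ _ m) (trans (κ-scale a b m) (cong (a ℚ.*_) (sym (κ-0∷ b m))))
  κ-scale a b (suc k ∷ m) = trans (κ-suc∷ _ k m) (sym (trans (cong (a ℚ.*_) (κ-suc∷ b k m)) (ℚP.*-zeroʳ a)))

κ-≟ : ∀ a b → Maybe (κ a ≈ κ b)
κ-≟ a b with a ℚP.≟ b
... | yes e = just (λ m → cong (λ c → κ c m) e)
... | no _  = nothing

module S-Solver = RingSolver (CommutativeRing.rawRing ℚP.+-*-commutativeRing) seriesACR κ-hom κ-≟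

module S = S-Solver
-- Derivations and composition

deg-ind : (P : Mono → Set) → (∀ m → (∀ b → totDeg b < totDeg m → P b) → P m) → ∀ m → P m
deg-ind P h m = go (suc (totDeg m)) m ≤-refl
  where
  go : ∀ n m → totDeg m < n → P m
  go (suc n) m (s≤s le) = h m (λ b lt → go n b (≤-trans lt le))

-- A series is a function on lists and need not agree on lists that differ by trailing zeros, so a
-- vanishing constant term is required at every list of total degree zero, not only at `[]`.
Z : Series → Set
Z u = ∀ m → totDeg m ≡ 0 → u m ≡ 0ℚ

⊛-vanish : ∀ m {f g} → (∀ a b → totDeg a + totDeg b ≡ totDeg m → f a ℚ.* g b ≡ 0ℚ) → (f ⊛ g) m ≡ 0ℚ
⊛-vanish m {f} {g} h = trans (⊛-cong-deg m {f} {λ _ → 0ℚ} {g} {g} (λ a b e → trans (h a b e) (sym (ℚP.*-zeroˡ (g b)))))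
  (⊛-zeroˡ (λ _ → 0ℚ) g (λ _ → refl) m)

-- A factor without constant term uses up at least one degree, so `g` is only evaluated in smaller
-- degree. The uniqueness arguments below are inductions driven by this.
⊛-low : ∀ m {f g} → Z f → (∀ b → totDeg b < totDeg m → g b ≡ 0ℚ) → (f ⊛ g) m ≡ 0ℚ
⊛-low m {f} {g} zf h = ⊛-vanish m k
  where
  k : ∀ a b → totDeg a + totDeg b ≡ totDeg m → f a ℚ.* g b ≡ 0ℚ
  k a b e with totDeg a in ea
  ... | zero  = trans (cong (ℚ._* g b) (zf a ea)) (ℚP.*-zeroˡ (g b))
  ... | suc d = trans (cong (f a ℚ.*_) (h b (subst (totDeg b <_) e (s≤s (m≤n+m _ d))))) (ℚP.*-zeroʳ (f a))

Z-⊛ˡ : ∀ f g → Z f → Z (f ⊛ g)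
Z-⊛ˡ f g zf m e = ⊛-low m zf (λ b lt → ⊥-elim (n≮0 (subst (totDeg b <_) e lt)))

Z-⊛ʳ : ∀ f g → Z g → Z (f ⊛ g)
Z-⊛ʳ f g zg m e = trans (⊛-comm f g m) (Z-⊛ˡ g f zg m e)

Z-⊕ : ∀ f g → Z f → Z g → Z (f ⊕ g)
Z-⊕ f g zf zg m e = trans (⊕-at f g m) (trans (cong₂ ℚ._+_ (zf m e) (zg m e)) (ℚP.+-identityˡ 0ℚ))

Z-⊖ : ∀ f → Z f → Z (⊖ f)
Z-⊖ f zf m e = trans (⊖-at f m) (cong ℚ.-_ (zf m e))

Z-≈ : ∀ {f g} → f ≈ g → Z f → Z g
Z-≈ e zf m e0 = trans (sym (e m)) (zf m e0)

opaque
  θ : Series → Series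
  θ f m = ⟪ totDeg m ⟫ ℚ.* f m

  θ-at : ∀ f m → θ f m ≡ ⟪ totDeg m ⟫ ℚ.* f m
  θ-at f m = refl

θ-cong : ∀ {f g} → f ≈ g → θ f ≈ θ g
θ-cong {f} {g} e m = trans (θ-at f m) (trans (cong (⟪ totDeg m ⟫ ℚ.*_) (e m)) (sym (θ-at g m)))

θ-⊕ : ∀ f g → θ (f ⊕ g) ≈ θ f ⊕ θ g
θ-⊕ f g m = trans (θ-at _ m) (trans (cong (⟪ totDeg m ⟫ ℚ.*_) (⊕-at f g m)) (trans (ℚP.*-distribˡ-+ ⟪ totDeg m ⟫ (f m) (g m))
  (sym (trans (⊕-at _ _ m) (cong₂ ℚ._+_ (θ-at f m) (θ-at g m))))))

θ-⊖ : ∀ f → θ (⊖ f) ≈ ⊖ (θ f)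
θ-⊖ f m = trans (θ-at _ m) (trans (cong (⟪ totDeg m ⟫ ℚ.*_) (⊖-at f m)) (trans (sym (ℚP.neg-distribʳ-* ⟪ totDeg m ⟫ (f m)))
  (sym (trans (⊖-at _ m) (cong ℚ.-_ (θ-at f m))))))

θ-Z : ∀ f → Z (θ f)
θ-Z f m e = trans (θ-at f m) (trans (cong (λ d → ⟪ d ⟫ ℚ.* f m) e) (trans (cong (ℚ._* f m) (⟪⟫-def 0)) (ℚP.*-zeroˡ (f m))))

⟪⟫-cancelˡ : ∀ d {x y} → ⟪ suc d ⟫ ℚ.* x ≡ ⟪ suc d ⟫ ℚ.* y → x ≡ y
⟪⟫-cancelˡ d {x} {y} e = *-cancelʳ-⟪⟫ d (trans (ℚP.*-comm x _) (trans e (ℚP.*-comm _ y)))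

θ-0 : ∀ f m → θ f m ≡ 0ℚ → (totDeg m ≡ 0 → f m ≡ 0ℚ) → f m ≡ 0ℚ
θ-0 f m e h with totDeg m in eq
... | zero  = h refl
... | suc d = ⟪⟫-cancelˡ d (trans (sym (trans (θ-at f m) (cong (λ d → ⟪ d ⟫ ℚ.* f m) eq))) (trans e (sym (ℚP.*-zeroʳ ⟪ suc d ⟫))))

-- Over a tail of the monomial, the degree of the removed head becomes a constant shift.
θ-leibniz′ : ∀ m c d (f g : Series) →
  ⟪ c + d + totDeg m ⟫ ℚ.* (f ⊛ g) m ≡ ((λ b → ⟪ c + totDeg b ⟫ ℚ.* f b) ⊛ g) m ℚ.+ (f ⊛ (λ b → ⟪ d + totDeg b ⟫ ℚ.* g b)) m
θ-leibniz′ [] c d f g = begin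
  ⟪ c + d + 0 ⟫ ℚ.* (f ⊛ g) []
    ≡⟨ cong₂ ℚ._*_ (trans (cong ⟪_⟫ (+-identityʳ (c + d))) (⟪⟫-+ c d)) (⊛-[] f g) ⟩
  (⟪ c ⟫ ℚ.+ ⟪ d ⟫) ℚ.* (f [] ℚ.* g [])
    ≡⟨ solve 4 (λ c d x y → (c :+ d) :* (x :* y) := (c :* x) :* y :+ x :* (d :* y)) refl ⟪ c ⟫ ⟪ d ⟫ (f []) (g []) ⟩
  (⟪ c ⟫ ℚ.* f []) ℚ.* g [] ℚ.+ f [] ℚ.* (⟪ d ⟫ ℚ.* g [])
    ≡⟨ cong₂ (λ c d → (⟪ c ⟫ ℚ.* f []) ℚ.* g [] ℚ.+ f [] ℚ.* (⟪ d ⟫ ℚ.* g [])) (sym (+-identityʳ c)) (sym (+-identityʳ d)) ⟩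
  (⟪ c + 0 ⟫ ℚ.* f []) ℚ.* g [] ℚ.+ f [] ℚ.* (⟪ d + 0 ⟫ ℚ.* g [])
    ≡⟨ sym (cong₂ ℚ._+_ (⊛-[] _ g) (⊛-[] f _)) ⟩
  ((λ b → ⟪ c + totDeg b ⟫ ℚ.* f b) ⊛ g) [] ℚ.+ (f ⊛ (λ b → ⟪ d + totDeg b ⟫ ℚ.* g b)) [] ∎
  where
  open ≡-Reasoning
  open +-*-Solver
θ-leibniz′ (k ∷ m) c d f g = begin
  ⟪ c + d + (k + totDeg m) ⟫ ℚ.* (f ⊛ g) (k ∷ m)
    ≡⟨ trans (cong (⟪ c + d + (k + totDeg m) ⟫ ℚ.*_) (⊛-∷ f g k m)) (sym (Σ<-*ˡ (suc k) ⟪ c + d + (k + totDeg m) ⟫ (λ i → ((f ∘ (i ∷_)) ⊛ (g ∘ (k ∸ i ∷_))) m))) ⟩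
  Σ< (suc k) (λ i → ⟪ c + d + (k + totDeg m) ⟫ ℚ.* ((f ∘ (i ∷_)) ⊛ (g ∘ (k ∸ i ∷_))) m)
    ≡⟨ Σ<-cong (suc k) (λ { i (s≤s i≤k) → trans (cong (λ e → ⟪ e ⟫ ℚ.* ((f ∘ (i ∷_)) ⊛ (g ∘ (k ∸ i ∷_))) m) (eq i i≤k (totDeg m)))
         (trans (θ-leibniz′ m (c + i) (d + (k ∸ i)) (f ∘ (i ∷_)) (g ∘ (k ∸ i ∷_)))
           (cong₂ ℚ._+_ (⊛-cong {g = g ∘ (k ∸ i ∷_)} (λ b → cong (λ e → ⟪ e ⟫ ℚ.* f (i ∷ b)) (+-assoc c i (totDeg b))) (λ _ → refl) m)
                        (⊛-cong {f = f ∘ (i ∷_)} (λ _ → refl) (λ b → cong (λ e → ⟪ e ⟫ ℚ.* g (k ∸ i ∷ b)) (+-assoc d (k ∸ i) (totDeg b))) m))) }) ⟩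
  Σ< (suc k) (λ i → ((θf ∘ (i ∷_)) ⊛ (g ∘ (k ∸ i ∷_))) m ℚ.+ ((f ∘ (i ∷_)) ⊛ (θg ∘ (k ∸ i ∷_))) m)
    ≡⟨ Σ<-+ (suc k) _ _ ⟩
  Σ< (suc k) (λ i → ((θf ∘ (i ∷_)) ⊛ (g ∘ (k ∸ i ∷_))) m) ℚ.+ Σ< (suc k) (λ i → ((f ∘ (i ∷_)) ⊛ (θg ∘ (k ∸ i ∷_))) m)
    ≡⟨ sym (cong₂ ℚ._+_ (⊛-∷ θf g k m) (⊛-∷ f θg k m)) ⟩
  (θf ⊛ g) (k ∷ m) ℚ.+ (f ⊛ θg) (k ∷ m) ∎
  where
  open ≡-Reasoning
  θf θg : Series
  θf b = ⟪ c + totDeg b ⟫ ℚ.* f b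
  θg b = ⟪ d + totDeg b ⟫ ℚ.* g b
  eq : ∀ i → i ≤ k → ∀ t → c + d + (k + t) ≡ c + i + (d + (k ∸ i)) + t
  eq i i≤k t = begin
    c + d + (k + t)             ≡⟨ sym (+-assoc (c + d) k t) ⟩
    c + d + k + t               ≡⟨ cong (λ k → c + d + k + t) (sym (m+[n∸m]≡n i≤k)) ⟩
    c + d + (i + (k ∸ i)) + t   ≡⟨ cong (_+ t) (ℕS.solve 4 (λ c d i j → c ℕS.:+ d ℕS.:+ (i ℕS.:+ j) ℕS.:= c ℕS.:+ i ℕS.:+ (d ℕS.:+ j)) refl c d i (k ∸ i)) ⟩
    c + i + (d + (k ∸ i)) + t   ∎

θ-⊛ : ∀ f g → θ (f ⊛ g) ≈ θ f ⊛ g ⊕ f ⊛ θ g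
θ-⊛ f g m = trans (θ-at _ m) (trans (θ-leibniz′ m 0 0 f g) (trans (cong₂ ℚ._+_
  (⊛-cong {g = g} (λ b → sym (θ-at f b)) (λ _ → refl) m) (⊛-cong {f = f} (λ _ → refl) (λ b → sym (θ-at g b)) m)) (sym (⊕-at _ _ m))))

κ-deg : ∀ c m k → totDeg m ≡ suc k → κ c m ≡ 0ℚ
κ-deg c (zero ∷ m)  k e = trans (κ-0∷ c m) (κ-deg c m k e)
κ-deg c (suc j ∷ m) k e = κ-suc∷ c j m

θ-κ : ∀ c → θ (κ c) ≈ κ 0ℚ
θ-κ c m = trans (θ-at _ m) (trans h (sym (κ-0 m)))
  where
  h : ⟪ totDeg m ⟫ ℚ.* κ c m ≡ 0ℚ
  h with totDeg m in eq
  ... | zero  = trans (cong (ℚ._* κ c m) (⟪⟫-def 0)) (ℚP.*-zeroˡ (κ c m))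
  ... | suc d = trans (cong (⟪ suc d ⟫ ℚ.*_) (κ-deg c m d eq)) (ℚP.*-zeroʳ ⟪ suc d ⟫)

-- Proves an identity modulo a known equation `p ≈ q`: `c` is the cofactor in x - y = c (p - q), and
-- what remains is a polynomial identity for the ring solver. Nested uses combine several equations.
≈-by : ∀ {p q x y : Series} c → p ≈ q → x ⊕ c ⊛ q ≈ y ⊕ c ⊛ p → x ≈ y
≈-by {p} {q} {x} {y} c e h m = trans (k x (c ⊛ q) m) (trans (⊕-cong {g = ⊖ (c ⊛ q)} (λ m → trans (h m) (⊕-cong {f = y} (λ _ → refl) (⊛-cong {f = c} (λ _ → refl) e) m)) (λ _ → refl) m) (sym (k y (c ⊛ q) m)))
  where
  k : ∀ x z → x ≈ (x ⊕ z) ⊕ ⊖ z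
  k = S.solve 2 (λ x z → x S.:= (x S.:+ z) S.:+ (S.:- z)) (λ _ → refl)

-- Since `B` has no constant term, 1 - B is a unit.
fixpoint-0 : ∀ E B → Z B → E ≈ B ⊛ E → ∀ m → E m ≡ 0ℚ
fixpoint-0 E B zB e = deg-ind (λ m → E m ≡ 0ℚ) (λ m ih → trans (e m) (⊛-low m zB ih))

-- The equation determines each coefficient of θE from coefficients of `E` in smaller degree, and in
-- positive degree θ multiplies by a nonzero number. A homogeneous linear equation thus has only the
-- zero solution without constant term.
ode-0 : ∀ E A B → Z E → Z A → Z B → θ E ≈ A ⊛ E ⊕ B ⊛ θ E → ∀ m → E m ≡ 0ℚ
ode-0 E A B zE zA zB e = deg-ind (λ m → E m ≡ 0ℚ) (λ m ih → θ-0 E m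
  (trans (e m) (trans (⊕-at _ _ m) (trans (cong₂ ℚ._+_ (⊛-low m zA ih)
    (⊛-low m zB (λ b lt → trans (θ-at E b) (trans (cong (⟪ totDeg b ⟫ ℚ.*_) (ih b lt)) (ℚP.*-zeroʳ ⟪ totDeg b ⟫))))) (ℚP.+-identityˡ 0ℚ))))
  (zE m))

≈0⇒≈ : ∀ {x y} → (∀ m → (x ⊕ ⊖ y) m ≡ 0ℚ) → x ≈ y
≈0⇒≈ {x} {y} h m = trans (S.solve 2 (λ x y → x S.:= (x S.:+ S.:- y) S.:+ y) (λ _ → refl) x y m)
  (trans (⊕-at _ _ m) (trans (cong (ℚ._+ y m) (h m)) (ℚP.+-identityˡ (y m))))

θ-injective : ∀ {x y} → θ x ≈ θ y → (∀ m → totDeg m ≡ 0 → x m ≡ y m) → x ≈ y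
θ-injective {x} {y} e h = ≈0⇒≈ (λ m → θ-0 _ m
  (trans (θ-⊕ x (⊖ y) m) (trans (⊕-cong (e) (θ-⊖ y) m) (trans (S.solve 1 (λ y → y S.:+ S.:- y S.:= S.con 0ℚ) (λ _ → refl) (θ y) m) (κ-0 m))))
  (λ e0 → trans (⊕-at x _ m) (trans (cong₂ ℚ._+_ (h m e0) (⊖-at y m)) (ℚP.+-inverseʳ (y m)))))

pow : Series → ℕ → Series
pow f zero    = κ 1ℚ
pow f (suc k) = f ⊛ pow f k

pow-cong : ∀ {f g} → f ≈ g → ∀ k → pow f k ≈ pow g k
pow-cong e zero    m = refl
pow-cong e (suc k) m = ⊛-cong e (pow-cong e k) m

powS≡ : ∀ f k → powS f k ≡ pow f k
powS≡ f zero    = sym (κ-def 1ℚ)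
powS≡ f (suc k) = trans (mulS≡ f _) (cong (f ⊛_) (powS≡ f k))

pow-low : ∀ {u} → Z u → ∀ k m → totDeg m < k → pow u k m ≡ 0ℚ
pow-low zu (suc k) m (s≤s le) = ⊛-low m zu (λ b lt → pow-low zu k b (<-≤-trans lt le))

θ-pow : ∀ u k → θ (pow u (suc k)) ≈ κ ⟪ suc k ⟫ ⊛ (pow u k ⊛ θ u)
θ-pow u zero    m = trans (θ-⊛ u (κ 1ℚ) m) (trans (⊕-cong {f = θ u ⊛ κ 1ℚ} (λ _ → refl) (⊛-cong {f = u} (λ _ → refl) (θ-κ 1ℚ)) m)
  (trans (S.solve 2 (λ u t → t S.:* S.con 1ℚ S.:+ u S.:* S.con 0ℚ S.:= S.con 1ℚ S.:* (S.con 1ℚ S.:* t)) (λ _ → refl) u (θ u) m) (cong (λ c → (κ c ⊛ (κ 1ℚ ⊛ θ u)) m) (sym (⟪⟫-def 1)))))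
θ-pow u (suc k) m = trans (θ-⊛ u _ m) (trans (⊕-cong {f = θ u ⊛ pow u (suc k)} (λ _ → refl) (⊛-cong {f = u} (λ _ → refl) (θ-pow u k)) m)
  (trans (S.solve 4 (λ u p t c → t S.:* (u S.:* p) S.:+ u S.:* (c S.:* (p S.:* t)) S.:= (S.con 1ℚ S.:+ c) S.:* ((u S.:* p) S.:* t)) (λ _ → refl) u (pow u k) (θ u) (κ ⟪ suc k ⟫) m)
  (⊛-cong {g = (u ⊛ pow u k) ⊛ θ u} (λ m → trans (sym (κ-+ 1ℚ ⟪ suc k ⟫ m)) (cong (λ c → κ c m) (sym (trans (⟪⟫-+ 1 (suc k)) (cong (ℚ._+ ⟪ suc k ⟫) (⟪⟫-def 1)))))) (λ _ → refl) m)))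
  where
  κ-+ : ∀ a b → κ (a ℚ.+ b) ≈ κ a ⊕ κ b
  κ-+ a b m = trans (κ-lift ℚ._+_ refl a b m) (sym (⊕-at _ _ m))

Σ<-trunc : ∀ n N f → n ≤ N → (∀ i → n ≤ i → f i ≡ 0ℚ) → Σ< N f ≡ Σ< n f
Σ<-trunc zero    N       f le       h = trans (Σ<-zero N (λ i _ → h i z≤n)) (sym (Σ<-0 f))
Σ<-trunc (suc n) (suc N) f (s≤s le) h = trans (Σ<-suc N f) (trans (cong (f 0 ℚ.+_) (Σ<-trunc n N (f ∘ suc) le (λ i n≤i → h (suc i) (s≤s n≤i)))) (sym (Σ<-suc n f)))

opaque
  unfolding ΣL

  comp : (ℕ → ℚ) → Series → Series
  comp c u m = Σ< (suc (totDeg m)) (λ k → c k ℚ.* pow u k m)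

  comp-at : ∀ c u m → comp c u m ≡ Σ< (suc (totDeg m)) (λ k → c k ℚ.* pow u k m)
  comp-at c u m = refl

compose≈ : ∀ c u → compose c u ≈ comp c u
compose≈ c u m = trans (sym (ΣL-def (upTo (suc (totDeg m))) _)) (trans (ΣL-upTo (suc (totDeg m)) _)
  (trans (Σ<-cong (suc (totDeg m)) (λ k _ → cong (λ p → c k ℚ.* p m) (powS≡ u k))) (sym (comp-at c u m))))

comp-cong : ∀ c {u v} → u ≈ v → comp c u ≈ comp c v
comp-cong c {u} {v} e m = trans (comp-at c u m) (trans (Σ<-cong (suc (totDeg m)) (λ k _ → cong (c k ℚ.*_) (pow-cong e k m))) (sym (comp-at c v m)))

comp-congˡ : ∀ {c d} u → (∀ k → c k ≡ d k) → comp c u ≈ comp d u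
comp-congˡ {c} {d} u e m = trans (comp-at c u m) (trans (Σ<-cong (suc (totDeg m)) (λ k _ → cong (ℚ._* pow u k m) (e k))) (sym (comp-at d u m)))

-- The powers u^k start in degree k, so any larger cut-off gives the same value. A cut-off common to
-- all factors of a monomial allows sums and products to be exchanged.
comp-trunc : ∀ c {u} → Z u → ∀ K m → totDeg m < K → comp c u m ≡ Σ< K (λ k → c k ℚ.* pow u k m)
comp-trunc c {u} zu K m lt = trans (comp-at c u m) (sym (Σ<-trunc (suc (totDeg m)) K _ lt
  (λ i le → trans (cong (c i ℚ.*_) (pow-low zu i m le)) (ℚP.*-zeroʳ (c i)))))

comp-⊕ : ∀ c d u → comp c u ⊕ comp d u ≈ comp (λ k → c k ℚ.+ d k) u
comp-⊕ c d u m = trans (⊕-at _ _ m) (trans (cong₂ ℚ._+_ (comp-at c u m) (comp-at d u m)) (trans (sym (Σ<-+ (suc (totDeg m)) _ _))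
  (trans (Σ<-cong (suc (totDeg m)) (λ k _ → sym (ℚP.*-distribʳ-+ (pow u k m) (c k) (d k)))) (sym (comp-at _ u m)))))

comp-κ : ∀ a c u → comp (λ k → a ℚ.* c k) u ≈ κ a ⊛ comp c u
comp-κ a c u m = trans (comp-at _ u m) (trans (Σ<-cong (suc (totDeg m)) (λ k _ → ℚP.*-assoc a (c k) (pow u k m))) (trans (Σ<-*ˡ (suc (totDeg m)) a (λ k → c k ℚ.* pow u k m))
  (sym (trans (κ-⊛ a _ m) (cong (a ℚ.*_) (comp-at c u m))))))

comp-const : ∀ c u m → totDeg m ≡ 0 → comp c u m ≡ κ (c 0) m
comp-const c u m e = trans (comp-at c u m) (trans (cong (λ t → Σ< (suc t) (λ k → c k ℚ.* pow u k m)) e)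
  (trans (Σ<-suc 0 _) (trans (cong (c 0 ℚ.* κ 1ℚ m ℚ.+_) (Σ<-0 _)) (trans (ℚP.+-identityʳ _) (h m e)))))
  where
  h : ∀ m → totDeg m ≡ 0 → c 0 ℚ.* κ 1ℚ m ≡ κ (c 0) m
  h []         e = trans (cong (c 0 ℚ.*_) (κ-[] 1ℚ)) (trans (ℚP.*-identityʳ (c 0)) (sym (κ-[] (c 0))))
  h (zero ∷ m) e = trans (cong (c 0 ℚ.*_) (κ-0∷ 1ℚ m)) (trans (h m e) (sym (κ-0∷ (c 0) m)))

-- The coefficients of c′(x) and of x c(x).
der shift : (ℕ → ℚ) → ℕ → ℚ
der c k = ⟪ suc k ⟫ ℚ.* c (suc k)
shift c zero    = 0ℚ
shift c (suc k) = c k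

comp-shift : ∀ c {u} → Z u → u ⊛ comp c u ≈ comp (shift c) u
comp-shift c {u} zu m = begin
  (u ⊛ comp c u) m
    ≡⟨ ⊛-cong-deg m (λ a b e → cong (u a ℚ.*_) (comp-trunc c zu K b (s≤s (subst (totDeg b ≤_) e (m≤n+m _ (totDeg a)))))) ⟩
  (u ⊛ (λ b → Σ< K (λ k → c k ℚ.* pow u k b))) m
    ≡⟨ ⊛-Σ<ʳ K (λ k b → c k ℚ.* pow u k b) u m ⟩
  Σ< K (λ k → (u ⊛ (λ b → c k ℚ.* pow u k b)) m)
    ≡⟨ Σ<-cong K (λ k _ → trans (⊛-cong {f = u} (λ _ → refl) (λ b → sym (κ-⊛ (c k) (pow u k) b)) m)
         (trans (S.solve 3 (λ u c p → u S.:* (c S.:* p) S.:= c S.:* (u S.:* p)) (λ _ → refl) u (κ (c k)) (pow u k) m) (κ-⊛ (c k) _ m))) ⟩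
  Σ< K (λ k → c k ℚ.* pow u (suc k) m)
    ≡⟨ sym (trans (comp-trunc (shift c) zu (suc K) m (m<n⇒m<1+n ≤-refl)) (trans (Σ<-suc K _) (trans (cong (ℚ._+ Σ< K (λ k → c k ℚ.* pow u (suc k) m)) (ℚP.*-zeroˡ (κ 1ℚ m))) (ℚP.+-identityˡ _)))) ⟩
  comp (shift c) u m ∎
  where
  open ≡-Reasoning
  K = suc (totDeg m)

-- The chain rule, from the power rule `θ-pow` applied termwise to a truncated sum.
θ-comp : ∀ c {u} → Z u → θ (comp c u) ≈ comp (der c) u ⊛ θ u
θ-comp c {u} zu m = begin
  θ (comp c u) m
    -- One term more than necessary is kept, because differentiation lowers the index by one.
    ≡⟨ trans (θ-at _ m) (cong (⟪ totDeg m ⟫ ℚ.*_) (comp-trunc c zu (suc K) m (m<n⇒m<1+n ≤-refl))) ⟩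
  ⟪ totDeg m ⟫ ℚ.* Σ< (suc K) (λ k → c k ℚ.* pow u k m)
    ≡⟨ trans (sym (Σ<-*ˡ (suc K) ⟪ totDeg m ⟫ (λ k → c k ℚ.* pow u k m))) (Σ<-cong (suc K) (λ k _ → trans (swap ⟪ totDeg m ⟫ (c k) (pow u k m)) (cong (c k ℚ.*_) (sym (θ-at (pow u k) m))))) ⟩
  Σ< (suc K) (λ k → c k ℚ.* θ (pow u k) m)
    ≡⟨ trans (Σ<-suc K _) (trans (cong (ℚ._+ Σ< K (λ k → c (suc k) ℚ.* θ (pow u (suc k)) m)) (trans (cong (c 0 ℚ.*_) (trans (θ-κ 1ℚ m) (κ-0 m))) (ℚP.*-zeroʳ (c 0)))) (ℚP.+-identityˡ _)) ⟩
  Σ< K (λ k → c (suc k) ℚ.* θ (pow u (suc k)) m)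
    ≡⟨ Σ<-cong K (λ k _ → trans (cong (c (suc k) ℚ.*_) (trans (θ-pow u k m) (κ-⊛ _ _ m)))
         (trans (swap′ (c (suc k)) ⟪ suc k ⟫ ((pow u k ⊛ θ u) m)) (sym (trans (⊛-cong {g = θ u} (λ b → sym (κ-⊛ (der c k) (pow u k) b)) (λ _ → refl) m)
           (trans (⊛-assoc _ _ _ m) (κ-⊛ (der c k) _ m)))))) ⟩
  Σ< K (λ k → ((λ b → der c k ℚ.* pow u k b) ⊛ θ u) m)
    ≡⟨ sym (⊛-Σ<ˡ K (λ k b → der c k ℚ.* pow u k b) (θ u) m) ⟩
  ((λ b → Σ< K (λ k → der c k ℚ.* pow u k b)) ⊛ θ u) m
    ≡⟨ ⊛-cong-deg m (λ a b e → cong (ℚ._* θ u b) (sym (comp-trunc (der c) zu K a (s≤s (subst (totDeg a ≤_) e (m≤m+n _ (totDeg b))))))) ⟩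
  (comp (der c) u ⊛ θ u) m ∎
  where
  open ≡-Reasoning
  K = suc (totDeg m)
  swap : ∀ a b c → a ℚ.* (b ℚ.* c) ≡ b ℚ.* (a ℚ.* c)
  swap = solve 3 (λ a b c → a :* (b :* c) := b :* (a :* c)) refl where open +-*-Solver
  swap′ : ∀ a b c → a ℚ.* (b ℚ.* c) ≡ (b ℚ.* a) ℚ.* c
  swap′ = solve 3 (λ a b c → a :* (b :* c) := (b :* a) :* c) refl where open +-*-Solver

-- Square roots and logarithms

½ : ℚ
½ = ℤ.+ 1 ℚ./ 2

/1-neg : ∀ i → (ℤ.- i) ℚ./ 1 ≡ ℚ.- (i ℚ./ 1)
/1-neg i = begin
  x                                ≡⟨ solve 2 (λ x y → x := (x :+ y) :+ :- y) refl x (i ℚ./ 1) ⟩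
  (x ℚ.+ i ℚ./ 1) ℚ.+ ℚ.- (i ℚ./ 1)    ≡⟨ cong (ℚ._+ ℚ.- (i ℚ./ 1)) (trans (/1-+ (ℤ.- i) i) (cong (ℚ._/ 1) (ℤP.+-inverseˡ i))) ⟩
  0ℚ ℚ.+ ℚ.- (i ℚ./ 1)               ≡⟨ ℚP.+-identityˡ (ℚ.- (i ℚ./ 1)) ⟩
  ℚ.- (i ℚ./ 1) ∎
  where
  open ≡-Reasoning
  open +-*-Solver
  x = (ℤ.- i) ℚ./ 1

binomHalf-ratio : ∀ k → ⟪ suc k ⟫ ℚ.* ((ℤ.+ 1 ℤ.- ℤ.+ (2 * k)) ℚ./ suc (suc (2 * k))) ≡ ½ ℚ.+ ℚ.- ⟪ k ⟫
binomHalf-ratio k = *-cancelʳ-⟪⟫ 1 (begin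
  (⟪ suc k ⟫ ℚ.* r) ℚ.* ⟪ 2 ⟫
    ≡⟨ solve 3 (λ a r b → (a :* r) :* b := r :* (b :* a)) refl ⟪ suc k ⟫ r ⟪ 2 ⟫ ⟩
  r ℚ.* (⟪ 2 ⟫ ℚ.* ⟪ suc k ⟫)
    ≡⟨ cong (r ℚ.*_) (trans (sym (⟪⟫-* 2 (suc k))) (cong ⟪_⟫ (*-suc 2 k))) ⟩
  r ℚ.* ⟪ suc (suc (2 * k)) ⟫
    ≡⟨ /-cancel (ℤ.+ 1 ℤ.- ℤ.+ (2 * k)) (suc (2 * k)) ⟩
  (ℤ.+ 1 ℤ.- ℤ.+ (2 * k)) ℚ./ 1
    ≡⟨ trans (sym (/1-+ (ℤ.+ 1) (ℤ.- ℤ.+ (2 * k)))) (cong (1ℚ ℚ.+_) (trans (/1-neg (ℤ.+ (2 * k))) (cong ℚ.-_ (trans (sym (⟪⟫-def (2 * k))) (⟪⟫-* 2 k))))) ⟩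
  1ℚ ℚ.+ ℚ.- (⟪ 2 ⟫ ℚ.* ⟪ k ⟫)
    ≡⟨ trans (cong (λ t → 1ℚ ℚ.+ ℚ.- (t ℚ.* ⟪ k ⟫)) (⟪⟫-def 2))
       (trans (solve 1 (λ k → con 1ℚ :+ :- (con (ℤ.+ 2 ℚ./ 1) :* k) := (con ½ :+ :- k) :* con (ℤ.+ 2 ℚ./ 1)) refl ⟪ k ⟫)
       (cong ((½ ℚ.+ ℚ.- ⟪ k ⟫) ℚ.*_) (sym (⟪⟫-def 2)))) ⟩
  (½ ℚ.+ ℚ.- ⟪ k ⟫) ℚ.* ⟪ 2 ⟫ ∎)
  where
  open ≡-Reasoning
  open +-*-Solver
  r = (ℤ.+ 1 ℤ.- ℤ.+ (2 * k)) ℚ./ suc (suc (2 * k))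

-- In coefficients, this is (1 + x) f′ = ½ f for f = √(1 + x). Only this equation and the constant
-- term 1 characterise the square root in what follows.
binomHalf-der : ∀ k → der binomHalf k ℚ.+ shift (der binomHalf) k ≡ ½ ℚ.* binomHalf k
binomHalf-der k = trans (cong₂ ℚ._+_ (d k) (e k)) (solve 2 (λ b k → b :* (con ½ :+ :- k) :+ k :* b := con ½ :* b) refl (binomHalf k) ⟪ k ⟫)
  where
  open +-*-Solver
  d : ∀ k → der binomHalf k ≡ binomHalf k ℚ.* (½ ℚ.+ ℚ.- ⟪ k ⟫)
  d k = trans (solve 3 (λ a b r → a :* (b :* r) := b :* (a :* r)) refl ⟪ suc k ⟫ (binomHalf k) _) (cong (binomHalf k ℚ.*_) (binomHalf-ratio k))
  e : ∀ k → shift (der binomHalf) k ≡ ⟪ k ⟫ ℚ.* binomHalf k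
  e zero    = sym (trans (cong (ℚ._* 1ℚ) (⟪⟫-def 0)) refl)
  e (suc k) = refl

δ₀ δ₁ : ℕ → ℚ
δ₀ zero    = 1ℚ
δ₀ (suc _) = 0ℚ
δ₁ = shift δ₀

-- In coefficients, this is (1 + x) log′(1 + x) = 1.
logCoeff-der : ∀ k → der logCoeff k ℚ.+ shift (der logCoeff) k ≡ δ₀ k
logCoeff-der k = trans (cong (ℚ._+ shift (der logCoeff) k) (d k)) (e k)
  where
  d : ∀ k → der logCoeff k ≡ sgn k ℚ./ 1
  d k = trans (ℚP.*-comm ⟪ suc k ⟫ (sgn k ℚ./ suc k)) (/-cancel (sgn k) k)
  e : ∀ k → sgn k ℚ./ 1 ℚ.+ shift (der logCoeff) k ≡ δ₀ k
  e zero    = refl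
  e (suc k) = trans (cong (ℤ.- sgn k ℚ./ 1 ℚ.+_) (d k)) (trans (/1-+ (ℤ.- sgn k) (sgn k)) (cong (ℚ._/ 1) (ℤP.+-inverseˡ (sgn k))))

comp-δ₀ : ∀ u → comp δ₀ u ≈ κ 1ℚ
comp-δ₀ u m = trans (comp-at δ₀ u m) (trans (Σ<-suc (totDeg m) _) (trans (cong₂ ℚ._+_ (ℚP.*-identityˡ (κ 1ℚ m))
  (Σ<-zero (totDeg m) (λ i _ → ℚP.*-zeroˡ (pow u (suc i) m)))) (ℚP.+-identityʳ (κ 1ℚ m))))

comp-der : ∀ c d {u} → Z u → (∀ k → der c k ℚ.+ shift (der c) k ≡ d k) → (κ 1ℚ ⊕ u) ⊛ θ (comp c u) ≈ comp d u ⊛ θ u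
comp-der c d {u} zu h m = begin
  ((κ 1ℚ ⊕ u) ⊛ θ (comp c u)) m
    ≡⟨ ⊛-cong {f = κ 1ℚ ⊕ u} (λ _ → refl) (θ-comp c zu) m ⟩
  ((κ 1ℚ ⊕ u) ⊛ (comp (der c) u ⊛ θ u)) m
    ≡⟨ S.solve 3 (λ u d t → (S.con 1ℚ S.:+ u) S.:* (d S.:* t) S.:= (d S.:+ u S.:* d) S.:* t) (λ _ → refl) u (comp (der c) u) (θ u) m ⟩
  ((comp (der c) u ⊕ u ⊛ comp (der c) u) ⊛ θ u) m
    ≡⟨ ⊛-cong {g = θ u} (λ m → trans (⊕-cong {f = comp (der c) u} (λ _ → refl) (comp-shift (der c) zu) m)
         (trans (comp-⊕ (der c) (shift (der c)) u m) (comp-congˡ u h m))) (λ _ → refl) m ⟩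
  (comp d u ⊛ θ u) m ∎
  where open ≡-Reasoning

log-ode : ∀ {u} → Z u → (κ 1ℚ ⊕ u) ⊛ θ (comp logCoeff u) ≈ θ u
log-ode {u} zu m = trans (comp-der logCoeff δ₀ zu logCoeff-der m) (trans (⊛-cong {g = θ u} (comp-δ₀ u) (λ _ → refl) m) (⊛-identityˡ (θ u) m))

sqrt-ode : ∀ {u} → Z u → (κ 1ℚ ⊕ u) ⊛ θ (comp binomHalf u) ≈ κ ½ ⊛ (comp binomHalf u ⊛ θ u)
sqrt-ode {u} zu m = trans (comp-der binomHalf _ zu binomHalf-der m)
  (trans (⊛-cong {g = θ u} (comp-κ ½ binomHalf u) (λ _ → refl) m) (⊛-assoc (κ ½) _ _ m))

sqrt-Z : ∀ u → Z (comp binomHalf u ⊕ ⊖ κ 1ℚ)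
sqrt-Z u m e = trans (⊕-at _ _ m) (trans (cong₂ ℚ._+_ (comp-const binomHalf u m e) (⊖-at (κ 1ℚ) m)) (ℚP.+-inverseʳ (κ 1ℚ m)))

-- The error E = s² - (1 + u) satisfies (1 + u) θE = θu · E, by `sqrt-ode` multiplied by 2s, and it
-- has no constant term; so `ode-0` applies.
sqrt-square : ∀ {u} → Z u → comp binomHalf u ⊛ comp binomHalf u ≈ κ 1ℚ ⊕ u
sqrt-square {u} zu = ≈0⇒≈ (ode-0 E (θ u) (⊖ u) zE (θ-Z u) (Z-⊖ u zu) ode)
  where
  s = comp binomHalf u
  E = s ⊛ s ⊕ ⊖ (κ 1ℚ ⊕ u)
  zE : Z E
  zE = Z-≈ (S.solve 2 (λ s u → (s S.:+ S.:- S.con 1ℚ) S.:* (s S.:+ S.con 1ℚ) S.:+ S.:- u S.:= s S.:* s S.:+ S.:- (S.con 1ℚ S.:+ u)) (λ _ → refl) s u)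
    (Z-⊕ _ _ (Z-⊛ˡ _ _ (sqrt-Z u)) (Z-⊖ u zu))
  θE : θ E ≈ κ (ℤ.+ 2 ℚ./ 1) ⊛ (s ⊛ θ s) ⊕ ⊖ θ u
  θE m = trans (θ-⊕ (s ⊛ s) _ m) (trans (⊕-cong (θ-⊛ s s) (λ m → trans (θ-⊖ _ m) (⊖-cong (λ m → trans (θ-⊕ _ u m) (⊕-cong {g = θ u} (θ-κ 1ℚ) (λ _ → refl) m)) m)) m)
    (S.solve 3 (λ s t v → (t S.:* s S.:+ s S.:* t) S.:+ S.:- (S.con 0ℚ S.:+ v) S.:= S.con (ℤ.+ 2 ℚ./ 1) S.:* (s S.:* t) S.:+ S.:- v) (λ _ → refl) s (θ s) (θ u) m))
  ode : θ E ≈ θ u ⊛ E ⊕ (⊖ u) ⊛ θ E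
  ode m = trans (θE m) (trans (≈-by {x = κ (ℤ.+ 2 ℚ./ 1) ⊛ (s ⊛ θ s) ⊕ ⊖ θ u} {y = θ u ⊛ E ⊕ (⊖ u) ⊛ (κ (ℤ.+ 2 ℚ./ 1) ⊛ (s ⊛ θ s) ⊕ ⊖ θ u)} (κ (ℤ.+ 2 ℚ./ 1) ⊛ s) (sqrt-ode zu)
    (S.solve 4 (λ s t u v → (S.con (ℤ.+ 2 ℚ./ 1) S.:* (s S.:* t) S.:+ S.:- v) S.:+ (S.con (ℤ.+ 2 ℚ./ 1) S.:* s) S.:* (S.con ½ S.:* (s S.:* v)) S.:=
       (v S.:* (s S.:* s S.:+ S.:- (S.con 1ℚ S.:+ u)) S.:+ (S.:- u) S.:* (S.con (ℤ.+ 2 ℚ./ 1) S.:* (s S.:* t) S.:+ S.:- v)) S.:+ (S.con (ℤ.+ 2 ℚ./ 1) S.:* s) S.:* ((S.con 1ℚ S.:+ u) S.:* t))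
       (λ _ → refl) s (θ s) u (θ u)) m)
    (sym (⊕-cong {f = θ u ⊛ E} (λ _ → refl) (⊛-cong {f = ⊖ u} (λ _ → refl) θE) m)))

-- From (a - b)(a + b) = 0 and a + b = 2 + ((a - 1) + (b - 1)) the difference reproduces itself with
-- a factor without constant term. The constant term 1 of both series is what selects the sign.
sqrt-unique : ∀ a b → Z (a ⊕ ⊖ κ 1ℚ) → Z (b ⊕ ⊖ κ 1ℚ) → a ⊛ a ≈ b ⊛ b → a ≈ b
sqrt-unique a b za zb e = ≈0⇒≈ (fixpoint-0 (a ⊕ ⊖ b) B zB
  (≈-by {x = a ⊕ ⊖ b} {y = B ⊛ (a ⊕ ⊖ b)} (κ ½) e
    (S.solve 2 (λ a b → (a S.:+ S.:- b) S.:+ S.con ½ S.:* (b S.:* b) S.:=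
      (S.con (ℚ.- ½) S.:* ((a S.:+ S.:- S.con 1ℚ) S.:+ (b S.:+ S.:- S.con 1ℚ))) S.:* (a S.:+ S.:- b) S.:+ S.con ½ S.:* (a S.:* a)) (λ _ → refl) a b)))
  where
  B = κ (ℚ.- ½) ⊛ ((a ⊕ ⊖ κ 1ℚ) ⊕ (b ⊕ ⊖ κ 1ℚ))
  zB : Z B
  zB = Z-⊛ʳ _ _ (Z-⊕ _ _ za zb)

-- Univariate series in the variable s_{e+1}

ι : ℕ → (ℕ → ℚ) → Series
ι e       f []          = f 0
ι zero    f (k ∷ m)     = κ (f k) m
ι (suc e) f (zero ∷ m)  = ι e f m
ι (suc e) f (suc k ∷ m) = 0ℚ

cv : (ℕ → ℚ) → (ℕ → ℚ) → ℕ → ℚ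
cv f g n = Σ< (suc n) (λ i → f i ℚ.* g (n ∸ i))

κ-Σ< : ∀ n f m → κ (Σ< n f) m ≡ Σ< n (λ i → κ (f i) m)
κ-Σ< zero    f m = trans (cong (λ c → κ c m) (Σ<-0 f)) (trans (κ-0 m) (sym (Σ<-0 (λ i → κ (f i) m))))
κ-Σ< (suc n) f m = trans (cong (λ c → κ c m) (Σ<-suc n f)) (trans (κ-lift ℚ._+_ refl (f 0) (Σ< n (f ∘ suc)) m)
  (trans (cong (κ (f 0) m ℚ.+_) (κ-Σ< n (f ∘ suc) m)) (sym (Σ<-suc n (λ i → κ (f i) m)))))

κ-scale : ∀ a b m → κ (a ℚ.* b) m ≡ a ℚ.* κ b m
κ-scale a b m = trans (_-Raw-AlmostCommutative⟶_.*-homo κ-hom a b m) (κ-⊛ a (κ b) m)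

cv-0 : ∀ f g → f 0 ℚ.* g 0 ≡ cv f g 0
cv-0 f g = sym (trans (Σ<-suc 0 _) (trans (cong (f 0 ℚ.* g 0 ℚ.+_) (Σ<-0 _)) (ℚP.+-identityʳ _)))

ι-⊛ : ∀ e f g → ι e f ⊛ ι e g ≈ ι e (cv f g)
ι-⊛ zero    f g []         = trans (⊛-[] _ _) (cv-0 f g)
ι-⊛ zero    f g (k ∷ m)    = trans (⊛-∷ _ _ k m) (trans (Σ<-cong (suc k) (λ i _ → sym (_-Raw-AlmostCommutative⟶_.*-homo κ-hom (f i) (g (k ∸ i)) m)))
  (sym (κ-Σ< (suc k) (λ i → f i ℚ.* g (k ∸ i)) m)))
ι-⊛ (suc e) f g []         = trans (⊛-[] _ _) (cv-0 f g)
ι-⊛ (suc e) f g (zero ∷ m) = trans (⊛-∷ _ _ 0 m) (trans (Σ<-suc 0 _) (trans (cong (((ι e f) ⊛ (ι e g)) m ℚ.+_) (Σ<-0 _))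
  (trans (ℚP.+-identityʳ _) (ι-⊛ e f g m))))
ι-⊛ (suc e) f g (suc k ∷ m) = trans (⊛-∷ _ _ (suc k) m) (Σ<-zero (2 + k) (λ
  { zero _    → trans (⊛-comm _ _ m) (⊛-zeroˡ _ _ (λ _ → refl) m)
  ; (suc i) _ → ⊛-zeroˡ _ _ (λ _ → refl) m }))

ι-cong : ∀ e {f g} → (∀ k → f k ≡ g k) → ι e f ≈ ι e g
ι-cong zero    h []          = h 0
ι-cong zero    h (k ∷ m)     = cong (λ c → κ c m) (h k)
ι-cong (suc e) h []          = h 0
ι-cong (suc e) h (zero ∷ m)  = ι-cong e h m
ι-cong (suc e) h (suc k ∷ m) = refl

ι-⊕ : ∀ e f g → ι e f ⊕ ι e g ≈ ι e (λ k → f k ℚ.+ g k)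
ι-⊕ e f g m = trans (⊕-at _ _ m) (go e m)
  where
  go : ∀ e m → ι e f m ℚ.+ ι e g m ≡ ι e (λ k → f k ℚ.+ g k) m
  go zero    []          = refl
  go zero    (k ∷ m)     = sym (κ-lift ℚ._+_ refl (f k) (g k) m)
  go (suc e) []          = refl
  go (suc e) (zero ∷ m)  = go e m
  go (suc e) (suc k ∷ m) = refl

ι-κ : ∀ e c f → κ c ⊛ ι e f ≈ ι e (λ k → c ℚ.* f k)
ι-κ e c f m = trans (κ-⊛ c _ m) (go e m)
  where
  go : ∀ e m → c ℚ.* ι e f m ≡ ι e (λ k → c ℚ.* f k) m
  go zero    []          = refl
  go zero    (k ∷ m)     = sym (κ-scale c (f k) m)
  go (suc e) []          = refl
  go (suc e) (zero ∷ m)  = go e m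
  go (suc e) (suc k ∷ m) = ℚP.*-zeroʳ c

ι-δ₀ : ∀ e → ι e δ₀ ≈ κ 1ℚ
ι-δ₀ zero    []          = sym (κ-[] 1ℚ)
ι-δ₀ zero    (zero ∷ m)  = sym (κ-0∷ 1ℚ m)
ι-δ₀ zero    (suc k ∷ m) = trans (κ-0 m) (sym (κ-suc∷ 1ℚ k m))
ι-δ₀ (suc e) []          = sym (κ-[] 1ℚ)
ι-δ₀ (suc e) (zero ∷ m)  = trans (ι-δ₀ e m) (sym (κ-0∷ 1ℚ m))
ι-δ₀ (suc e) (suc k ∷ m) = sym (κ-suc∷ 1ℚ k m)

sv≈ι : ∀ e → sv e ≈ ι e δ₁
sv≈ι zero    []                = refl
sv≈ι zero    (zero ∷ m)        = sym (κ-0 m)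
sv≈ι zero    (suc (suc k) ∷ m) = sym (κ-0 m)
sv≈ι zero    (suc zero ∷ m)    = trans (h m) (cong-app (sym (κ-def 1ℚ)) m)
  where
  h : ∀ m → (if sameMono m [] then 1ℚ else 0ℚ) ≡ (if allZero m then 1ℚ else 0ℚ)
  h []      = refl
  h (k ∷ m) = refl
sv≈ι (suc e) []          with allZero (replicate e 0 ++ [ 1 ]) | az e
  where
  az : ∀ e → allZero (replicate e 0 ++ [ 1 ]) ≡ false
  az zero    = refl
  az (suc e) = az e
... | _ | refl = refl
sv≈ι (suc e) (zero ∷ m)  = sv≈ι e m
sv≈ι (suc e) (suc k ∷ m) = refl

θ-ι : ∀ e f → θ (ι e f) ≈ ι e (λ k → ⟪ k ⟫ ℚ.* f k)
θ-ι e f m = trans (θ-at _ m) (go e m)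
  where
  κ-θ : ∀ c j m → ⟪ j + totDeg m ⟫ ℚ.* κ c m ≡ ⟪ j ⟫ ℚ.* κ c m
  κ-θ c j []          = cong (λ t → ⟪ t ⟫ ℚ.* κ c []) (+-identityʳ j)
  κ-θ c j (zero ∷ m)  = trans (cong (⟪ j + totDeg m ⟫ ℚ.*_) (κ-0∷ c m)) (trans (κ-θ c j m) (cong (⟪ j ⟫ ℚ.*_) (sym (κ-0∷ c m))))
  κ-θ c j (suc k ∷ m) = trans (cong (⟪ j + totDeg (suc k ∷ m) ⟫ ℚ.*_) (κ-suc∷ c k m)) (trans (ℚP.*-zeroʳ ⟪ j + totDeg (suc k ∷ m) ⟫)
    (sym (trans (cong (⟪ j ⟫ ℚ.*_) (κ-suc∷ c k m)) (ℚP.*-zeroʳ ⟪ j ⟫))))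
  go : ∀ e m → ⟪ totDeg m ⟫ ℚ.* ι e f m ≡ ι e (λ k → ⟪ k ⟫ ℚ.* f k) m
  go zero    []          = refl
  go zero    (k ∷ m)     = trans (κ-θ (f k) k m) (sym (κ-scale ⟪ k ⟫ (f k) m))
  go (suc e) []          = refl
  go (suc e) (zero ∷ m)  = go e m
  go (suc e) (suc k ∷ m) = ℚP.*-zeroʳ ⟪ totDeg (suc k ∷ m) ⟫

ι-const : ∀ e f m → totDeg m ≡ 0 → ι e f m ≡ f 0
ι-const zero    f []         h = refl
ι-const zero    f (zero ∷ m) h = k (f 0) m h
  where
  k : ∀ c m → totDeg m ≡ 0 → κ c m ≡ c
  k c []         h = κ-[] c
  k c (zero ∷ m) h = trans (κ-0∷ c m) (k c m h)
ι-const (suc e) f []         h = refl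
ι-const (suc e) f (zero ∷ m) h = ι-const e f m h

-- Schröder series

addS-≈ : ∀ {f f′ g g′} → f ≈ f′ → g ≈ g′ → addS f g ≈ f′ ⊕ g′
addS-≈ {f} {f′} {g} {g′} e e′ m = trans (cong₂ ℚ._+_ (e m) (e′ m)) (sym (⊕-at f′ g′ m))

mulS-≈ : ∀ {f f′ g g′} → f ≈ f′ → g ≈ g′ → mulS f g ≈ f′ ⊛ g′
mulS-≈ {f} {f′} {g} {g′} e e′ m = trans (cong-app (mulS≡ f g) m) (⊛-cong e e′ m)

constS-≈ : ∀ c → constS c ≈ κ c
constS-≈ c = cong-app (sym (κ-def c))

scaleS-≈ : ∀ c {f f′} → f ≈ f′ → scaleS c f ≈ κ c ⊛ f′
scaleS-≈ c {f} {f′} e m = trans (cong (c ℚ.*_) (e m)) (sym (κ-⊛ c f′ m))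

square-≈ : ∀ {f f′} → f ≈ f′ → powS f 2 ≈ f′ ⊛ (f′ ⊛ κ 1ℚ)
square-≈ {f} {f′} e = mulS-≈ e (mulS-≈ e (constS-≈ 1ℚ))

reflS : ∀ {f} → f ≈ f
reflS _ = refl

sumS-upTo : ∀ N F m → sumS (map F (upTo N)) m ≡ Σ< N (λ e → F e m)
sumS-upTo N F m = go N id
  where
  go : ∀ N g → sumS (map F (applyUpTo g N)) m ≡ Σ< N (λ e → F (g e) m)
  go zero    g = trans (constS-≈ 0ℚ m) (trans (κ-0 m) (sym (Σ<-0 _)))
  go (suc N) g = trans (cong (F (g 0) m ℚ.+_) (go N (g ∘ suc))) (sym (Σ<-suc N (λ e → F (g e) m)))

cv-δ₁ : ∀ w n → cv δ₁ w n ≡ shift w n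
cv-δ₁ w zero    = trans (Σ<-suc 0 _) (trans (cong₂ ℚ._+_ (ℚP.*-zeroˡ (w 0)) (Σ<-0 _)) (ℚP.+-identityˡ 0ℚ))
cv-δ₁ w (suc k) = trans (Σ<-suc (suc k) _) (trans (cong₂ ℚ._+_ (ℚP.*-zeroˡ (w (suc k))) (trans (Σ<-suc k _)
  (cong₂ ℚ._+_ (ℚP.*-identityˡ (w k)) (Σ<-zero k (λ i _ → ℚP.*-zeroˡ (w (k ∸ suc i))))))) (trans (ℚP.+-identityˡ _) (ℚP.+-identityʳ (w k))))

s-⊛ : ∀ e w → ι e δ₁ ⊛ ι e w ≈ ι e (shift w)
s-⊛ e w m = trans (ι-⊛ e δ₁ w m) (ι-cong e (cv-δ₁ w) m)

/-cancelˡ : ∀ d x → ⟪ suc d ⟫ ℚ.* (x ℚ.* (ℤ.+ 1 ℚ./ suc d)) ≡ x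
/-cancelˡ d x = trans (solve 3 (λ a x r → a :* (x :* r) := x :* (r :* a)) refl ⟪ suc d ⟫ x (ℤ.+ 1 ℚ./ suc d))
  (trans (cong (x ℚ.*_) (/-cancel (ℤ.+ 1) d)) (ℚP.*-identityʳ x))
  where open +-*-Solver

-- `w` and `u` will be the numbers of trees and of forests with a given number of leaves. The
-- analysis only needs the two recurrences w = x + w² u and u = 1 + w u, which say u = 1 / (1 - w).
module Schröder (w u : ℕ → ℚ) (w0 : w 0 ≡ 0ℚ)
  (w-rec : ∀ n → w n ≡ δ₁ n ℚ.+ cv w (cv w u) n) (u-rec : ∀ n → u n ≡ δ₀ n ℚ.+ cv w u n) where

  -- `rot k` is the number of dissections fixed by a nontrivial rotation with `k` cycles, `avg` the
  -- same divided by k, which is -log(1 - w), and `idc n` the share w_{n-1} / 2n of the identity. As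
  -- series `R′` is (w - s) / s² and `R` is (w - s) / s, for the reflections fixing two vertices and
  -- one vertex. The constant term of `R` is 0 instead of w₁ because the single vertex is not in the
  -- class.
  kw rot avg idc R′ R : ℕ → ℚ
  kw k = ⟪ k ⟫ ℚ.* w k
  rot = cv u kw
  avg zero    = 0ℚ
  avg (suc k) = rot (suc k) ℚ.* (ℤ.+ 1 ℚ./ suc k)
  idc zero    = 0ℚ
  idc (suc k) = ½ ℚ.* (w k ℚ.* (ℤ.+ 1 ℚ./ suc k))
  R′ k = w (suc (suc k))
  R = shift R′

  w1 : w 1 ≡ 1ℚ
  w1 = trans (w-rec 1) (trans (cong (1ℚ ℚ.+_) (trans (Σ<-suc 1 _) (cong₂ ℚ._+_ (trans (cong (ℚ._* cv w u 1) w0) (ℚP.*-zeroˡ (cv w u 1)))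
    (trans (Σ<-suc 0 _) (trans (cong₂ ℚ._+_ (trans (cong (w 1 ℚ.*_) (trans (sym (cv-0 w u)) (trans (cong (ℚ._* u 0) w0) (ℚP.*-zeroˡ (u 0))))) (ℚP.*-zeroʳ (w 1)))
      (Σ<-0 _)) (ℚP.+-identityˡ 0ℚ)))))) (trans (cong (1ℚ ℚ.+_) (ℚP.+-identityˡ 0ℚ)) (ℚP.+-identityʳ 1ℚ)))

  rot0 : rot 0 ≡ 0ℚ
  rot0 = trans (sym (cv-0 u kw)) (trans (cong (λ t → u 0 ℚ.* (t ℚ.* w 0)) (⟪⟫-def 0)) (trans (cong (u 0 ℚ.*_) (ℚP.*-zeroˡ (w 0))) (ℚP.*-zeroʳ (u 0))))

  shift-R : ∀ k → shift R k ℚ.+ δ₁ k ≡ w k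
  shift-R zero          = trans (ℚP.+-identityˡ 0ℚ) (sym w0)
  shift-R (suc zero)    = trans (ℚP.+-identityˡ 1ℚ) (sym w1)
  shift-R (suc (suc k)) = ℚP.+-identityʳ (w (suc (suc k)))

  module _ (e : ℕ) where
    s W U Δ Q : Series
    s = ι e δ₁
    W = ι e w
    U = ι e u
    Δ = s ⊛ (s ⊛ κ 1ℚ) ⊕ (κ (q (ℤ.- ℤ.+ 6)) ⊛ s ⊕ κ 1ℚ)
    Q = κ 1ℚ ⊕ s ⊕ κ (ℤ.- ℤ.+ 4 ℚ./ 1) ⊛ W

    zs : Z s
    zs m h = ι-const e δ₁ m h

    zW : Z W
    zW m h = trans (ι-const e w m h) w0

    W-eq : W ≈ s ⊕ W ⊛ (W ⊛ U)
    W-eq m = trans (ι-cong e w-rec m) (sym (trans (⊕-cong {f = s} reflS (λ m → trans (⊛-cong {f = W} reflS (ι-⊛ e w u) m) (ι-⊛ e w (cv w u) m)) m)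
      (ι-⊕ e δ₁ (cv w (cv w u)) m)))

    U-eq : U ≈ κ 1ℚ ⊕ W ⊛ U
    U-eq m = trans (ι-cong e u-rec m) (sym (trans (⊕-cong (λ m → sym (ι-δ₀ e m)) (ι-⊛ e w u) m) (ι-⊕ e δ₀ (cv w u) m)))

    -- Multiply `W-eq` by 1 - W and replace (1 - W) U by 1. The discriminant of the resulting
    -- equation 2W² - (1 + s) W + s = 0 is (1 + s)² - 8s = s² - 6s + 1.
    W-quadratic : W ≈ s ⊕ (κ (ℤ.+ 2 ℚ./ 1) ⊛ (W ⊛ W) ⊕ ⊖ (s ⊛ W))
    W-quadratic = ≈-by (κ 1ℚ ⊕ ⊖ W) W-eq (≈-by (W ⊛ W) U-eq
      (S.solve 3 (λ s w u →
        (w S.:+ (S.con 1ℚ S.:+ S.:- w) S.:* (s S.:+ w S.:* (w S.:* u))) S.:+ (w S.:* w) S.:* (S.con 1ℚ S.:+ w S.:* u) S.:=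
        ((s S.:+ (S.con (ℤ.+ 2 ℚ./ 1) S.:* (w S.:* w) S.:+ S.:- (s S.:* w))) S.:+ (S.con 1ℚ S.:+ S.:- w) S.:* w) S.:+ (w S.:* w) S.:* u) (λ _ → refl) s W U))

    -- By the quadratic equation 1 + 2W - s is an inverse of 1 - W as well, so its difference E from
    -- `U` satisfies E = W E.
    U-linear : U ≈ κ 1ℚ ⊕ κ (ℤ.+ 2 ℚ./ 1) ⊛ W ⊕ ⊖ s
    U-linear = ≈0⇒≈ (fixpoint-0 (U ⊕ ⊖ U′) W zW (≈-by (κ 1ℚ) U-eq (≈-by (κ (ℤ.- ℤ.+ 1 ℚ./ 1)) W-quadratic
      (S.solve 3 (λ s w u → let v = S.con 1ℚ S.:+ S.con (ℤ.+ 2 ℚ./ 1) S.:* w S.:+ S.:- s in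
        ((u S.:+ S.:- v) S.:+ S.con 1ℚ S.:* (S.con 1ℚ S.:+ w S.:* u)) S.:+ S.con (ℤ.- ℤ.+ 1 ℚ./ 1) S.:* (s S.:+ (S.con (ℤ.+ 2 ℚ./ 1) S.:* (w S.:* w) S.:+ S.:- (s S.:* w))) S.:=
        (w S.:* (u S.:+ S.:- v) S.:+ S.con 1ℚ S.:* u) S.:+ S.con (ℤ.- ℤ.+ 1 ℚ./ 1) S.:* w) (λ _ → refl) s W U))))
      where
      U′ = κ 1ℚ ⊕ κ (ℤ.+ 2 ℚ./ 1) ⊛ W ⊕ ⊖ s

    Δ-≈ : addS (powS (sv e) 2) (addS (scaleS (q (ℤ.- ℤ.+ 6)) (sv e)) (constS 1ℚ)) ≈ Δ
    Δ-≈ = addS-≈ (square-≈ (sv≈ι e)) (addS-≈ (scaleS-≈ _ (sv≈ι e)) (constS-≈ 1ℚ))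

    -- `Q` solves the quadratic equation backwards for the root, and its constant term is 1, so it
    -- is the root that `sqrtS` produces.
    sqrtA-≈ : sqrtA (sv e) ≈ Q
    sqrtA-≈ m = trans (compose≈ binomHalf _ m) (trans (comp-cong binomHalf v≈ m) (sqrt-unique _ Q (sqrt-Z v) zQ sq m))
      where
      v = Δ ⊕ κ (ℚ.- 1ℚ)
      v≈ = addS-≈ Δ-≈ (constS-≈ (ℚ.- 1ℚ))
      zv : Z v
      zv = Z-≈ (S.solve 1 (λ s → s S.:* (s S.:+ S.con (q (ℤ.- ℤ.+ 6))) S.:= (s S.:* (s S.:* S.con 1ℚ) S.:+ (S.con (q (ℤ.- ℤ.+ 6)) S.:* s S.:+ S.con 1ℚ)) S.:+ S.con (ℚ.- 1ℚ)) (λ _ → refl) s)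
        (Z-⊛ˡ s _ zs)
      zQ : Z (Q ⊕ ⊖ κ 1ℚ)
      zQ = Z-≈ (S.solve 2 (λ s w → s S.:+ S.con (ℤ.- ℤ.+ 4 ℚ./ 1) S.:* w S.:= (S.con 1ℚ S.:+ s S.:+ S.con (ℤ.- ℤ.+ 4 ℚ./ 1) S.:* w) S.:+ S.:- S.con 1ℚ) (λ _ → refl) s W)
        (Z-⊕ s _ zs (Z-⊛ʳ _ W zW))
      sq : comp binomHalf v ⊛ comp binomHalf v ≈ Q ⊛ Q
      -- The factor 8 comes from Q² - (s² - 6s + 1) = 8 (s + 2W² - sW - W).
      sq = λ m → trans (sqrt-square zv m) (≈-by {x = κ 1ℚ ⊕ v} {y = Q ⊛ Q} (κ (ℤ.+ 8 ℚ./ 1)) W-quadratic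
        (S.solve 2 (λ s w → let Δ = s S.:* (s S.:* S.con 1ℚ) S.:+ (S.con (q (ℤ.- ℤ.+ 6)) S.:* s S.:+ S.con 1ℚ) ; Q = S.con 1ℚ S.:+ s S.:+ S.con (ℤ.- ℤ.+ 4 ℚ./ 1) S.:* w in
          (S.con 1ℚ S.:+ (Δ S.:+ S.con (ℚ.- 1ℚ))) S.:+ S.con (ℤ.+ 8 ℚ./ 1) S.:* (s S.:+ (S.con (ℤ.+ 2 ℚ./ 1) S.:* (w S.:* w) S.:+ S.:- (s S.:* w))) S.:=
          Q S.:* Q S.:+ S.con (ℤ.+ 8 ℚ./ 1) S.:* w) (λ _ → refl) s W) m)

    θ-avg : θ (ι e avg) ≈ U ⊛ θ W
    θ-avg m = trans (θ-ι e avg m) (trans (ι-cong e h m) (sym (trans (⊛-cong {f = U} reflS (θ-ι e w) m) (ι-⊛ e u kw m))))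
      where
      h : ∀ k → ⟪ k ⟫ ℚ.* avg k ≡ rot k
      h zero    = trans (ℚP.*-zeroʳ ⟪ 0 ⟫) (sym rot0)
      h (suc k) = /-cancelˡ k (rot (suc k))

    -- Inserting the root turns the argument of the logarithm into 3/4 - s/4 + (1 + s - 4W)/4 = 1 -
    -- W. Both sides have θ-derivative -θW / (1 - W), by `log-ode` and `θ-avg`, and no constant
    -- term.
    Lterm-≈ : Lterm (sv e) ≈ ⊖ ι e avg
    Lterm-≈ m = trans (compose≈ logCoeff _ m) (trans (comp-cong logCoeff v≈ m) (θ-injective θL const m))
      where
      v≈ : addS (addS (constS (ℤ.+ 3 ℚ./ 4)) (addS (scaleS (ℤ.- ℤ.+ 1 ℚ./ 4) (sv e)) (scaleS (ℤ.+ 1 ℚ./ 4) (sqrtA (sv e))))) (constS (ℚ.- 1ℚ)) ≈ ⊖ W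
      v≈ m = trans (addS-≈ (addS-≈ (constS-≈ _) (addS-≈ (scaleS-≈ (ℤ.- ℤ.+ 1 ℚ./ 4) (sv≈ι e)) (scaleS-≈ (ℤ.+ 1 ℚ./ 4) sqrtA-≈))) (constS-≈ _) m)
        (S.solve 2 (λ s w → (S.con (ℤ.+ 3 ℚ./ 4) S.:+ (S.con (ℤ.- ℤ.+ 1 ℚ./ 4) S.:* s S.:+ S.con (ℤ.+ 1 ℚ./ 4) S.:* (S.con 1ℚ S.:+ s S.:+ S.con (ℤ.- ℤ.+ 4 ℚ./ 1) S.:* w))) S.:+ S.con (ℚ.- 1ℚ)
          S.:= S.:- w) (λ _ → refl) s W m)
      L = comp logCoeff (⊖ W)
      z-W : Z (⊖ W)
      z-W = Z-⊖ W zW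
      θL : θ L ≈ θ (⊖ ι e avg)
      θL m = trans (≈-by {x = θ L} {y = ⊖ (U ⊛ θ W)} U (log-ode z-W) (≈-by (⊖ θ L) U-eq (≈-by U (θ-⊖ W)
        (S.solve 5 (λ w u t l n → ((l S.:+ u S.:* n) S.:+ (S.:- l) S.:* (S.con 1ℚ S.:+ w S.:* u)) S.:+ u S.:* (S.:- t) S.:=
          ((S.:- (u S.:* t) S.:+ u S.:* ((S.con 1ℚ S.:+ S.:- w) S.:* l)) S.:+ (S.:- l) S.:* u) S.:+ u S.:* n) (λ _ → refl) W U (θ W) (θ L) (θ (⊖ W))))) m)
        (sym (trans (θ-⊖ (ι e avg) m) (⊖-cong θ-avg m)))
      const : ∀ m → totDeg m ≡ 0 → L m ≡ (⊖ ι e avg) m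
      const m h = trans (comp-const logCoeff (⊖ W) m h) (trans (κ-0 m) (sym (trans (⊖-at _ m) (cong ℚ.-_ (ι-const e avg m h)))))

    -- θ of `idc` is ½ s W, so `idc` is essentially the integral of W, and this is its closed form
    -- up to the logarithm. After applying θ and inserting U = 1 + 2W - s, the two sides differ by a
    -- multiple of the derivative `θW-eq` of the quadratic equation.
    idc-≈ : κ (ℤ.+ 16 ℚ./ 1) ⊛ ι e idc ≈ κ (ℤ.+ 8 ℚ./ 1) ⊛ ι e avg ⊕ (κ (ℤ.+ 4 ℚ./ 1) ⊛ s ⊕ κ (ℤ.- ℤ.+ 12 ℚ./ 1) ⊛ W ⊕ κ (ℤ.+ 4 ℚ./ 1) ⊛ (s ⊛ W))
    idc-≈ = θ-injective θ≈ (λ m h → trans (zl m h) (sym (zr m h)))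
      where
      zι : ∀ f → f 0 ≡ 0ℚ → Z (ι e f)
      zι f f0 m h = trans (ι-const e f m h) f0
      zl : Z (κ (ℤ.+ 16 ℚ./ 1) ⊛ ι e idc)
      zl = Z-⊛ʳ _ _ (zι idc refl)
      zr : Z (κ (ℤ.+ 8 ℚ./ 1) ⊛ ι e avg ⊕ (κ (ℤ.+ 4 ℚ./ 1) ⊛ s ⊕ κ (ℤ.- ℤ.+ 12 ℚ./ 1) ⊛ W ⊕ κ (ℤ.+ 4 ℚ./ 1) ⊛ (s ⊛ W)))
      zr = Z-⊕ _ _ (Z-⊛ʳ _ _ (zι avg refl)) (Z-⊕ _ _ (Z-⊕ _ _ (Z-⊛ʳ _ _ zs) (Z-⊛ʳ _ _ zW)) (Z-⊛ʳ _ _ (Z-⊛ˡ _ _ zs)))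
      θκ : ∀ c f → θ (κ c ⊛ f) ≈ κ c ⊛ θ f
      θκ c f m = trans (θ-⊛ (κ c) f m) (trans (⊕-cong {g = κ c ⊛ θ f} (⊛-cong {g = f} (θ-κ c) reflS) reflS m)
        (S.solve 2 (λ f g → S.con 0ℚ S.:* f S.:+ g S.:= g) (λ _ → refl) f (κ c ⊛ θ f) m))
      θs : θ s ≈ s
      θs m = trans (θ-ι e δ₁ m) (ι-cong e h m)
        where
        h : ∀ k → ⟪ k ⟫ ℚ.* δ₁ k ≡ δ₁ k
        h zero          = ℚP.*-zeroʳ ⟪ 0 ⟫
        h (suc zero)    = trans (ℚP.*-identityʳ ⟪ 1 ⟫) (⟪⟫-def 1)
        h (suc (suc k)) = ℚP.*-zeroʳ ⟪ suc (suc k) ⟫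
      θsW : θ (s ⊛ W) ≈ s ⊛ W ⊕ s ⊛ θ W
      θsW m = trans (θ-⊛ s W m) (⊕-cong {g = s ⊛ θ W} (⊛-cong {g = W} θs reflS) reflS m)
      θidc : θ (ι e idc) ≈ κ ½ ⊛ (s ⊛ W)
      θidc m = trans (θ-ι e idc m) (trans (ι-cong e h m) (sym (trans (⊛-cong {f = κ ½} reflS (s-⊛ e w) m) (ι-κ e ½ (shift w) m))))
        where
        h : ∀ k → ⟪ k ⟫ ℚ.* idc k ≡ ½ ℚ.* shift w k
        h zero    = trans (ℚP.*-zeroʳ ⟪ 0 ⟫) (sym (ℚP.*-zeroʳ ½))
        h (suc k) = trans (solve 3 (λ a b c → a :* (b :* c) := b :* (a :* c)) refl ⟪ suc k ⟫ ½ (w k ℚ.* (ℤ.+ 1 ℚ./ suc k))) (cong (½ ℚ.*_) (/-cancelˡ k (w k)))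
          where open +-*-Solver
      θW-eq : θ W ≈ s ⊕ (κ (ℤ.+ 2 ℚ./ 1) ⊛ (θ W ⊛ W ⊕ W ⊛ θ W) ⊕ ⊖ (s ⊛ W ⊕ s ⊛ θ W))
      θW-eq m = trans (θ-cong W-quadratic m) (trans (θ-⊕ s _ m) (⊕-cong θs (λ m → trans (θ-⊕ _ _ m)
        (⊕-cong (λ m → trans (θκ (ℤ.+ 2 ℚ./ 1) (W ⊛ W) m) (⊛-cong {f = κ (ℤ.+ 2 ℚ./ 1)} reflS (θ-⊛ W W) m)) (λ m → trans (θ-⊖ _ m) (⊖-cong θsW m)) m)) m))
      θ≈ : θ (κ (ℤ.+ 16 ℚ./ 1) ⊛ ι e idc) ≈ θ (κ (ℤ.+ 8 ℚ./ 1) ⊛ ι e avg ⊕ (κ (ℤ.+ 4 ℚ./ 1) ⊛ s ⊕ κ (ℤ.- ℤ.+ 12 ℚ./ 1) ⊛ W ⊕ κ (ℤ.+ 4 ℚ./ 1) ⊛ (s ⊛ W)))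
      θ≈ m = trans (θκ _ _ m) (trans (⊛-cong {f = κ (ℤ.+ 16 ℚ./ 1)} reflS θidc m) (trans
        (≈-by {x = κ (ℤ.+ 16 ℚ./ 1) ⊛ (κ ½ ⊛ (s ⊛ W))}
              {y = κ (ℤ.+ 8 ℚ./ 1) ⊛ (U ⊛ θ W) ⊕ (κ (ℤ.+ 4 ℚ./ 1) ⊛ s ⊕ κ (ℤ.- ℤ.+ 12 ℚ./ 1) ⊛ θ W ⊕ κ (ℤ.+ 4 ℚ./ 1) ⊛ (s ⊛ W ⊕ s ⊛ θ W))}
              (κ (ℤ.- ℤ.+ 8 ℚ./ 1) ⊛ θ W) U-linear (≈-by (κ (ℤ.+ 4 ℚ./ 1)) θW-eq
          (S.solve 4 (λ s w t u →
            (S.con (ℤ.+ 16 ℚ./ 1) S.:* (S.con ½ S.:* (s S.:* w)) S.:+ (S.con (ℤ.- ℤ.+ 8 ℚ./ 1) S.:* t) S.:* (S.con 1ℚ S.:+ S.con (ℤ.+ 2 ℚ./ 1) S.:* w S.:+ S.:- s)) S.:+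
              S.con (ℤ.+ 4 ℚ./ 1) S.:* (s S.:+ (S.con (ℤ.+ 2 ℚ./ 1) S.:* (t S.:* w S.:+ w S.:* t) S.:+ S.:- (s S.:* w S.:+ s S.:* t))) S.:=
            ((S.con (ℤ.+ 8 ℚ./ 1) S.:* (u S.:* t) S.:+ (S.con (ℤ.+ 4 ℚ./ 1) S.:* s S.:+ S.con (ℤ.- ℤ.+ 12 ℚ./ 1) S.:* t S.:+ S.con (ℤ.+ 4 ℚ./ 1) S.:* (s S.:* w S.:+ s S.:* t)))
              S.:+ (S.con (ℤ.- ℤ.+ 8 ℚ./ 1) S.:* t) S.:* u) S.:+ S.con (ℤ.+ 4 ℚ./ 1) S.:* t) (λ _ → refl) s W (θ W) U)) m)
        (sym (trans (θ-⊕ _ _ m) (⊕-cong (λ m → trans (θκ _ _ m) (⊛-cong {f = κ (ℤ.+ 8 ℚ./ 1)} reflS θ-avg m))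
          (λ m → trans (θ-⊕ _ _ m) (⊕-cong (λ m → trans (θ-⊕ _ _ m) (⊕-cong (λ m → trans (θκ _ _ m) (⊛-cong {f = κ (ℤ.+ 4 ℚ./ 1)} reflS θs m)) (θκ _ W) m))
            (λ m → trans (θκ _ _ m) (⊛-cong {f = κ (ℤ.+ 4 ℚ./ 1)} reflS θsW m)) m)) m)))))

  logPart : ℕ → Series
  logPart N m = Σ< N (λ e → (½ ℚ.* (ℤ.+ totient (suc e) ℚ./ suc e)) ℚ.* ι e avg m)

  partialSum-≈ : ∀ N → partialSum N ≈ logPart N
  partialSum-≈ N m = trans (sumS-upTo N _ m) (Σ<-cong N (λ e _ → h (ℤ.+ totient (suc e) ℚ./ suc e) e))
    where
    open +-*-Solver
    h : ∀ c e → (ℤ.- ℤ.+ 1 ℚ./ 2) ℚ.* (c ℚ.* Lterm (sv e) m) ≡ (½ ℚ.* c) ℚ.* ι e avg m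
    h c e = trans (cong (λ t → (ℤ.- ℤ.+ 1 ℚ./ 2) ℚ.* (c ℚ.* t)) (trans (Lterm-≈ e m) (⊖-at (ι e avg) m)))
      (solve 2 (λ c x → con (ℤ.- ℤ.+ 1 ℚ./ 2) :* (c :* :- x) := (con ½ :* c) :* x) refl c (ι e avg m))

  -- `correction` replaces the term ½ `avg` that the logarithm for d = 1 supplies by the true share
  -- `idc` of the identity, and adds the reflections: ½ x₁ R for odd n, where all n of them fix one
  -- vertex, and for even n the n/2 with two fixed vertices and the n/2 with none, each kind with
  -- weight ¼.
  x₁ x₂ correction target : Series
  x₁ = ι 0 δ₁
  x₂ = ι 1 δ₁
  correction = (ι 0 idc ⊕ ⊖ (κ ½ ⊛ ι 0 avg)) ⊕ (κ ½ ⊛ (x₁ ⊛ ι 1 R) ⊕ (κ (ℤ.+ 1 ℚ./ 4) ⊛ (x₁ ⊛ (x₁ ⊛ ι 1 R′)) ⊕ κ (ℤ.+ 1 ℚ./ 4) ⊛ ι 1 w))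

  -- The logarithms are summed up to the length of the monomial, beyond which they do not contribute.
  target m = (logPart (length m) ⊕ correction) m

  -- The denominators are cleared by the relations x₂ R + x₂ = w and x₂² R′ + x₂ = w in the variable
  -- s₂. Together with `idc-≈` they enter with the cofactors x₂², 8 x₁ x₂ and 4 x₁², and the rest is
  -- a polynomial identity.
  correction-≈ : κ (ℤ.+ 16 ℚ./ 1) ⊛ ((x₂ ⊛ (x₂ ⊛ κ 1ℚ)) ⊛ correction) ≈ restTimes16s2²
  correction-≈ m = trans (≈-by {x = κ (ℤ.+ 16 ℚ./ 1) ⊛ ((x₂ ⊛ (x₂ ⊛ κ 1ℚ)) ⊛ correction)} {y = rest} (x₂ ⊛ x₂) (idc-≈ 0)
    (≈-by (κ (ℤ.+ 8 ℚ./ 1) ⊛ (x₁ ⊛ x₂)) xR (≈-by (κ (ℤ.+ 4 ℚ./ 1) ⊛ (x₁ ⊛ x₁)) xxR′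
      (S.solve 8 (λ a b i A r r′ v o → let r4 = S.con (ℤ.+ 4 ℚ./ 1) ; four = S.con (ℤ.- ℤ.+ 4 ℚ./ 1) ; quarter = S.con (ℤ.+ 1 ℚ./ 4) ; b² = b S.:* (b S.:* S.con 1ℚ) ; a² = a S.:* (a S.:* S.con 1ℚ) ; qa = S.con 1ℚ S.:+ a S.:+ four S.:* o ; qb = S.con 1ℚ S.:+ b S.:+ four S.:* v in
        ((S.con (ℤ.+ 16 ℚ./ 1) S.:* (b² S.:* ((i S.:+ S.:- (S.con ½ S.:* A)) S.:+ (S.con ½ S.:* (a S.:* r) S.:+ (quarter S.:* (a S.:* (a S.:* r′)) S.:+ quarter S.:* v))))
          S.:+ (b S.:* b) S.:* (S.con (ℤ.+ 8 ℚ./ 1) S.:* A S.:+ (r4 S.:* a S.:+ S.con (ℤ.- ℤ.+ 12 ℚ./ 1) S.:* o S.:+ r4 S.:* (a S.:* o))))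
          S.:+ (S.con (ℤ.+ 8 ℚ./ 1) S.:* (a S.:* b)) S.:* v)
          S.:+ (r4 S.:* (a S.:* a)) S.:* v
        S.:=
        (((b² S.:* (b S.:+ (a² S.:+ (S.con (q (ℤ.- ℤ.+ 4)) S.:* a S.:+ (S.con (q (ℤ.- ℤ.+ 2)) S.:+ S.con 0ℚ)))))
          S.:+ ((a² S.:+ (S.con (q (ℤ.- ℤ.+ 3)) S.:* (a² S.:* b) S.:+ (S.con (q (ℤ.+ 2)) S.:* (a S.:* b) S.:+ S.con 0ℚ)))
          S.:+ (((b² S.:* (S.con (q (ℤ.+ 3)) S.:+ S.con (q (ℤ.- ℤ.+ 1)) S.:* a)) S.:* qa)
          S.:+ (S.con (q (ℤ.- ℤ.+ 1)) S.:* ((b² S.:+ (a² S.:+ (S.con (q (ℤ.+ 2)) S.:* (a S.:* b) S.:+ S.con 0ℚ))) S.:* qb) S.:+ S.con 0ℚ))))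
          S.:+ (b S.:* b) S.:* (S.con (ℤ.+ 16 ℚ./ 1) S.:* i)
          S.:+ (S.con (ℤ.+ 8 ℚ./ 1) S.:* (a S.:* b)) S.:* (b S.:* r S.:+ b))
          S.:+ (r4 S.:* (a S.:* a)) S.:* (b S.:* (b S.:* r′) S.:+ b)) (λ _ → refl)
        x₁ x₂ (ι 0 idc) (ι 0 avg) (ι 1 R) (ι 1 R′) (ι 1 w) (ι 0 w)))) m)
    (sym (rest≈ m))
    where
    b² = x₂ ⊛ (x₂ ⊛ κ 1ℚ)
    a² = x₁ ⊛ (x₁ ⊛ κ 1ℚ)
    rest = b² ⊛ (x₂ ⊕ (a² ⊕ (κ (q (ℤ.- ℤ.+ 4)) ⊛ x₁ ⊕ (κ (q (ℤ.- ℤ.+ 2)) ⊕ κ 0ℚ))))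
      ⊕ ((a² ⊕ (κ (q (ℤ.- ℤ.+ 3)) ⊛ (a² ⊛ x₂) ⊕ (κ (q (ℤ.+ 2)) ⊛ (x₁ ⊛ x₂) ⊕ κ 0ℚ)))
      ⊕ ((b² ⊛ (κ (q (ℤ.+ 3)) ⊕ κ (q (ℤ.- ℤ.+ 1)) ⊛ x₁)) ⊛ Q 0
      ⊕ (κ (q (ℤ.- ℤ.+ 1)) ⊛ ((b² ⊕ (a² ⊕ (κ (q (ℤ.+ 2)) ⊛ (x₁ ⊛ x₂) ⊕ κ 0ℚ))) ⊛ Q 1) ⊕ κ 0ℚ)))
    rest≈ : restTimes16s2² ≈ rest
    rest≈ = addS-≈ (mulS-≈ e² (addS-≈ e₂ (addS-≈ f² (addS-≈ (scaleS-≈ _ e₁) (addS-≈ (constS-≈ _) (constS-≈ 0ℚ))))))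
      (addS-≈ (addS-≈ f² (addS-≈ (scaleS-≈ _ (mulS-≈ f² e₂)) (addS-≈ (scaleS-≈ _ (mulS-≈ e₁ e₂)) (constS-≈ 0ℚ))))
      (addS-≈ (mulS-≈ (mulS-≈ e² (addS-≈ (constS-≈ _) (scaleS-≈ _ e₁))) (sqrtA-≈ 0))
      (addS-≈ (scaleS-≈ _ (mulS-≈ (addS-≈ e² (addS-≈ f² (addS-≈ (scaleS-≈ _ (mulS-≈ e₁ e₂)) (constS-≈ 0ℚ)))) (sqrtA-≈ 1))) (constS-≈ 0ℚ))))
      where
      e₁ = sv≈ι 0
      e₂ = sv≈ι 1
      e² = square-≈ e₂
      f² = square-≈ e₁
    w≈ : ι 1 (shift R) ⊕ x₂ ≈ ι 1 w
    w≈ m = trans (ι-⊕ 1 (shift R) δ₁ m) (ι-cong 1 shift-R m)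
    xR : x₂ ⊛ ι 1 R ⊕ x₂ ≈ ι 1 w
    xR m = trans (⊕-cong {g = x₂} (s-⊛ 1 R) reflS m) (w≈ m)
    xxR′ : x₂ ⊛ (x₂ ⊛ ι 1 R′) ⊕ x₂ ≈ ι 1 w
    xxR′ m = trans (⊕-cong {g = x₂} (⊛-cong {f = x₂} reflS (s-⊛ 1 R′)) reflS m) (xR m)

  ι-beyond : ∀ m e f → length m ≤ e → f 0 ≡ 0ℚ → ι e f m ≡ 0ℚ
  ι-beyond []          e       f le f0 = f0
  ι-beyond (zero ∷ m)  (suc e) f (s≤s le) f0 = ι-beyond m e f le f0
  ι-beyond (suc k ∷ m) (suc e) f le f0 = refl

  logPart-stable : ∀ N m → length m ≤ N → logPart N m ≡ logPart (length m) m
  logPart-stable N m le = Σ<-trunc (length m) N _ le (λ e l → trans (cong ((½ ℚ.* (ℤ.+ totient (suc e) ℚ./ suc e)) ℚ.*_) (ι-beyond m e avg l refl))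
    (ℚP.*-zeroʳ (½ ℚ.* (ℤ.+ totient (suc e) ℚ./ suc e))))

  -- The cofactors of the divisors of `m` are lists of the same length as `m`. Hence one bound on
  -- the number of logarithms serves all the coefficients of `target` that enter a coefficient of
  -- the product.
  ⊛-cong-length : ∀ m {f g h} → (∀ b → length b ≡ length m → g b ≡ h b) → (f ⊛ g) m ≡ (f ⊛ h) m
  ⊛-cong-length []      {f} {g} {h} e = trans (⊛-[] f g) (trans (cong (f [] ℚ.*_) (e [] refl)) (sym (⊛-[] f h)))
  ⊛-cong-length (k ∷ m) {f} {g} {h} e = trans (⊛-∷ f g k m) (trans
    (Σ<-cong (suc k) (λ i _ → ⊛-cong-length m (λ b l → e (k ∸ i ∷ b) (cong suc l)))) (sym (⊛-∷ f h k m)))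

  target-identity : ∀ m N → length m ≤ N → scaleS (q (ℤ.+ 16)) (mulS (powS s2 2) target) m ≡ rhsTimes16s2² N m
  target-identity m N le = begin
    scaleS (q (ℤ.+ 16)) (mulS (powS s2 2) target) m
      ≡⟨ cong (q (ℤ.+ 16) ℚ.*_) (trans (mulS-≈ (square-≈ (sv≈ι 1)) reflS m) (⊛-cong-length m (λ b l →
           trans (⊕-at (logPart (length b)) correction b) (trans (cong (ℚ._+ correction b) (sym (logPart-stable N b (subst (_≤ N) (sym l) le)))) (sym (⊕-at (logPart N) correction b)))))) ⟩
    q (ℤ.+ 16) ℚ.* (b² ⊛ (logPart N ⊕ correction)) m
      ≡⟨ sym (κ-⊛ (q (ℤ.+ 16)) _ m) ⟩
    (κ (q (ℤ.+ 16)) ⊛ (b² ⊛ (logPart N ⊕ correction))) m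
      ≡⟨ S.solve 3 (λ b l c → S.con (q (ℤ.+ 16)) S.:* (b S.:* (l S.:+ c)) S.:= S.con (q (ℤ.+ 16)) S.:* (b S.:* l) S.:+ S.con (q (ℤ.+ 16)) S.:* (b S.:* c)) (λ _ → refl) b² (logPart N) correction m ⟩
    (κ (q (ℤ.+ 16)) ⊛ (b² ⊛ logPart N) ⊕ κ (q (ℤ.+ 16)) ⊛ (b² ⊛ correction)) m
      ≡⟨ ⊕-cong {f = κ (q (ℤ.+ 16)) ⊛ (b² ⊛ logPart N)} reflS correction-≈ m ⟩
    (κ (q (ℤ.+ 16)) ⊛ (b² ⊛ logPart N) ⊕ restTimes16s2²) m
      ≡⟨ sym (addS-≈ (scaleS-≈ (q (ℤ.+ 16)) (mulS-≈ (square-≈ (sv≈ι 1)) (partialSum-≈ N))) reflS m) ⟩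
    rhsTimes16s2² N m ∎
    where
    open ≡-Reasoning
    b² = x₂ ⊛ (x₂ ⊛ κ 1ℚ)

-- Counting in finite lists

-- The pigeonhole principle: the partner of the head is deleted from `ys`, and injectivity keeps it
-- from being needed again. A relation rather than a function is used because partners often come
-- out of an existence proof.
length-≤ : ∀ {A B : Set} (R : A → B → Set) xs ys → Unique xs →
  (∀ {x} → x ∈ xs → ∃[ y ] (y ∈ ys × R x y)) →
  (∀ {x x′ y} → x ∈ xs → x′ ∈ xs → R x y → R x′ y → x ≡ x′) → length xs ≤ length ys
length-≤ R []       ys ux        tot inj = z≤n
length-≤ R (x ∷ xs) ys (x∉ ∷ ux) tot inj with tot (here refl)
... | y , y∈ , Rxy with ∈-∃++ y∈
... | ys₁ , ys₂ , refl = subst (suc (length xs) ≤_) (sym e) (s≤s (length-≤ R xs (ys₁ ++ ys₂) ux tot′ (λ p p′ → inj (there p) (there p′))))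
  where
  e : length (ys₁ ++ y ∷ ys₂) ≡ suc (length (ys₁ ++ ys₂))
  e = trans (length-++ ys₁) (trans (+-suc _ _) (cong suc (sym (length-++ ys₁))))
  move : ∀ {z} → z ≢ y → z ∈ ys₁ ++ y ∷ ys₂ → z ∈ ys₁ ++ ys₂
  move z≢y p with ∈-++⁻ ys₁ p
  ... | inj₁ q          = ∈-++⁺ˡ q
  ... | inj₂ (here q)   = ⊥-elim (z≢y q)
  ... | inj₂ (there q)  = ∈-++⁺ʳ ys₁ q
  tot′ : ∀ {x′} → x′ ∈ xs → ∃[ z ] (z ∈ ys₁ ++ ys₂ × R x′ z)
  tot′ {x′} p with tot (there p)
  ... | z , z∈ , Rz = z , move (λ { refl → All.lookup x∉ p (inj (here refl) (there p) Rxy Rz) }) z∈ , Rz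

length-≡ : ∀ {A : Set} (xs ys : List A) → Unique xs → Unique ys →
  (∀ {x} → x ∈ xs → x ∈ ys) → (∀ {x} → x ∈ ys → x ∈ xs) → length xs ≡ length ys
length-≡ xs ys ux uy f g = ≤-antisym
  (length-≤ _≡_ xs ys ux (λ {x} p → x , f p , refl) (λ _ _ e e′ → trans e (sym e′)))
  (length-≤ _≡_ ys xs uy (λ {x} p → x , g p , refl) (λ _ _ e e′ → trans e (sym e′)))

count : ∀ {A : Set} → (A → Bool) → List A → ℕ
count p xs = length (filterᵇ p xs)

∈-filterᵇ⁺ : ∀ {A : Set} (p : A → Bool) {x xs} → x ∈ xs → T (p x) → x ∈ filterᵇ p xs
∈-filterᵇ⁺ p = ∈-filter⁺ (T? ∘ p)

∈-filterᵇ⁻ : ∀ {A : Set} (p : A → Bool) {x xs} → x ∈ filterᵇ p xs → x ∈ xs × T (p x)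
∈-filterᵇ⁻ p = ∈-filter⁻ (T? ∘ p)

unique-filterᵇ : ∀ {A : Set} (p : A → Bool) {xs} → Unique xs → Unique (filterᵇ p xs)
unique-filterᵇ p = UP.filter⁺ (T? ∘ p)

count-≤ : ∀ {A B : Set} (R : A → B → Set) {p : A → Bool} {q : B → Bool} xs ys → Unique xs →
  (∀ {x} → x ∈ xs → T (p x) → ∃[ y ] (y ∈ ys × T (q y) × R x y)) →
  (∀ {x x′ y} → x ∈ xs → x′ ∈ xs → R x y → R x′ y → x ≡ x′) → count p xs ≤ count q ys
count-≤ R {p} {q} xs ys ux tot inj = length-≤ R _ _ (unique-filterᵇ p ux)
  (λ m → let (x∈ , px) = ∈-filterᵇ⁻ p m ; (y , y∈ , qy , r) = tot x∈ px in y , ∈-filterᵇ⁺ q y∈ qy , r)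
  (λ m m′ → inj (proj₁ (∈-filterᵇ⁻ p m)) (proj₁ (∈-filterᵇ⁻ p m′)))

count-cong : ∀ {A : Set} {p q : A → Bool} xs → (∀ x → x ∈ xs → p x ≡ q x) → count p xs ≡ count q xs
count-cong []       h = refl
count-cong {p = p} {q} (x ∷ xs) h with p x | q x | h x (here refl)
... | true  | true  | _ = cong suc (count-cong xs (λ y m → h y (there m)))
... | false | false | _ = count-cong xs (λ y m → h y (there m))

convL : ∀ {A B : Set} → (ℕ → List A) → (ℕ → List B) → ℕ → List (A × B)
convL X Y n = concatMap (λ i → cartesianProduct (X i) (Y (n ∸ i))) (upTo (suc n))

record Sized {A : Set} (sz : A → ℕ) (X : ℕ → List A) : Set where
  field
    unique   : ∀ n → Unique (X n)
    sound    : ∀ {n a} → a ∈ X n → sz a ≡ n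
    complete : ∀ a → a ∈ X (sz a)

-- Lists indexed by size are disjoint, so that concatenating them keeps the elements distinct.
unique-concatMap : ∀ {A B : Set} (key : B → A) (f : A → List B) {xs} → Unique xs → (∀ x → Unique (f x)) →
  (∀ {x b} → b ∈ f x → key b ≡ x) → Unique (concatMap f xs)
unique-concatMap key f []        uf k = []
unique-concatMap key f {x ∷ xs} (x∉ ∷ u) uf k = UP.++⁺ (uf x) (unique-concatMap key f u uf k) disj
  where
  disj : ∀ {v} → ¬ (v ∈ f x × v ∈ concatMap f xs)
  disj (p , p′) with find (∈-concatMap⁻ f {xs = xs} p′)
  ... | y , y∈ , v∈ = All.lookup x∉ y∈ (trans (sym (k p)) (k v∈))

∈-convL⁺ : ∀ {A B : Set} X Y {i n} {a : A} {b : B} → i ≤ n → a ∈ X i → b ∈ Y (n ∸ i) → (a , b) ∈ convL X Y n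
∈-convL⁺ X Y i≤n p p′ = ∈-concatMap⁺ _ (lose (∈-upTo⁺ (s≤s i≤n)) (∈-cartesianProduct⁺ p p′))

∈-convL⁻ : ∀ {A B : Set} X Y {n} {a : A} {b : B} → (a , b) ∈ convL X Y n → ∃[ i ] (i ≤ n × a ∈ X i × b ∈ Y (n ∸ i))
∈-convL⁻ X Y {n} p with find (∈-concatMap⁻ (λ i → cartesianProduct (X i) (Y (n ∸ i))) {xs = upTo (suc n)} p)
... | i , i∈ , q with ∈-upTo⁻ i∈ | ∈-cartesianProduct⁻ (X i) (Y (n ∸ i)) q
... | s≤s i≤n | a∈ , b∈ = i , i≤n , a∈ , b∈

sized-conv : ∀ {A B : Set} {szA szB X Y} → Sized {A} szA X → Sized {B} szB Y →
  Sized (λ ab → szA (proj₁ ab) + szB (proj₂ ab)) (convL X Y)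
sized-conv {szA = szA} {szB} {X} {Y} sX sY = record
  { unique = λ n → unique-concatMap (szA ∘ proj₁) (λ i → cartesianProduct (X i) (Y (n ∸ i))) (UP.upTo⁺ (suc n))
      (λ i → UP.cartesianProduct⁺ (Sized.unique sX i) (Sized.unique sY (n ∸ i)))
      (λ {i} m → Sized.sound sX (proj₁ (∈-cartesianProduct⁻ (X i) (Y (n ∸ i)) m)))
  ; sound = λ m → let (i , i≤n , a∈ , b∈) = ∈-convL⁻ X Y m in
      trans (cong₂ _+_ (Sized.sound sX a∈) (Sized.sound sY b∈)) (m+[n∸m]≡n i≤n)
  ; complete = λ { (a , b) → ∈-convL⁺ X Y (m≤m+n (szA a) (szB b)) (Sized.complete sX a)
      (subst (λ k → b ∈ Y k) (sym (m+n∸m≡n (szA a) (szB b))) (Sized.complete sY b)) } }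

length-cartesianProduct : ∀ {A B : Set} (xs : List A) (ys : List B) → length (cartesianProduct xs ys) ≡ length xs * length ys
length-cartesianProduct []       ys = refl
length-cartesianProduct (x ∷ xs) ys = trans (length-++ (map (x ,_) ys)) (cong₂ _+_ (length-map (x ,_) ys) (length-cartesianProduct xs ys))

card : ∀ {A : Set} → (ℕ → List A) → ℕ → ℚ
card X n = ⟪ length (X n) ⟫

⟪length⟫-concatMap : ∀ {A : Set} (f : ℕ → List A) g n → ⟪ length (concatMap f (applyUpTo g n)) ⟫ ≡ Σ< n (λ i → ⟪ length (f (g i)) ⟫)
⟪length⟫-concatMap f g zero    = trans (⟪⟫-def 0) (sym (Σ<-0 _))
⟪length⟫-concatMap f g (suc n) = trans (cong ⟪_⟫ (length-++ (f (g 0)))) (trans (⟪⟫-+ _ _)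
  (trans (cong (⟪ length (f (g 0)) ⟫ ℚ.+_) (⟪length⟫-concatMap f (g ∘ suc) n)) (sym (Σ<-suc n (λ i → ⟪ length (f (g i)) ⟫)))))

card-conv : ∀ {A B : Set} (X : ℕ → List A) (Y : ℕ → List B) n → card (convL X Y) n ≡ cv (card X) (card Y) n
card-conv X Y n = trans (⟪length⟫-concatMap (λ i → cartesianProduct (X i) (Y (n ∸ i))) id (suc n)) (Σ<-cong (suc n) (λ i _ →
  trans (cong ⟪_⟫ (length-cartesianProduct (X i) (Y (n ∸ i)))) (⟪⟫-* (length (X i)) (length (Y (n ∸ i))))))

-- Plane trees in which every inner node has at least two children

data Tree : Set where
  leaf : Tree
  node : Tree → Tree → List Tree → Tree

Forest : Set
Forest = List Tree

mutual
  ∥_∥ : Tree → ℕ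
  ∥ leaf ∥       = 1
  ∥ node x y u ∥ = ∥ x ∥ + (∥ y ∥ + ∥ u ∥*)

  ∥_∥* : Forest → ℕ
  ∥ [] ∥*    = 0
  ∥ x ∷ u ∥* = ∥ x ∥ + ∥ u ∥*

∥∥>0 : ∀ t → 0 < ∥ t ∥
∥∥>0 leaf         = s≤s z≤n
∥∥>0 (node x y u) = <-≤-trans (∥∥>0 x) (m≤m+n ∥ x ∥ _)

mutual
  -- The bound is only a guarantee that all trees with at most that many leaves occur; larger ones
  -- occur too and are filtered out in `trees`. A child has fewer leaves than its node, so the bound
  -- drops there, whereas the first tree of a forest may carry all the leaves and keeps it.
  treesUpTo : ℕ → List Tree
  treesUpTo zero    = []
  treesUpTo (suc f) = leaf ∷ cartesianProductWith (λ x yu → node x (proj₁ yu) (proj₂ yu)) (treesUpTo f) (cartesianProduct (treesUpTo f) (forestsUpTo f))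

  forestsUpTo : ℕ → List Forest
  forestsUpTo zero    = [ [] ]
  forestsUpTo (suc f) = [] ∷ cartesianProductWith _∷_ (treesUpTo (suc f)) (forestsUpTo f)

mutual
  unique-treesUpTo : ∀ f → Unique (treesUpTo f)
  unique-treesUpTo zero    = []
  unique-treesUpTo (suc f) = All.tabulate (λ { m refl → h m }) ∷
    UP.cartesianProductWith⁺ _ (λ { refl → refl , refl }) (unique-treesUpTo f) (UP.cartesianProduct⁺ (unique-treesUpTo f) (unique-forestsUpTo f))
    where
    h : ¬ (leaf ∈ cartesianProductWith (λ x yu → node x (proj₁ yu) (proj₂ yu)) (treesUpTo f) (cartesianProduct (treesUpTo f) (forestsUpTo f)))
    h m with ∈-cartesianProductWith⁻ (λ x yu → node x (proj₁ yu) (proj₂ yu)) (treesUpTo f) _ m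
    ... | _ , _ , _ , _ , ()

  unique-forestsUpTo : ∀ f → Unique (forestsUpTo f)
  unique-forestsUpTo zero    = [] ∷ []
  unique-forestsUpTo (suc f) = All.tabulate (λ { m refl → h m }) ∷
    UP.cartesianProductWith⁺ _ (λ { refl → refl , refl }) (unique-treesUpTo (suc f)) (unique-forestsUpTo f)
    where
    h : ¬ ([] ∈ cartesianProductWith _∷_ (treesUpTo (suc f)) (forestsUpTo f))
    h m with ∈-cartesianProductWith⁻ _∷_ (treesUpTo (suc f)) (forestsUpTo f) m
    ... | _ , _ , _ , _ , ()

mutual
  ∈-treesUpTo : ∀ f t → ∥ t ∥ ≤ f → t ∈ treesUpTo f
  ∈-treesUpTo zero    t            le = ⊥-elim (<⇒≱ (∥∥>0 t) le)
  ∈-treesUpTo (suc f) leaf         le = here refl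
  ∈-treesUpTo (suc f) (node x y u) le = there (∈-cartesianProductWith⁺ _
    (∈-treesUpTo f x (≤-pred (<-≤-trans (m<m+n ∥ x ∥ (<-≤-trans (∥∥>0 y) (m≤m+n ∥ y ∥ _))) le)))
    (∈-cartesianProduct⁺ (∈-treesUpTo f y (≤-trans (m≤m+n ∥ y ∥ _) yu≤)) (∈-forestsUpTo f u (≤-trans (m≤n+m ∥ u ∥* ∥ y ∥) yu≤))))
    where
    yu≤ : ∥ y ∥ + ∥ u ∥* ≤ f
    yu≤ = ≤-pred (<-≤-trans (m<n+m _ (∥∥>0 x)) le)

  ∈-forestsUpTo : ∀ f u → ∥ u ∥* ≤ f → u ∈ forestsUpTo f
  ∈-forestsUpTo zero    []      le = here refl
  ∈-forestsUpTo zero    (x ∷ u) le = ⊥-elim (<⇒≱ (<-≤-trans (∥∥>0 x) (m≤m+n ∥ x ∥ _)) le)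
  ∈-forestsUpTo (suc f) []      le = here refl
  ∈-forestsUpTo (suc f) (x ∷ u) le = there (∈-cartesianProductWith⁺ _∷_ (∈-treesUpTo (suc f) x (≤-trans (m≤m+n ∥ x ∥ _) le))
    (∈-forestsUpTo f u (≤-pred (<-≤-trans (m<n+m _ (∥∥>0 x)) le))))

trees : ℕ → List Tree
trees n = filter (λ t → ∥ t ∥ ≟ n) (treesUpTo n)

forests : ℕ → List Forest
forests n = filter (λ u → ∥ u ∥* ≟ n) (forestsUpTo n)

sized-trees : Sized ∥_∥ trees
sized-trees = record
  { unique = λ n → UP.filter⁺ _ (unique-treesUpTo n)
  ; sound = λ {n} m → proj₂ (∈-filter⁻ (λ t → ∥ t ∥ ≟ n) {xs = treesUpTo n} m)
  ; complete = λ t → ∈-filter⁺ (λ t′ → ∥ t′ ∥ ≟ ∥ t ∥) (∈-treesUpTo ∥ t ∥ t ≤-refl) refl }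

sized-forests : Sized ∥_∥* forests
sized-forests = record
  { unique = λ n → UP.filter⁺ _ (unique-forestsUpTo n)
  ; sound = λ {n} m → proj₂ (∈-filter⁻ (λ u → ∥ u ∥* ≟ n) {xs = forestsUpTo n} m)
  ; complete = λ u → ∈-filter⁺ (λ u′ → ∥ u′ ∥* ≟ ∥ u ∥*) (∈-forestsUpTo ∥ u ∥* u ≤-refl) refl }

∈-sized : ∀ {A : Set} {sz : A → ℕ} {X} → Sized sz X → ∀ {a n} → sz a ≡ n → a ∈ X n
∈-sized s refl = Sized.complete s _

-- The first two children are separate factors and the others form a forest, which gives w = x + w²
-- / (1 - w).
trees-rec : ∀ n → card trees n ≡ δ₁ n ℚ.+ cv (card trees) (cv (card trees) (card forests)) n
trees-rec n = trans (cong ⟪_⟫ (trans (length-≡ _ (leaves n ++ inner n) (Sized.unique sized-trees n) uniq (λ {t} → to {t}) (λ {t} → from {t})) (length-++ (leaves n))))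
  (trans (⟪⟫-+ _ _) (cong₂ ℚ._+_ (δ n) (trans (cong ⟪_⟫ (length-map mk (convL trees (convL trees forests) n))) (trans (card-conv trees (convL trees forests) n)
    (Σ<-cong (suc n) (λ i _ → cong (card trees i ℚ.*_) (card-conv trees forests (n ∸ i))))))))
  where
  mk : Tree × (Tree × Forest) → Tree
  mk (x , y , u) = node x y u
  leaves inner : ℕ → List Tree
  leaves 1 = [ leaf ]
  leaves _ = []
  inner n = map mk (convL trees (convL trees forests) n)
  sz : Sized (λ xyu → ∥ proj₁ xyu ∥ + (∥ proj₁ (proj₂ xyu) ∥ + ∥ proj₂ (proj₂ xyu) ∥*)) (convL trees (convL trees forests))
  sz = sized-conv sized-trees (sized-conv sized-trees sized-forests)
  δ : ∀ n → ⟪ length (leaves n) ⟫ ≡ δ₁ n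
  δ zero          = ⟪⟫-def 0
  δ (suc zero)    = ⟪⟫-def 1
  δ (suc (suc n)) = ⟪⟫-def 0
  ul : ∀ n → Unique (leaves n)
  ul zero          = []
  ul (suc zero)    = [] ∷ []
  ul (suc (suc n)) = []
  isLeaf : ∀ n {t} → t ∈ leaves n → t ≡ leaf × n ≡ 1
  isLeaf (suc zero) (here refl) = refl , refl
  uniq : Unique (leaves n ++ inner n)
  uniq = UP.++⁺ (ul n) (UP.map⁺ (λ { {_ , _ , _} {_ , _ , _} refl → refl }) (Sized.unique sz n)) disj
    where
    disj : ∀ {t} → ¬ (t ∈ leaves n × t ∈ inner n)
    disj (p , p′) with isLeaf n p | ∈-map⁻ mk p′
    ... | refl , _ | _ , _ , ()
  to : ∀ {t} → t ∈ trees n → t ∈ leaves n ++ inner n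
  to {leaf} m with Sized.sound sized-trees {n} m
  ... | refl = here refl
  to {node x y u} m = ∈-++⁺ʳ (leaves n) (∈-map⁺ mk (∈-sized sz {x , y , u} (Sized.sound sized-trees {n} m)))
  from : ∀ {t} → t ∈ leaves n ++ inner n → t ∈ trees n
  from m with ∈-++⁻ (leaves n) m
  from m | inj₁ p with isLeaf n p
  ... | refl , refl = here refl
  from m | inj₂ p with ∈-map⁻ mk p
  ... | (x , y , u) , q , refl = ∈-sized sized-trees {node x y u} (Sized.sound sz {n} q)

forests-rec : ∀ n → card forests n ≡ δ₀ n ℚ.+ cv (card trees) (card forests) n
forests-rec n = trans (cong ⟪_⟫ (trans (length-≡ _ (nils n ++ conses n) (Sized.unique sized-forests n) uniq (λ {t} → to {t}) (λ {t} → from {t})) (length-++ (nils n))))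
  (trans (⟪⟫-+ _ _) (cong₂ ℚ._+_ (δ n) (trans (cong ⟪_⟫ (length-map mk (convL trees forests n))) (card-conv trees forests n))))
  where
  mk : Tree × Forest → Forest
  mk (x , u) = x ∷ u
  nils conses : ℕ → List Forest
  nils 0 = [ [] ]
  nils _ = []
  conses n = map mk (convL trees forests n)
  sz : Sized (λ xu → ∥ proj₁ xu ∥ + ∥ proj₂ xu ∥*) (convL trees forests)
  sz = sized-conv sized-trees sized-forests
  δ : ∀ n → ⟪ length (nils n) ⟫ ≡ δ₀ n
  δ zero    = ⟪⟫-def 1
  δ (suc n) = ⟪⟫-def 0
  un : ∀ n → Unique (nils n)
  un zero    = [] ∷ []
  un (suc n) = []
  isNil : ∀ n {t} → t ∈ nils n → t ≡ [] × n ≡ 0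
  isNil zero (here refl) = refl , refl
  uniq : Unique (nils n ++ conses n)
  uniq = UP.++⁺ (un n) (UP.map⁺ (λ { {_ , _} {_ , _} refl → refl }) (Sized.unique sz n)) disj
    where
    disj : ∀ {t} → ¬ (t ∈ nils n × t ∈ conses n)
    disj (p , p′) with isNil n p | ∈-map⁻ mk p′
    ... | refl , _ | _ , _ , ()
  to : ∀ {t} → t ∈ forests n → t ∈ nils n ++ conses n
  to {[]} m with Sized.sound sized-forests {n} m
  ... | refl = here refl
  to {x ∷ u} m = ∈-++⁺ʳ (nils n) (∈-map⁺ mk (∈-sized sz {x , u} (Sized.sound sized-forests {n} m)))
  from : ∀ {t} → t ∈ nils n ++ conses n → t ∈ forests n
  from m with ∈-++⁻ (nils n) m
  from m | inj₁ p with isNil n p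
  ... | refl , refl = here refl
  from m | inj₂ p with ∈-map⁻ mk p
  ... | (x , u) , q , refl = ∈-sized sized-forests {x ∷ u} (Sized.sound sz {n} q)

module Sch = Schröder (card trees) (card forests) (⟪⟫-def 0) trees-rec forests-rec

-- The non-crossing arcs of a tree whose leaves are the unit arcs of an interval

mutual
  Arc : Tree → ℕ → ℕ → ℕ → Set
  Arc leaf         l a b = a ≡ l × b ≡ suc l
  Arc (node x y u) l a b = (a ≡ l × b ≡ l + ∥ node x y u ∥) ⊎ (Arc x l a b ⊎ (Arc y (l + ∥ x ∥) a b ⊎ Arc* u (l + ∥ x ∥ + ∥ y ∥) a b))

  Arc* : Forest → ℕ → ℕ → ℕ → Set
  Arc* []      l a b = ⊥
  Arc* (x ∷ u) l a b = Arc x l a b ⊎ Arc* u (l + ∥ x ∥) a b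

mutual
  arc? : ∀ t l a b → Dec (Arc t l a b)
  arc? leaf         l a b = (a ≟ l) ×-dec (b ≟ suc l)
  arc? (node x y u) l a b = ((a ≟ l) ×-dec (b ≟ l + ∥ node x y u ∥)) ⊎-dec (arc? x l a b ⊎-dec (arc? y (l + ∥ x ∥) a b ⊎-dec arc*? u (l + ∥ x ∥ + ∥ y ∥) a b))

  arc*? : ∀ u l a b → Dec (Arc* u l a b)
  arc*? []      l a b = no (λ ())
  arc*? (x ∷ u) l a b = arc? x l a b ⊎-dec arc*? u (l + ∥ x ∥) a b

Rel : Set₁
Rel = ℕ → ℕ → Set

-- The arc from `l` to `r` is not demanded, so forests and the periodic pieces of symmetric
-- dissections qualify as well as trees.
record Fam (S : Rel) (l r : ℕ) : Set where
  field
    l≤r   : l ≤ r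
    range : ∀ {a b} → S a b → l ≤ a × a < b × b ≤ r
    edge  : ∀ {a} → l ≤ a → a < r → S a (suc a)
    cross : ∀ {a b c d} → a < b → b < c → c < d → S a c → S b d → ⊥
open Fam

fam-leaf : ∀ l → Fam (λ a b → a ≡ l × b ≡ suc l) l (suc l)
fam-leaf l = record
  { l≤r = n≤1+n l
  ; range = λ { (refl , refl) → ≤-refl , n<1+n l , ≤-refl }
  ; edge = λ { l≤a (s≤s a≤l) → ≤-antisym a≤l l≤a , cong suc (≤-antisym a≤l l≤a) }
  ; cross = λ { a<b _ _ (refl , refl) (refl , refl) → <-irrefl refl a<b } }

fam-[] : ∀ l → Fam (λ _ _ → ⊥) l l
fam-[] l = record
  { l≤r = ≤-refl ; range = λ () ; edge = λ l≤a a<l → ⊥-elim (<⇒≱ a<l l≤a) ; cross = λ _ _ _ () }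

fam-++ : ∀ {S S′ l m r} → Fam S l m → Fam S′ m r → Fam (λ a b → S a b ⊎ S′ a b) l r
fam-++ {S} {S′} {l} {m} {r} f g = record
  { l≤r = ≤-trans (l≤r f) (l≤r g)
  ; range = λ { (inj₁ s) → let (p , p′ , p″) = range f s in p , p′ , ≤-trans p″ (l≤r g)
              ; (inj₂ s) → let (p , p′ , p″) = range g s in ≤-trans (l≤r f) p , p′ , p″ }
  ; edge = λ {a} l≤a a<r → ed a l≤a a<r (a <? m)
  ; cross = λ { a<b b<c c<d (inj₁ s) (inj₁ s′) → cross f a<b b<c c<d s s′
              ; a<b b<c c<d (inj₁ s) (inj₂ s′) → <⇒≱ b<c (≤-trans (proj₂ (proj₂ (range f s))) (proj₁ (range g s′)))
              ; a<b b<c c<d (inj₂ s) (inj₁ s′) → <⇒≱ (<-trans a<b (<-trans b<c c<d)) (≤-trans (proj₂ (proj₂ (range f s′))) (proj₁ (range g s)))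
              ; a<b b<c c<d (inj₂ s) (inj₂ s′) → cross g a<b b<c c<d s s′ } }
  where
  ed : ∀ a → l ≤ a → a < r → Dec (a < m) → S a (suc a) ⊎ S′ a (suc a)
  ed a l≤a a<r (yes a<m) = inj₁ (edge f l≤a a<m)
  ed a l≤a a<r (no a≮m)  = inj₂ (edge g (≮⇒≥ a≮m) a<r)

fam-top : ∀ {S l r} → l < r → Fam S l r → Fam (λ a b → (a ≡ l × b ≡ r) ⊎ S a b) l r
fam-top l<r f = record
  { l≤r = l≤r f
  ; range = λ { (inj₁ (refl , refl)) → ≤-refl , l<r , ≤-refl ; (inj₂ s) → range f s }
  ; edge = λ l≤a a<r → inj₂ (edge f l≤a a<r)
  ; cross = λ { a<b b<c c<d (inj₁ (refl , refl)) (inj₁ (refl , refl)) → <-irrefl refl a<b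
              ; a<b b<c c<d (inj₁ (refl , refl)) (inj₂ s′) → <⇒≱ c<d (proj₂ (proj₂ (range f s′)))
              ; a<b b<c c<d (inj₂ s) (inj₁ (refl , refl)) → <⇒≱ a<b (proj₁ (range f s))
              ; a<b b<c c<d (inj₂ s) (inj₂ s′) → cross f a<b b<c c<d s s′ } }

mutual
  fam : ∀ t l → Fam (Arc t l) l (l + ∥ t ∥)
  fam leaf         l = subst (Fam (Arc leaf l) l) (+-comm 1 l) (fam-leaf l)
  fam (node x y u) l = fam-top (m<m+n l (∥∥>0 (node x y u)))
    (subst (Fam (Arc* (x ∷ y ∷ u) l) l) (trans (+-assoc (l + ∥ x ∥) _ _) (+-assoc l _ _)) (fam-++ (fam x l) (fam-++ (fam y (l + ∥ x ∥)) (fam* u (l + ∥ x ∥ + ∥ y ∥)))))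

  fam* : ∀ u l → Fam (Arc* u l) l (l + ∥ u ∥*)
  fam* []      l = subst (Fam (Arc* [] l) l) (sym (+-identityʳ l)) (fam-[] l)
  fam* (x ∷ u) l = subst (Fam (Arc* (x ∷ u) l) l) (+-assoc l _ _) (fam-++ (fam x l) (fam* u (l + ∥ x ∥)))

arc-top : ∀ t l → Arc t l l (l + ∥ t ∥)
arc-top leaf         l = refl , +-comm l 1
arc-top (node x y u) l = inj₁ (refl , refl)

infix 4 _≐_
_≐_ : Rel → Rel → Set
S ≐ S′ = ∀ {a b} → (S a b → S′ a b) × (S′ a b → S a b)

≐-sym : ∀ {S S′} → S ≐ S′ → S′ ≐ S
≐-sym e = proj₂ e , proj₁ e

-- An arc starting at `l` cannot belong to the second part, which begins later. The end of the first
-- tree of a forest can therefore be read off as the end of the longest arc at `l`.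
split-≤ : ∀ {S S′ T T′ l m m′ r r′} → Fam S l m → Fam S′ m r → Fam T l m′ → Fam T′ m′ r′ → l < m′ → S l m →
  (λ a b → S a b ⊎ S′ a b) ≐ (λ a b → T a b ⊎ T′ a b) → m ≤ m′
split-≤ fS fS′ fT fT′ l<m′ s e with proj₁ e (inj₁ s)
... | inj₁ t = proj₂ (proj₂ (range fT t))
... | inj₂ t = ⊥-elim (<⇒≱ l<m′ (proj₁ (range fT′ t)))

split-≐ : ∀ {S S′ T T′ l m r r′} → Fam S l m → Fam S′ m r → Fam T l m → Fam T′ m r′ →
  (λ a b → S a b ⊎ S′ a b) ≐ (λ a b → T a b ⊎ T′ a b) → S ≐ T × S′ ≐ T′
split-≐ {S} {S′} {T} {T′} fS fS′ fT fT′ e =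
  (half₁ {S} {S′} {T} {T′} fS fT′ (proj₁ e) , half₁ {T} {T′} {S} {S′} fT fS′ (proj₂ e)) , (half₂ {S} {S′} {T} {T′} fS′ fT (proj₁ e) , half₂ {T} {T′} {S} {S′} fT′ fS (proj₂ e))
  where
  half₁ : ∀ {A A′ B B′ : Rel} {l m r′ a b} → Fam A l m → Fam B′ m r′ → (A a b ⊎ A′ a b → B a b ⊎ B′ a b) → A a b → B a b
  half₁ fA fB′ h s with h (inj₁ s)
  ... | inj₁ t = t
  ... | inj₂ t = let (_ , p , p′) = range fA s in ⊥-elim (<⇒≱ p (≤-trans p′ (proj₁ (range fB′ t))))
  half₂ : ∀ {A A′ B B′ : Rel} {l m r a b} → Fam A′ m r → Fam B l m → (A a b ⊎ A′ a b → B a b ⊎ B′ a b) → A′ a b → B′ a b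
  half₂ fA′ fB h s with h (inj₂ s)
  ... | inj₂ t = t
  ... | inj₁ t = let (_ , p , p′) = range fB t in ⊥-elim (<⇒≱ p (≤-trans p′ (proj₁ (range fA′ s))))

split-tree : ∀ x x′ u u′ l → Arc* (x ∷ u) l ≐ Arc* (x′ ∷ u′) l → Arc x l ≐ Arc x′ l × Arc* u (l + ∥ x ∥) ≐ Arc* u′ (l + ∥ x ∥) × ∥ x ∥ ≡ ∥ x′ ∥
split-tree x x′ u u′ l e = proj₁ r , proj₂ r , sz
  where
  sz : ∥ x ∥ ≡ ∥ x′ ∥
  sz = +-cancelˡ-≡ l _ _ (≤-antisym
    (split-≤ (fam x l) (fam* u _) (fam x′ l) (fam* u′ _) (m<m+n l (∥∥>0 x′)) (arc-top x l) e)
    (split-≤ (fam x′ l) (fam* u′ _) (fam x l) (fam* u _) (m<m+n l (∥∥>0 x)) (arc-top x′ l) (λ {a} {b} → ≐-sym {Arc* (x ∷ u) l} {Arc* (x′ ∷ u′) l} e {a} {b})))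
  e′ : Arc* (x ∷ u) l ≐ (λ a b → Arc x′ l a b ⊎ Arc* u′ (l + ∥ x ∥) a b)
  e′ = subst (λ n → Arc* (x ∷ u) l ≐ (λ a b → Arc x′ l a b ⊎ Arc* u′ (l + n) a b)) (sym sz) e
  r = split-≐ (fam x l) (fam* u _) (subst (λ n → Fam (Arc x′ l) l (l + n)) (sym sz) (fam x′ l)) (fam* u′ (l + ∥ x ∥)) e′

leaf≢node : ∀ x y u l → ¬ (Arc (node x y u) l l (l + ∥ node x y u ∥) → Arc leaf l l (l + ∥ node x y u ∥))
leaf≢node x y u l h with h (inj₁ (refl , refl))
... | _ , e = <-irrefl (sym (+-cancelˡ-≡ l _ 1 (trans e (+-comm 1 l)))) (≤-trans (+-mono-≤ (∥∥>0 x) (∥∥>0 y)) (+-monoʳ-≤ ∥ x ∥ (m≤m+n ∥ y ∥ _)))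

mutual
  -- Deleting the top arc leaves the arcs of the forest of children, which `split-tree` takes apart.
  -- The deletion is unambiguous because a node has at least two children, so no child has the same
  -- arc (`¬top`).
  arc-injective : ∀ t t′ l → Arc t l ≐ Arc t′ l → t ≡ t′
  arc-injective leaf         leaf            l e = refl
  arc-injective leaf         (node x y u)    l e = ⊥-elim (leaf≢node x y u l (proj₂ e))
  arc-injective (node x y u) leaf            l e = ⊥-elim (leaf≢node x y u l (proj₁ e))
  arc-injective (node x y u) (node x′ y′ u′) l e = go x′ y′ u′ (split-tree x x′ (y ∷ u) (y′ ∷ u′) l inner)
    where
    t t′ : Tree
    t  = node x y u
    t′ = node x′ y′ u′
    sz : ∀ t t′ → Arc t l ≐ Arc t′ l → l + ∥ t ∥ ≤ l + ∥ t′ ∥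
    sz t t′ e = proj₂ (proj₂ (range (fam t′ l) (proj₁ e (arc-top t l))))
    size : l + ∥ t ∥ ≡ l + ∥ t′ ∥
    size = ≤-antisym (sz t t′ e) (sz t′ t (λ {a} {b} → ≐-sym {Arc t l} {Arc t′ l} e {a} {b}))
    ¬top : ∀ x y u {b} → b ≡ l + ∥ node x y u ∥ → ¬ Arc* (x ∷ y ∷ u) l l b
    ¬top x y u refl (inj₁ s) = <⇒≱ (+-monoʳ-< l (m<m+n ∥ x ∥ (<-≤-trans (∥∥>0 y) (m≤m+n ∥ y ∥ _)))) (proj₂ (proj₂ (range (fam x l) s)))
    ¬top x y u refl (inj₂ s) = <⇒≱ (m<m+n l (∥∥>0 x)) (proj₁ (range (fam* (y ∷ u) (l + ∥ x ∥)) s))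
    half : ∀ x y u x′ y′ u′ {a b} → l + ∥ node x y u ∥ ≡ l + ∥ node x′ y′ u′ ∥ → (Arc (node x y u) l a b → Arc (node x′ y′ u′) l a b) → Arc* (x ∷ y ∷ u) l a b → Arc* (x′ ∷ y′ ∷ u′) l a b
    half x y u x′ y′ u′ eq h s with h (inj₂ s)
    ... | inj₂ s′          = s′
    ... | inj₁ (refl , e′) = ⊥-elim (¬top x y u (trans e′ (sym eq)) s)
    inner : Arc* (x ∷ y ∷ u) l ≐ Arc* (x′ ∷ y′ ∷ u′) l
    inner = half x y u x′ y′ u′ size (proj₁ e) , half x′ y′ u′ x y u (sym size) (proj₂ e)
    go : ∀ x′ y′ u′ → Arc x l ≐ Arc x′ l × Arc* (y ∷ u) (l + ∥ x ∥) ≐ Arc* (y′ ∷ u′) (l + ∥ x ∥) × ∥ x ∥ ≡ ∥ x′ ∥ → node x y u ≡ node x′ y′ u′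
    go x′ y′ u′ (e₁ , e₂ , _) with split-tree y y′ u u′ (l + ∥ x ∥) e₂
    ... | e₃ , e₄ , _ with arc-injective x x′ l e₁ | arc-injective y y′ (l + ∥ x ∥) e₃ | arc*-injective u u′ (l + ∥ x ∥ + ∥ y ∥) e₄
    ... | refl | refl | refl = refl

  arc*-injective : ∀ u u′ l → Arc* u l ≐ Arc* u′ l → u ≡ u′
  arc*-injective []      []        l e = refl
  arc*-injective []      (x ∷ u)   l e = ⊥-elim (proj₂ e (inj₁ (arc-top x l)))
  arc*-injective (x ∷ u) []        l e = ⊥-elim (proj₁ e (inj₁ (arc-top x l)))
  arc*-injective (x ∷ u) (x′ ∷ u′) l e with split-tree x x′ u u′ l e
  ... | e₁ , e₂ , _ = cong₂ _∷_ (arc-injective x x′ l e₁) (arc*-injective u u′ (l + ∥ x ∥) e₂)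

largest : ∀ {P : ℕ → Set} → (∀ i → Dec (P i)) → ∀ l r → l < r → P (suc l) → ∃[ i ] (l < i × i ≤ r × P i × (∀ j → i < j → j ≤ r → ¬ P j))
largest P? l (suc r) (s≤s l≤r) p with P? (suc r)
... | yes q = suc r , s≤s l≤r , ≤-refl , q , λ j i<j j≤r _ → <⇒≱ i<j j≤r
... | no ¬q with m≤n⇒m<n∨m≡n l≤r
... | inj₂ refl = ⊥-elim (¬q p)
... | inj₁ l<r with largest P? l r l<r p
... | i , l<i , i≤r , pi , h = i , l<i , m≤n⇒m≤1+n i≤r , pi , λ j i<j j≤1+r pj → h′ j i<j (m≤n⇒m<n∨m≡n j≤1+r) pj
  where
  h′ : ∀ j → i < j → j < suc r ⊎ j ≡ suc r → ¬ _
  h′ j i<j (inj₁ (s≤s j≤r)) pj = h j i<j j≤r pj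
  h′ j i<j (inj₂ refl)      pj = ¬q pj

Edges Noncrossing : Rel → ℕ → ℕ → Set
Edges R l r       = ∀ {a} → l ≤ a → a < r → R a (suc a)
Noncrossing R l r = ∀ {a b c d} → l ≤ a → a < b → b < c → c < d → d ≤ r → R a c → R b d → ⊥

Agree : Rel → Rel → ℕ → ℕ → Set
Agree R S l r = ∀ {a b} → l ≤ a → a < b → b ≤ r → (R a b → S a b) × (S a b → R a b)

-- No arc of `R` straddles `i`: one starting strictly between `l` and `i` would cross the arc from
-- `l` to `i`, and one starting at `l` would be longer than the longest.
agree-++ : ∀ {R S S′ l i r} → Noncrossing R l r → R l i → (∀ {b} → i < b → b ≤ r → ¬ R l b) → Fam S l i → Fam S′ i r →
  Agree R S l i → Agree R S′ i r → Agree R (λ a b → S a b ⊎ S′ a b) l r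
agree-++ {R} {S} {S′} {l} {i} {r} nc Rli max fS fS′ ag ag′ {a} {b} l≤a a<b b≤r = to , from
  where
  from : S a b ⊎ S′ a b → R a b
  from (inj₁ s) = let (p , p′ , p″) = range fS s in proj₂ (ag p p′ p″) s
  from (inj₂ s) = let (p , p′ , p″) = range fS′ s in proj₂ (ag′ p p′ p″) s
  to : R a b → S a b ⊎ S′ a b
  to h with b ≤? i | i ≤? a
  ... | yes b≤i | _       = inj₁ (proj₁ (ag l≤a a<b b≤i) h)
  ... | no  _   | yes i≤a = inj₂ (proj₁ (ag′ i≤a a<b b≤r) h)
  ... | no b≰i  | no i≰a with m≤n⇒m<n∨m≡n l≤a
  ... | inj₁ l<a  = ⊥-elim (nc ≤-refl l<a (≰⇒> i≰a) (≰⇒> b≰i) b≤r Rli h)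
  ... | inj₂ refl = ⊥-elim (max (≰⇒> b≰i) b≤r h)

sub-noncrossing : ∀ {R l r l′ r′} → Noncrossing R l r → l ≤ l′ → r′ ≤ r → Noncrossing R l′ r′
sub-noncrossing nc l≤ ≤r p q q′ q″ p′ = nc (≤-trans l≤ p) q q′ q″ (≤-trans p′ ≤r)

double-mono : ∀ {i r} → i ≤ r → i + i ≤ r + r
double-mono p = +-mono-≤ p p

2+double-mono : ∀ {l i} → l < i → suc (suc (l + l)) ≤ i + i
2+double-mono {l} {i} p = subst (_≤ i + i) (cong suc (+-suc l l)) (double-mono p)

fuel-step : ∀ {l i r f} → l < i → r ≤ l + l + suc f → r ≤ i + i + f
fuel-step {l} {i} {r} {f} l<i le = ≤-trans le (≤-trans (≤-reflexive (+-suc (l + l) f)) (+-monoˡ-≤ f (≤-trans (n≤1+n _) (2+double-mono l<i))))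

fuel-step′ : ∀ {l r f} → suc r + suc r ≤ suc (l + l + suc f) → r + r ≤ l + l + f
fuel-step′ {l} {r} {f} le = ≤-pred (≤-pred (subst₂ _≤_ (cong suc (+-suc r r)) (cong suc (+-suc (l + l) f)) le))

-- The fuel bounds twice the length of the interval, and one less for trees,
-- since a forest may consist of a single tree.
module _ {R : Rel} (R? : ∀ a b → Dec (R a b)) where
  mutual
    -- The converse of `fam*`: the longest arc at `l` spans the first tree, the remaining interval
    -- carries the rest of the forest, and `agree-++` shows that nothing is lost.
    arc*-complete : ∀ f l r → r + r ≤ l + l + f → l ≤ r → Edges R l r → Noncrossing R l r → ∃[ u ] (l + ∥ u ∥* ≡ r × Agree R (Arc* u l) l r)
    arc*-complete zero l r le l≤r ed nc with m≤n⇒m<n∨m≡n l≤r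
    ... | inj₁ l<r  = ⊥-elim (<⇒≱ (≤-trans (n≤1+n _) (2+double-mono l<r)) (subst (r + r ≤_) (+-identityʳ (l + l)) le))
    ... | inj₂ refl = [] , +-identityʳ l , λ l≤a a<b b≤l → ⊥-elim (<⇒≱ a<b (≤-trans b≤l l≤a))
    arc*-complete (suc f) l r le l≤r ed nc with m≤n⇒m<n∨m≡n l≤r
    ... | inj₂ refl = [] , +-identityʳ l , λ l≤a a<b b≤l → ⊥-elim (<⇒≱ a<b (≤-trans b≤l l≤a))
    ... | inj₁ l<r with largest (R? l) l r l<r (ed ≤-refl l<r)
    ... | i , l<i , i≤r , Rli , max
      with arc-complete f l i (≤-trans (double-mono i≤r) (subst (r + r ≤_) (+-suc (l + l) f) le)) l<i Rli (λ p p′ → ed p (<-≤-trans p′ i≤r)) (sub-noncrossing nc ≤-refl i≤r)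
         | arc*-complete f i r (fuel-step l<i le) i≤r (λ p p′ → ed (≤-trans (<⇒≤ l<i) p) p′) (sub-noncrossing nc (<⇒≤ l<i) ≤-refl)
    ... | t , refl , ag | u , refl , ag′ = t ∷ u , sym (+-assoc l _ _) , agree-++ nc Rli (max _) (fam t l) (fam* u _) ag ag′

    arc-complete : ∀ f l r → r + r ≤ suc (l + l + f) → l < r → R l r → Edges R l r → Noncrossing R l r → ∃[ t ] (l + ∥ t ∥ ≡ r × Agree R (Arc t l) l r)
    arc-complete zero    l r       le l<r Rlr ed nc = ⊥-elim (<⇒≱ (2+double-mono l<r) (subst (λ n → r + r ≤ suc n) (+-identityʳ (l + l)) le))
    arc-complete (suc f) l (suc r) le (s≤s l≤r) Rlr ed nc with m≤n⇒m<n∨m≡n l≤r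
    ... | inj₂ refl = leaf , +-comm l 1 , λ {a} {b} l≤a a<b b≤1+l → (λ _ → let a≡l = ≤-antisym (≤-pred (≤-trans a<b b≤1+l)) l≤a in
              a≡l , ≤-antisym b≤1+l (subst (_< b) a≡l a<b))
            , λ { (refl , refl) → Rlr }
    -- The arc to the right end of the interval is the top arc itself, so the first child is found
    -- as the longest arc ending at `r` or before.
    ... | inj₁ l<r with largest (R? l) l r l<r (ed ≤-refl (s≤s l≤r))
    ... | i , l<i , i≤r , Rli , max
      with arc-complete f l i (≤-trans (double-mono i≤r) (m≤n⇒m≤1+n (fuel-step′ {l} {r} le))) l<i Rli (λ p p′ → ed p (<-≤-trans p′ (m≤n⇒m≤1+n i≤r))) (sub-noncrossing nc ≤-refl (m≤n⇒m≤1+n i≤r))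
         | arc*-complete f i (suc r) (≤-trans (≤-reflexive (cong suc (+-suc r r))) (≤-trans (s≤s (s≤s (fuel-step′ {l} {r} le))) (+-monoˡ-≤ f (2+double-mono l<i)))) (m≤n⇒m≤1+n i≤r) (λ p p′ → ed (≤-trans (<⇒≤ l<i) p) p′) (sub-noncrossing nc (<⇒≤ l<i) ≤-refl)
    -- The first child ends before the interval does, hence there is a second child and `node`
    -- applies.
    ... | t , refl , ag | []    , e , ag′ = ⊥-elim (<⇒≱ (s≤s i≤r) (≤-reflexive (trans (sym e) (+-identityʳ _))))
    ... | t , refl , ag | y ∷ u , e , ag′ = node t y u , size , final
      where
      size : l + ∥ node t y u ∥ ≡ suc r
      size = trans (sym (+-assoc l _ _)) e
      -- The relation with the top arc removed; for it the arc to `i` is the longest one at `l`, as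
      -- `agree-++` requires.
      R₀ : Rel
      R₀ a b = R a b × (a ≡ l → b ≤ r)
      famU : Fam (Arc* (y ∷ u) (l + ∥ t ∥)) (l + ∥ t ∥) (suc r)
      famU = subst (Fam _ _) e (fam* (y ∷ u) (l + ∥ t ∥))
      inner : Agree R₀ (Arc* (t ∷ y ∷ u) l) l (suc r)
      inner = agree-++ {R = R₀} (λ { p q q′ q″ p′ (h , _) (h′ , _) → nc p q q′ q″ p′ h h′ }) (Rli , λ _ → i≤r)
        (λ { {b} i<b b≤ (h , k) → max b i<b (k refl) h }) (fam t l) famU
        (λ p q q′ → (λ { (h , _) → proj₁ (ag p q q′) h }) , (λ s → proj₂ (ag p q q′) s , λ _ → ≤-trans q′ i≤r))
        (λ p q q′ → (λ { (h , _) → proj₁ (ag′ p q q′) h }) , (λ s → proj₂ (ag′ p q q′) s , λ { refl → ⊥-elim (<⇒≱ l<i p) }))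
      final : Agree R (Arc (node t y u) l) l (suc r)
      final {a} {b} p q q′ = to , from
        where
        to : R a b → Arc (node t y u) l a b
        to h with a ≟ l | b ≟ suc r
        ... | yes refl | yes refl = inj₁ (refl , sym size)
        ... | yes refl | no b≢    = inj₂ (proj₁ (inner p q q′) (h , λ _ → ≤-pred (≤∧≢⇒< q′ b≢)))
        ... | no a≢l   | _        = inj₂ (proj₁ (inner p q q′) (h , λ e → ⊥-elim (a≢l e)))
        from : Arc (node t y u) l a b → R a b
        from (inj₁ (refl , refl)) = subst (R l) (sym size) Rlr
        from (inj₂ s)             = proj₁ (proj₂ (inner p q q′) s)

-- Booleans and finite quantifiers

T-ext : ∀ {a b} → (T a → T b) → (T b → T a) → a ≡ b
T-ext {false} {false} f g = refl
T-ext {false} {true}  f g = ⊥-elim (g tt)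
T-ext {true}  {false} f g = ⊥-elim (f tt)
T-ext {true}  {true}  f g = refl

∧⁺ : ∀ {a b} → T a → T b → T (a ∧ b)
∧⁺ p p′ = Equivalence.from T-∧ (p , p′)

∧⁻ : ∀ {a b} → T (a ∧ b) → T a × T b
∧⁻ = Equivalence.to T-∧

∨⁻ : ∀ {a b} → T (a ∨ b) → T a ⊎ T b
∨⁻ = Equivalence.to T-∨

∨⁺ˡ : ∀ {a b} → T a → T (a ∨ b)
∨⁺ˡ = Equivalence.from T-∨ ∘ inj₁

∨⁺ʳ : ∀ {a b} → T b → T (a ∨ b)
∨⁺ʳ {a} p = Equivalence.from (T-∨ {a}) (inj₂ p)

not⁺ : ∀ {a} → ¬ T a → T (not a)
not⁺ {false} h = tt
not⁺ {true}  h = h tt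

not⁻ : ∀ {a} → T (not a) → ¬ T a
not⁻ {false} h ()

⇒⁺ : ∀ {a b} → (T a → T b) → T (not a ∨ b)
⇒⁺ {false} h = tt
⇒⁺ {true}  h = h tt

⇒⁻ : ∀ {a b} → T (not a ∨ b) → T a → T b
⇒⁻ {true} h _ = h

⇔⁺ : ∀ {a b} → a ≡ b → T (a ⇔ᵇ b)
⇔⁺ {false} refl = tt
⇔⁺ {true}  refl = tt

⇔⁻ : ∀ {a b} → T (a ⇔ᵇ b) → a ≡ b
⇔⁻ {false} {false} h = refl
⇔⁻ {true}  {true}  h = refl

==⁻ : ∀ {n} (i j : Fin n) → T (i == j) → i ≡ j
==⁻ i j h = FP.toℕ-injective (≡ᵇ⇒≡ (toℕ i) (toℕ j) h)

==⁺ : ∀ {n} {i j : Fin n} → i ≡ j → T (i == j)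
==⁺ {i = i} refl = ≡⇒≡ᵇ (toℕ i) (toℕ i) refl

opaque
  forallFin⁺ : ∀ {n} {p : Fin n → Bool} → (∀ i → T (p i)) → T (forallFin p)
  forallFin⁺ {n} {p} h = AllP.all⁻ p {xs = allFin n} (All.tabulate (λ {i} _ → h i))

  forallFin⁻ : ∀ {n} {p : Fin n → Bool} → T (forallFin p) → ∀ i → T (p i)
  forallFin⁻ {p = p} h i = All.lookup (AllP.all⁺ p (allFin _) h) (∈-allFin i)

-- Graphs as lists of edges

sublists-⊆ : ∀ {A : Set} (xs : List A) {ys x} → ys ∈ sublists xs → x ∈ ys → x ∈ xs
sublists-⊆ []       (here refl) ()
sublists-⊆ (x ∷ xs) m p with ∈-++⁻ (sublists xs) m
... | inj₁ q = there (sublists-⊆ xs q p)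
... | inj₂ q with ∈-map⁻ (x ∷_) q
... | zs , z∈ , refl with p
... | here e   = here e
... | there p′ = there (sublists-⊆ xs z∈ p′)

filterᵇ-∈-sublists : ∀ {A : Set} (p : A → Bool) xs → filterᵇ p xs ∈ sublists xs
filterᵇ-∈-sublists p []       = here refl
filterᵇ-∈-sublists p (x ∷ xs) with p x
... | true  = ∈-++⁺ʳ (sublists xs) (∈-map⁺ (x ∷_) (filterᵇ-∈-sublists p xs))
... | false = ∈-++⁺ˡ (filterᵇ-∈-sublists p xs)

unique-sublists : ∀ {A : Set} {xs : List A} → Unique xs → Unique (sublists xs)
unique-sublists {xs = []}     u        = [] ∷ []
unique-sublists {xs = x ∷ xs} (x∉ ∷ u) = UP.++⁺ (unique-sublists u) (UP.map⁺ (λ { refl → refl }) (unique-sublists u)) disj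
  where
  disj : ∀ {ys} → ¬ (ys ∈ sublists xs × ys ∈ map (x ∷_) (sublists xs))
  disj (p , q) with ∈-map⁻ (x ∷_) q
  ... | zs , _ , refl = All.lookup x∉ (sublists-⊆ xs p (here refl)) refl

-- A sublist of a duplicate-free list is determined by its elements, since the order is inherited.
-- So edge lists in `graphs n` are canonical, and equality of graphs can be checked on adjacency.
filterᵇ-sublist : ∀ {A : Set} (p : A → Bool) {xs ys} → Unique xs → ys ∈ sublists xs →
  (∀ {x} → x ∈ xs → T (p x) → x ∈ ys) → (∀ {x} → x ∈ ys → T (p x)) → filterᵇ p xs ≡ ys
filterᵇ-sublist p {[]}     u        (here refl) f g = refl
filterᵇ-sublist p {x ∷ xs} (x∉ ∷ u) m f g with ∈-++⁻ (sublists xs) m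
... | inj₁ q with p x in eq
...   | true  = ⊥-elim (All.lookup x∉ (sublists-⊆ xs q (f (here refl) (subst T (sym eq) tt))) refl)
...   | false = filterᵇ-sublist p u q (λ z → f (there z)) g
filterᵇ-sublist p {x ∷ xs} (x∉ ∷ u) m f g | inj₂ q with ∈-map⁻ (x ∷_) q
... | zs , z∈ , refl with p x in eq
...   | false = ⊥-elim (subst T eq (g (here refl)))
...   | true  = cong (x ∷_) (filterᵇ-sublist p u z∈ f′ (λ z → g (there z)))
  where
  f′ : ∀ {y} → y ∈ xs → T (p y) → y ∈ zs
  f′ y∈ py with f (there y∈) py
  ... | here refl = ⊥-elim (All.lookup x∉ y∈ refl)
  ... | there r   = r

module _ {n : ℕ} where

  ∈-pairs⁺ : ∀ {i j : Fin n} → toℕ i < toℕ j → (i , j) ∈ pairs n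
  ∈-pairs⁺ {i} {j} lt = ∈-concatMap⁺ _ (lose (∈-allFin i) (∈-map⁺ (i ,_) (∈-filterᵇ⁺ (λ j → toℕ i <ᵇ toℕ j) (∈-allFin j) (<⇒<ᵇ lt))))

  ∈-pairs⁻ : ∀ {i j : Fin n} → (i , j) ∈ pairs n → toℕ i < toℕ j
  ∈-pairs⁻ m with find (∈-concatMap⁻ (λ i → map (i ,_) (filterᵇ (λ j → toℕ i <ᵇ toℕ j) (allFin n))) {xs = allFin n} m)
  ... | i , _ , q with ∈-map⁻ (i ,_) q
  ... | j , r , refl = <ᵇ⇒< (toℕ i) (toℕ j) (proj₂ (∈-filterᵇ⁻ (λ j → toℕ i <ᵇ toℕ j) {xs = allFin n} r))

  unique-pairs : Unique (pairs n)
  unique-pairs = unique-concatMap proj₁ (λ i → map (i ,_) (filterᵇ (λ j → toℕ i <ᵇ toℕ j) (allFin n))) (UP.allFin⁺ n)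
    (λ i → UP.map⁺ (λ { refl → refl }) (unique-filterᵇ (λ j → toℕ i <ᵇ toℕ j) (UP.allFin⁺ n)))
    (λ {i} m → k i m)
    where
    k : ∀ i {e} → e ∈ map (i ,_) (filterᵇ (λ j → toℕ i <ᵇ toℕ j) (allFin n)) → proj₁ e ≡ i
    k i m with ∈-map⁻ (i ,_) m
    ... | _ , _ , refl = refl

  unique-graphs : Unique (graphs n)
  unique-graphs = unique-sublists unique-pairs

  adj⁻ : ∀ (G : Graph n) i j → T (adj G i j) → (i , j) ∈ G ⊎ (j , i) ∈ G
  adj⁻ G i j h with find (AnyP.any⁻ _ G h)
  ... | (a , b) , m , t with ∨⁻ {(a == i) ∧ (b == j)} {(a == j) ∧ (b == i)} t
  ... | inj₁ t′ with ∧⁻ {a == i} {b == j} t′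
  ... | p , p′ with ==⁻ a i p | ==⁻ b j p′
  ... | refl | refl = inj₁ m
  adj⁻ G i j h | (a , b) , m , t | inj₂ t′ with ∧⁻ {a == j} {b == i} t′
  ... | p , p′ with ==⁻ a j p | ==⁻ b i p′
  ... | refl | refl = inj₂ m

  adj⁺ : ∀ (G : Graph n) i j → (i , j) ∈ G ⊎ (j , i) ∈ G → T (adj G i j)
  adj⁺ G i j (inj₁ m) = AnyP.any⁺ _ (lose m (∨⁺ˡ (∧⁺ (==⁺ {i = i} refl) (==⁺ {i = j} refl))))
  adj⁺ G i j (inj₂ m) = AnyP.any⁺ _ (lose m (∨⁺ʳ {a = (j == i) ∧ (i == j)} (∧⁺ (==⁺ {i = j} refl) (==⁺ {i = i} refl))))

  adj-sym : ∀ (G : Graph n) i j → adj G i j ≡ adj G j i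
  adj-sym G i j = T-ext (h i j) (h j i)
    where
    h : ∀ i j → T (adj G i j) → T (adj G j i)
    h i j t with adj⁻ G i j t
    ... | inj₁ m = adj⁺ G j i (inj₂ m)
    ... | inj₂ m = adj⁺ G j i (inj₁ m)

  adj-irrefl : ∀ {G : Graph n} → G ∈ graphs n → ∀ i → ¬ T (adj G i i)
  adj-irrefl {G} G∈ i t with adj⁻ G i i t
  ... | inj₁ m = <-irrefl refl (∈-pairs⁻ (sublists-⊆ (pairs n) G∈ m))
  ... | inj₂ m = <-irrefl refl (∈-pairs⁻ (sublists-⊆ (pairs n) G∈ m))

  mk : (Fin n → Fin n → Bool) → Graph n
  mk χ = filterᵇ (λ e → χ (proj₁ e) (proj₂ e)) (pairs n)

  mk-∈ : ∀ χ → mk χ ∈ graphs n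
  mk-∈ χ = filterᵇ-∈-sublists (λ e → χ (proj₁ e) (proj₂ e)) (pairs n)

  adj-mk-< : ∀ χ {i j} → toℕ i < toℕ j → adj (mk χ) i j ≡ χ i j
  adj-mk-< χ {i} {j} lt = T-ext to (λ t → adj⁺ (mk χ) i j (inj₁ (∈-filterᵇ⁺ _ (∈-pairs⁺ lt) t)))
    where
    to : T (adj (mk χ) i j) → T (χ i j)
    to t with adj⁻ (mk χ) i j t
    ... | inj₁ m = proj₂ (∈-filterᵇ⁻ (λ e → χ (proj₁ e) (proj₂ e)) {xs = pairs n} m)
    ... | inj₂ m = ⊥-elim (<-asym lt (∈-pairs⁻ (proj₁ (∈-filterᵇ⁻ (λ e → χ (proj₁ e) (proj₂ e)) {xs = pairs n} m))))

  adj-mk : ∀ χ → (∀ i j → χ i j ≡ χ j i) → (∀ i → ¬ T (χ i i)) → ∀ i j → adj (mk χ) i j ≡ χ i j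
  adj-mk χ sy ir i j with <-cmp (toℕ i) (toℕ j)
  ... | tri< lt _ _ = adj-mk-< χ lt
  ... | tri> _ _ gt = trans (adj-sym (mk χ) i j) (trans (adj-mk-< χ gt) (sy j i))
  ... | tri≈ _ e _ with FP.toℕ-injective e
  ... | refl = T-ext (λ t → ⊥-elim (adj-irrefl (mk-∈ χ) i t)) (λ t → ⊥-elim (ir i t))

  graph-ext : ∀ {G H : Graph n} → G ∈ graphs n → H ∈ graphs n → (∀ {i j} → toℕ i < toℕ j → adj G i j ≡ adj H i j) → G ≡ H
  graph-ext {G} {H} G∈ H∈ h = trans (sym (can G G∈ (λ _ → refl))) (can H H∈ h)
    where
    can : ∀ K → K ∈ graphs n → (∀ {i j} → toℕ i < toℕ j → adj G i j ≡ adj K i j) → mk (adj G) ≡ K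
    can K K∈ h = filterᵇ-sublist _ unique-pairs K∈
      (λ { {i , j} m t → fr (∈-pairs⁻ m) (adj⁻ K i j (subst T (h (∈-pairs⁻ m)) t)) })
      (λ { {i , j} m → subst T (sym (h (∈-pairs⁻ (sublists-⊆ (pairs n) K∈ m)))) (adj⁺ K i j (inj₁ m)) })
      where
      fr : ∀ {i j} → toℕ i < toℕ j → (i , j) ∈ K ⊎ (j , i) ∈ K → (i , j) ∈ K
      fr lt (inj₁ m) = m
      fr lt (inj₂ m) = ⊥-elim (<-asym lt (∈-pairs⁻ (sublists-⊆ (pairs n) K∈ m)))

  Perm : Set
  Perm = Vec (Fin n) n

  infixl 30 _⟨_⟩
  _⟨_⟩ : Perm → Fin n → Fin n
  σ ⟨ i ⟩ = lookup σ i

  record Inj (σ : Perm) : Set where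
    constructor mkInj
    field inj : ∀ {i j} → σ ⟨ i ⟩ ≡ σ ⟨ j ⟩ → i ≡ j
  open Inj public

  vec-ext : ∀ {σ τ : Perm} → (∀ i → σ ⟨ i ⟩ ≡ τ ⟨ i ⟩) → σ ≡ τ
  vec-ext {σ} {τ} h = trans (sym (VP.tabulate∘lookup σ)) (trans (VP.tabulate-cong h) (VP.tabulate∘lookup τ))

  ∈-allVecs : ∀ k (v : Vec (Fin n) k) → v ∈ allVecs n k
  ∈-allVecs zero    Vec.[]       = here refl
  ∈-allVecs (suc k) (i Vec.∷ v) = ∈-concatMap⁺ _ (lose (∈-allFin i) (∈-map⁺ (i Vec.∷_) (∈-allVecs k v)))

  unique-allVecs : ∀ k → Unique (allVecs n k)
  unique-allVecs zero    = [] ∷ []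
  unique-allVecs (suc k) = unique-concatMap Vec.head (λ i → map (i Vec.∷_) (allVecs n k)) (UP.allFin⁺ n)
    (λ i → UP.map⁺ (λ { refl → refl }) (unique-allVecs k)) (λ {i} m → h i m)
    where
    h : ∀ i {v} → v ∈ map (i Vec.∷_) (allVecs n k) → Vec.head v ≡ i
    h i m with ∈-map⁻ (i Vec.∷_) m
    ... | _ , _ , refl = refl

  unique-perms : Unique (perms n)
  unique-perms = unique-filterᵇ isPerm (unique-allVecs n)

  ∈-perms⁺ : ∀ {σ} → Inj σ → σ ∈ perms n
  ∈-perms⁺ {σ} h = ∈-filterᵇ⁺ isPerm (∈-allVecs n σ)
    (forallFin⁺ (λ i → forallFin⁺ (λ j → ⇒⁺ {σ ⟨ i ⟩ == σ ⟨ j ⟩} (λ t → ==⁺ (inj h (==⁻ (σ ⟨ i ⟩) (σ ⟨ j ⟩) t))))))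

  ∈-perms⁻ : ∀ {σ} → σ ∈ perms n → Inj σ
  ∈-perms⁻ {σ} m = mkInj (λ {i} {j} e → ==⁻ i j (⇒⁻ {σ ⟨ i ⟩ == σ ⟨ j ⟩} (forallFin⁻ (forallFin⁻ (proj₂ (∈-filterᵇ⁻ isPerm {xs = allVecs n n} m)) i) j) (==⁺ e)))

  infixl 31 _·_
  _·_ : Perm → Perm → Perm
  σ · τ = tabulate (λ i → σ ⟨ τ ⟨ i ⟩ ⟩)

  ·-at : ∀ σ τ i → (σ · τ) ⟨ i ⟩ ≡ σ ⟨ τ ⟨ i ⟩ ⟩
  ·-at σ τ i = VP.lookup∘tabulate (λ i → σ ⟨ τ ⟨ i ⟩ ⟩) i

  ·-inj : ∀ {σ τ} → Inj σ → Inj τ → Inj (σ · τ)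
  ·-inj {σ} {τ} hσ hτ = mkInj (λ {i} {j} e → inj hτ (inj hσ (trans (sym (·-at σ τ i)) (trans e (·-at σ τ j)))))

-- A value that is missed could be punched out, giving an injection into a smaller set.
injective⇒surjective : ∀ {n} (f : Fin n → Fin n) → (∀ {i j} → f i ≡ f j → i ≡ j) → ∀ y → ∃[ x ] f x ≡ y
injective⇒surjective {suc n} f inj y with FP.any? (λ x → f x FP.≟ y)
... | yes r = r
... | no ¬r = ⊥-elim (1+n≰n (FP.injective⇒≤ {f = λ x → F.punchOut {i = y} {f x} (λ e → ¬r (x , sym e))}
  (λ e → inj (FP.punchOut-injective {i = y} _ _ e))))

module _ {n : ℕ} where

  inv : ∀ (σ : Perm {n}) → Inj σ → Perm {n}
  inv σ h = tabulate (λ y → proj₁ (injective⇒surjective (lookup σ) (inj h) y))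

  inv-r : ∀ σ (h : Inj σ) i → σ ⟨ inv σ h ⟨ i ⟩ ⟩ ≡ i
  inv-r σ h i = trans (cong (lookup σ) (VP.lookup∘tabulate _ i)) (proj₂ (injective⇒surjective (lookup σ) (inj h) i))

  inv-l : ∀ σ (h : Inj σ) i → inv σ h ⟨ σ ⟨ i ⟩ ⟩ ≡ i
  inv-l σ h i = inj h (inv-r σ h (σ ⟨ i ⟩))

  inv-inj : ∀ σ (h : Inj σ) → Inj (inv σ h)
  inv-inj σ h = mkInj (λ {i} {j} e → trans (sym (inv-r σ h i)) (trans (cong (lookup σ) e) (inv-r σ h j)))

  iso⁺ : ∀ (H G : Graph n) σ → (∀ i j → adj H i j ≡ adj G (σ ⟨ i ⟩) (σ ⟨ j ⟩)) → T (isIso H G σ)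
  iso⁺ H G σ h = forallFin⁺ (λ i → forallFin⁺ (λ j → ⇔⁺ (h i j)))

  iso⁻ : ∀ (H G : Graph n) σ → T (isIso H G σ) → ∀ i j → adj H i j ≡ adj G (σ ⟨ i ⟩) (σ ⟨ j ⟩)
  iso⁻ H G σ h i j = ⇔⁻ (forallFin⁻ (forallFin⁻ h i) j)

  -- The pullback, so that `σ` is an isomorphism from `act σ G` to `G` in the sense of `isIso`.
  act : Perm {n} → Graph n → Graph n
  act σ G = mk (λ i j → adj G (σ ⟨ i ⟩) (σ ⟨ j ⟩))

  adj-act : ∀ σ {G} → G ∈ graphs n → ∀ i j → adj (act σ G) i j ≡ adj G (σ ⟨ i ⟩) (σ ⟨ j ⟩)
  adj-act σ {G} G∈ = adj-mk _ (λ i j → adj-sym G (σ ⟨ i ⟩) (σ ⟨ j ⟩)) (λ i → adj-irrefl G∈ (σ ⟨ i ⟩))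

  act-∈ : ∀ σ G → act σ G ∈ graphs n
  act-∈ σ G = mk-∈ _

-- Counting in products

count-++ : ∀ {A : Set} (p : A → Bool) xs ys → count p (xs ++ ys) ≡ count p xs + count p ys
count-++ p []       ys = refl
count-++ p (x ∷ xs) ys with p x
... | true  = cong suc (count-++ p xs ys)
... | false = count-++ p xs ys

count-map : ∀ {A B : Set} (p : B → Bool) (f : A → B) xs → count p (map f xs) ≡ count (p ∘ f) xs
count-map p f []       = refl
count-map p f (x ∷ xs) with p (f x)
... | true  = cong suc (count-map p f xs)
... | false = count-map p f xs

-- Together with `count-swap` this is the device for double counting: fibres have constant size `c`
-- over the points where `b` holds and are empty elsewhere.
count-fibres : ∀ {A B : Set} (p : A × B → Bool) (b : A → Bool) c xs ys →
  (∀ {x} → x ∈ xs → T (b x) → count (λ y → p (x , y)) ys ≡ c) → (∀ {x} → x ∈ xs → ¬ T (b x) → count (λ y → p (x , y)) ys ≡ 0) →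
  count p (cartesianProduct xs ys) ≡ count b xs * c
count-fibres p b c []       ys h h′ = refl
count-fibres p b c (x ∷ xs) ys h h′ = trans (count-++ p (map (x ,_) ys) (cartesianProduct xs ys))
  (trans (cong₂ _+_ (count-map p (x ,_) ys) (count-fibres p b c xs ys (λ m → h (there m)) (λ m → h′ (there m)))) k)
  where
  k : count (λ y → p (x , y)) ys + count b xs * c ≡ count b (x ∷ xs) * c
  k with b x in eq
  ... | true  = cong (_+ count b xs * c) (h (here refl) (subst T (sym eq) tt))
  ... | false = cong (_+ count b xs * c) (h′ (here refl) (λ t → subst T eq t))

count-all : ∀ {A : Set} (xs : List A) → count (λ _ → true) xs ≡ length xs
count-all []       = refl
count-all (x ∷ xs) = cong suc (count-all xs)

count-none : ∀ {A : Set} (p : A → Bool) xs → (∀ {x} → x ∈ xs → ¬ T (p x)) → count p xs ≡ 0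
count-none p []       h = refl
count-none p (x ∷ xs) h with p x in eq
... | true  = ⊥-elim (h (here refl) (subst T (sym eq) tt))
... | false = count-none p xs (λ m → h (there m))

count-bij : ∀ {A B : Set} {p : A → Bool} {q : B → Bool} xs ys → Unique xs → Unique ys → (f : A → B) (g : B → A) →
  (∀ {x} → x ∈ xs → T (p x) → f x ∈ ys × T (q (f x)) × g (f x) ≡ x) →
  (∀ {y} → y ∈ ys → T (q y) → g y ∈ xs × T (p (g y)) × f (g y) ≡ y) → count p xs ≡ count q ys
count-bij {A} {B} {p} {q} xs ys ux uy f g h k = ≤-antisym
  (count-≤ (λ x y → T (p x) × x ≡ g y) {p} {q} xs ys ux (λ x∈ px → let (y∈ , qy , e) = h x∈ px in _ , y∈ , qy , px , sym e) (λ { _ _ (_ , refl) (_ , refl) → refl }))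
  (count-≤ (λ y x → T (q y) × y ≡ f x) {q} {p} ys xs uy (λ y∈ qy → let (x∈ , px , e) = k y∈ qy in _ , x∈ , px , qy , sym e) (λ { _ _ (_ , refl) (_ , refl) → refl }))

count-swap : ∀ {A B : Set} (p : A × B → Bool) xs ys → Unique xs → Unique ys →
  count p (cartesianProduct xs ys) ≡ count (λ yx → p (proj₂ yx , proj₁ yx)) (cartesianProduct ys xs)
count-swap p xs ys ux uy = count-bij (cartesianProduct xs ys) (cartesianProduct ys xs) (UP.cartesianProduct⁺ ux uy) (UP.cartesianProduct⁺ uy ux)
  (λ xy → proj₂ xy , proj₁ xy) (λ yx → proj₂ yx , proj₁ yx)
  (λ m t → let (a , b) = ∈-cartesianProduct⁻ xs ys m in ∈-cartesianProduct⁺ b a , t , refl)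
  (λ m t → let (a , b) = ∈-cartesianProduct⁻ ys xs m in ∈-cartesianProduct⁺ b a , t , refl)

count-one : ∀ {A : Set} (p : A → Bool) {xs x} → Unique xs → x ∈ xs → T (p x) → (∀ {y} → y ∈ xs → T (p y) → y ≡ x) → count p xs ≡ 1
count-one p {xs} {x} u x∈ px h = count-bij {p = p} {q = λ _ → true} xs [ tt ] u ([] ∷ []) (λ _ → tt) (λ _ → x)
  (λ y∈ py → here refl , tt , sym (h y∈ py)) (λ _ _ → x∈ , px , refl)

-- The orbit–stabiliser theorem for graphs

module _ {n : ℕ} {G : Graph n} (G∈ : G ∈ graphs n) where

  iso-unique : ∀ {σ} → count (λ H → isIso H G σ) (graphs n) ≡ 1
  iso-unique {σ} = count-one _ unique-graphs (act-∈ σ G) (iso⁺ (act σ G) G σ (adj-act σ G∈))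
    (λ {H} H∈ t → graph-ext H∈ (act-∈ σ G) (λ {i} {j} _ → trans (iso⁻ H G σ t i j) (sym (adj-act σ G∈ i j))))

  isos-count : ∀ {H σ₀} → Inj σ₀ → T (isIso H G σ₀) → count (isIso H G) (perms n) ≡ length (autos G)
  isos-count {H} {σ₀} h t₀ = count-bij (perms n) (perms n) unique-perms unique-perms (λ σ → σ · inv σ₀ h) (λ τ → τ · σ₀)
    (λ {σ} m t → ∈-perms⁺ (·-inj {σ = σ} (∈-perms⁻ m) (inv-inj σ₀ h)) , iso⁺ G G (σ · inv σ₀ h) (to σ t)
      , vec-ext (λ i → trans (·-at (σ · inv σ₀ h) σ₀ i) (trans (·-at σ (inv σ₀ h) _) (cong (lookup σ) (inv-l σ₀ h i)))))
    (λ {τ} m t → ∈-perms⁺ (·-inj {σ = τ} (∈-perms⁻ m) h) , iso⁺ H G (τ · σ₀) (from τ t)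
      , vec-ext (λ i → trans (·-at (τ · σ₀) (inv σ₀ h) i) (trans (·-at τ σ₀ (inv σ₀ h ⟨ i ⟩)) (cong (lookup τ) (inv-r σ₀ h i)))))
    where
    to : ∀ σ → T (isIso H G σ) → ∀ i j → adj G i j ≡ adj G ((σ · inv σ₀ h) ⟨ i ⟩) ((σ · inv σ₀ h) ⟨ j ⟩)
    to σ t i j = trans (cong₂ (adj G) (sym (inv-r σ₀ h i)) (sym (inv-r σ₀ h j))) (trans (sym (iso⁻ H G σ₀ t₀ (inv σ₀ h ⟨ i ⟩) (inv σ₀ h ⟨ j ⟩)))
      (trans (iso⁻ H G σ t (inv σ₀ h ⟨ i ⟩) (inv σ₀ h ⟨ j ⟩)) (cong₂ (adj G) (sym (·-at σ (inv σ₀ h) i)) (sym (·-at σ (inv σ₀ h) j)))))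
    from : ∀ τ → T (isIso G G τ) → ∀ i j → adj H i j ≡ adj G ((τ · σ₀) ⟨ i ⟩) ((τ · σ₀) ⟨ j ⟩)
    from τ t i j = trans (iso⁻ H G σ₀ t₀ i j) (trans (iso⁻ G G τ t (σ₀ ⟨ i ⟩) (σ₀ ⟨ j ⟩)) (cong₂ (adj G) (sym (·-at τ σ₀ i)) (sym (·-at τ σ₀ j))))

  -- Counts the pairs of a graph `H` and an isomorphism σ from `H` to `G`. For given σ the only `H`
  -- is the pullback of `G`; for given `H` in the class the isomorphisms differ from a fixed one by
  -- automorphisms of `G`.
  orbit-stabiliser : classSize G * length (autos G) ≡ length (perms n)
  orbit-stabiliser = begin
    classSize G * length (autos G)
      ≡⟨ sym (count-fibres (λ Hσ → isIso (proj₁ Hσ) G (proj₂ Hσ)) (λ H → any (isIso H G) (perms n)) (length (autos G)) (graphs n) (perms n)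
           (λ {H} _ t → let (σ₀ , σ₀∈ , t₀) = find (AnyP.any⁻ (isIso H G) (perms n) t) in isos-count {H} {σ₀} (∈-perms⁻ σ₀∈) t₀)
           (λ {H} _ ¬t → count-none (isIso H G) (perms n) (λ m t → ¬t (AnyP.any⁺ (isIso H G) (lose m t))))) ⟩
    count (λ Hσ → isIso (proj₁ Hσ) G (proj₂ Hσ)) (cartesianProduct (graphs n) (perms n))
      ≡⟨ count-swap _ (graphs n) (perms n) unique-graphs unique-perms ⟩
    count (λ σH → isIso (proj₂ σH) G (proj₁ σH)) (cartesianProduct (perms n) (graphs n))
      ≡⟨ count-fibres _ (λ _ → true) 1 (perms n) (graphs n) (λ {σ} _ _ → iso-unique {σ}) (λ _ ¬t → ⊥-elim (¬t tt)) ⟩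
    count (λ _ → true) (perms n) * 1
      ≡⟨ trans (*-identityʳ _) (count-all (perms n)) ⟩
    length (perms n) ∎
    where open ≡-Reasoning

-- Polygons and the dihedral group

module Polygon (n : ℕ) (2<n : 2 < n) where

  0<n : 0 < n
  0<n = <-trans (s≤s z≤n) 2<n

  n-1 : ℕ
  n-1 = n ∸ 1

  1+n-1 : suc n-1 ≡ n
  1+n-1 = m+[n∸m]≡n 0<n

  instance
    n≢0 : NonZero n
    n≢0 = >-nonZero 0<n

  infix 4 _≋_
  record _≋_ (x y : ℕ) : Set where
    constructor mk≋
    field un≋ : x % n ≡ y % n
  open _≋_ public

  ≋-refl : ∀ {x} → x ≋ x
  ≋-refl = mk≋ refl

  ≋-reflexive : ∀ {x y} → x ≡ y → x ≋ y
  ≋-reflexive refl = ≋-refl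

  ≋-sym : ∀ {x y} → x ≋ y → y ≋ x
  ≋-sym (mk≋ e) = mk≋ (sym e)

  ≋-trans : ∀ {x y z} → x ≋ y → y ≋ z → x ≋ z
  ≋-trans (mk≋ e) (mk≋ e′) = mk≋ (trans e e′)

  ≋-+ : ∀ {x x′ y y′} → x ≋ x′ → y ≋ y′ → x + y ≋ x′ + y′
  ≋-+ {x} {x′} {y} {y′} (mk≋ e) (mk≋ e′) = mk≋ (trans (%-distribˡ-+ x y n) (trans (cong₂ (λ a b → (a + b) % n) e e′) (sym (%-distribˡ-+ x′ y′ n))))

  ≋-suc : ∀ {x y} → x ≋ y → suc x ≋ suc y
  ≋-suc = ≋-+ (≋-refl {1})

  ≋-n : ∀ x → x + n ≋ x
  ≋-n x = mk≋ ([m+n]%n≡m%n x n)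

  ≋-kn : ∀ x j → x + j * n ≋ x
  ≋-kn x j = mk≋ ([m+kn]%n≡m%n x j n)

  ≋-% : ∀ x → x % n ≋ x
  ≋-% x = mk≋ (m%n%n≡m%n x n)

  -- Adding z (n - 1) serves as subtraction of `z` modulo n; `neg` below uses the same substitute
  -- for a minus sign.
  ≋-cancelʳ : ∀ z {x y} → x + z ≋ y + z → x ≋ y
  ≋-cancelʳ z {x} {y} e = ≋-trans (≋-sym (h x)) (≋-trans (≋-+ e (≋-refl {z * n-1})) (h y))
    where
    h : ∀ x → x + z + z * n-1 ≋ x
    h x = ≋-trans (≋-reflexive (trans (+-assoc x z _) (cong (x +_) (trans (sym (*-suc z n-1)) (cong (z *_) 1+n-1))))) (≋-kn x z)

  ≋-pred : ∀ {x y} → suc x ≋ suc y → x ≋ y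
  ≋-pred {x} {y} e = ≋-cancelʳ 1 (subst₂ _≋_ (+-comm 1 x) (+-comm 1 y) e)

  ≋-small : ∀ {x y} → x < n → y < n → x ≋ y → x ≡ y
  ≋-small x<n y<n (mk≋ e) = trans (sym (m<n⇒m%n≡m x<n)) (trans e (m<n⇒m%n≡m y<n))

  ≋-near : ∀ {x y} → x ≤ y → y < x + n → x ≋ y → x ≡ y
  ≋-near {x} {y} x≤y y<x+n e with m≤n⇒∃[o]m+o≡n x≤y
  ... | d , refl = sym (trans (cong (x +_) d≡0) (+-identityʳ x))
    where
    d≡0 : d ≡ 0
    d≡0 = ≋-small (+-cancelˡ-< x d n y<x+n) 0<n (≋-sym (≋-cancelʳ x (subst₂ _≋_ refl (+-comm x d) e)))

  opaque
    pt : ℕ → Fin n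
    pt x = x mod n

    toℕ-pt : ∀ x → toℕ (pt x) ≡ x % n
    toℕ-pt x = FP.toℕ-fromℕ< (m%n<n x n)

  pt-cong : ∀ {x y} → x ≋ y → pt x ≡ pt y
  pt-cong {x} {y} (mk≋ e) = FP.toℕ-injective (trans (toℕ-pt x) (trans e (sym (toℕ-pt y))))

  pt-injective : ∀ {x y} → pt x ≡ pt y → x ≋ y
  pt-injective {x} {y} e = mk≋ (trans (sym (toℕ-pt x)) (trans (cong toℕ e) (toℕ-pt y)))

  toℕ-pt-< : ∀ {x} → x < n → toℕ (pt x) ≡ x
  toℕ-pt-< {x} x<n = trans (toℕ-pt x) (m<n⇒m%n≡m x<n)

  pt-toℕ : ∀ i → pt (toℕ i) ≡ i
  pt-toℕ i = FP.toℕ-injective (toℕ-pt-< (FP.toℕ<n i))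

  Adj : Set
  Adj = Fin n → Fin n → Bool

  infix 30 _°
  -- Vertices of the polygon are residues modulo n, and chords are read on their cover by the
  -- natural numbers, where arcs have a start and an end.
  _° : Adj → Rel
  (A °) x y = T (A (pt x) (pt y))

  °-resp : ∀ A {x x′ y y′} → x ≋ x′ → y ≋ y′ → (A °) x y → (A °) x′ y′
  °-resp A e e′ = subst T (cong₂ A (pt-cong e) (pt-cong e′))

  -- A dissection whose polygon is 0, 1, ..., n - 1. Crossings are excluded for quadruples within
  -- any window of one period, which makes the notion visibly invariant under rotations; `nc-cyclic`
  -- derives this from the window starting at 0.
  record Std (A : Adj) : Set where
    field
      sym°  : ∀ {x y} → (A °) x y → (A °) y x
      edge° : ∀ x → (A °) x (suc x)
      cross° : ∀ {a b c d} → a < b → b < c → c < d → d < a + n → (A °) a c → (A °) b d → ⊥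
  open Std public

  infixl 20 _∙_
  _∙_ : Adj → (Fin n → Fin n) → Adj
  (A ∙ f) i j = A (f i) (f j)

  std-cong : ∀ {A B} → (∀ i j → A i j ≡ B i j) → Std A → Std B
  std-cong e s = record
    { sym° = λ h → subst T (e _ _) (sym° s (subst T (sym (e _ _)) h))
    ; edge° = λ x → subst T (e _ _) (edge° s x)
    ; cross° = λ p q r t h h′ → cross° s p q r t (subst T (sym (e _ _)) h) (subst T (sym (e _ _)) h′) }

  consecutive : Fin n → Fin n → Bool
  consecutive i j = (toℕ j ≡ᵇ suc (toℕ i)) ∨ ((suc (toℕ i) ≡ᵇ n) ∧ (toℕ j ≡ᵇ 0))

  hamB ncB polyB : Graph n → Perm {n} → Bool
  hamB G π = forallFin (λ i → forallFin (λ j → not (consecutive i j) ∨ adj G (lookup π i) (lookup π j)))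
  ncB G π = forallFin (λ a → forallFin (λ b → forallFin (λ c → forallFin (λ d →
      not ((toℕ a <ᵇ toℕ b) ∧ (toℕ b <ᵇ toℕ c) ∧ (toℕ c <ᵇ toℕ d)
           ∧ adj G (lookup π a) (lookup π c) ∧ adj G (lookup π b) (lookup π d))))))
  polyB G π = hamB G π ∧ ncB G π

  consecutive⁺ : ∀ x → T (consecutive (pt x) (pt (suc x)))
  consecutive⁺ x with m≤n⇒m<n∨m≡n (m%n<n x n)
  ... | inj₁ lt = ∨⁺ˡ (≡⇒≡ᵇ _ _ (trans (toℕ-pt (suc x)) (trans (sym (un≋ (≋-suc (≋-% x)))) (trans (m<n⇒m%n≡m lt) (cong suc (sym (toℕ-pt x)))))))
  ... | inj₂ e  = ∨⁺ʳ {toℕ (pt (suc x)) ≡ᵇ suc (toℕ (pt x))} (∧⁺ (≡⇒≡ᵇ _ _ (trans (cong suc (toℕ-pt x)) e))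
    (≡⇒≡ᵇ _ _ (trans (toℕ-pt (suc x)) (trans (sym (un≋ (≋-suc (≋-% x)))) (trans (cong (_% n) e) (n%n≡0 n))))))

  consecutive⁻ : ∀ i j → T (consecutive i j) → j ≡ pt (suc (toℕ i))
  consecutive⁻ i j t with ∨⁻ {toℕ j ≡ᵇ suc (toℕ i)} t
  ... | inj₁ e = trans (sym (pt-toℕ j)) (cong pt (≡ᵇ⇒≡ _ _ e))
  ... | inj₂ e with ∧⁻ {suc (toℕ i) ≡ᵇ n} e
  ... | e₁ , e₂ = trans (sym (pt-toℕ j)) (trans (cong pt (≡ᵇ⇒≡ (toℕ j) 0 e₂)) (trans (pt-cong (≋-sym (≋-n 0))) (cong pt (sym (≡ᵇ⇒≡ (suc (toℕ i)) n e₁)))))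

  Ham : Graph n → Perm {n} → Set
  Ham G π = ∀ x → ((adj G ∙ lookup π) °) x (suc x)

  ham⁺ : ∀ G π → Ham G π → T (hamB G π)
  ham⁺ G π h = forallFin⁺ (λ i → forallFin⁺ (λ j → ⇒⁺ {consecutive i j} (λ t →
    subst₂ (λ i j → T (adj G (lookup π i) (lookup π j))) (pt-toℕ i) (sym (consecutive⁻ i j t)) (h (toℕ i)))))

  ham⁻ : ∀ G π → T (hamB G π) → Ham G π
  ham⁻ G π h x = ⇒⁻ {consecutive (pt x) (pt (suc x))} (forallFin⁻ (forallFin⁻ h (pt x)) (pt (suc x))) (consecutive⁺ x)

  NC : Adj → Set
  NC A = ∀ {a b c d} → a < b → b < c → c < d → d < n → (A °) a c → (A °) b d → ⊥

  nc⁺ : ∀ G π → NC (adj G ∙ lookup π) → T (ncB G π)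
  nc⁺ G π h = forallFin⁺ (λ a → forallFin⁺ (λ b → forallFin⁺ (λ c → forallFin⁺ (λ d → not⁺ (λ t → bad a b c d t)))))
    where
    bad : ∀ a b c d → ¬ T ((toℕ a <ᵇ toℕ b) ∧ (toℕ b <ᵇ toℕ c) ∧ (toℕ c <ᵇ toℕ d) ∧ adj G (lookup π a) (lookup π c) ∧ adj G (lookup π b) (lookup π d))
    bad a b c d t with ∧⁻ {toℕ a <ᵇ toℕ b} t
    ... | p , t₁ with ∧⁻ {toℕ b <ᵇ toℕ c} t₁
    ... | p′ , t₂ with ∧⁻ {toℕ c <ᵇ toℕ d} t₂
    ... | p″ , t₃ with ∧⁻ {adj G (lookup π a) (lookup π c)} t₃
    ... | h₁ , h₂ = h (<ᵇ⇒< _ _ p) (<ᵇ⇒< _ _ p′) (<ᵇ⇒< _ _ p″) (FP.toℕ<n d) (lift a c h₁) (lift b d h₂)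
      where
      lift : ∀ i j → T (adj G (lookup π i) (lookup π j)) → ((adj G ∙ lookup π) °) (toℕ i) (toℕ j)
      lift i j = subst₂ (λ i j → T (adj G (lookup π i) (lookup π j))) (sym (pt-toℕ i)) (sym (pt-toℕ j))

  nc⁻ : ∀ G π → T (ncB G π) → NC (adj G ∙ lookup π)
  nc⁻ G π t {a} {b} {c} {d} a<b b<c c<d d<n h h′ = not⁻ (forallFin⁻ (forallFin⁻ (forallFin⁻ (forallFin⁻ t (pt a)) (pt b)) (pt c)) (pt d))
    (∧⁺ {toℕ (pt a) <ᵇ toℕ (pt b)} (lt a<b b<n) (∧⁺ {toℕ (pt b) <ᵇ toℕ (pt c)} (lt b<c c<n) (∧⁺ {toℕ (pt c) <ᵇ toℕ (pt d)} (lt c<d d<n) (∧⁺ h h′))))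
    where
    c<n = <-trans c<d d<n
    b<n = <-trans b<c c<n
    lt : ∀ {x y} → x < y → y < n → T (toℕ (pt x) <ᵇ toℕ (pt y))
    lt x<y y<n = <⇒<ᵇ (subst₂ _<_ (sym (toℕ-pt-< (<-trans x<y y<n))) (sym (toℕ-pt-< y<n)) x<y)

  -- A cyclically ordered quadruple becomes linearly ordered after subtracting multiples of n.
  nc-cyclic : ∀ {A} → (∀ {x y} → (A °) x y → (A °) y x) → NC A →
    ∀ {a b c d} → a < b → b < c → c < d → d < a + n → (A °) a c → (A °) b d → ⊥
  nc-cyclic {A} sy nc {a} {b} {c} {d} a<b b<c c<d d<a+n h h′ =
    reduce a₀<n (+-cancelʳ-< Q _ _ (subst₂ _<_ eqa eqb a<b)) (+-cancelʳ-< Q _ _ (subst₂ _<_ eqb eqc b<c)) (+-cancelʳ-< Q _ _ (subst₂ _<_ eqc eqd c<d))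
      (+-cancelʳ-< Q _ _ (subst₂ _<_ eqd (trans (cong (_+ n) eqa) (trans (+-assoc (a % n) Q n) (trans (cong (a % n +_) (+-comm Q n)) (sym (+-assoc (a % n) n Q))))) d<a+n))
      (°-resp A (res eqa) (res eqc) h) (°-resp A (res eqb) (res eqd) h′)
    where
    Q = (a / n) * n
    a₀<n = m%n<n a n
    eqa : a ≡ a % n + Q
    eqa = m≡m%n+[m/n]*n a n
    sub : ∀ {x} → a ≤ x → x ≡ (x ∸ Q) + Q
    sub a≤x = sym (m∸n+n≡m (≤-trans (subst (Q ≤_) (sym eqa) (m≤n+m Q _)) a≤x))
    eqb = sub (<⇒≤ a<b)
    eqc = sub (<⇒≤ (<-trans a<b b<c))
    eqd = sub (<⇒≤ (<-trans a<b (<-trans b<c c<d)))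
    res : ∀ {x y} → x ≡ y + Q → x ≋ y
    res {x} {y} e = ≋-trans (≋-reflexive e) (≋-kn y (a / n))
    reduce : ∀ {a b c d} → a < n → a < b → b < c → c < d → d < a + n → (A °) a c → (A °) b d → ⊥
    reduce {a} {b} {c} {d} a<n a<b b<c c<d d<a+n h h′ with d <? n | c <? n | b <? n
    ... | yes d<n | _ | _ = nc a<b b<c c<d d<n h h′
    ... | no d≮n | yes c<n | _ with m≤n⇒∃[o]m+o≡n (≮⇒≥ d≮n)
    ...   | d′ , refl = nc (+-cancelˡ-< n d′ a (subst (n + d′ <_) (+-comm a n) d<a+n)) a<b b<c c<n
              (°-resp A (≋-trans (≋-reflexive (+-comm n d′)) (≋-n d′)) ≋-refl (sy h′)) h
    reduce {a} {b} {c} {d} a<n a<b b<c c<d d<a+n h h′ | no d≮n | no c≮n | yes b<n with m≤n⇒∃[o]m+o≡n (≮⇒≥ d≮n) | m≤n⇒∃[o]m+o≡n (≮⇒≥ c≮n)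
    ...   | d′ , refl | c′ , refl = nc (+-cancelˡ-< n c′ d′ c<d) (+-cancelˡ-< n d′ a (subst (n + d′ <_) (+-comm a n) d<a+n)) a<b b<n
              (°-resp A (≋-trans (≋-reflexive (+-comm n c′)) (≋-n c′)) ≋-refl (sy h))
              (°-resp A (≋-trans (≋-reflexive (+-comm n d′)) (≋-n d′)) ≋-refl (sy h′))
    reduce {a} {b} {c} {d} a<n a<b b<c c<d d<a+n h h′ | no d≮n | no c≮n | no b≮n with m≤n⇒∃[o]m+o≡n (≮⇒≥ d≮n) | m≤n⇒∃[o]m+o≡n (≮⇒≥ c≮n) | m≤n⇒∃[o]m+o≡n (≮⇒≥ b≮n)
    ...   | d′ , refl | c′ , refl | b′ , refl = nc (+-cancelˡ-< n b′ c′ b<c) (+-cancelˡ-< n c′ d′ c<d) (+-cancelˡ-< n d′ a (subst (n + d′ <_) (+-comm a n) d<a+n)) a<n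
              (°-resp A (≋-trans (≋-reflexive (+-comm n b′)) (≋-n b′)) (≋-trans (≋-reflexive (+-comm n d′)) (≋-n d′)) h′)
              (°-resp A (≋-trans (≋-reflexive (+-comm n c′)) (≋-n c′)) ≋-refl (sy h))

  poly⁻ : ∀ G π → T (polyB G π) → Std (adj G ∙ lookup π)
  poly⁻ G π t = record
    { sym° = sy
    ; edge° = ham⁻ G π (proj₁ (∧⁻ {hamB G π} t))
    ; cross° = nc-cyclic {adj G ∙ lookup π} sy (nc⁻ G π (proj₂ (∧⁻ {hamB G π} t))) }
    where
    sy : ∀ {x y} → ((adj G ∙ lookup π) °) x y → ((adj G ∙ lookup π) °) y x
    sy {x} {y} = subst T (adj-sym G (lookup π (pt x)) (lookup π (pt y)))

  poly⁺ : ∀ G π → Std (adj G ∙ lookup π) → T (polyB G π)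
  poly⁺ G π s = ∧⁺ (ham⁺ G π (edge° s)) (nc⁺ G π (λ p q r t → cross° s p q r (<-≤-trans t (m≤n+m n _))))

  rotFin refFin : ℕ → Fin n → Fin n
  rotFin a i = pt (toℕ i + a)
  refFin a i = pt (a + (n ∸ toℕ i))

  rot ref : ℕ → Perm {n}
  rot a = tabulate (rotFin a)
  ref a = tabulate (refFin a)

  -- The maps x ↦ x + a and x ↦ a - x, the latter without subtraction.
  IsRot IsRef : Perm {n} → ℕ → Set
  IsRot σ a = ∀ x → lookup σ (pt x) ≡ pt (x + a)
  IsRef σ a = ∀ x y → x + y ≋ a → lookup σ (pt x) ≡ pt y

  toℕ-pt-≋ : ∀ x → toℕ (pt x) ≋ x
  toℕ-pt-≋ x = ≋-trans (≋-reflexive (toℕ-pt x)) (≋-% x)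

  rot-at : ∀ a → IsRot (rot a) a
  rot-at a x = trans (VP.lookup∘tabulate (rotFin a) (pt x)) (pt-cong (≋-+ (toℕ-pt-≋ x) (≋-refl {a})))

  ref-at : ∀ a → IsRef (ref a) a
  ref-at a x y e = trans (VP.lookup∘tabulate (refFin a) (pt x)) (pt-cong (≋-cancelʳ (toℕ (pt x))
    (≋-trans (≋-reflexive (trans (+-assoc a _ _) (cong (a +_) (m∸n+n≡m (<⇒≤ (FP.toℕ<n (pt x)))))))
    (≋-trans (≋-n a) (≋-trans (≋-sym e) (≋-trans (≋-reflexive (+-comm x y)) (≋-+ (≋-refl {y}) (≋-sym (toℕ-pt-≋ x)))))))))

  neg : ℕ → ℕ
  neg x = x * n-1

  neg-≋ : ∀ x → x + neg x ≋ 0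
  neg-≋ x = ≋-trans (≋-reflexive (trans (sym (*-suc x n-1)) (cong (x *_) 1+n-1))) (≋-kn 0 x)

  ref-neg : ∀ a x → lookup (ref a) (pt x) ≡ pt (neg x + a)
  ref-neg a x = ref-at a x (neg x + a) (≋-trans (≋-reflexive (sym (+-assoc x (neg x) a))) (≋-+ (neg-≋ x) (≋-refl {a})))

  perm-ext : ∀ {σ τ : Perm {n}} → (∀ x → lookup σ (pt x) ≡ lookup τ (pt x)) → σ ≡ τ
  perm-ext {σ} {τ} h = vec-ext {n} {σ} {τ} (λ i → subst (λ i → lookup σ i ≡ lookup τ i) (pt-toℕ i) (h (toℕ i)))

  isRot⇒≡ : ∀ {σ a b} → IsRot σ a → a ≋ b → σ ≡ rot b
  isRot⇒≡ {σ} {a} {b} h e = perm-ext {σ} {rot b} (λ x → trans (h x) (trans (pt-cong (≋-+ (≋-refl {x}) e)) (sym (rot-at b x))))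

  isRef⇒≡ : ∀ {σ a b} → IsRef σ a → a ≋ b → σ ≡ ref b
  isRef⇒≡ {σ} {a} {b} h e = perm-ext {σ} {ref b} (λ x → trans (h x (neg x + b) (≋-trans (≋-trans (≋-reflexive (sym (+-assoc x (neg x) b))) (≋-+ (neg-≋ x) (≋-refl {b}))) (≋-sym e))) (sym (ref-neg b x)))

  inj-pt : ∀ {σ : Perm {n}} → (∀ x y → lookup σ (pt x) ≡ lookup σ (pt y) → x ≋ y) → Inj σ
  inj-pt {σ} h = mkInj (λ {i} {j} e → trans (sym (pt-toℕ i)) (trans (pt-cong (h (toℕ i) (toℕ j)
    (trans (cong (lookup σ) (pt-toℕ i)) (trans e (cong (lookup σ) (sym (pt-toℕ j))))))) (pt-toℕ j)))

  rot-inj : ∀ a → Inj (rot a)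
  rot-inj a = inj-pt {rot a} (λ x y e → ≋-cancelʳ a (pt-injective (trans (sym (rot-at a x)) (trans e (rot-at a y)))))

  ref-inj : ∀ a → Inj (ref a)
  ref-inj a = inj-pt {ref a} (λ x y e → ≋-cancelʳ (neg x + neg y) (
    let e′ = ≋-cancelʳ a (pt-injective (trans (sym (ref-neg a x)) (trans e (ref-neg a y))))
        l = ≋-trans (≋-reflexive (sym (+-assoc x (neg x) (neg y)))) (≋-+ (neg-≋ x) (≋-refl {neg y}))
        r = ≋-trans (≋-+ (≋-refl {y}) (≋-+ e′ (≋-refl {neg y}))) (≋-trans (≋-reflexive (sym (+-assoc y (neg y) (neg y)))) (≋-+ (neg-≋ y) (≋-refl {neg y})))
    in ≋-trans l (≋-sym r)))

  std-rot : ∀ {A σ a} → IsRot σ a → Std A → Std (A ∙ lookup σ)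
  std-rot {A} {σ} {a} h s = record
    { sym° = λ {x} {y} t → to {y} {x} (sym° s (fr {x} {y} t))
    ; edge° = λ x → to (edge° s (x + a))
    ; cross° = λ {x} {y} {z} {w} p q r t h₁ h₂ → cross° s (+-monoˡ-< a p) (+-monoˡ-< a q) (+-monoˡ-< a r)
        (subst (w + a <_) (trans (+-assoc x n a) (trans (cong (x +_) (+-comm n a)) (sym (+-assoc x a n)))) (+-monoˡ-< a t)) (fr h₁) (fr h₂) }
    where
    to : ∀ {x y} → (A °) (x + a) (y + a) → ((A ∙ lookup σ) °) x y
    to {x} {y} = subst₂ (λ i j → T (A i j)) (sym (h x)) (sym (h y))
    fr : ∀ {x y} → ((A ∙ lookup σ) °) x y → (A °) (x + a) (y + a)
    fr {x} {y} = subst₂ (λ i j → T (A i j)) (h x) (h y)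

  std-ref : ∀ {A σ a} → IsRef σ a → Std A → Std (A ∙ lookup σ)
  std-ref {A} {σ} {a} h s = record
    { sym° = λ {x} {y} t → to {y} {x} (z y) (z x) (sym° s (fr {x} {y} (z x) (z y) t))
    ; edge° = λ x → to {x} {suc x} {suc (neg (suc x) + a)} {neg (suc x) + a} (≋-trans (≋-reflexive (+-suc x _)) (z (suc x))) (z (suc x)) (sym° s (edge° s (neg (suc x) + a)))
    ; cross° = λ {x} {y} {u} {v} p q r t h₁ h₂ →
        -- A reflection reverses the order, so the image of the largest point `v` comes first. `w`
        -- represents it, and the images of the other points lie above it by their distances from
        -- `v`.
        let w = neg v + a
            zv : ∀ {x} → x ≤ v → x + (w + (v ∸ x)) ≋ a
            zv {x} x≤v = ≋-trans (≋-reflexive (trans (cong (x +_) (+-comm w _)) (trans (sym (+-assoc x _ w)) (cong (_+ w) (m+[n∸m]≡n x≤v))))) (z v)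
            u≤v = <⇒≤ r
            y≤v = <⇒≤ (<-trans q r)
            x≤v = <⇒≤ (<-trans p (<-trans q r))
        in cross° s {w} {w + (v ∸ u)} {w + (v ∸ y)} {w + (v ∸ x)}
             (m<m+n w (m<n⇒0<n∸m r)) (+-monoʳ-< w (∸-monoʳ-< q u≤v)) (+-monoʳ-< w (∸-monoʳ-< p y≤v))
             (+-monoʳ-< w (+-cancelˡ-< x _ n (subst (_< x + n) (sym (m+[n∸m]≡n x≤v)) t)))
             (sym° s (fr {y} {v} (zv y≤v) (z v) h₂)) (sym° s (fr {x} {u} (zv x≤v) (zv u≤v) h₁)) }
    where
    z : ∀ x → x + (neg x + a) ≋ a
    z x = ≋-trans (≋-reflexive (sym (+-assoc x (neg x) a))) (≋-+ (neg-≋ x) (≋-refl {a}))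
    to : ∀ {x y x′ y′} → x + x′ ≋ a → y + y′ ≋ a → (A °) x′ y′ → ((A ∙ lookup σ) °) x y
    to {x} {y} e e′ = subst₂ (λ i j → T (A i j)) (sym (h x _ e)) (sym (h y _ e′))
    fr : ∀ {x y x′ y′} → x + x′ ≋ a → y + y′ ≋ a → ((A ∙ lookup σ) °) x y → (A °) x′ y′
    fr {x} {y} e e′ = subst₂ (λ i j → T (A i j)) (h x _ e) (h y _ e′)

  ¬2≋0 : ¬ (2 ≋ 0)
  ¬2≋0 e with ≋-small 2<n 0<n e
  ... | ()

  -- Angles run from 1 to n as in `totient`, so the identity appears as `rot n`.
  1⋯n : List ℕ
  1⋯n = map suc (upTo n)

  ∈-1⋯n⁻ : ∀ {a} → a ∈ 1⋯n → 1 ≤ a × a ≤ n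
  ∈-1⋯n⁻ m with ∈-map⁻ suc m
  ... | x , x∈ , refl = s≤s z≤n , ∈-upTo⁻ x∈

  unique-1⋯n : Unique 1⋯n
  unique-1⋯n = UP.map⁺ suc-injective (UP.upTo⁺ n)

  representative : ∀ x → ∃[ a ] (a ∈ 1⋯n × x ≋ a)
  representative x with x % n in eq
  ... | zero  = n , subst (_∈ 1⋯n) 1+n-1 (∈-map⁺ suc (∈-upTo⁺ (≤-reflexive 1+n-1))) , mk≋ (trans eq (sym (n%n≡0 n)))
  ... | suc y = suc y , ∈-map⁺ suc (∈-upTo⁺ (<-trans (n<1+n y) y<n)) , mk≋ (trans eq (sym (m<n⇒m%n≡m y<n)))
    where
    y<n : suc y < n
    y<n = subst (_< n) eq (m%n<n x n)

  dihedral : List (Perm {n})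
  dihedral = map rot 1⋯n ++ map ref 1⋯n

  1⋯n-≋ : ∀ {a b} → a ∈ 1⋯n → b ∈ 1⋯n → a ≋ b → a ≡ b
  1⋯n-≋ {a} {b} a∈ b∈ e with ≤-total a b | ∈-1⋯n⁻ a∈ | ∈-1⋯n⁻ b∈
  ... | inj₁ a≤b | 1≤a , _ | _ , b≤n = ≋-near a≤b (<-≤-trans (s≤s b≤n) (+-monoˡ-≤ n 1≤a)) e
  ... | inj₂ b≤a | _ , a≤n | 1≤b , _ = sym (≋-near b≤a (<-≤-trans (s≤s a≤n) (+-monoˡ-≤ n 1≤b)) (≋-sym e))

  -- Comparing the images of 0 and of 1 gives 2 ≋ 0, which is false for n > 2. For n = 2 the two
  -- families coincide.
  rot≢ref : ∀ a b → rot a ≢ ref b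
  rot≢ref a b e = ¬2≋0 (≋-cancelʳ b (≋-trans (≋-+ (≋-refl {2}) (≋-sym a≋b)) (≋-trans (≋-suc e₁) (≋-trans (≋-reflexive (sym (+-assoc 1 (neg 1) b))) (≋-+ (neg-≋ 1) (≋-refl {b}))))))
    where
    e₁ : 1 + a ≋ neg 1 + b
    e₁ = pt-injective (trans (sym (rot-at a 1)) (trans (cong (λ σ → lookup σ (pt 1)) e) (ref-neg b 1)))
    a≋b : a ≋ b
    a≋b = pt-injective (trans (sym (rot-at a 0)) (trans (cong (λ σ → lookup σ (pt 0)) e) (ref-neg b 0)))

  map-unique : ∀ {A B : Set} (f : A → B) {xs} → (∀ {x y} → x ∈ xs → y ∈ xs → f x ≡ f y → x ≡ y) → Unique xs → Unique (map f xs)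
  map-unique f h []       = []
  map-unique f h (x∉ ∷ u) = AllP.map⁺ (All.tabulate (λ m e → All.lookup x∉ m (h (here refl) (there m) e))) ∷ map-unique f (λ p q → h (there p) (there q)) u

  unique-dihedral : Unique dihedral
  unique-dihedral = UP.++⁺
    (map-unique rot (λ {a} {b} p q e → 1⋯n-≋ p q (pt-injective (trans (sym (rot-at a 0)) (trans (cong (λ σ → lookup σ (pt 0)) e) (rot-at b 0))))) unique-1⋯n)
    (map-unique ref (λ {a} {b} p q e → 1⋯n-≋ p q (pt-injective (trans (sym (ref-neg a 0)) (trans (cong (λ σ → lookup σ (pt 0)) e) (ref-neg b 0))))) unique-1⋯n)
    disj
    where
    disj : ∀ {σ} → ¬ (σ ∈ map rot 1⋯n × σ ∈ map ref 1⋯n)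
    disj (p , p′) with ∈-map⁻ rot p | ∈-map⁻ ref p′
    ... | a , _ , refl | b , _ , e = rot≢ref a b e

  length-dihedral : length dihedral ≡ n + n
  length-dihedral = trans (length-++ (map rot 1⋯n)) (cong₂ _+_ (h rot) (h ref))
    where
    h : ∀ {A : Set} (f : ℕ → A) → length (map f 1⋯n) ≡ n
    h f = trans (length-map f 1⋯n) (trans (length-map suc (upTo n)) (length-upTo n))

  data Dihedral (σ : Perm {n}) : Set where
    isRot : ∀ a → IsRot σ a → Dihedral σ
    isRef : ∀ a → IsRef σ a → Dihedral σ

  ∈-dihedral⁻ : ∀ {σ} → σ ∈ dihedral → Dihedral σ
  ∈-dihedral⁻ m with ∈-++⁻ (map rot 1⋯n) m
  ... | inj₁ p with ∈-map⁻ rot p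
  ... | a , _ , refl = isRot a (rot-at a)
  ∈-dihedral⁻ m | inj₂ p with ∈-map⁻ ref p
  ... | a , _ , refl = isRef a (ref-at a)

  ∈-dihedral⁺ : ∀ {σ} → Dihedral σ → σ ∈ dihedral
  ∈-dihedral⁺ {σ} (isRot a h) with representative a
  ... | b , b∈ , e = ∈-++⁺ˡ (subst (_∈ map rot 1⋯n) (sym (isRot⇒≡ {σ} h e)) (∈-map⁺ rot b∈))
  ∈-dihedral⁺ {σ} (isRef a h) with representative a
  ... | b , b∈ , e = ∈-++⁺ʳ (map rot 1⋯n) (subst (_∈ map ref 1⋯n) (sym (isRef⇒≡ {σ} h e)) (∈-map⁺ ref b∈))

  dihedral-std : ∀ {A σ} → Dihedral σ → Std A → Std (A ∙ lookup σ)
  dihedral-std {A} {σ} (isRot a h) = std-rot {A} {σ} h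
  dihedral-std {A} {σ} (isRef a h) = std-ref {A} {σ} h

  dihedral-inj : ∀ {σ} → Dihedral σ → Inj σ
  dihedral-inj {σ} (isRot a h) = subst Inj (sym (isRot⇒≡ {σ} h (≋-refl {a}))) (rot-inj a)
  dihedral-inj {σ} (isRef a h) = subst Inj (sym (isRef⇒≡ {σ} h (≋-refl {a}))) (ref-inj a)

-- A non-crossing polygon has no second Hamiltonian cycle

module Hamilton (n : ℕ) (2<n : 2 < n) where
  open Polygon n 2<n

  module _ {A : Adj} (std : Std A) {π : Perm {n}} (π-inj : Inj π) (ham : ∀ x → ((A ∙ lookup π) °) x (suc x)) where

    p : ℕ → ℕ
    p t = toℕ (lookup π (pt t))

    p<n : ∀ t → p t < n
    p<n t = FP.toℕ<n (lookup π (pt t))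

    p-step : ∀ t → (A °) (p t) (p (suc t))
    p-step t = subst₂ (λ i j → T (A i j)) (sym (pt-toℕ _)) (sym (pt-toℕ _)) (ham t)

    p-injective : ∀ {s t} → p s ≡ p t → s ≋ t
    p-injective e = pt-injective (inj π-inj (FP.toℕ-injective e))

    p-apart : ∀ t r j → j < r → r < n → p (t + r) ≢ p (t + j)
    p-apart t r j j<r r<n e = <-irrefl (sym (+-cancelˡ-≡ t _ _ (sym (≋-near (+-monoʳ-≤ t (<⇒≤ j<r))
      (<-≤-trans (+-monoʳ-< t r<n) (≤-trans (+-monoˡ-≤ n (m≤m+n t j)) ≤-refl)) (≋-sym (p-injective e)))))) j<r

    p-surjective : ∀ t v → v < n → ∃[ r ] (r < n × p (t + r) ≡ v)
    p-surjective t v v<n with injective⇒surjective (λ s → lookup π (pt (t + toℕ s)))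
      (λ {i} {j} e → FP.toℕ-injective (≋-small (FP.toℕ<n i) (FP.toℕ<n j)
        (≋-cancelʳ t (subst₂ _≋_ (+-comm t _) (+-comm t _) (pt-injective (inj π-inj e)))))) (pt v)
    ... | s , e = toℕ s , FP.toℕ<n s , trans (cong toℕ e) (toℕ-pt-< v<n)

    -- If the cycle used a diagonal, its remaining path could not pass from one side of it to the other.
    no-diagonal : ∀ t lo hi → (lo ≡ p t × hi ≡ p (suc t)) ⊎ (lo ≡ p (suc t) × hi ≡ p t) → suc lo < hi → ¬ (lo ≡ 0 × suc hi ≡ n) → ⊥
    no-diagonal t lo hi ends 1+lo<hi ¬side = contra (classify (p (t + 2)) (lo≢ 0 2<n) (hi≢ 0 2<n))
      where
      Ends : Set
      Ends = (lo ≡ p t × hi ≡ p (suc t)) ⊎ (lo ≡ p (suc t) × hi ≡ p t)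
      A-diag : (A °) lo hi
      A-diag = f ends
        where
        f : Ends → (A °) lo hi
        f (inj₁ (e , e′)) = subst₂ (A °) (sym e) (sym e′) (p-step t)
        f (inj₂ (e , e′)) = subst₂ (A °) (sym e) (sym e′) (sym° std (p-step t))
      hi<n : hi < n
      hi<n = f ends
        where
        f : Ends → hi < n
        f (inj₁ (_ , e)) = subst (_< n) (sym e) (p<n (suc t))
        f (inj₂ (_ , e)) = subst (_< n) (sym e) (p<n t)
      t+0 : t + 0 ≡ t
      t+0 = +-identityʳ t
      t+1 : t + 1 ≡ suc t
      t+1 = +-comm t 1
      away : ∀ s → 2 + s < n → p (t + (2 + s)) ≢ p t × p (t + (2 + s)) ≢ p (suc t)
      away s lt = (λ e → p-apart t (2 + s) 0 (s≤s z≤n) lt (trans e (cong p (sym t+0)))) , (λ e → p-apart t (2 + s) 1 (s≤s (s≤s z≤n)) lt (trans e (cong p (sym t+1))))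
      lo≢ : ∀ s → 2 + s < n → p (t + (2 + s)) ≢ lo
      lo≢ s lt e = f ends
        where
        f : Ends → ⊥
        f (inj₁ (e′ , _)) = proj₁ (away s lt) (trans e e′)
        f (inj₂ (e′ , _)) = proj₂ (away s lt) (trans e e′)
      hi≢ : ∀ s → 2 + s < n → p (t + (2 + s)) ≢ hi
      hi≢ s lt e = f ends
        where
        f : Ends → ⊥
        f (inj₁ (_ , e′)) = proj₂ (away s lt) (trans e e′)
        f (inj₂ (_ , e′)) = proj₁ (away s lt) (trans e e′)
      Ins Out : ℕ → Set
      Ins v = lo < v × v < hi
      Out v = v < lo ⊎ hi < v
      classify : ∀ v → v ≢ lo → v ≢ hi → Ins v ⊎ Out v
      classify v v≢lo v≢hi with <-cmp v lo | <-cmp v hi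
      ... | tri< a _ _ | _          = inj₂ (inj₁ a)
      ... | tri≈ _ e _ | _          = ⊥-elim (v≢lo e)
      ... | tri> _ _ c | tri< a _ _ = inj₁ (c , a)
      ... | tri> _ _ _ | tri≈ _ e _ = ⊥-elim (v≢hi e)
      ... | tri> _ _ _ | tri> _ _ c = inj₂ (inj₂ c)
      no-cross : ∀ {u v} → v < n → Ins u → Out v → ¬ (A °) u v
      no-cross v<n (lo<u , u<hi) (inj₁ v<lo) h = cross° std v<lo lo<u u<hi (<-≤-trans hi<n (m≤n+m n _)) (sym° std h) A-diag
      no-cross v<n (lo<u , u<hi) (inj₂ hi<v) h = cross° std lo<u u<hi hi<v (<-≤-trans v<n (m≤n+m n _)) A-diag h
      next : ∀ s → (A °) (p (t + (2 + s))) (p (t + (3 + s)))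
      next s = subst (λ x → (A °) (p (t + (2 + s))) (p x)) (sym (+-suc t (2 + s))) (p-step (t + (2 + s)))
      spread-ins : ∀ s → 2 + s < n → Ins (p (t + 2)) → Ins (p (t + (2 + s)))
      spread-ins zero    lt i = i
      spread-ins (suc s) lt i with classify (p (t + (3 + s))) (lo≢ (suc s) lt) (hi≢ (suc s) lt)
      ... | inj₁ i′ = i′
      ... | inj₂ o  = ⊥-elim (no-cross (p<n _) (spread-ins s (<-trans (n<1+n _) lt) i) o (next s))
      spread-out : ∀ s → 2 + s < n → Out (p (t + 2)) → Out (p (t + (2 + s)))
      spread-out zero    lt o = o
      spread-out (suc s) lt o with classify (p (t + (3 + s))) (lo≢ (suc s) lt) (hi≢ (suc s) lt)
      ... | inj₂ o′ = o′
      ... | inj₁ i  = ⊥-elim (no-cross (p<n _) i (spread-out s (<-trans (n<1+n _) lt) o) (sym° std (next s)))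
      cover : ∀ v → v < n → v ≢ lo → v ≢ hi → ∃[ s ] (2 + s < n × p (t + (2 + s)) ≡ v)
      cover v v<n v≢lo v≢hi with p-surjective t v v<n
      ... | suc (suc s) , lt , e = s , lt , e
      ... | zero , _ , e = ⊥-elim (f ends)
        where
        f : Ends → ⊥
        f (inj₁ (e′ , _)) = v≢lo (trans (sym e) (trans (cong p t+0) (sym e′)))
        f (inj₂ (_ , e′)) = v≢hi (trans (sym e) (trans (cong p t+0) (sym e′)))
      ... | suc zero , _ , e = ⊥-elim (f ends)
        where
        f : Ends → ⊥
        f (inj₁ (_ , e′)) = v≢hi (trans (sym e) (trans (cong p t+1) (sym e′)))
        f (inj₂ (e′ , _)) = v≢lo (trans (sym e) (trans (cong p t+1) (sym e′)))
      -- A vertex beyond the diagonal: 0 if possible, else n - 1. Both fail only when the chord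
      -- joins 0 and n - 1, which is an edge of the polygon.
      outside : ∃[ v ] (v < n × v ≢ lo × v ≢ hi × Out v)
      outside with lo ≟ 0
      ... | no lo≢0 = 0 , 0<n , (λ e → lo≢0 (sym e)) , (λ e → n≮0 (subst (suc lo <_) (sym e) 1+lo<hi)) , inj₁ (n≢0⇒n>0 lo≢0)
      ... | yes lo≡0 = n-1 , ≤-reflexive 1+n-1 , (λ e → <⇒≢ (<-≤-trans (s≤s z≤n) (≤-pred (subst (2 <_) (sym 1+n-1) 2<n))) (sym (trans e lo≡0))) , (λ e → <-irrefl (sym e) hi<n-1) , inj₂ hi<n-1
        where
        hi<n-1 : hi < n-1
        hi<n-1 = ≤-pred (subst (suc (suc hi) ≤_) (sym 1+n-1) (≤∧≢⇒< hi<n (λ e → ¬side (lo≡0 , e))))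
      contra : Ins (p (t + 2)) ⊎ Out (p (t + 2)) → ⊥
      contra (inj₁ i) with outside
      ... | v , v<n , v≢lo , v≢hi , o with cover v v<n v≢lo v≢hi
      ... | s , lt , refl with spread-ins s lt i | o
      ... | a , b | inj₁ v<lo = <-asym a v<lo
      ... | a , b | inj₂ hi<v = <-asym b hi<v
      contra (inj₂ o) with cover (suc lo) (<-trans 1+lo<hi hi<n) (λ e → <-irrefl (sym e) (n<1+n lo)) (λ e → <-irrefl e 1+lo<hi)
      ... | s , lt , e with subst Out e (spread-out s lt o)
      ... | inj₁ v<lo = <-asym v<lo (n<1+n lo)
      ... | inj₂ hi<v = <-asym 1+lo<hi hi<v

    -- Every chord that `no-diagonal` leaves to the cycle is an edge of the polygon; the pair 0, n -
    -- 1 is the edge that closes it up.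
    step : ∀ t → p (suc t) ≋ suc (p t) ⊎ p t ≋ suc (p (suc t))
    step t with <-cmp (p t) (p (suc t))
    ... | tri≈ _ e _ = ⊥-elim (p-apart t 1 0 (s≤s z≤n) (<-trans (s≤s (s≤s z≤n)) 2<n) (trans (cong p (+-comm t 1)) (trans (sym e) (cong p (sym (+-identityʳ t))))))
    ... | tri< lt _ _ = go (suc (p t) ≟ p (suc t)) (p t ≟ 0) (suc (p (suc t)) ≟ n)
      where
      go : Dec (suc (p t) ≡ p (suc t)) → Dec (p t ≡ 0) → Dec (suc (p (suc t)) ≡ n) → p (suc t) ≋ suc (p t) ⊎ p t ≋ suc (p (suc t))
      go (yes e) _ _ = inj₁ (≋-reflexive (sym e))
      go (no ne) (yes e₁) (yes e₂) = inj₂ (≋-trans (≋-reflexive e₁) (≋-trans (≋-sym (≋-n 0)) (≋-reflexive (sym e₂))))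
      go (no ne) (no n₁) _ = ⊥-elim (no-diagonal t (p t) (p (suc t)) (inj₁ (refl , refl)) (≤∧≢⇒< lt ne) (λ z → n₁ (proj₁ z)))
      go (no ne) _ (no n₂) = ⊥-elim (no-diagonal t (p t) (p (suc t)) (inj₁ (refl , refl)) (≤∧≢⇒< lt ne) (λ z → n₂ (proj₂ z)))
    ... | tri> _ _ gt = go (suc (p (suc t)) ≟ p t) (p (suc t) ≟ 0) (suc (p t) ≟ n)
      where
      go : Dec (suc (p (suc t)) ≡ p t) → Dec (p (suc t) ≡ 0) → Dec (suc (p t) ≡ n) → p (suc t) ≋ suc (p t) ⊎ p t ≋ suc (p (suc t))
      go (yes e) _ _ = inj₂ (≋-reflexive (sym e))
      go (no ne) (yes e₁) (yes e₂) = inj₁ (≋-trans (≋-reflexive e₁) (≋-trans (≋-sym (≋-n 0)) (≋-reflexive (sym e₂))))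
      go (no ne) (no n₁) _ = ⊥-elim (no-diagonal t (p (suc t)) (p t) (inj₂ (refl , refl)) (≤∧≢⇒< gt ne) (λ z → n₁ (proj₁ z)))
      go (no ne) _ (no n₂) = ⊥-elim (no-diagonal t (p (suc t)) (p t) (inj₂ (refl , refl)) (≤∧≢⇒< gt ne) (λ z → n₂ (proj₂ z)))

    no-return : ∀ t → ¬ (p t ≋ p (suc (suc t)))
    no-return t e = p-apart t 2 0 (s≤s z≤n) 2<n (trans (cong p (+-comm t 2)) (trans (sym (≋-small (p<n t) (p<n (suc (suc t))) e)) (cong p (sym (+-identityʳ t)))))

    -- The direction is kept, since turning back would revisit the vertex of two steps before. A
    -- cycle that always moves by +1 is a rotation, one that always moves by -1 a reflection.
    forward : p 1 ≋ suc (p 0) → ∀ t → p (suc t) ≋ suc (p t)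
    forward h zero    = h
    forward h (suc t) with step (suc t)
    ... | inj₁ e = e
    ... | inj₂ e = ⊥-elim (no-return t (≋-pred (≋-trans (≋-sym (forward h t)) e)))

    backward : p 0 ≋ suc (p 1) → ∀ t → p t ≋ suc (p (suc t))
    backward h zero    = h
    backward h (suc t) with step (suc t)
    ... | inj₂ e = e
    ... | inj₁ e = ⊥-elim (no-return t (≋-trans (backward h t) (≋-sym e)))

    π-pt : ∀ x → lookup π (pt x) ≡ pt (p x)
    π-pt x = sym (pt-toℕ _)

    ham⇒dihedral : Dihedral π
    ham⇒dihedral with step 0
    ... | inj₁ h = isRot (p 0) (λ x → trans (π-pt x) (pt-cong (up x)))
      where
      up : ∀ x → p x ≋ x + p 0
      up zero    = ≋-refl
      up (suc x) = ≋-trans (forward h x) (≋-suc (up x))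
    ... | inj₂ h = isRef (p 0) (λ x y e → trans (π-pt x) (pt-cong (≋-cancelʳ x (≋-trans (≋-reflexive (+-comm (p x) x)) (≋-trans (down x) (≋-trans (≋-sym e) (≋-reflexive (+-comm x y))))))))
      where
      down : ∀ x → x + p x ≋ p 0
      down zero    = ≋-refl
      down (suc x) = ≋-trans (≋-reflexive (sym (+-suc x _))) (≋-trans (≋-+ (≋-refl {x}) (≋-sym (backward h x))) (down x))

-- Cycle types

module _ {n : ℕ} where

  iter-conj : ∀ (σ τ π : Perm {n}) → (∀ i → π ⟨ τ ⟨ i ⟩ ⟩ ≡ σ ⟨ π ⟨ i ⟩ ⟩) → ∀ j x → π ⟨ iter τ j x ⟩ ≡ iter σ j (π ⟨ x ⟩)
  iter-conj σ τ π h zero    x = refl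
  iter-conj σ τ π h (suc j) x = trans (h (iter τ j x)) (cong (lookup σ) (iter-conj σ τ π h j x))

  hasPeriod-conj : ∀ (σ τ π : Perm {n}) → Inj π → (∀ i → π ⟨ τ ⟨ i ⟩ ⟩ ≡ σ ⟨ π ⟨ i ⟩ ⟩) → ∀ j x → hasPeriod τ j x ≡ hasPeriod σ j (π ⟨ x ⟩)
  hasPeriod-conj σ τ π π-inj h j x = cong₂ _∧_ (e j) (cong and′ (map-cong (λ j′ → cong not (e (suc j′))) (upTo (j ∸ 1))))
    where
    and′ : List Bool → Bool
    and′ = foldr _∧_ true
    e : ∀ j → (iter τ j x == x) ≡ (iter σ j (π ⟨ x ⟩) == π ⟨ x ⟩)
    e j = T-ext (λ t → ==⁺ (trans (sym (iter-conj σ τ π h j x)) (cong (lookup π) (==⁻ (iter τ j x) x t))))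
                (λ t → ==⁺ (inj π-inj (trans (iter-conj σ τ π h j x) (==⁻ (iter σ j (π ⟨ x ⟩)) (π ⟨ x ⟩) t))))

  cycleType-conj : ∀ (σ τ π : Perm {n}) → Inj π → (∀ i → π ⟨ τ ⟨ i ⟩ ⟩ ≡ σ ⟨ π ⟨ i ⟩ ⟩) → cycleType τ ≡ cycleType σ
  cycleType-conj σ τ π π-inj h = map-cong (λ e → cong (_/ suc e) (count-bij (allFin n) (allFin n) (UP.allFin⁺ n) (UP.allFin⁺ n) (lookup π) (lookup (inv π π-inj))
    (λ {x} _ t → ∈-allFin _ , subst T (hasPeriod-conj σ τ π π-inj h (suc e) x) t , inv-l π π-inj x)
    (λ {y} _ t → ∈-allFin _ , subst T (sym (trans (hasPeriod-conj σ τ π π-inj h (suc e) (inv π π-inj ⟨ y ⟩)) (cong (hasPeriod σ (suc e)) (inv-r π π-inj y)))) t , inv-r π π-inj y))) (upTo n)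

sumL : ∀ {A : Set} → (A → ℕ) → List A → ℕ
sumL f xs = sum (map f xs)

count-sum : ∀ {A B : Set} (p : A × B → Bool) xs ys → count p (cartesianProduct xs ys) ≡ sumL (λ x → count (λ y → p (x , y)) ys) xs
count-sum p []       ys = refl
count-sum p (x ∷ xs) ys = trans (count-++ p (map (x ,_) ys) (cartesianProduct xs ys)) (cong₂ _+_ (count-map p (x ,_) ys) (count-sum p xs ys))

sumL-++ : ∀ {A : Set} (f : A → ℕ) xs ys → sumL f (xs ++ ys) ≡ sumL f xs + sumL f ys
sumL-++ f []       ys = refl
sumL-++ f (x ∷ xs) ys = trans (cong (f x +_) (sumL-++ f xs ys)) (sym (+-assoc (f x) _ _))

sumL-map : ∀ {A B : Set} (f : B → ℕ) (g : A → B) xs → sumL f (map g xs) ≡ sumL (f ∘ g) xs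
sumL-map f g xs = cong sum (sym (map-∘ xs))

filterᵇ-filterᵇ : ∀ {A : Set} (p q : A → Bool) xs → length (filterᵇ p (filterᵇ q xs)) ≡ count (λ x → q x ∧ p x) xs
filterᵇ-filterᵇ p q []       = refl
filterᵇ-filterᵇ p q (x ∷ xs) with q x
... | false = filterᵇ-filterᵇ p q xs
... | true with p x
...   | true  = cong suc (filterᵇ-filterᵇ p q xs)
...   | false = filterᵇ-filterᵇ p q xs

frac-cancel : ∀ a b → 0 < b → frac a b ℚ.* ⟪ b ⟫ ≡ ⟪ a ⟫
frac-cancel a (suc b) _ = trans (/-cancel (ℤ.+ a) b) (sym (⟪⟫-def a))

-- With a = |Aut G|, b the size of the class and N = n!, orbit-stabiliser turns the weights into
-- plain counts.
frac-weights : ∀ c a b N → b * a ≡ N → 0 < N → (frac c a ℚ.* frac 1 b) ℚ.* ⟪ N ⟫ ≡ ⟪ c ⟫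
frac-weights c zero    b       N e lt = ⊥-elim (<⇒≢ lt (trans (sym (*-zeroʳ b)) e))
frac-weights c (suc a) zero    N e lt = ⊥-elim (<⇒≢ lt e)
frac-weights c (suc a) (suc b) N refl lt = begin
  (frac c (suc a) ℚ.* frac 1 (suc b)) ℚ.* ⟪ suc b * suc a ⟫
    ≡⟨ cong ((frac c (suc a) ℚ.* frac 1 (suc b)) ℚ.*_) (⟪⟫-* (suc b) (suc a)) ⟩
  (frac c (suc a) ℚ.* frac 1 (suc b)) ℚ.* (⟪ suc b ⟫ ℚ.* ⟪ suc a ⟫)
    ≡⟨ solve 4 (λ x y z w → (x :* y) :* (z :* w) := (x :* w) :* (y :* z)) refl (frac c (suc a)) (frac 1 (suc b)) ⟪ suc b ⟫ ⟪ suc a ⟫ ⟩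
  (frac c (suc a) ℚ.* ⟪ suc a ⟫) ℚ.* (frac 1 (suc b) ℚ.* ⟪ suc b ⟫)
    ≡⟨ cong₂ ℚ._*_ (frac-cancel c (suc a) (s≤s z≤n)) (trans (frac-cancel 1 (suc b) (s≤s z≤n)) (⟪⟫-def 1)) ⟩
  ⟪ c ⟫ ℚ.* 1ℚ
    ≡⟨ ℚP.*-identityʳ ⟪ c ⟫ ⟩
  ⟪ c ⟫ ∎
  where
  open ≡-Reasoning
  open +-*-Solver

-- Reduction to pairs of a dissection of the standard polygon and a dihedral symmetry

module Reduction (n : ℕ) (2<n : 2 < n) (m : Mono) where
  open Polygon n 2<n
  open Hamilton n 2<n

  typeB : Perm {n} → Bool
  typeB σ = sameMono (cycleType σ) m

  idP : Perm {n}
  idP = tabulate id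

  idP-at : ∀ i → lookup idP i ≡ i
  idP-at = VP.lookup∘tabulate id

  disB stdB : Graph n → Bool
  disB G = any (polyB G) (perms n)
  stdB G = polyB G idP

  std⁻ : ∀ G → T (stdB G) → Std (adj G)
  std⁻ G t = std-cong (λ i j → cong₂ (adj G) (idP-at i) (idP-at j)) (poly⁻ G idP t)

  std⁺ : ∀ G → Std (adj G) → T (stdB G)
  std⁺ G s = poly⁺ G idP (std-cong (λ i j → cong₂ (adj G) (sym (idP-at i)) (sym (idP-at j))) s)

  autoB : Graph n × Perm {n} → Bool
  autoB (G , σ) = isIso G G σ ∧ typeB σ

  disP stdP : Graph n × Perm {n} → Bool
  disP Gσ = disB (proj₁ Gσ) ∧ autoB Gσ
  stdP Gσ = stdB (proj₁ Gσ) ∧ autoB Gσ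

  graphs×perms : List (Graph n × Perm {n})
  graphs×perms = cartesianProduct (graphs n) (perms n)

  unique-graphs×perms : Unique graphs×perms
  unique-graphs×perms = UP.cartesianProduct⁺ unique-graphs unique-perms

  N : ℕ
  N = length (perms n)

  N>0 : 0 < N
  N>0 = ∈-length (∈-perms⁺ {n} {rot 0} (rot-inj 0))

  term : Graph n → ℚ
  term G = cycleIndex G m ℚ.* frac 1 (classSize G)

  term-N : ∀ {G} → G ∈ graphs n → term G ℚ.* ⟪ N ⟫ ≡ ⟪ count (λ σ → autoB (G , σ)) (perms n) ⟫
  term-N {G} G∈ = trans (frac-weights _ (length (autos G)) (classSize G) N (orbit-stabiliser G∈) N>0)
    (cong ⟪_⟫ (filterᵇ-filterᵇ typeB (isIso G G) (perms n)))

  zd-N : ∀ xs → (∀ {G} → G ∈ xs → G ∈ graphs n) → ΣQ (map term (filterᵇ disB xs)) ℚ.* ⟪ N ⟫ ≡ ⟪ count disP (cartesianProduct xs (perms n)) ⟫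
  zd-N []       h = trans (ℚP.*-zeroˡ ⟪ N ⟫) (sym (⟪⟫-def 0))
  zd-N (G ∷ xs) h = trans (go (disB G) refl) (sym (trans (cong ⟪_⟫ (count-++ disP (map (G ,_) (perms n)) (cartesianProduct xs (perms n))))
      (trans (⟪⟫-+ _ _) (cong (ℚ._+ ⟪ count disP (cartesianProduct xs (perms n)) ⟫) (cong ⟪_⟫ (count-map disP (G ,_) (perms n)))))))
    where
    ih : ΣQ (map term (filterᵇ disB xs)) ℚ.* ⟪ N ⟫ ≡ ⟪ count disP (cartesianProduct xs (perms n)) ⟫
    ih = zd-N xs (λ p → h (there p))
    go : ∀ b → disB G ≡ b → ΣQ (map term (filterᵇ disB (G ∷ xs))) ℚ.* ⟪ N ⟫ ≡ ⟪ count (λ σ → disB G ∧ autoB (G , σ)) (perms n) ⟫ ℚ.+ ⟪ count disP (cartesianProduct xs (perms n)) ⟫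
    go true  e rewrite e = trans (ℚP.*-distribʳ-+ ⟪ N ⟫ (term G) (ΣQ (map term (filterᵇ disB xs)))) (cong₂ ℚ._+_ (term-N (h (here refl))) ih)
    go false e rewrite e = trans ih (sym (trans (cong (ℚ._+ ⟪ count disP (cartesianProduct xs (perms n)) ⟫) (trans (cong ⟪_⟫ (count-none (λ _ → false) (perms n) (λ _ ()))) (⟪⟫-def 0))) (ℚP.+-identityˡ _)))

  Ham∙ : ∀ {G π₀ π} → (h : Inj π₀) → Ham G π → ∀ x → (((adj G ∙ lookup π₀) ∙ lookup (inv π₀ h · π)) °) x (suc x)
  Ham∙ {G} {π₀} {π} h ham x = subst₂ (λ i j → T (adj G i j)) (e (pt x)) (e (pt (suc x))) (ham x)
    where
    e : ∀ i → lookup π i ≡ lookup π₀ (lookup (inv π₀ h · π) i)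
    e i = sym (trans (cong (lookup π₀) (·-at (inv π₀ h) π i)) (inv-r π₀ h (lookup π i)))

  -- A Hamiltonian parametrisation π differs from the given polygon π₀ by a dihedral map, and such
  -- maps preserve the non-crossing property; so every Hamiltonian cycle exhibits `G` as a
  -- dissection.
  std-ham : ∀ {G π} → T (disB G) → Inj π → Ham G π → Std (adj G ∙ lookup π)
  std-ham {G} {π} t π-inj ham with find (AnyP.any⁻ (polyB G) (perms n) t)
  ... | π₀ , π₀∈ , pl = std-cong (λ i j → cong₂ (adj G) (e i) (e j))
      (dihedral-std {A₀} (ham⇒dihedral {A₀} (poly⁻ G π₀ pl) {inv π₀ h · π} (·-inj {σ = inv π₀ h} {π} (inv-inj π₀ h) π-inj) (Ham∙ {G} {π₀} {π} h ham)) (poly⁻ G π₀ pl))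
    where
    h = ∈-perms⁻ {n} {π₀} π₀∈
    A₀ = adj G ∙ lookup π₀
    e : ∀ i → lookup π₀ (lookup (inv π₀ h · π) i) ≡ lookup π i
    e i = trans (cong (lookup π₀) (·-at (inv π₀ h) π i)) (inv-r π₀ h (lookup π i))

  std-act : ∀ {G π} → G ∈ graphs n → Std (adj G ∙ lookup π) → Std (adj (act π G))
  std-act {G} {π} G∈ = std-cong (λ i j → sym (adj-act π G∈ i j))

  -- The Hamiltonian parametrisations are exactly π₀ · δ with δ dihedral.
  ham-count : ∀ {G} → T (disB G) → count (hamB G) (perms n) ≡ n + n
  ham-count {G} t with find (AnyP.any⁻ (polyB G) (perms n) t)
  ... | π₀ , π₀∈ , pl = trans (count-bij {p = hamB G} {q = λ _ → true} (perms n) dihedral unique-perms unique-dihedral (λ π → inv π₀ h · π) (λ δ → π₀ · δ)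
        (λ {π} π∈ t → ∈-dihedral⁺ (ham⇒dihedral {A₀} S₀ {inv π₀ h · π} (·-inj {σ = inv π₀ h} {π} (inv-inj π₀ h) (∈-perms⁻ π∈)) (Ham∙ {G} {π₀} {π} h (ham⁻ G π t))) , tt
          , vec-ext {n} {π₀ · (inv π₀ h · π)} {π} (λ i → trans (·-at π₀ (inv π₀ h · π) i) (trans (cong (lookup π₀) (·-at (inv π₀ h) π i)) (inv-r π₀ h (lookup π i)))))
        (λ {δ} δ∈ _ → let d = ∈-dihedral⁻ {δ} δ∈ in ∈-perms⁺ (·-inj {σ = π₀} {δ} h (dihedral-inj {δ} d))
          , ham⁺ G (π₀ · δ) (λ x → subst₂ (λ i j → T (adj G i j)) (sym (·-at π₀ δ (pt x))) (sym (·-at π₀ δ (pt (suc x)))) (edge° (dihedral-std {A₀} {δ} d S₀) x))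
          , vec-ext {n} {inv π₀ h · (π₀ · δ)} {δ} (λ i → trans (·-at (inv π₀ h) (π₀ · δ) i) (trans (cong (lookup (inv π₀ h)) (·-at π₀ δ i)) (inv-l π₀ h (lookup δ i))))))
      (trans (count-all dihedral) length-dihedral)
    where
    h = ∈-perms⁻ {n} {π₀} π₀∈
    A₀ = adj G ∙ lookup π₀
    S₀ = poly⁻ G π₀ pl

  module Conj (π : Perm {n}) (h : Inj π) where
    π⁻¹ : Perm {n}
    π⁻¹ = inv π h

    fwd bwd : Graph n × Perm {n} → Graph n × Perm {n}
    fwd (G , σ) = act π G , (π⁻¹ · σ) · π
    bwd (G , τ) = act π⁻¹ G , (π · τ) · π⁻¹

    at-fwd : ∀ σ i → lookup π (lookup ((π⁻¹ · σ) · π) i) ≡ lookup σ (lookup π i)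
    at-fwd σ i = trans (cong (lookup π) (trans (·-at (π⁻¹ · σ) π i) (·-at π⁻¹ σ (lookup π i)))) (inv-r π h _)

    at-bwd : ∀ τ i → lookup ((π · τ) · π⁻¹) i ≡ lookup π (lookup τ (lookup π⁻¹ i))
    at-bwd τ i = trans (·-at (π · τ) π⁻¹ i) (·-at π τ (lookup π⁻¹ i))

    auto-fwd : ∀ {G σ} → G ∈ graphs n → T (autoB (G , σ)) → T (autoB (fwd (G , σ)))
    auto-fwd {G} {σ} G∈ t with ∧⁻ {isIso G G σ} t
    ... | a , ty = ∧⁺ (iso⁺ (act π G) (act π G) ((π⁻¹ · σ) · π) (λ i j → trans (adj-act π G∈ i j) (trans (iso⁻ G G σ a (lookup π i) (lookup π j))
        (trans (sym (cong₂ (adj G) (at-fwd σ i) (at-fwd σ j))) (sym (adj-act π G∈ _ _))))))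
      (subst (λ c → T (sameMono c m)) (sym (cycleType-conj σ ((π⁻¹ · σ) · π) π h (at-fwd σ))) ty)

    auto-bwd : ∀ {G τ} → G ∈ graphs n → T (autoB (G , τ)) → T (autoB (bwd (G , τ)))
    auto-bwd {G} {τ} G∈ t with ∧⁻ {isIso G G τ} t
    ... | a , ty = ∧⁺ (iso⁺ (act π⁻¹ G) (act π⁻¹ G) ((π · τ) · π⁻¹) (λ i j → trans (adj-act π⁻¹ G∈ i j) (trans (iso⁻ G G τ a (lookup π⁻¹ i) (lookup π⁻¹ j))
        (trans (sym (cong₂ (adj G) (e i) (e j))) (sym (adj-act π⁻¹ G∈ _ _))))))
      (subst (λ c → T (sameMono c m)) (sym (cycleType-conj τ ((π · τ) · π⁻¹) π⁻¹ (inv-inj π h) e)) ty)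
      where
      e : ∀ i → lookup π⁻¹ (lookup ((π · τ) · π⁻¹) i) ≡ lookup τ (lookup π⁻¹ i)
      e i = trans (cong (lookup π⁻¹) (at-bwd τ i)) (inv-l π h _)

    perm-fwd : ∀ {σ} → σ ∈ perms n → (π⁻¹ · σ) · π ∈ perms n
    perm-fwd {σ} m = ∈-perms⁺ (·-inj {σ = π⁻¹ · σ} {π} (·-inj {σ = π⁻¹} {σ} (inv-inj π h) (∈-perms⁻ m)) h)

    perm-bwd : ∀ {τ} → τ ∈ perms n → (π · τ) · π⁻¹ ∈ perms n
    perm-bwd {τ} m = ∈-perms⁺ (·-inj {σ = π · τ} {π⁻¹} (·-inj {σ = π} {τ} h (∈-perms⁻ m)) (inv-inj π h))

    act-inv : ∀ {G} → G ∈ graphs n → act π⁻¹ (act π G) ≡ G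
    act-inv {G} G∈ = graph-ext (act-∈ π⁻¹ (act π G)) G∈ (λ {i} {j} _ → trans (adj-act π⁻¹ (act-∈ π G) i j) (trans (adj-act π G∈ _ _) (cong₂ (adj G) (inv-r π h i) (inv-r π h j))))

    act-inv′ : ∀ {G} → G ∈ graphs n → act π (act π⁻¹ G) ≡ G
    act-inv′ {G} G∈ = graph-ext (act-∈ π (act π⁻¹ G)) G∈ (λ {i} {j} _ → trans (adj-act π (act-∈ π⁻¹ G) i j) (trans (adj-act π⁻¹ G∈ _ _) (cong₂ (adj G) (inv-l π h i) (inv-l π h j))))

    bwd-fwd : ∀ {G σ} → G ∈ graphs n → bwd (fwd (G , σ)) ≡ (G , σ)
    bwd-fwd {G} {σ} G∈ = cong₂ _,_ (act-inv G∈) (vec-ext {n} {(π · ((π⁻¹ · σ) · π)) · π⁻¹} {σ} (λ i → trans (at-bwd ((π⁻¹ · σ) · π) i) (trans (at-fwd σ (lookup π⁻¹ i)) (cong (lookup σ) (inv-r π h i)))))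

    fwd-bwd : ∀ {G τ} → G ∈ graphs n → fwd (bwd (G , τ)) ≡ (G , τ)
    fwd-bwd {G} {τ} G∈ = cong₂ _,_ (act-inv′ G∈) (vec-ext {n} {(π⁻¹ · ((π · τ) · π⁻¹)) · π} {τ} (λ i → inj h (trans (at-fwd ((π · τ) · π⁻¹) i) (trans (at-bwd τ (lookup π i)) (cong (λ j → lookup π (lookup τ j)) (inv-l π h i))))))

    -- Pulling back along π moves the Hamiltonian cycle π to the standard polygon and conjugates the
    -- automorphism, which keeps its cycle type.
    conj-count : count (λ Gσ → disP Gσ ∧ hamB (proj₁ Gσ) π) graphs×perms ≡ count stdP graphs×perms
    conj-count = count-bij graphs×perms graphs×perms unique-graphs×perms unique-graphs×perms fwd bwd
      (λ { {G , σ} m t → let (G∈ , σ∈) = ∈-cartesianProduct⁻ (graphs n) (perms n) m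
                             (d , hm) = ∧⁻ {disP (G , σ)} t
                             (dis , au) = ∧⁻ {disB G} d in
           ∈-cartesianProduct⁺ (act-∈ π G) (perm-fwd {σ} σ∈) ,
           ∧⁺ (std⁺ (act π G) (std-act {G} {π} G∈ (std-ham {G} {π} dis h (ham⁻ G π hm)))) (auto-fwd {G} {σ} G∈ au) ,
           bwd-fwd {G} {σ} G∈ })
      (λ { {G , τ} m t → let (G∈ , τ∈) = ∈-cartesianProduct⁻ (graphs n) (perms n) m
                             (st , au) = ∧⁻ {stdB G} t
                             s : Std (adj (act π⁻¹ G) ∙ lookup π)
                             s = std-cong (λ i j → trans (sym (cong₂ (adj G) (inv-l π h i) (inv-l π h j))) (sym (adj-act π⁻¹ G∈ (lookup π i) (lookup π j)))) (std⁻ G st)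
                             pl = poly⁺ (act π⁻¹ G) π s in
           ∈-cartesianProduct⁺ (act-∈ π⁻¹ G) (perm-bwd {τ} τ∈) ,
           ∧⁺ (∧⁺ (AnyP.any⁺ (polyB (act π⁻¹ G)) (lose (∈-perms⁺ {n} {π} h) pl)) (auto-bwd {G} {τ} G∈ au)) (ham⁺ (act π⁻¹ G) π (edge° s)) ,
           fwd-bwd {G} {τ} G∈ })

  open Conj using (conj-count)

  -- Counts triples of a dissection, an automorphism and a Hamiltonian parametrisation: each pair
  -- has 2n parametrisations, and each of the n! permutations occurs with as many pairs as there are
  -- on the standard polygon.
  double-count : count disP graphs×perms * (n + n) ≡ N * count stdP graphs×perms
  double-count = begin
    count disP graphs×perms * (n + n)
      ≡⟨ sym (count-fibres (λ x → disP (proj₁ x) ∧ hamB (proj₁ (proj₁ x)) (proj₂ x)) disP (n + n) graphs×perms (perms n)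
           (λ { {G , σ} m t → trans (count-cong (perms n) (λ π _ → T-ext (λ t′ → proj₂ (∧⁻ {disP (G , σ)} t′)) (λ t′ → ∧⁺ t t′))) (ham-count {G} (proj₁ (∧⁻ {disB G} t))) })
           (λ { {G , σ} m ¬t → count-none _ (perms n) (λ _ t′ → ¬t (proj₁ (∧⁻ {disP (G , σ)} t′))) })) ⟩
    count (λ x → disP (proj₁ x) ∧ hamB (proj₁ (proj₁ x)) (proj₂ x)) (cartesianProduct graphs×perms (perms n))
      ≡⟨ count-swap _ graphs×perms (perms n) unique-graphs×perms unique-perms ⟩
    count (λ x → disP (proj₂ x) ∧ hamB (proj₁ (proj₂ x)) (proj₁ x)) (cartesianProduct (perms n) graphs×perms)
      ≡⟨ count-fibres _ (λ _ → true) (count stdP graphs×perms) (perms n) graphs×perms (λ {π} π∈ _ → conj-count π (∈-perms⁻ π∈)) (λ _ ¬t → ⊥-elim (¬t tt)) ⟩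
    count (λ _ → true) (perms n) * count stdP graphs×perms
      ≡⟨ cong (_* count stdP graphs×perms) (count-all (perms n)) ⟩
    N * count stdP graphs×perms ∎
    where open ≡-Reasoning

  fixed : Perm {n} → ℕ
  fixed σ = count (λ G → stdP (G , σ)) (graphs n)

  -- An automorphism carries the polygon to a Hamiltonian cycle, and there is only one.
  auto⇒dihedral : ∀ {G σ} → Inj σ → T (stdP (G , σ)) → Dihedral σ
  auto⇒dihedral {G} {σ} h t with ∧⁻ {stdB G} t
  ... | st , au = ham⇒dihedral {adj G} (std⁻ G st) {σ} h (λ x → subst T (iso⁻ G G σ (proj₁ (∧⁻ {isIso G G σ} au)) (pt x) (pt (suc x))) (edge° (std⁻ G st) x))

  std-count : count stdP graphs×perms ≡ sumL (fixed ∘ rot) 1⋯n + sumL (fixed ∘ ref) 1⋯n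
  std-count = begin
    count stdP graphs×perms
      ≡⟨ count-swap stdP (graphs n) (perms n) unique-graphs unique-perms ⟩
    count (λ σG → stdP (proj₂ σG , proj₁ σG)) (cartesianProduct (perms n) (graphs n))
      ≡⟨ count-bij {p = λ σG → stdP (proj₂ σG , proj₁ σG)} {q = λ σG → stdP (proj₂ σG , proj₁ σG)} (cartesianProduct (perms n) (graphs n)) (cartesianProduct dihedral (graphs n))
           (UP.cartesianProduct⁺ unique-perms unique-graphs) (UP.cartesianProduct⁺ unique-dihedral unique-graphs) id id
           (λ { {σ , G} m t → let (σ∈ , G∈) = ∈-cartesianProduct⁻ (perms n) (graphs n) m in ∈-cartesianProduct⁺ (∈-dihedral⁺ (auto⇒dihedral {G} {σ} (∈-perms⁻ σ∈) t)) G∈ , t , refl })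
           (λ { {σ , G} m t → let (σ∈ , G∈) = ∈-cartesianProduct⁻ dihedral (graphs n) m in ∈-cartesianProduct⁺ (∈-perms⁺ (dihedral-inj {σ} (∈-dihedral⁻ {σ} σ∈))) G∈ , t , refl }) ⟩
    count (λ σG → stdP (proj₂ σG , proj₁ σG)) (cartesianProduct dihedral (graphs n))
      ≡⟨ count-sum _ dihedral (graphs n) ⟩
    sumL fixed dihedral
      ≡⟨ trans (sumL-++ fixed (map rot 1⋯n) (map ref 1⋯n)) (cong₂ _+_ (sumL-map fixed rot 1⋯n) (sumL-map fixed ref 1⋯n)) ⟩
    sumL (fixed ∘ rot) 1⋯n + sumL (fixed ∘ ref) 1⋯n ∎
    where open ≡-Reasoning

  zd-dihedral : ΣQ (map term (filterᵇ disB (graphs n))) ℚ.* ⟪ n + n ⟫ ≡ ⟪ sumL (fixed ∘ rot) 1⋯n + sumL (fixed ∘ ref) 1⋯n ⟫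
  zd-dihedral = cancel N N>0 (begin
    (z ℚ.* ⟪ n + n ⟫) ℚ.* ⟪ N ⟫    ≡⟨ solve 3 (λ a b c → (a :* b) :* c := (a :* c) :* b) refl z ⟪ n + n ⟫ ⟪ N ⟫ ⟩
    (z ℚ.* ⟪ N ⟫) ℚ.* ⟪ n + n ⟫    ≡⟨ cong (ℚ._* ⟪ n + n ⟫) (zd-N (graphs n) id) ⟩
    ⟪ count disP graphs×perms ⟫ ℚ.* ⟪ n + n ⟫  ≡⟨ sym (⟪⟫-* (count disP graphs×perms) (n + n)) ⟩
    ⟪ count disP graphs×perms * (n + n) ⟫  ≡⟨ cong ⟪_⟫ (trans double-count (cong (N *_) std-count)) ⟩
    ⟪ N * t ⟫                    ≡⟨ trans (cong ⟪_⟫ (*-comm N t)) (⟪⟫-* t N) ⟩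
    ⟪ t ⟫ ℚ.* ⟪ N ⟫              ∎)
    where
    open ≡-Reasoning
    open +-*-Solver
    z = ΣQ (map term (filterᵇ disB (graphs n)))
    t = sumL (fixed ∘ rot) 1⋯n + sumL (fixed ∘ ref) 1⋯n
    cancel : ∀ N → 0 < N → ∀ {x y} → x ℚ.* ⟪ N ⟫ ≡ y ℚ.* ⟪ N ⟫ → x ≡ y
    cancel (suc N) _ = *-cancelʳ-⟪⟫ N

-- Counting invariant dissections by codes

module Codes (n : ℕ) (2<n : 2 < n) where
  open Polygon n 2<n

  iff : Set → Set → Set
  iff A B = (A → B) × (B → A)

  gr : {S : Rel} → (∀ x y → Dec (S x y)) → Graph n
  gr S? = mk (λ i j → ⌊ S? (toℕ i) (toℕ j) ⌋)

  gr-° : ∀ {S : Rel} (S? : ∀ x y → Dec (S x y)) {x y} → x < y → y < n → iff ((adj (gr S?) °) x y) (S x y)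
  gr-° {S} S? {x} {y} x<y y<n = (λ t → subst₂ S ex ey (toWitness {a? = S? _ _} (subst T e t)))
                              , (λ s → subst T (sym e) (fromWitness {a? = S? _ _} (subst₂ S (sym ex) (sym ey) s)))
    where
    ex = toℕ-pt-< (<-trans x<y y<n)
    ey = toℕ-pt-< y<n
    e : adj (gr S?) (pt x) (pt y) ≡ ⌊ S? (toℕ (pt x)) (toℕ (pt y)) ⌋
    e = adj-mk-< _ (subst₂ _<_ (sym ex) (sym ey) x<y)

  adj-sym° : ∀ G {x y} → (adj G °) x y → (adj G °) y x
  adj-sym° G {x} {y} = subst T (adj-sym G (pt x) (pt y))

  -- In the linear order the edge between n - 1 and 0 is not of the form x, x + 1, so it is supplied
  -- separately.
  lin-std : ∀ {S : Rel} (S? : ∀ x y → Dec (S x y)) → (∀ x → suc x < n → S x (suc x)) → S 0 n-1 →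
    (∀ {a b c d} → a < b → b < c → c < d → d < n → S a c → S b d → ⊥) → Std (adj (gr S?))
  lin-std {S} S? ed top nc = record
    { sym° = λ {x} {y} → adj-sym° (gr S?) {x} {y}
    ; edge° = λ x → °-resp A (≋-% x) (≋-suc (≋-% x)) (step (x % n) (m%n<n x n))
    ; cross° = nc-cyclic {A} (λ {x} {y} → adj-sym° (gr S?) {x} {y}) (λ p q r t h h′ → nc p q r t
        (proj₁ (gr-° S? (<-trans p q) (<-trans r t)) h) (proj₁ (gr-° S? (<-trans q r) t) h′)) }
    where
    A = adj (gr S?)
    step : ∀ x → x < n → (A °) x (suc x)
    step x x<n with m≤n⇒m<n∨m≡n x<n
    ... | inj₁ lt = proj₂ (gr-° S? (n<1+n x) lt) (ed x lt)
    ... | inj₂ e  = °-resp A (≋-refl {x}) (≋-trans (≋-sym (≋-n 0)) (≋-reflexive (sym e)))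
      (adj-sym° (gr S?) {0} {x} (subst ((A °) 0) n-1≡x (proj₂ (gr-° S? (subst (0 <_) (sym n-1≡x) 0<x) (≤-reflexive 1+n-1)) top)))
      where
      n-1≡x : n-1 ≡ x
      n-1≡x = suc-injective (trans 1+n-1 (sym e))
      0<x : 0 < x
      0<x = <-trans (s≤s z≤n) (≤-pred (subst (2 <_) (sym e) 2<n))

  -- The common scheme for the identity, rotations and reflections: a code `c` describes the chords
  -- x < y < n by `S c`, the code is determined by these chords, and every graph satisfying `Q` has
  -- a code.
  code-count : ∀ {C : Set} (cs : List C) → Unique cs → (S : C → Rel) (S? : ∀ c x y → Dec (S c x y)) (Q : Graph n → Bool) →
    (∀ {c} → c ∈ cs → T (Q (gr (S? c)))) →
    (∀ {c c′} → c ∈ cs → c′ ∈ cs → (∀ {x y} → x < y → y < n → iff (S c x y) (S c′ x y)) → c ≡ c′) →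
    (∀ {G} → G ∈ graphs n → T (Q G) → ∃[ c ] (c ∈ cs × (∀ {x y} → x < y → y < n → iff ((adj G °) x y) (S c x y)))) →
    count Q (graphs n) ≡ length cs
  code-count cs ucs S S? Q sound inj complete = ≤-antisym
    (≤-trans (count-≤ (λ G c → G ∈ graphs n × (∀ {x y} → x < y → y < n → iff ((adj G °) x y) (S c x y))) {Q} {λ _ → true} (graphs n) cs unique-graphs
      (λ {G} G∈ t → let (c , c∈ , h) = complete G∈ t in c , c∈ , tt , G∈ , (λ {x} {y} → h {x} {y}))
      (λ {G} {G′} _ _ (G∈ , h) (G′∈ , h′) → graph-ext G∈ G′∈ (λ {i} {j} lt → T-ext
         (λ t → down G′ i j (proj₂ (h′ lt (FP.toℕ<n j)) (proj₁ (h lt (FP.toℕ<n j)) (up G i j t))))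
         (λ t → down G i j (proj₂ (h lt (FP.toℕ<n j)) (proj₁ (h′ lt (FP.toℕ<n j)) (up G′ i j t)))))))
      (≤-reflexive (count-all cs)))
    (≤-trans (≤-reflexive (sym (count-all cs))) (count-≤ (λ c G → G ≡ gr (S? c)) {λ _ → true} {Q} cs (graphs n) ucs
      (λ {c} c∈ _ → gr (S? c) , mk-∈ _ , sound c∈ , refl)
      (λ {c} {c′} c∈ c′∈ e e′ → inj c∈ c′∈ (λ {x} {y} p q →
        (λ s → proj₁ (gr-° (S? c′) p q) (subst (λ G → (adj G °) x y) (trans (sym e) e′) (proj₂ (gr-° (S? c) p q) s)))
      , (λ s → proj₁ (gr-° (S? c) p q) (subst (λ G → (adj G °) x y) (trans (sym e′) e) (proj₂ (gr-° (S? c′) p q) s)))))))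
    where
    up : ∀ G i j → T (adj G i j) → (adj G °) (toℕ i) (toℕ j)
    up G i j = subst₂ (λ i j → T (adj G i j)) (sym (pt-toℕ i)) (sym (pt-toℕ j))
    down : ∀ G i j → (adj G °) (toℕ i) (toℕ j) → T (adj G i j)
    down G i j = subst₂ (λ i j → T (adj G i j)) (pt-toℕ i) (pt-toℕ j)

  std-edges : ∀ {A} → Std A → ∀ l r → Edges (A °) l r
  std-edges s l r {a} _ _ = edge° s a

  std-noncrossing : ∀ {A} → Std A → ∀ l r → r < l + n → Noncrossing (A °) l r
  std-noncrossing s l r lt p q q′ q″ p′ = cross° s q q′ q″ (≤-<-trans p′ (<-≤-trans lt (+-monoˡ-≤ n p)))

  std-top : ∀ {A} → Std A → (A °) 0 n-1
  std-top {A} s = sym° s (°-resp A (≋-refl {n-1}) (≋-trans (≋-reflexive 1+n-1) (≋-n 0)) (edge° s n-1))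

  °? : ∀ A x y → Dec ((A °) x y)
  °? A x y = T? (A (pt x) (pt y))

  -- Without symmetry: all non-crossing families on [0, n - 1]

  tree-std : ∀ t → ∥ t ∥ ≡ n-1 → Std (adj (gr (arc? t 0)))
  tree-std t e = lin-std (arc? t 0) (λ x lt → Fam.edge (fam t 0) z≤n (subst (x <_) (sym e) (≤-pred (subst (suc x <_) (sym 1+n-1) lt))))
    (subst (Arc t 0 0) e (arc-top t 0)) (λ p q r _ → Fam.cross (fam t 0) p q r)

  tree-inj : ∀ t t′ → ∥ t ∥ ≡ n-1 → ∥ t′ ∥ ≡ n-1 → (∀ {x y} → x < y → y < n → iff (Arc t 0 x y) (Arc t′ 0 x y)) → t ≡ t′
  tree-inj t t′ e e′ h = arc-injective t t′ 0 (λ {a} {b} →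
    (λ s → let (_ , p , p′) = Fam.range (fam t 0) s in proj₁ (h p (bound e p′)) s) , (λ s → let (_ , p , p′) = Fam.range (fam t′ 0) s in proj₂ (h p (bound e′ p′)) s))
    where
    bound : ∀ {k b} → k ≡ n-1 → b ≤ k → b < n
    bound refl b≤ = ≤-trans (s≤s b≤) (≤-reflexive 1+n-1)

  tree-complete : ∀ {A} → Std A → ∃[ t ] (∥ t ∥ ≡ n-1 × (∀ {x y} → x < y → y < n → iff ((A °) x y) (Arc t 0 x y)))
  tree-complete {A} s with arc-complete {R = A °} (°? A) (n-1 + n-1) 0 n-1 (n≤1+n _) (<-≤-trans (s≤s z≤n) (≤-pred (subst (2 <_) (sym 1+n-1) 2<n)))
    (std-top {A} s) (std-edges {A} s 0 n-1) (std-noncrossing {A} s 0 n-1 (≤-reflexive 1+n-1))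
  ... | t , e , ag = t , e , λ x<y y<n → ag z≤n x<y (≤-pred (≤-trans y<n (≤-reflexive (sym 1+n-1))))

-- Dissections fixed by the identity.

module Identity (n : ℕ) (2<n : 2 < n) (m : Mono) where
  open Polygon n 2<n
  open Reduction n 2<n m
  open Codes n 2<n

  isoQ : Perm {n} → Graph n → Bool
  isoQ σ G = stdB G ∧ isIso G G σ

  fixed-yes : ∀ σ → T (typeB σ) → fixed σ ≡ count (isoQ σ) (graphs n)
  fixed-yes σ t = count-cong (graphs n) (λ G _ → T-ext
    (λ h → let (a , b) = ∧⁻ {stdB G} h in ∧⁺ a (proj₁ (∧⁻ {isIso G G σ} b)))
    (λ h → let (a , b) = ∧⁻ {stdB G} h in ∧⁺ a (∧⁺ b t)))

  fixed-no : ∀ σ → ¬ T (typeB σ) → fixed σ ≡ 0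
  fixed-no σ ¬t = count-none _ (graphs n) (λ {G} _ h → ¬t (proj₂ (∧⁻ {isIso G G σ} (proj₂ (∧⁻ {stdB G} h)))))

  -- The edge between 0 and n - 1 is the root edge, that is the top arc; the other n - 1 sides of
  -- the polygon are the leaves.
  identity-count : count (isoQ (rot n)) (graphs n) ≡ length (trees n-1)
  identity-count = code-count (trees n-1) (Sized.unique sized-trees n-1) (λ t → Arc t 0) (λ t → arc? t 0) (isoQ (rot n))
    (λ {t} t∈ → let G = gr (arc? t 0) in ∧⁺ (std⁺ G (tree-std t (Sized.sound sized-trees {n-1} t∈)))
      (iso⁺ G G (rot n) (λ i j → cong₂ (adj G) (e i) (e j))))
    (λ {t} {t′} t∈ t′∈ → tree-inj t t′ (Sized.sound sized-trees {n-1} t∈) (Sized.sound sized-trees {n-1} t′∈))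
    (λ {G} G∈ h → let (t , e , ag) = tree-complete {adj G} (std⁻ G (proj₁ (∧⁻ {stdB G} h))) in t , ∈-sized sized-trees e , (λ {x} {y} → ag {x} {y}))
    where
    e : ∀ i → i ≡ lookup (rot n) i
    e i = trans (sym (pt-toℕ i)) (trans (pt-cong (≋-sym (≋-n (toℕ i)))) (trans (sym (rot-at n (toℕ i))) (cong (lookup (rot n)) (pt-toℕ i))))

-- Dissections with rotational symmetry: periodic families of arcs

-- The k-periodic continuation of a family B living on [q, q + k]
lift : ∀ k → 0 < k → Rel → ℕ → Rel
lift k 0<k B q x y = B (q + _%_ (x ∸ q) k {{>-nonZero 0<k}}) (y ∸ (_/_ (x ∸ q) k {{>-nonZero 0<k}}) * k)

-- Each chord of the n-gon is seen twice in the universal cover; shifting by n keeps all indices above q.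
chord : ℕ → ∀ k → 0 < k → Rel → ℕ → Rel
chord n k 0<k B q x y = lift k 0<k B q (x + n) (y + n) ⊎ lift k 0<k B q (y + n) (x + n + n)

chord? : ∀ n k (0<k : 0 < k) {B : Rel} → (∀ x y → Dec (B x y)) → ∀ q x y → Dec (chord n k 0<k B q x y)
chord? n k 0<k B? q x y = B? _ _ ⊎-dec B? _ _

module Lift (k : ℕ) (0<k : 0 < k) {B : Rel} (B? : ∀ x y → Dec (B x y)) (q : ℕ) (famB : Fam B q (q + k)) where

  instance
    k≢0 : NonZero k
    k≢0 = >-nonZero 0<k

  L : Rel
  L = lift k 0<k B q

  L-def : ∀ {r} j y → r < k → L (q + r + j * k) y ≡ B (q + r) (y ∸ j * k)
  L-def {r} j y r<k = cong₂ (λ a b → B (q + a) (y ∸ b * k)) (trans (cong (_% k) e) (trans ([m+kn]%n≡m%n r j k) (m<n⇒m%n≡m r<k)))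
    (trans (cong (_/ k) e) (trans (+-distrib-/-∣ʳ r (Data.Nat.Divisibility.divides j refl)) (cong₂ _+_ (m<n⇒m/n≡0 r<k) (m*n/n≡m j k))))
    where
    e : q + r + j * k ∸ q ≡ r + j * k
    e = trans (cong (_∸ q) (+-assoc q r (j * k))) (m+n∸m≡n q _)

  rep : ∀ {x} → q ≤ x → ∃[ r ] ∃[ j ] (r < k × x ≡ q + r + j * k)
  rep {x} q≤x = (x ∸ q) % k , (x ∸ q) / k , m%n<n (x ∸ q) k ,
    trans (sym (m+[n∸m]≡n q≤x)) (trans (cong (q +_) (m≡m%n+[m/n]*n (x ∸ q) k)) (sym (+-assoc q _ _)))

  L⁻ : ∀ {x y} → q ≤ x → L x y → ∃[ a ] ∃[ b ] ∃[ j ] (B a b × x ≡ a + j * k × y ≡ b + j * k)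
  L⁻ {x} {y} q≤x h with rep q≤x
  ... | r , j , r<k , refl = q + r , y ∸ j * k , j , h′ , refl , sym (m∸n+n≡m (<⇒≤ jk<y))
    where
    h′ = subst id (L-def j y r<k) h
    jk<y : j * k < y
    jk<y = m∸n≢0⇒n<m {y} {j * k} (λ e → n≮0 (subst (q + r <_) e (proj₁ (proj₂ (Fam.range famB h′)))))

  L⁺ : ∀ {a b} j → B a b → L (a + j * k) (b + j * k)
  L⁺ {a} {b} j h with Fam.range famB h
  ... | q≤a , a<b , b≤ with m≤n⇒∃[o]m+o≡n q≤a
  ... | r , refl = subst id (sym (L-def j (b + j * k) (+-cancelˡ-< q r k (<-≤-trans a<b b≤)))) (subst (B (q + r)) (sym (m+n∸n≡m b (j * k))) h)

  L-base : ∀ {a b} → q ≤ a → a < q + k → L a b → B a b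
  L-base {a} {b} q≤a a<q+k h with m≤n⇒∃[o]m+o≡n q≤a
  ... | r , refl = subst id (L-def 0 b (+-cancelˡ-< q r k a<q+k)) (subst (λ x → L x b) (sym (+-identityʳ (q + r))) h)

  L-range : ∀ {x y} → q ≤ x → L x y → x < y × y ≤ x + k
  L-range q≤x h with L⁻ q≤x h
  ... | a , b , j , h′ , refl , refl with Fam.range famB h′
  ... | q≤a , a<b , b≤ = +-monoˡ-< (j * k) a<b , ≤-trans (+-monoˡ-≤ (j * k) (≤-trans b≤ (+-monoˡ-≤ k q≤a))) (≤-reflexive (trans (+-assoc a k _) (trans (cong (a +_) (+-comm k _)) (sym (+-assoc a _ k)))))

  L-edge : ∀ {x} → q ≤ x → L x (suc x)
  L-edge q≤x with rep q≤x
  ... | r , j , r<k , refl = L⁺ {q + r} {suc (q + r)} j (Fam.edge famB (m≤m+n q r) (+-monoʳ-< q r<k))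

  +k-comm : ∀ a j → a + j * k + k ≡ a + suc j * k
  +k-comm a j = trans (+-assoc a _ k) (cong (a +_) (+-comm (j * k) k))

  L-shift : ∀ {x y} → q ≤ x → L x y → L (x + k) (y + k)
  L-shift q≤x h with L⁻ q≤x h
  ... | a , b , j , h′ , refl , refl = subst₂ L (sym (+k-comm a j)) (sym (+k-comm b j)) (L⁺ (suc j) h′)

  L-unshift : ∀ {x y} → q ≤ x → L (x + k) (y + k) → L x y
  L-unshift {x} {y} q≤x h with L⁻ (≤-trans q≤x (m≤m+n x k)) h
  ... | a , b , suc j , h′ , e , e′ = subst₂ L (sym (+-cancelʳ-≡ k _ _ (trans e (sym (+k-comm a j))))) (sym (+-cancelʳ-≡ k _ _ (trans e′ (sym (+k-comm b j))))) (L⁺ j h′)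
  ... | a , b , zero , h′ , e , e′ with Fam.range famB h′
  ... | q≤a , a<b , b≤ = ⊥-elim (<⇒≱ (<-≤-trans a<b b≤) (≤-trans (+-monoˡ-≤ k q≤x) (≤-reflexive (trans e (+-identityʳ a)))))

  L-shift* : ∀ i {x y} → q ≤ x → L x y → L (x + i * k) (y + i * k)
  L-shift* zero    {x} {y} q≤x h = subst₂ L (sym (+-identityʳ x)) (sym (+-identityʳ y)) h
  L-shift* (suc i) {x} {y} q≤x h = subst₂ L (+k-comm x i) (+k-comm y i) (L-shift (≤-trans q≤x (m≤m+n x _)) (L-shift* i q≤x h))

  L-unshift* : ∀ i {x y} → q ≤ x → L (x + i * k) (y + i * k) → L x y
  L-unshift* zero    {x} {y} q≤x h = subst₂ L (+-identityʳ x) (+-identityʳ y) h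
  L-unshift* (suc i) {x} {y} q≤x h = L-unshift* i q≤x (L-unshift (≤-trans q≤x (m≤m+n x _)) (subst₂ L (sym (+k-comm x i)) (sym (+k-comm y i)) h))

  -- Translates of the base family live on intervals that meet at most in an endpoint, so crossing
  -- arcs belong to the same translate and already cross in `B`.
  L-cross : ∀ {x₁ x₂ x₃ x₄} → q ≤ x₁ → x₁ < x₂ → x₂ < x₃ → x₃ < x₄ → L x₁ x₃ → L x₂ x₄ → ⊥
  L-cross q≤x₁ p p′ p″ h h′ with L⁻ q≤x₁ h | L⁻ (≤-trans q≤x₁ (<⇒≤ p)) h′
  ... | a , c , j , hB , refl , refl | b , d , i , hB′ , refl , refl with Fam.range famB hB | Fam.range famB hB′
  ... | q≤a , a<c , c≤ | q≤b , b<d , d≤ with ≤-antisym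
          (block {j} {i} (+-cancelˡ-< q _ _ (<-≤-trans (≤-<-trans (+-monoˡ-≤ (j * k) q≤a) p) (≤-trans (+-monoˡ-≤ (i * k) (≤-trans (<⇒≤ b<d) d≤)) (≤-reflexive (+-assoc q k _))))))
          (block {i} {j} (+-cancelˡ-< q _ _ (<-≤-trans (≤-<-trans (+-monoˡ-≤ (i * k) q≤b) p′) (≤-trans (+-monoˡ-≤ (j * k) c≤) (≤-reflexive (+-assoc q k _))))))
    where
    block : ∀ {i j} → i * k < k + j * k → i ≤ j
    block {i} {j} lt = ≤-pred (*-cancelʳ-< k i (suc j) lt)
  ... | refl = Fam.cross famB (+-cancelʳ-< (j * k) _ _ p) (+-cancelʳ-< (j * k) _ _ p′) (+-cancelʳ-< (j * k) _ _ p″) hB hB′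

-- The form of `n` says that the rotation by `k` has order d + 2 ≥ 2. Hence an arc of length at most
-- `k` spans at most half of the polygon.
module Periodic (n : ℕ) (2<n : 2 < n) (k : ℕ) (0<k : 0 < k) (d : ℕ) (n≡dk : n ≡ suc (suc d) * k) where
  open Polygon n 2<n
  open Codes n 2<n

  k+k≤n : k + k ≤ n
  k+k≤n = ≤-trans (+-monoʳ-≤ k (m≤m+n k (d * k))) (≤-reflexive (sym n≡dk))

  k<n : k < n
  k<n = <-≤-trans (m<m+n k 0<k) k+k≤n

  Inv : Adj → ℕ → Set
  Inv A c = ∀ x y → A (pt x) (pt y) ≡ A (pt (x + c)) (pt (y + c))

  module Chords {B : Rel} (B? : ∀ x y → Dec (B x y)) (q : ℕ) (q<k : q < k) (famB : Fam B q (q + k)) where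
    open Lift k 0<k B? q famB

    q≤+n : ∀ x → q ≤ x + n
    q≤+n x = ≤-trans (<⇒≤ (<-trans q<k k<n)) (m≤n+m n x)

    L-n : ∀ {x y} → q ≤ x → iff (L x y) (L (x + n) (y + n))
    L-n {x} {y} q≤x = (λ h → subst₂ L (e x) (e y) (L-shift* (suc (suc d)) q≤x h)) , (λ h → L-unshift* (suc (suc d)) q≤x (subst₂ L (sym (e x)) (sym (e y)) h))
      where
      e : ∀ x → x + suc (suc d) * k ≡ x + n
      e x = cong (x +_) (sym n≡dk)

    -- A chord between x and y bounds two arcs, from x to y and from y around to x + n; it belongs
    -- to the dissection if either of them is in the periodic family.
    K : Rel
    K x y = L x y ⊎ L y (x + n)

    K-n : ∀ {x y} → q ≤ x → x < y → iff (K x y) (K (x + n) (y + n))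
    K-n q≤x x<y = (λ { (inj₁ h) → inj₁ (proj₁ (L-n q≤x) h) ; (inj₂ h) → inj₂ (proj₁ (L-n (≤-trans q≤x (<⇒≤ x<y))) h) })
                , (λ { (inj₁ h) → inj₁ (proj₂ (L-n q≤x) h) ; (inj₂ h) → inj₂ (proj₂ (L-n (≤-trans q≤x (<⇒≤ x<y))) h) })

    K-k : ∀ {x y} → q ≤ x → x < y → iff (K x y) (K (x + k) (y + k))
    K-k {x} {y} q≤x x<y = (λ { (inj₁ h) → inj₁ (L-shift q≤x h) ; (inj₂ h) → inj₂ (subst (L (y + k)) e (L-shift (≤-trans q≤x (<⇒≤ x<y)) h)) })
                , (λ { (inj₁ h) → inj₁ (L-unshift q≤x h) ; (inj₂ h) → inj₂ (L-unshift (≤-trans q≤x (<⇒≤ x<y)) (subst (L (y + k)) (sym e) h)) })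
      where
      e : x + n + k ≡ x + k + n
      e = trans (+-assoc x n k) (trans (cong (x +_) (+-comm n k)) (sym (+-assoc x k n)))

    K-swap : ∀ {x y} → q ≤ x → iff (K x y) (K y (x + n))
    K-swap q≤x = (λ { (inj₁ h) → inj₂ (proj₁ (L-n q≤x) h) ; (inj₂ h) → inj₁ h }) , (λ { (inj₁ h) → inj₂ h ; (inj₂ h) → inj₁ (proj₂ (L-n q≤x) h) })

    K-n* : ∀ i {x y} → q ≤ x → x < y → iff (K x y) (K (x + i * n) (y + i * n))
    K-n* zero    {x} {y} q≤x x<y = subst₂ K (sym (+-identityʳ x)) (sym (+-identityʳ y)) , subst₂ K (+-identityʳ x) (+-identityʳ y)
    K-n* (suc i) {x} {y} q≤x x<y = (λ h → subst₂ K (e x) (e y) (proj₁ step (proj₁ (K-n* i q≤x x<y) h))) , (λ h → proj₂ (K-n* i q≤x x<y) (proj₂ step (subst₂ K (sym (e x)) (sym (e y)) h)))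
      where
      step = K-n (≤-trans q≤x (m≤m+n x (i * n))) (+-monoˡ-< (i * n) x<y)
      e : ∀ x → x + i * n + n ≡ x + suc i * n
      e x = trans (+-assoc x _ n) (cong (x +_) (+-comm (i * n) n))

    K-cross : ∀ {a b c e} → q ≤ a → a < b → b < c → c < e → e < a + n → K a c → K b e → ⊥
    K-cross q≤a p p′ p″ lt (inj₁ h) (inj₁ h′) = L-cross q≤a p p′ p″ h h′
    K-cross {a} q≤a p p′ p″ lt (inj₁ h) (inj₂ h′) = L-cross (≤-trans q≤a (<⇒≤ (<-trans p (<-trans p′ p″)))) lt (+-monoˡ-< n p) (+-monoˡ-< n p′) h′ (proj₁ (L-n q≤a) h)
    K-cross q≤a p p′ p″ lt (inj₂ h) (inj₁ h′) = L-cross (≤-trans q≤a (<⇒≤ p)) p′ p″ lt h′ h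
    K-cross q≤a p p′ p″ lt (inj₂ h) (inj₂ h′) = L-cross (≤-trans q≤a (<⇒≤ (<-trans p p′))) p″ lt (+-monoˡ-< n p) h h′

    -- If both arcs bounded by a chord have length at most `k`, then n = 2k and the chord is a
    -- diameter; its second arc is then the translate of the first by `k`.
    K-short : ∀ {x y} → q ≤ x → x < y → y ≤ x + k → K x y → L x y
    K-short q≤x x<y y≤ (inj₁ h) = h
    K-short {x} {y} q≤x x<y y≤ (inj₂ h) = L-unshift q≤x (subst₂ L y≡ x+n≡ h)
      where
      x+n≤ : x + n ≤ y + k
      x+n≤ = proj₂ (L-range (≤-trans q≤x (<⇒≤ x<y)) h)
      y≡ : y ≡ x + k
      y≡ = ≤-antisym y≤ (+-cancelʳ-≤ k _ _ (≤-trans (≤-trans (≤-reflexive (+-assoc x k k)) (+-monoʳ-≤ x k+k≤n)) x+n≤))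
      x+n≡ : x + n ≡ y + k
      x+n≡ = ≤-antisym x+n≤ (≤-trans (≤-reflexive (trans (cong (_+ k) y≡) (+-assoc x k k))) (+-monoʳ-≤ x k+k≤n))

    S : Rel
    S = chord n k 0<k B q

    S? : ∀ x y → Dec (S x y)
    S? = chord? n k 0<k B? q

    A : Adj
    A = adj (gr S?)

    °-n : ∀ {x y} → iff ((A °) x y) ((A °) (x + n) (y + n))
    °-n {x} {y} = °-resp A (≋-sym (≋-n x)) (≋-sym (≋-n y)) , °-resp A (≋-n x) (≋-n y)

    A-K′ : ∀ i x₀ y₁ → q ≤ x₀ + i * n → x₀ + i * n < y₁ + i * n → y₁ + i * n < x₀ + i * n + n → x₀ < n → iff ((A °) (x₀ + i * n) (y₁ + i * n)) (K (x₀ + i * n) (y₁ + i * n))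
    A-K′ i x₀ y₁ q≤x x<y y<x+n x₀<n = go y₁ x<y y<x+n (y₁ <? n)
      where
      comm : ∀ z → z + n + i * n ≡ z + i * n + n
      comm z = trans (+-assoc z n _) (trans (cong (z +_) (+-comm n _)) (sym (+-assoc z _ n)))
      go : ∀ y₁ → x₀ + i * n < y₁ + i * n → y₁ + i * n < x₀ + i * n + n → Dec (y₁ < n) → iff ((A °) (x₀ + i * n) (y₁ + i * n)) (K (x₀ + i * n) (y₁ + i * n))
      go y₁ x<y y<x+n (yes y₁<n) =
        (λ t → proj₂ (K-n q≤x x<y) (subst₂ K (comm x₀) (comm y₁) (proj₁ (K-n* i (q≤+n x₀) (+-monoˡ-< n x₀<y₁)) (proj₁ (gr-° S? x₀<y₁ y₁<n) (°-resp A (≋-kn x₀ i) (≋-kn y₁ i) t))))) ,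
        (λ h → °-resp A (≋-sym (≋-kn x₀ i)) (≋-sym (≋-kn y₁ i)) (proj₂ (gr-° S? x₀<y₁ y₁<n) (proj₂ (K-n* i (q≤+n x₀) (+-monoˡ-< n x₀<y₁)) (subst₂ K (sym (comm x₀)) (sym (comm y₁)) (proj₁ (K-n q≤x x<y) h)))))
        where
        x₀<y₁ : x₀ < y₁
        x₀<y₁ = +-cancelʳ-< (i * n) _ _ x<y
      -- The end lies in the next copy of the polygon, so its residue `y₀` precedes `x₀` and the
      -- graph stores the chord from `y₀` to `x₀`.
      go y₁ x<y y<x+n (no y₁≮n) with m≤n⇒∃[o]m+o≡n (≮⇒≥ y₁≮n)
      ... | y₀ , refl =
        (λ t → proj₂ (K-n q≤x x<y) (subst₂ K (comm x₀) (cong (_+ n) (cong (_+ i * n) (+-comm y₀ n)) ) (subst (K (x₀ + n + i * n)) (comm (y₀ + n))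
                 (proj₁ (K-n* i (q≤+n x₀) lt) (proj₁ (K-swap (q≤+n y₀)) (proj₁ (gr-° S? y₀<x₀ x₀<n) (adj-sym° (gr S?) {x₀} {y₀} (°-resp A (≋-kn x₀ i) ey₀ t)))))))) ,
        (λ h → °-resp A (≋-sym (≋-kn x₀ i)) (≋-sym ey₀) (adj-sym° (gr S?) {y₀} {x₀} (proj₂ (gr-° S? y₀<x₀ x₀<n) (proj₂ (K-swap (q≤+n y₀)) (proj₂ (K-n* i (q≤+n x₀) lt)
                 (subst (K (x₀ + n + i * n)) (sym (comm (y₀ + n))) (subst₂ K (sym (comm x₀)) (sym (cong (_+ n) (cong (_+ i * n) (+-comm y₀ n)))) (proj₁ (K-n q≤x x<y) h))))))))
        where
        y₀<x₀ : y₀ < x₀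
        y₀<x₀ = +-cancelˡ-< n y₀ x₀ (subst (n + y₀ <_) (+-comm x₀ n) (+-cancelʳ-< (i * n) _ _ (subst (n + y₀ + i * n <_) (sym (comm x₀)) y<x+n)))
        lt : x₀ + n < y₀ + n + n
        lt = +-monoˡ-< n (<-≤-trans x₀<n (m≤n+m n y₀))
        ey₀ : n + y₀ + i * n ≋ y₀
        ey₀ = ≋-trans (≋-kn (n + y₀) i) (≋-trans (≋-reflexive (+-comm n y₀)) (≋-n y₀))

    -- The graph is defined by chords with 0 ≤ x < y < n only; periodicity of `K` extends the
    -- description to every window of one period above `q`.
    A-K : ∀ {x y} → q ≤ x → x < y → y < x + n → iff ((A °) x y) (K x y)
    A-K {x} {y} q≤x x<y y<x+n = subst₂ (λ x y → iff ((A °) x y) (K x y)) (sym ex) (sym ey)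
      (A-K′ (x / n) (x % n) (y ∸ (x / n) * n) (subst (q ≤_) ex q≤x) (subst₂ _<_ ex ey x<y) (subst₂ (λ x y → y < x + n) ex ey y<x+n) (m%n<n x n))
      where
      ex : x ≡ x % n + (x / n) * n
      ex = m≡m%n+[m/n]*n x n
      ey : y ≡ y ∸ (x / n) * n + (x / n) * n
      ey = sym (m∸n+n≡m (≤-trans (≤-trans (m≤n+m _ (x % n)) (≤-reflexive (sym ex))) (<⇒≤ x<y)))

    std-A : Std A
    std-A = record
      { sym° = λ {x} {y} → adj-sym° (gr S?) {x} {y}
      ; edge° = λ x → proj₂ (°-n {x} {suc x}) (proj₂ (A-K (q≤+n x) (n<1+n _) (subst (_≤ x + n + n) (+-comm (x + n) 2) (+-monoʳ-≤ (x + n) (<⇒≤ 2<n)))) (inj₁ (L-edge (q≤+n x))))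
      ; cross° = λ {a} {b} {c} {e} p p′ p″ lt h h′ → K-cross (q≤+n a) (+-monoˡ-< n p) (+-monoˡ-< n p′) (+-monoˡ-< n p″) (+-monoˡ-< n lt)
          (proj₁ (A-K (q≤+n a) (+-monoˡ-< n (<-trans p p′)) (+-monoˡ-< n (<-trans p″ lt))) (proj₁ (°-n {a} {c}) h))
          (proj₁ (A-K (q≤+n b) (+-monoˡ-< n (<-trans p′ p″)) (+-monoˡ-< n (<-≤-trans lt (+-monoˡ-≤ n (<⇒≤ p))))) (proj₁ (°-n {b} {e}) h′)) }

    inv-A : Inv A k
    inv-A x y = go (x % n) (y % n) (m%n<n x n) (m%n<n y n) (≋-% x) (≋-% y)
      where
      lt-case : ∀ {x₀ y₀} → x₀ < y₀ → y₀ < n → iff ((A °) x₀ y₀) ((A °) (x₀ + k) (y₀ + k))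
      lt-case {x₀} {y₀} p p′ = (λ t → sh (proj₂ (A-K qk xk yk) (proj₁ (K-k (q≤+n x₀) xn) (proj₁ (A-K (q≤+n x₀) xn yn) (proj₁ (°-n {x₀} {y₀}) t)))))
                             , (λ t → proj₂ (°-n {x₀} {y₀}) (proj₂ (A-K (q≤+n x₀) xn yn) (proj₂ (K-k (q≤+n x₀) xn) (proj₁ (A-K qk xk yk) (hs t)))))
        where
        xn = +-monoˡ-< n p
        yn = +-monoˡ-< n (<-≤-trans p′ (m≤n+m n x₀))
        qk = ≤-trans (q≤+n x₀) (m≤m+n (x₀ + n) k)
        xk = +-monoˡ-< k xn
        c : ∀ z → z + n + k ≡ z + k + n
        c z = trans (+-assoc z n k) (trans (cong (z +_) (+-comm n k)) (sym (+-assoc z k n)))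
        yk : y₀ + n + k < x₀ + n + k + n
        yk = subst (y₀ + n + k <_) (trans (+-assoc (x₀ + n) n k) (trans (cong (x₀ + n +_) (+-comm n k)) (sym (+-assoc (x₀ + n) k n)))) (+-monoˡ-< k yn)
        e : ∀ z → z + n + k ≋ z + k
        e z = ≋-trans (≋-reflexive (c z)) (≋-n (z + k))
        sh : (A °) (x₀ + n + k) (y₀ + n + k) → (A °) (x₀ + k) (y₀ + k)
        sh = °-resp A (e x₀) (e y₀)
        hs : (A °) (x₀ + k) (y₀ + k) → (A °) (x₀ + n + k) (y₀ + n + k)
        hs = °-resp A (≋-sym (e x₀)) (≋-sym (e y₀))
      go : ∀ x₀ y₀ → x₀ < n → y₀ < n → x₀ ≋ x → y₀ ≋ y → A (pt x) (pt y) ≡ A (pt (x + k)) (pt (y + k))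
      go x₀ y₀ x₀<n y₀<n ex ey = subst₂ (λ i j → A i j ≡ A (pt (x + k)) (pt (y + k))) (pt-cong ex) (pt-cong ey)
        (subst₂ (λ i j → A (pt x₀) (pt y₀) ≡ A i j) (pt-cong (≋-+ ex (≋-refl {k}))) (pt-cong (≋-+ ey (≋-refl {k}))) (cmp (<-cmp x₀ y₀)))
        where
        cmp : _ → A (pt x₀) (pt y₀) ≡ A (pt (x₀ + k)) (pt (y₀ + k))
        cmp (tri< p _ _) = T-ext (proj₁ (lt-case p y₀<n)) (proj₂ (lt-case p y₀<n))
        cmp (tri> _ _ p) = trans (adj-sym (gr S?) (pt x₀) (pt y₀)) (trans (T-ext (proj₁ (lt-case p x₀<n)) (proj₂ (lt-case p x₀<n))) (adj-sym (gr S?) (pt (y₀ + k)) (pt (x₀ + k))))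
        cmp (tri≈ _ refl _) = T-ext (λ t → ⊥-elim (adj-irrefl (mk-∈ _) (pt x₀) t)) (λ t → ⊥-elim (adj-irrefl (mk-∈ _) (pt (x₀ + k)) t))

-- Codes for dissections with rotational symmetry.

module RotationCount (n : ℕ) (2<n : 2 < n) (k : ℕ) (0<k : 0 < k) (d : ℕ) (n≡dk : n ≡ suc (suc d) * k) where
  open Polygon n 2<n
  open Codes n 2<n
  open Periodic n 2<n k 0<k d n≡dk

  -- In a code (u , q , t) the forest `u` starts at `q`, and the last tree `t` ends at q + k. The
  -- condition q < ∥ t ∥ makes the arc of `t` cover the edge from k - 1 to k, with exactly `q`
  -- leaves of `t` to the right of this edge; so `q` marks a leaf of `t`. This gives the count u ·
  -- θw.
  Code : Set
  Code = Forest × (ℕ × Tree)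

  marked : ℕ → List (ℕ × Tree)
  marked i = cartesianProduct (upTo i) (trees i)

  codes : List Code
  codes = convL forests marked k

  family : Code → Rel
  family (u , q , t) a b = Arc* u q a b ⊎ Arc t (q + ∥ u ∥*) a b

  family? : ∀ c a b → Dec (family c a b)
  family? (u , q , t) a b = arc*? u q a b ⊎-dec arc? t (q + ∥ u ∥*) a b

  ∈-codes⁻ : ∀ {u q t} → (u , q , t) ∈ codes → ∥ u ∥* + ∥ t ∥ ≡ k × q < ∥ t ∥
  ∈-codes⁻ {u} {q} {t} c∈ with ∈-convL⁻ forests marked c∈
  ... | i , i≤k , u∈ , qt∈ with ∈-cartesianProduct⁻ (upTo (k ∸ i)) (trees (k ∸ i)) qt∈
  ... | q∈ , t∈ with Sized.sound sized-trees {k ∸ i} t∈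
  ... | e = trans (cong₂ _+_ (Sized.sound sized-forests {i} u∈) e) (m+[n∸m]≡n i≤k) , subst (q <_) (sym e) (∈-upTo⁻ q∈)

  ∈-codes⁺ : ∀ {u q t} → ∥ u ∥* + ∥ t ∥ ≡ k → q < ∥ t ∥ → (u , q , t) ∈ codes
  ∈-codes⁺ {u} {q} {t} e q< = ∈-convL⁺ forests marked (≤-trans (m≤m+n _ ∥ t ∥) (≤-reflexive e)) (Sized.complete sized-forests u)
    (∈-cartesianProduct⁺ (∈-upTo⁺ (subst (q <_) e′ q<)) (∈-sized sized-trees {t} e′))
    where
    e′ : ∥ t ∥ ≡ k ∸ ∥ u ∥*
    e′ = trans (sym (m+n∸m≡n ∥ u ∥* ∥ t ∥)) (cong (_∸ ∥ u ∥*) e)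

  unique-codes : Unique codes
  unique-codes = unique-concatMap (λ c → ∥ proj₁ c ∥*) (λ i → cartesianProduct (forests i) (marked (k ∸ i))) (UP.upTo⁺ (suc k))
    (λ i → UP.cartesianProduct⁺ (Sized.unique sized-forests i) (UP.cartesianProduct⁺ (UP.upTo⁺ (k ∸ i)) (Sized.unique sized-trees (k ∸ i))))
    (λ {i} m → Sized.sound sized-forests {i} (proj₁ (∈-cartesianProduct⁻ (forests i) (marked (k ∸ i)) m)))

  card-codes : ⟪ length codes ⟫ ≡ Sch.rot k
  card-codes = trans (card-conv forests marked k) (Σ<-cong (suc k) (λ i _ → cong (card forests i ℚ.*_)
    (trans (cong ⟪_⟫ (trans (length-cartesianProduct (upTo (k ∸ i)) (trees (k ∸ i))) (cong (_* length (trees (k ∸ i))) (length-upTo (k ∸ i))))) (⟪⟫-* (k ∸ i) _))))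

  fam-code : ∀ {u q t} → ∥ u ∥* + ∥ t ∥ ≡ k → Fam (family (u , q , t)) q (q + k)
  fam-code {u} {q} {t} e = subst (Fam _ q) (trans (+-assoc q _ _) (cong (q +_) e)) (fam-++ (fam* u q) (fam t (q + ∥ u ∥*)))

  q<k : ∀ {u q t} → ∥ u ∥* + ∥ t ∥ ≡ k → q < ∥ t ∥ → q < k
  q<k e q< = <-≤-trans q< (≤-trans (m≤n+m _ _) (≤-reflexive e))

  P<k : ∀ {u q t} → ∥ u ∥* + ∥ t ∥ ≡ k → q < ∥ t ∥ → q + ∥ u ∥* < k
  P<k {u} {q} e q< = <-≤-trans (+-monoˡ-< ∥ u ∥* q<) (≤-reflexive (trans (+-comm _ ∥ u ∥*) e))

  module At {u q t} (e : ∥ u ∥* + ∥ t ∥ ≡ k) (q< : q < ∥ t ∥) where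
    open Chords (family? (u , q , t)) q (q<k {u} {q} {t} e q<) (fam-code {u} {q} {t} e) public
    open Lift k 0<k (family? (u , q , t)) q (fam-code {u} {q} {t} e) public

  S : Code → Rel
  S c = chord n k 0<k (family c) (proj₁ (proj₂ c))

  S? : ∀ c x y → Dec (S c x y)
  S? c = chord? n k 0<k (family? c) (proj₁ (proj₂ c))

  code-std : ∀ {c} → c ∈ codes → Std (adj (gr (S? c)))
  code-std {u , q , t} c∈ = At.std-A {u} {q} {t} (proj₁ (∈-codes⁻ {u} {q} {t} c∈)) (proj₂ (∈-codes⁻ {u} {q} {t} c∈))

  code-inv : ∀ {c} → c ∈ codes → Inv (adj (gr (S? c))) k
  code-inv {u , q , t} c∈ = At.inv-A {u} {q} {t} (proj₁ (∈-codes⁻ {u} {q} {t} c∈)) (proj₂ (∈-codes⁻ {u} {q} {t} c∈))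

  module Inject {u q t u′ q′ t′} (e : ∥ u ∥* + ∥ t ∥ ≡ k) (q< : q < ∥ t ∥) (e′ : ∥ u′ ∥* + ∥ t′ ∥ ≡ k) (q<′ : q′ < ∥ t′ ∥)
    (same : gr (S? (u , q , t)) ≡ gr (S? (u′ , q′ , t′))) where
    module C  = At {u} {q} {t} e q<
    module C′ = At {u′} {q′} {t′} e′ q<′

    P P′ : ℕ
    P  = q + ∥ u ∥*
    P′ = q′ + ∥ u′ ∥*

    -- From `k` on both periodic families are defined, whatever the offsets, and arcs of length at
    -- most `k` can be recovered from the graph by `K-short`.
    transfer : ∀ {x y} → k ≤ x → C.L x y → C′.L x y
    transfer {x} {y} k≤x h = C′.K-short q′≤x x<y y≤ (proj₁ (C′.A-K q′≤x x<y y<x+n) (subst (λ G → (adj G °) x y) same (proj₂ (C.A-K q≤x x<y y<x+n) (inj₁ h))))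
      where
      q≤x = ≤-trans (<⇒≤ (q<k {u} {q} {t} e q<)) k≤x
      q′≤x = ≤-trans (<⇒≤ (q<k {u′} {q′} {t′} e′ q<′)) k≤x
      x<y = proj₁ (C.L-range q≤x h)
      y≤ = proj₂ (C.L-range q≤x h)
      y<x+n = ≤-<-trans y≤ (+-monoʳ-< x k<n)

    1* : ∀ x → x + 1 * k ≡ x + k
    1* x = cong (x +_) (+-identityʳ k)

    top : C′.L (P + k) (q + k + k)
    top = transfer (m≤n+m k P) (subst₂ C.L (1* P) (1* (q + k)) (C.L⁺ {P} {q + k} 1 (inj₂ (subst (Arc t P P) (trans (+-assoc q _ _) (cong (q +_) e)) (arc-top t P)))))

    -- Both outer arcs cover the edge from k - 1 to k, so the one of the second code contains the one of the first.
    nested : P′ ≤ P × q ≤ q′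
    nested with C′.L⁻ (≤-trans (<⇒≤ (q<k {u′} {q′} {t′} e′ q<′)) (m≤n+m k P)) top
    ... | a , b , suc (suc j) , _ , ea , _ = ⊥-elim (<⇒≱ (+-monoˡ-< k (P<k {u} {q} {t} e q<)) (≤-trans (≤-trans (+-monoʳ-≤ k (m≤m+n k (j * k))) (m≤n+m _ a)) (≤-reflexive (sym ea))))
    ... | a , b , zero , h , _ , eb = ⊥-elim (<⇒≱ (+-monoˡ-< k (q<k {u′} {q′} {t′} e′ q<′)) (≤-trans (+-monoˡ-≤ k (m≤n+m k q)) (≤-trans (≤-reflexive (trans eb (+-identityʳ b))) (proj₂ (proj₂ (Fam.range (fam-code {u′} {q′} {t′} e′) h))))))
    ... | a , b , suc zero , inj₁ h , _ , eb = ⊥-elim (<⇒≱ (P<k {u′} {q′} {t′} e′ q<′) (≤-trans (≤-trans (m≤n+m k q) (≤-reflexive (+-cancelʳ-≡ k _ _ (trans eb (1* b))))) (proj₂ (proj₂ (Fam.range (fam* u′ q′) h)))))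
    ... | a , b , suc zero , inj₂ h , ea , eb with Fam.range (fam t′ P′) h
    ... | P′≤a , _ , b≤ = subst (P′ ≤_) (sym (+-cancelʳ-≡ k _ _ (trans ea (1* a)))) P′≤a
                        , +-cancelʳ-≤ k _ _ (≤-trans (≤-reflexive (+-cancelʳ-≡ k _ _ (trans eb (1* b)))) (≤-trans b≤ (≤-reflexive (trans (+-assoc q′ _ _) (cong (q′ +_) e′)))))

    base : ∀ {a b} → q ≡ q′ → family (u , q , t) a b → family (u′ , q′ , t′) a b
    base {a} {b} refl h = C′.L-base q≤a (<-≤-trans a<b b≤) (C′.L-unshift q≤a (transfer (m≤n+m k a) (subst₂ C.L (1* a) (1* b) (C.L⁺ 1 h))))
      where
      r = Fam.range (fam-code {u} {q} {t} e) h
      q≤a = proj₁ r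
      a<b = proj₁ (proj₂ r)
      b≤ = proj₂ (proj₂ r)

  -- Nesting in both directions makes the two outer arcs equal, so the offsets agree; the forests
  -- and trees are then determined by their arcs.
  code-inj : ∀ {c c′} → c ∈ codes → c′ ∈ codes → gr (S? c) ≡ gr (S? c′) → c ≡ c′
  code-inj {u , q , t} {u′ , q′ , t′} c∈ c′∈ same = go (≤-antisym (proj₂ I.nested) (proj₂ I′.nested)) (≤-antisym (proj₁ I′.nested) (proj₁ I.nested)) I.base I′.base
    where
    e = proj₁ (∈-codes⁻ {u} {q} {t} c∈)
    q< = proj₂ (∈-codes⁻ {u} {q} {t} c∈)
    e′ = proj₁ (∈-codes⁻ {u′} {q′} {t′} c′∈)
    q<′ = proj₂ (∈-codes⁻ {u′} {q′} {t′} c′∈)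
    module I  = Inject {u} {q} {t} {u′} {q′} {t′} e q< e′ q<′ same
    module I′ = Inject {u′} {q′} {t′} {u} {q} {t} e′ q<′ e q< (sym same)
    go : ∀ {q′} → q ≡ q′ → q + ∥ u ∥* ≡ q′ + ∥ u′ ∥* → (∀ {a b} → q ≡ q′ → family (u , q , t) a b → family (u′ , q′ , t′) a b) →
      (∀ {a b} → q′ ≡ q → family (u′ , q′ , t′) a b → family (u , q , t) a b) → (u , q , t) ≡ (u′ , q′ , t′)
    go refl P≡ f g = fin (split-≐ (fam* u q) (fam t (q + ∥ u ∥*)) (subst (Fam (Arc* u′ q) q) (sym P≡) (fam* u′ q)) (fam t′ (q + ∥ u ∥*))
        (λ {a} {b} → (λ h → subst (λ p → Arc* u′ q a b ⊎ Arc t′ p a b) (sym P≡) (f {a} {b} refl h)) , (λ h → g {a} {b} refl (subst (λ p → Arc* u′ q a b ⊎ Arc t′ p a b) P≡ h))))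
      where
      fin : Arc* u q ≐ Arc* u′ q × Arc t (q + ∥ u ∥*) ≐ Arc t′ (q + ∥ u ∥*) → (u , q , t) ≡ (u′ , q , t′)
      fin (h , h′) = cong₂ (λ u t → u , q , t) (arc*-injective u u′ q h) (arc-injective t t′ (q + ∥ u ∥*) h′)

  module Complete {A : Adj} (std : Std A) (inv : Inv A k) where

    up : ∀ {x y} → (A °) x y → (A °) (x + k) (y + k)
    up {x} {y} = subst T (inv x y)

    down : ∀ {x y} → (A °) (x + k) (y + k) → (A °) x y
    down {x} {y} = subst T (sym (inv x y))

    ups : ∀ j {x y} → (A °) x y → (A °) (x + j * k) (y + j * k)
    ups zero    {x} {y} h = subst₂ (A °) (sym (+-identityʳ x)) (sym (+-identityʳ y)) h
    ups (suc j) {x} {y} h = subst₂ (A °) (e x) (e y) (up (ups j h))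
      where
      e : ∀ x → x + j * k + k ≡ x + suc j * k
      e x = trans (+-assoc x _ k) (cong (x +_) (+-comm (j * k) k))

    downs : ∀ j {x y} → (A °) (x + j * k) (y + j * k) → (A °) x y
    downs zero    {x} {y} h = subst₂ (A °) (+-identityʳ x) (+-identityʳ y) h
    downs (suc j) {x} {y} h = downs j (down (subst₂ (A °) (sym (e x)) (sym (e y)) h))
      where
      e : ∀ x → x + j * k + k ≡ x + suc j * k
      e x = trans (+-assoc x _ k) (cong (x +_) (+-comm (j * k) k))

    -- An arc of length τ that covers the edge from k - 1 to k, written by its overhang `q` beyond
    -- `k`; it starts before `k` because q < τ.
    Covering : ℕ → Set
    Covering τ = ∃[ q ] (q < τ × (A °) (q + (k ∸ τ)) (q + k))

    outer : ∃[ τ ] (0 < τ × τ ≤ k × Covering τ × (∀ j → τ < j → j ≤ k → ¬ Covering j))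
    outer = largest (λ τ → anyUpTo? (λ q → °? A (q + (k ∸ τ)) (q + k)) τ) 0 k 0<k
      -- The edge itself is the covering arc of length 1, so a longest one of length at most `k`
      -- exists.
      (0 , s≤s z≤n , subst ((A °) (k ∸ 1)) (m+[n∸m]≡n 0<k) (edge° std (k ∸ 1)))

    module Found {τ q : ℕ} (0<τ : 0 < τ) (τ≤k : τ ≤ k) (q<τ : q < τ) (hq : (A °) (q + (k ∸ τ)) (q + k))
      (max : ∀ j → τ < j → j ≤ k → ¬ Covering j) where
      P : ℕ
      P = q + (k ∸ τ)

      P+τ : P + τ ≡ q + k
      P+τ = trans (+-assoc q _ τ) (cong (q +_) (m∸n+n≡m τ≤k))

      P<k′ : P < k
      P<k′ = <-≤-trans (+-monoˡ-< (k ∸ τ) q<τ) (≤-reflexive (m+[n∸m]≡n τ≤k))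

      P<q+k : P < q + k
      P<q+k = subst (P <_) P+τ (m<m+n P 0<τ)

      -- Such an arc covers the fixed edge with length b - a between τ + 1 and `k`, contrary to the
      -- maximality of τ.
      too-long : ∀ {a b} → a < k → k ≤ b → b ≤ a + k → a + τ < b → ¬ (A °) a b
      too-long {a} {b} a<k k≤b b≤a+k a+τ<b h with m≤n⇒∃[o]m+o≡n k≤b
      ... | q′ , refl = max τ′ τ<τ′ τ′≤k (q′ , q′<τ′ , subst₂ (A °) ea (+-comm k q′) h)
        where
        τ′ = q′ + (k ∸ a)
        a+τ′ : a + τ′ ≡ k + q′
        a+τ′ = trans (cong (a +_) (+-comm q′ (k ∸ a))) (trans (sym (+-assoc a (k ∸ a) q′)) (cong (_+ q′) (m+[n∸m]≡n (<⇒≤ a<k))))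
        τ<τ′ : τ < τ′
        τ<τ′ = +-cancelˡ-< a τ τ′ (subst (a + τ <_) (sym a+τ′) a+τ<b)
        τ′≤k : τ′ ≤ k
        τ′≤k = +-cancelˡ-≤ a τ′ k (subst (_≤ a + k) (sym a+τ′) b≤a+k)
        q′<τ′ : q′ < τ′
        q′<τ′ = m<m+n q′ (m<n⇒0<n∸m a<k)
        ea : a ≡ q′ + (k ∸ τ′)
        ea = sym (+-cancelʳ-≡ τ′ _ _ (trans (+-assoc q′ _ τ′) (trans (cong (q′ +_) (m∸n+n≡m τ′≤k)) (trans (+-comm q′ k) (sym a+τ′)))))

      tree : ∃[ t ] (P + ∥ t ∥ ≡ q + k × Agree (A °) (Arc t P) P (q + k))
      tree = arc-complete {R = A °} (°? A) (q + k + (q + k)) P (q + k) (m≤n+m _ (suc (P + P))) P<q+k hq (std-edges {A} std P (q + k))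
        (std-noncrossing {A} std P (q + k) (subst (_< P + n) P+τ (+-monoʳ-< P (≤-<-trans τ≤k k<n))))

      forest : ∃[ u ] (q + ∥ u ∥* ≡ P × Agree (A °) (Arc* u q) q P)
      forest = arc*-complete {R = A °} (°? A) (P + P) q P (m≤n+m _ (q + q)) (m≤m+n q _) (std-edges {A} std q P)
        (std-noncrossing {A} std q P (+-monoʳ-< q (≤-<-trans (m∸n≤m k τ) k<n)))

      module Coded (t : Tree) (et : P + ∥ t ∥ ≡ q + k) (agt : Agree (A °) (Arc t P) P (q + k))
                   (u : Forest) (eu : q + ∥ u ∥* ≡ P) (agu : Agree (A °) (Arc* u q) q P) where
        size-t : ∥ t ∥ ≡ τ
        size-t = +-cancelˡ-≡ P _ _ (trans et (sym P+τ))

        e : ∥ u ∥* + ∥ t ∥ ≡ k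
        e = +-cancelˡ-≡ q _ _ (trans (sym (+-assoc q _ _)) (trans (cong (_+ ∥ t ∥) eu) et))

        q< : q < ∥ t ∥
        q< = subst (q <_) (sym size-t) q<τ

        B : Rel
        B = family (u , q , t)

        B⇒A : ∀ {a b} → B a b → (A °) a b
        B⇒A {a} {b} (inj₁ h) = let (p , p′ , p″) = Fam.range (fam* u q) h in proj₂ (agu p p′ (subst (b ≤_) eu p″)) h
        B⇒A {a} {b} (inj₂ h) = let (p , p′ , p″) = Fam.range (fam t (q + ∥ u ∥*)) h in
          proj₂ (agt (subst (_≤ a) eu p) p′ (subst (b ≤_) (trans (cong (_+ ∥ t ∥) eu) et) p″)) (subst (λ p → Arc t p a b) eu h)

        -- No arc of length at most `k` leaves the two pieces [q, P] and [P, q + k]: it would cross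
        -- the outer arc, or cover the fixed edge and exceed the outer arc in length.
        A⇒B : ∀ {a b} → q ≤ a → a < q + k → a < b → b ≤ a + k → (A °) a b → B a b
        A⇒B {a} {b} q≤a a<q+k a<b b≤a+k h with a <? P
        ... | yes a<P = left (b ≤? P) (b <? q + k)
          where
          left : Dec (b ≤ P) → Dec (b < q + k) → B a b
          left (yes b≤P) _ = inj₁ (proj₁ (agu q≤a a<b b≤P) h)
          left (no b≰P) (yes b<q+k) = ⊥-elim (cross° std a<P (≰⇒> b≰P) b<q+k (≤-<-trans (+-monoˡ-≤ k q≤a) (+-monoʳ-< a k<n)) h hq)
          left (no b≰P) (no b≮q+k) = ⊥-elim (too-long (<-trans a<P P<k′) (≤-trans (m≤n+m k q) (≮⇒≥ b≮q+k)) b≤a+k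
            (<-≤-trans (+-monoˡ-< τ a<P) (≤-trans (≤-reflexive P+τ) (≮⇒≥ b≮q+k))) h)
        ... | no a≮P = right (b ≤? q + k) (m≤n⇒m<n∨m≡n (≮⇒≥ a≮P))
          where
          right : Dec (b ≤ q + k) → P < a ⊎ P ≡ a → B a b
          right (yes b≤) _ = inj₂ (subst (λ p → Arc t p a b) (sym eu) (proj₁ (agt (≮⇒≥ a≮P) a<b b≤) h))
          right (no b≰) (inj₁ P<a) = ⊥-elim (cross° std P<a a<q+k (≰⇒> b≰) (<-≤-trans (≤-<-trans b≤a+k (+-monoˡ-< k a<q+k))
            (≤-trans (≤-reflexive (+-assoc q k k)) (+-mono-≤ (m≤m+n q _) k+k≤n))) hq h)
          right (no b≰) (inj₂ P≡a) = ⊥-elim (too-long (subst (_< k) P≡a P<k′) (≤-trans (m≤n+m k q) (<⇒≤ (≰⇒> b≰))) b≤a+k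
            (subst (_< b) (trans (sym P+τ) (cong (_+ τ) P≡a)) (≰⇒> b≰)) h)

        open At {u} {q} {t} e q< using (L; L⁻; L⁺; rep; K; q≤+n)

        L⇒A : ∀ {x y} → q ≤ x → L x y → (A °) x y
        L⇒A q≤x h with L⁻ q≤x h
        ... | a , b , j , h′ , refl , refl = ups j (B⇒A h′)

        A⇒L : ∀ {x y} → q ≤ x → x < y → y ≤ x + k → (A °) x y → L x y
        A⇒L {x} {y} q≤x x<y y≤ h with rep q≤x
        ... | r , j , r<k , refl = subst (L (q + r + j * k)) (sym y≡) (L⁺ j (A⇒B (m≤m+n q r) (+-monoʳ-< q r<k)
            (+-cancelʳ-< (j * k) _ _ (subst (q + r + j * k <_) y≡ x<y))
            (+-cancelʳ-≤ (j * k) _ _ (subst (_≤ q + r + k + j * k) y≡ (≤-trans y≤ (≤-reflexive (trans (+-assoc (q + r) _ k) (trans (cong (q + r +_) (+-comm (j * k) k)) (sym (+-assoc (q + r) k _))))))))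
            (downs j (subst ((A °) (q + r + j * k)) y≡ h))))
          where
          y≡ : y ≡ (y ∸ j * k) + j * k
          y≡ = sym (m∸n+n≡m (≤-trans (m≤n+m _ (q + r)) (<⇒≤ x<y)))

        A⇔K : ∀ {x y} → q ≤ x → x < y → y < x + n → iff ((A °) x y) (K x y)
        A⇔K {x} {y} q≤x x<y y<x+n = to (y ≤? x + k) (x + n ≤? y + k) , from
          where
          wrap : (A °) x y → (A °) y (x + n)
          wrap h = °-resp A (≋-refl {y}) (≋-sym (≋-n x)) (sym° std h)
          to : Dec (y ≤ x + k) → Dec (x + n ≤ y + k) → (A °) x y → K x y
          to (yes p) _ h = inj₁ (A⇒L q≤x x<y p h)
          to (no _) (yes p) h = inj₂ (A⇒L (≤-trans q≤x (<⇒≤ x<y)) y<x+n p (wrap h))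
          -- A chord longer than `k` on both sides crosses its own rotation by `k`, since x < x + k
          -- < y < y + k < x + n. Hence in a symmetric dissection every chord is an arc of length at
          -- most `k` in one of its two readings.
          to (no p) (no p′) h = ⊥-elim (cross° std (m<m+n x 0<k) (≰⇒> p) (m<m+n y 0<k) (≰⇒> p′) h (up h))
          from : K x y → (A °) x y
          from (inj₁ h) = L⇒A q≤x h
          from (inj₂ h) = sym° std (°-resp A (≋-refl {y}) (≋-n x) (L⇒A (≤-trans q≤x (<⇒≤ x<y)) h))

        agree : ∀ {x y} → x < y → y < n → iff ((A °) x y) (S (u , q , t) x y)
        agree {x} {y} x<y y<n = (λ h → proj₁ k′ (°-resp A (≋-sym (≋-n x)) (≋-sym (≋-n y)) h)) , (λ h → °-resp A (≋-n x) (≋-n y) (proj₂ k′ h))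
          where
          k′ = A⇔K (q≤+n x) (+-monoˡ-< n x<y) (+-monoˡ-< n (<-≤-trans y<n (m≤n+m n x)))

        coded : ∃[ c ] (c ∈ codes × (∀ {x y} → x < y → y < n → iff ((A °) x y) (S c x y)))
        coded = (u , q , t) , ∈-codes⁺ {u} {q} {t} e q< , agree

      found : ∃[ c ] (c ∈ codes × (∀ {x y} → x < y → y < n → iff ((A °) x y) (S c x y)))
      found = let (t , et , agt) = tree ; (u , eu , agu) = forest in Coded.coded t et agt u eu agu

    code-complete : ∃[ c ] (c ∈ codes × (∀ {x y} → x < y → y < n → iff ((A °) x y) (S c x y)))
    code-complete = let (τ , 0<τ , τ≤k , (q , q<τ , hq) , max) = outer in Found.found {τ} {q} 0<τ τ≤k q<τ hq max

  module _ (m : Mono) where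
    open Reduction n 2<n m
    open Identity n 2<n m

    inv-mult : ∀ {A} c j → Inv A c → Inv A (j * c)
    inv-mult {A} c zero    h x y = cong₂ (λ a b → A (pt a) (pt b)) (sym (+-identityʳ x)) (sym (+-identityʳ y))
    inv-mult {A} c (suc j) h x y = trans (inv-mult {A} c j h x y) (trans (h (x + j * c) (y + j * c)) (cong₂ (λ a b → A (pt a) (pt b)) (e x) (e y)))
      where
      e : ∀ x → x + j * c + c ≡ x + suc j * c
      e x = trans (+-assoc x _ c) (cong (x +_) (+-comm (j * c) c))

    inv-cong : ∀ {A c c′} → c ≋ c′ → Inv A c → Inv A c′
    inv-cong {A} e h x y = trans (h x y) (cong₂ A (pt-cong (≋-+ (≋-refl {x}) e)) (pt-cong (≋-+ (≋-refl {y}) e)))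

    -- The congruences say that the rotations by `a` and by `k` generate the same group, so they fix
    -- the same dissections.
    rotation-count : ∀ {a} j j′ → a ≋ j * k → k ≋ j′ * a → count (isoQ (rot a)) (graphs n) ≡ length codes
    rotation-count {a} j j′ e e′ = code-count codes unique-codes S S? (isoQ (rot a))
      (λ {c} c∈ → let G = gr (S? c) in ∧⁺ (std⁺ G (code-std {c} c∈)) (iso⁺ G G (rot a) (λ i₁ i₂ →
        trans (trans (cong₂ (adj G) (sym (pt-toℕ i₁)) (sym (pt-toℕ i₂))) (inv-cong {adj G} (≋-sym e) (inv-mult {adj G} k j (code-inv {c} c∈)) (toℕ i₁) (toℕ i₂)))
          (cong₂ (adj G) (r i₁) (r i₂)))))
      (λ {c} {c′} c∈ c′∈ h → code-inj {c} {c′} c∈ c′∈ (graph-ext (mk-∈ _) (mk-∈ _) (λ {i₁} {i₂} lt → T-ext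
        (λ t → dn (gr (S? c′)) i₁ i₂ (proj₂ (gr-° (S? c′) lt (FP.toℕ<n i₂)) (proj₁ (h lt (FP.toℕ<n i₂)) (proj₁ (gr-° (S? c) lt (FP.toℕ<n i₂)) (up (gr (S? c)) i₁ i₂ t)))))
        (λ t → dn (gr (S? c)) i₁ i₂ (proj₂ (gr-° (S? c) lt (FP.toℕ<n i₂)) (proj₂ (h lt (FP.toℕ<n i₂)) (proj₁ (gr-° (S? c′) lt (FP.toℕ<n i₂)) (up (gr (S? c′)) i₁ i₂ t))))))))
      (λ {G} G∈ h → let (st , is) = ∧⁻ {stdB G} h in Complete.code-complete {adj G} (std⁻ G st)
        (inv-cong {adj G} (≋-sym e′) (inv-mult {adj G} a j′ (λ x y → trans (iso⁻ G G (rot a) is (pt x) (pt y)) (cong₂ (adj G) (rot-at a x) (rot-at a y))))))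
      where
      r : ∀ i → pt (toℕ i + a) ≡ lookup (rot a) i
      r i = trans (sym (rot-at a (toℕ i))) (cong (lookup (rot a)) (pt-toℕ i))
      up : ∀ G i j → T (adj G i j) → (adj G °) (toℕ i) (toℕ j)
      up G i j = subst₂ (λ i j → T (adj G i j)) (sym (pt-toℕ i)) (sym (pt-toℕ j))
      dn : ∀ G i j → (adj G °) (toℕ i) (toℕ j) → T (adj G i j)
      dn G i j = subst₂ (λ i j → T (adj G i j)) (pt-toℕ i) (pt-toℕ j)

-- Dissections with a reflection symmetry: folding the right half onto one extra vertex

-- The reflection is x ↦ N - x. For N = n - 1 its axis passes through the edge between n - 1 and 0,
-- for N = n through the vertex 0. The left half is 0, ..., k with k the integer part of N / 2, and
-- k + 1 stands for the mirror side, so the folded dissection is a tree with k + 1 leaves.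
module Folding (n : ℕ) (2<n : 2 < n) (N k : ℕ) (k+k≤N : k + k ≤ N) (N≤ : N ≤ suc (k + k)) (Nn : suc N ≡ n ⊎ N ≡ n) where
  open Polygon n 2<n
  open Codes n 2<n

  opaque
    side : suc N ≡ n ⊎ N ≡ n
    side = Nn

  n≤1+N : n ≤ suc N
  n≤1+N with side
  ... | inj₁ e = ≤-reflexive (sym e)
  ... | inj₂ e = ≤-trans (≤-reflexive (sym e)) (n≤1+n N)

  N≤n : N ≤ n
  N≤n with side
  ... | inj₁ e = ≤-trans (n≤1+n N) (≤-reflexive e)
  ... | inj₂ e = ≤-reflexive e

  <n⇒≤N : ∀ {x} → x < n → x ≤ N
  <n⇒≤N x<n = ≤-pred (≤-trans x<n n≤1+N)

  N∸<n : ∀ {x} → 0 < x → x ≤ N → N ∸ x < n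
  N∸<n {x} 0<x x≤N = <-≤-trans (∸-monoʳ-< 0<x x≤N) N≤n

  0<k : 0 < k
  0<k = n≢0⇒n>0 (λ k≡0 → <⇒≱ (≤-pred (≤-trans 2<n n≤1+N)) (subst (λ k → N ≤ suc (k + k)) k≡0 N≤))

  k<N : k < N
  k<N = <-≤-trans (m<m+n k 0<k) k+k≤N

  k≤N : k ≤ N
  k≤N = <⇒≤ k<N

  k<n : k < n
  k<n = <-≤-trans k<N N≤n

  folded : ∀ {x} → x ≤ N → x + (N ∸ x) ≡ N
  folded = m+[n∸m]≡n

  -- E x y, for x < y ≤ N: both ends on the left, both on the right, or mirror images of each other.
  E : Rel → Rel
  E T x y = (y ≤ k × T x y) ⊎ ((N ∸ x ≤ k × T (N ∸ y) (N ∸ x)) ⊎ (x + y ≡ N × T x (suc k)))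

  -- When N = n, the vertex 0 also occurs as its mirror image n, so a chord at 0 may have to be read
  -- as a chord ending at n.
  S : Rel → Rel
  S T x y = E T x y ⊎ ((x ≡ 0 × N ≡ n) × E T y n)

  E? : ∀ {T} → (∀ a b → Dec (T a b)) → ∀ x y → Dec (E T x y)
  E? T? x y = ((y ≤? k) ×-dec T? x y) ⊎-dec (((N ∸ x ≤? k) ×-dec T? (N ∸ y) (N ∸ x)) ⊎-dec ((x + y ≟ N) ×-dec T? x (suc k)))

  S? : ∀ {T} → (∀ a b → Dec (T a b)) → ∀ x y → Dec (S T x y)
  S? T? x y = E? T? x y ⊎-dec (((x ≟ 0) ×-dec (N ≟ n)) ×-dec E? T? y n)

  right⇒≥k : ∀ {x} → x ≤ N → N ∸ x ≤ k → k ≤ x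
  right⇒≥k {x} x≤N le = +-cancelʳ-≤ k k x (≤-trans k+k≤N (≤-trans (≤-reflexive (sym (folded x≤N))) (+-monoʳ-≤ x le)))

  mirror⇒≤k : ∀ {x y} → x < y → x + y ≡ N → x ≤ k
  mirror⇒≤k {x} {y} x<y e with x ≤? k
  ... | yes p = p
  ... | no ¬p = ⊥-elim (<⇒≱ (+-mono-≤-< (≰⇒> ¬p) (<-trans (≰⇒> ¬p) x<y)) (≤-trans (≤-reflexive e) N≤))

  mirror⇒≥k : ∀ {x y} → x < y → x + y ≡ N → k ≤ y
  mirror⇒≥k {x} {y} x<y e with k ≤? y
  ... | yes p = p
  ... | no ¬p = ⊥-elim (<⇒≱ (+-mono-< (<-trans x<y (≰⇒> ¬p)) (≰⇒> ¬p)) (≤-trans k+k≤N (≤-reflexive (sym e))))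

  mirror∸ : ∀ {x y} → x + y ≡ N → N ∸ y ≡ x
  mirror∸ {x} {y} e = trans (cong (_∸ y) (sym e)) (m+n∸n≡m x y)

  mirror∸′ : ∀ {x y} → x + y ≡ N → N ∸ x ≡ y
  mirror∸′ {x} {y} e = trans (cong (_∸ x) (sym e)) (m+n∸m≡n x y)

  module Family {T : Rel} (T? : ∀ a b → Dec (T a b)) (famT : Fam T 0 (suc k)) (top : T 0 (suc k)) where

    E-cross : ∀ {a b c d} → a < b → b < c → c < d → d ≤ N → E T a c → E T b d → ⊥
    E-cross p q r le (inj₁ (_ , h)) (inj₁ (_ , h′)) = Fam.cross famT p q r h h′
    E-cross {a} {b} p q r le (inj₁ (c≤k , _)) (inj₂ (inj₁ (b≥ , _))) = <⇒≱ (<-≤-trans q c≤k) (right⇒≥k (≤-trans (<⇒≤ (<-trans q r)) le) b≥)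
    E-cross p q r le (inj₁ (c≤k , h)) (inj₂ (inj₂ (_ , h′))) = Fam.cross famT p q (s≤s c≤k) h h′
    E-cross p q r le (inj₂ (inj₁ (a≥ , _))) (inj₁ (d≤k , _)) = <⇒≱ (<-trans p (<-trans q r)) (≤-trans d≤k (right⇒≥k (≤-trans (<⇒≤ (<-trans p (<-trans q r))) le) a≥))
    E-cross p q r le (inj₂ (inj₁ (_ , h))) (inj₂ (inj₁ (_ , h′))) =
      Fam.cross famT (∸-monoʳ-< r le) (∸-monoʳ-< q (≤-trans (<⇒≤ r) le)) (∸-monoʳ-< p (≤-trans (<⇒≤ (<-trans q r)) le)) h′ h
    E-cross p q r le (inj₂ (inj₁ (a≥ , _))) (inj₂ (inj₂ (e , _))) =
      <⇒≱ p (≤-trans (mirror⇒≤k (<-trans q r) e) (right⇒≥k (≤-trans (<⇒≤ (<-trans p (<-trans q r))) le) a≥))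
    E-cross p q r le (inj₂ (inj₂ (e , _))) (inj₁ (d≤k , _)) = <⇒≱ r (≤-trans d≤k (mirror⇒≥k (<-trans p q) e))
    E-cross {a} {b} {c} {d} p q r le (inj₂ (inj₂ (e , h))) (inj₂ (inj₁ (b≥ , h′))) =
      Fam.cross famT (subst (N ∸ d <_) (mirror∸ e) (∸-monoʳ-< r le)) (subst (_< N ∸ b) (mirror∸ e) (∸-monoʳ-< q (≤-trans (<⇒≤ r) le))) (s≤s b≥) h′ h
    E-cross {a} {b} {c} {d} p q r le (inj₂ (inj₂ (e , _))) (inj₂ (inj₂ (e′ , _))) = <-irrefl (trans e (sym e′)) (+-mono-< p r)

    E-sym : ∀ {x y} → x < y → y ≤ N → E T x y → E T (N ∸ y) (N ∸ x)
    E-sym {x} {y} p le (inj₁ (y≤k , h)) = inj₂ (inj₁ (subst (_≤ k) (sym (m∸[m∸n]≡n le)) y≤k , subst₂ T (sym (m∸[m∸n]≡n (≤-trans (<⇒≤ p) le))) (sym (m∸[m∸n]≡n le)) h))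
    E-sym {x} {y} p le (inj₂ (inj₁ (x≥ , h))) = inj₁ (x≥ , h)
    E-sym {x} {y} p le (inj₂ (inj₂ (e , h))) = subst₂ (E T) (sym (mirror∸ e)) (sym (mirror∸′ e)) (inj₂ (inj₂ (e , h)))

    E-edge : ∀ {x} → suc x ≤ N → E T x (suc x)
    E-edge {x} le with suc x ≤? k | N ∸ x ≤? k
    ... | yes p | _ = inj₁ (p , Fam.edge famT z≤n (m≤n⇒m≤1+n p))
    ... | no _ | yes p = inj₂ (inj₁ (p , subst (T (N ∸ suc x)) (sym e) (Fam.edge famT z≤n (s≤s (≤-trans (≤-trans (n≤1+n _) (≤-reflexive (sym e))) p)))))
      where
      e : N ∸ x ≡ suc (N ∸ suc x)
      e = +-∸-assoc 1 le
    -- Neither half contains the edge, so N = 2k + 1 and it is the middle edge from k to k + 1,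
    -- which is its own mirror image.
    ... | no p | no p′ = inj₂ (inj₂ (trans (cong₂ (λ a b → a + suc b) x≡k x≡k) (trans (+-suc k k) (sym N≡)) , subst (λ x → T x (suc k)) (sym x≡k) (Fam.edge famT z≤n (n<1+n k))))
      where
      k≤x : k ≤ x
      k≤x = ≤-pred (≰⇒> p)
      x+k<N : x + k < N
      x+k<N = subst (x + k <_) (folded (≤-trans (n≤1+n x) le)) (+-monoʳ-< x (≰⇒> p′))
      x≡k : x ≡ k
      x≡k = ≤-antisym (+-cancelʳ-≤ k x k (≤-pred (<-≤-trans x+k<N N≤))) k≤x
      N≡ : N ≡ suc (k + k)
      N≡ = ≤-antisym N≤ (subst (λ x → x + k < N) x≡k x+k<N)

    SS? : ∀ x y → Dec (S T x y)
    SS? = S? T?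

    A : Adj
    A = adj (gr SS?)

    std-A : Std A
    std-A = lin-std SS? (λ x lt → inj₁ (E-edge (<n⇒≤N lt))) s-top nc
      where
      s-top : S T 0 n-1
      s-top with side
      ... | inj₁ e = inj₁ (inj₂ (inj₂ (suc-injective (trans 1+n-1 (sym e)) , top)))
      ... | inj₂ e = inj₂ ((refl , e) , subst (E T n-1) 1+n-1 (E-edge (≤-reflexive (trans 1+n-1 (sym e)))))
      nc : ∀ {a b c d} → a < b → b < c → c < d → d < n → S T a c → S T b d → ⊥
      nc p q r lt (inj₁ h) (inj₁ h′) = E-cross p q r (<n⇒≤N lt) h h′
      nc p q r lt (inj₂ ((_ , e) , h)) (inj₁ h′) = E-cross q r lt (≤-reflexive (sym e)) h′ h
      nc p q r lt _ (inj₂ ((refl , _) , _)) = n≮0 p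

    inv-half : ∀ {x y} → x < y → y < n → (A °) x y → (A °) (N ∸ x) (N ∸ y)
    inv-half {x} {y} x<y y<n t = go (proj₁ (gr-° SS? x<y y<n) t)
      where
      y≤N = <n⇒≤N y<n
      x≤N = ≤-trans (<⇒≤ x<y) y≤N
      small : N ∸ x < n → E T (N ∸ y) (N ∸ x) → (A °) (N ∸ x) (N ∸ y)
      small lt h = adj-sym° (gr SS?) {N ∸ y} {N ∸ x} (proj₂ (gr-° SS? (∸-monoʳ-< x<y y≤N) lt) (inj₁ h))
      -- when N = n, the vertex 0 = n is its own mirror image
      zero-case : x ≡ 0 → N ≡ n → E T 0 (N ∸ y) ⊎ E T (N ∸ y) n → (A °) (N ∸ x) (N ∸ y)
      zero-case refl e h = °-resp A (≋-trans (≋-sym (≋-n 0)) (≋-reflexive (sym e))) (≋-refl {N ∸ y})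
        (proj₂ (gr-° SS? (m<n⇒0<n∸m (subst (y <_) (sym e) y<n)) (N∸<n x<y y≤N)) (f h))
        where
        f : E T 0 (N ∸ y) ⊎ E T (N ∸ y) n → S T 0 (N ∸ y)
        f (inj₁ h) = inj₁ h
        f (inj₂ h) = inj₂ ((refl , e) , h)
      go : S T x y → (A °) (N ∸ x) (N ∸ y)
      go (inj₁ h) with x ≟ 0 | side
      ... | no x≢0 | _ = small (N∸<n (n≢0⇒n>0 x≢0) x≤N) (E-sym x<y y≤N h)
      ... | yes _ | inj₁ e = small (≤-<-trans (m∸n≤m N x) (≤-reflexive e)) (E-sym x<y y≤N h)
      ... | yes x≡0 | inj₂ e = zero-case x≡0 e (inj₂ (subst (E T (N ∸ y)) (trans (cong (N ∸_) x≡0) e) (E-sym x<y y≤N h)))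
      go (inj₂ ((x≡0 , e) , h)) = zero-case x≡0 e (inj₁ (subst (λ z → E T z (N ∸ y)) (trans (cong (N ∸_) (sym e)) (n∸n≡0 N)) (E-sym y<n (≤-reflexive (sym e)) h)))

  module Unfold {A : Adj} (std : Std A) (inv : ∀ {x y} → x ≤ N → y ≤ N → (A °) x y → (A °) (N ∸ x) (N ∸ y)) where

    D : ℕ → Set
    D a = (A °) a (N ∸ a) ⊎ pt a ≡ pt (N ∸ a)

    -- Chords of the left half, together with an arc to the extra vertex from each `a` that is
    -- joined to its mirror image or equal to it. The second alternative supplies the outermost or
    -- innermost arc when the axis passes through a vertex.
    R : Rel
    R a b = (b ≤ k × (A °) a b) ⊎ (b ≡ suc k × D a)

    R? : ∀ a b → Dec (R a b)
    R? a b = ((b ≤? k) ×-dec °? A a b) ⊎-dec ((b ≟ suc k) ×-dec (°? A a (N ∸ a) ⊎-dec (pt a FP.≟ pt (N ∸ a))))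

    R-edges : Edges R 0 (suc k)
    R-edges {a} _ (s≤s a≤k) with m≤n⇒m<n∨m≡n a≤k
    ... | inj₁ a<k = inj₁ (a<k , edge° std a)
    ... | inj₂ refl with m≤n⇒m<n∨m≡n k+k≤N
    ...   | inj₁ lt = inj₂ (refl , inj₁ (subst ((A °) k) (sym (trans (cong (_∸ k) (≤-antisym N≤ lt)) (trans (cong (_∸ k) (sym (+-suc k k))) (m+n∸m≡n k (suc k))))) (edge° std k)))
    ...   | inj₂ e = inj₂ (refl , inj₂ (cong pt (sym (mirror∸ e))))

    R-top : R 0 (suc k)
    R-top with side
    ... | inj₁ e = inj₂ (refl , inj₁ (subst ((A °) 0) (suc-injective (trans 1+n-1 (sym e))) (std-top std)))
    ... | inj₂ e = inj₂ (refl , inj₂ (pt-cong (≋-trans (≋-sym (≋-n 0)) (≋-reflexive (sym e)))))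

    -- An arc to the extra vertex from strictly inside a left chord would stand for a chord through
    -- the axis that crosses the left chord. A vertex fixed by the reflection does not lie strictly
    -- inside one.
    R-noncrossing : Noncrossing R 0 (suc k)
    R-noncrossing {a} {b} {c} {d} _ p q r le (inj₂ (refl , _)) _ = <⇒≱ r le
    R-noncrossing {a} {b} {c} {d} _ p q r le (inj₁ (c≤k , h)) (inj₁ (d≤k , h′)) = cross° std p q r (≤-<-trans d≤k (<-≤-trans k<n (m≤n+m n a))) h h′
    R-noncrossing {a} {b} {c} {d} _ p q r le (inj₁ (c≤k , h)) (inj₂ (_ , D-b)) = f D-b
      where
      b≤N = ≤-trans (<⇒≤ (<-≤-trans q c≤k)) k≤N
      k<N∸b : k < N ∸ b
      k<N∸b = +-cancelˡ-< b k _ (<-≤-trans (+-monoˡ-< k (<-≤-trans q c≤k)) (≤-trans k+k≤N (≤-reflexive (sym (folded b≤N)))))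
      N∸b<n : N ∸ b < n
      N∸b<n = N∸<n (≤-<-trans z≤n p) b≤N
      f : D b → ⊥
      f (inj₁ h′) = cross° std p q (≤-<-trans c≤k k<N∸b) (<-≤-trans N∸b<n (m≤n+m n a)) h h′
      f (inj₂ e) = <-irrefl (≋-small (<-trans (<-≤-trans q c≤k) k<n) N∸b<n (pt-injective e)) (<-trans (<-≤-trans q c≤k) k<N∸b)

    unfold-tree : ∃[ t ] (∥ t ∥ ≡ suc k × Agree R (Arc t 0) 0 (suc k))
    unfold-tree = arc-complete R? (suc k + suc k) 0 (suc k) (n≤1+n _) (s≤s z≤n) R-top (λ {a} → R-edges {a}) (λ {a} {b} {c} {d} → R-noncrossing {a} {b} {c} {d})

    module _ {T : Rel} (ag : Agree R T 0 (suc k)) where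

      E⇒A : ∀ {x y} → x < y → y ≤ N → ¬ (x ≋ y) → E T x y → (A °) x y
      E⇒A {x} {y} x<y y≤N _ (inj₁ (y≤k , h)) with proj₂ (ag z≤n x<y (m≤n⇒m≤1+n y≤k)) h
      ... | inj₁ (_ , h′) = h′
      ... | inj₂ (refl , _) = ⊥-elim (1+n≰n y≤k)
      E⇒A {x} {y} x<y y≤N _ (inj₂ (inj₁ (x≥ , h))) with proj₂ (ag z≤n (∸-monoʳ-< x<y y≤N) (m≤n⇒m≤1+n x≥)) h
      ... | inj₁ (_ , h′) = subst₂ (A °) (m∸[m∸n]≡n x≤N) (m∸[m∸n]≡n y≤N) (inv (m∸n≤m N x) (m∸n≤m N y) (sym° std h′))
        where x≤N = ≤-trans (<⇒≤ x<y) y≤N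
      ... | inj₂ (e , _) = ⊥-elim (1+n≰n (≤-trans (≤-reflexive (sym e)) x≥))
      E⇒A {x} {y} x<y y≤N x≋̸y (inj₂ (inj₂ (e , h))) with proj₂ (ag z≤n (s≤s (mirror⇒≤k x<y e)) ≤-refl) h
      ... | inj₁ (1+k≤k , _) = ⊥-elim (1+n≰n 1+k≤k)
      ... | inj₂ (_ , inj₁ h′) = subst ((A °) x) (mirror∸′ e) h′
      ... | inj₂ (_ , inj₂ e′) = ⊥-elim (x≋̸y (≋-trans (pt-injective e′) (≋-reflexive (mirror∸′ e))))

      S⇒A : ∀ {x y} → x < y → y < n → S T x y → (A °) x y
      S⇒A x<y y<n (inj₁ h) = E⇒A x<y (<n⇒≤N y<n) (λ e → <⇒≢ x<y (≋-small (<-trans x<y y<n) y<n e)) h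
      S⇒A {x} {y} x<y y<n (inj₂ ((refl , e) , h)) = °-resp A (≋-n 0) (≋-refl {y}) (sym° std (E⇒A y<n (≤-reflexive (sym e)) (λ e′ → <⇒≢ x<y (sym (≋-small y<n 0<n (≋-trans e′ (≋-n 0))))) h))

      A⇒S : ∀ {x y} → x < y → y < n → (A °) x y → S T x y
      A⇒S {x} {y} x<y y<n h = go (y ≤? k) (N ∸ x ≤? k) (x ≟ 0) Nn
        where
        y≤N = <n⇒≤N y<n
        x≤N = ≤-trans (<⇒≤ x<y) y≤N
        h′ : (A °) (N ∸ y) (N ∸ x)
        h′ = sym° std (inv x≤N y≤N h)
        -- A chord that passes from one side to the other without being its own mirror image crosses
        -- its mirror image; the sign of x + y - N decides in which order the four ends lie.
        wide : ¬ (y ≤ k) → ¬ (N ∸ x ≤ k) → N ∸ x < n → S T x y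
        wide y>k x<k lt with <-cmp (x + y) N
        ... | tri≈ _ e _ = inj₁ (inj₂ (inj₂ (e , proj₁ (ag z≤n (s≤s (mirror⇒≤k x<y e)) ≤-refl) (inj₂ (refl , inj₁ (subst ((A °) x) (sym (mirror∸′ e)) h))))))
        ... | tri< l _ _ = ⊥-elim (cross° std (m+n≤o⇒m≤o∸n (suc x) l)
                (+-cancelʳ-< y _ _ (≤-<-trans (≤-reflexive (m∸n+n≡m y≤N)) (≤-<-trans N≤ (+-mono-≤-< (≰⇒> y>k) (≰⇒> y>k)))))
                (m+n≤o⇒m≤o∸n (suc y) (subst (_< N) (+-comm x y) l)) (<-≤-trans lt (m≤n+m n x)) h h′)
        ... | tri> _ _ g = ⊥-elim (cross° std
                (+-cancelʳ-< y _ _ (≤-<-trans (≤-reflexive (m∸n+n≡m y≤N)) g))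
                (+-cancelʳ-< k x (N ∸ x) (<-≤-trans (subst (x + k <_) (folded x≤N) (+-monoʳ-< x (≰⇒> x<k))) (≤-trans N≤ (+-monoˡ-≤ k (≰⇒> x<k)))))
                (+-cancelˡ-< x _ _ (≤-<-trans (≤-reflexive (folded x≤N)) g)) (<-≤-trans y<n (m≤n+m n _)) h′ h)
        go : Dec (y ≤ k) → Dec (N ∸ x ≤ k) → Dec (x ≡ 0) → suc N ≡ n ⊎ N ≡ n → S T x y
        go (yes y≤k) _ _ _ = inj₁ (inj₁ (y≤k , proj₁ (ag z≤n x<y (m≤n⇒m≤1+n y≤k)) (inj₁ (y≤k , h))))
        go (no _) (yes x≥) _ _ = inj₁ (inj₂ (inj₁ (x≥ , proj₁ (ag z≤n (∸-monoʳ-< x<y y≤N) (m≤n⇒m≤1+n x≥)) (inj₁ (x≥ , h′)))))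
        go (no p) (no p′) (no x≢0) _ = wide p p′ (N∸<n (n≢0⇒n>0 x≢0) x≤N)
        go (no p) (no p′) (yes _) (inj₁ e) = wide p p′ (≤-<-trans (m∸n≤m N x) (≤-reflexive e))
        -- Vertex 0 lies on the axis, so this chord is the mirror image of the chord from 0 to N - y
        -- in the left half.
        go (no p) (no p′) (yes x≡0) (inj₂ e) = inj₂ ((x≡0 , e) , inj₂ (inj₁ (N∸y≤k , subst (λ z → T z (N ∸ y)) (sym (trans (cong (N ∸_) (sym e)) (n∸n≡0 N)))
            (proj₁ (ag z≤n (m<n⇒0<n∸m (subst (y <_) (sym e) y<n)) (m≤n⇒m≤1+n N∸y≤k)) (inj₁ (N∸y≤k , zero-arc))))))
          where
          N∸y≤k : N ∸ y ≤ k
          N∸y≤k = +-cancelˡ-≤ (suc k) _ _ (≤-trans (+-monoˡ-≤ (N ∸ y) (≰⇒> p)) (≤-trans (≤-reflexive (folded y≤N)) N≤))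
          zero-arc : (A °) 0 (N ∸ y)
          zero-arc = °-resp A (≋-trans (≋-reflexive (trans (cong (N ∸_) x≡0) e)) (≋-n 0)) (≋-refl {N ∸ y}) (inv x≤N y≤N h)

  -- A symmetric dissection determines the folded family.
  fold-injective : ∀ {T T′} → Fam T 0 (suc k) → Fam T′ 0 (suc k) → T′ 0 (suc k) → (∀ {x y} → x < y → y < n → S T x y → S T′ x y) → ∀ {a b} → T a b → T′ a b
  fold-injective {T} {T′} f f′ top′ h {a} {b} s = go (b ≤? k)
    where
    a<b = proj₁ (proj₂ (Fam.range f s))
    b≤1+k = proj₂ (proj₂ (Fam.range f s))
    a≤k : a ≤ k
    a≤k = ≤-pred (<-≤-trans a<b b≤1+k)
    ¬right : ∀ {a} → a < k → ¬ (N ∸ a ≤ k)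
    ¬right a<k le = <⇒≱ a<k (right⇒≥k (≤-trans (<⇒≤ a<k) k≤N) le)
    left : b ≤ k → S T′ a b → T′ a b
    left b≤k (inj₁ (inj₁ (_ , t))) = t
    left b≤k (inj₁ (inj₂ (inj₁ (le , _)))) = ⊥-elim (¬right (<-≤-trans a<b b≤k) le)
    left b≤k (inj₁ (inj₂ (inj₂ (e , _)))) = ⊥-elim (<⇒≱ (+-mono-<-≤ (<-≤-trans a<b b≤k) b≤k) (≤-trans k+k≤N (≤-reflexive (sym e))))
    left b≤k (inj₂ ((refl , e) , inj₁ (n≤k , _))) = ⊥-elim (<⇒≱ k<n n≤k)
    left b≤k (inj₂ ((refl , e) , inj₂ (inj₁ (le , t)))) = subst₂ T′ (trans (cong (N ∸_) (sym e)) (n∸n≡0 N)) (trans (mirror∸ {k} (trans (cong (k +_) b≡k) N≡)) (sym b≡k)) t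
      where
      b≡k : b ≡ k
      b≡k = ≤-antisym b≤k (right⇒≥k (≤-trans b≤k k≤N) le)
      N≡ : k + k ≡ N
      N≡ = ≤-antisym k+k≤N (≤-trans (≤-reflexive (sym (folded {b} (≤-trans b≤k k≤N)))) (+-mono-≤ b≤k le))
    left b≤k (inj₂ ((refl , e) , inj₂ (inj₂ (e′ , _)))) = ⊥-elim (<⇒≢ (m<n+m n a<b) (sym (trans e′ e)))
    middle : 0 < a → a < k → S T′ a (N ∸ a) → T′ a (suc k)
    middle 0<a a<k (inj₁ (inj₁ (le , _))) = ⊥-elim (¬right a<k le)
    middle 0<a a<k (inj₁ (inj₂ (inj₁ (le , _)))) = ⊥-elim (¬right a<k le)
    middle 0<a a<k (inj₁ (inj₂ (inj₂ (_ , t)))) = t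
    middle 0<a a<k (inj₂ ((refl , _) , _)) = ⊥-elim (n≮0 0<a)
    go : Dec (b ≤ k) → T′ a b
    go (yes b≤k) = left b≤k (h a<b (≤-<-trans b≤k k<n) (inj₁ (inj₁ (b≤k , s))))
    go (no b≰k) with ≤-antisym b≤1+k (≰⇒> b≰k)
    ... | refl with m≤n⇒m<n∨m≡n a≤k | a ≟ 0
    ...   | inj₂ refl | _ = Fam.edge f′ z≤n ≤-refl
    ...   | inj₁ _ | yes refl = top′
    ...   | inj₁ a<k | no a≢0 = middle (n≢0⇒n>0 a≢0) a<k (h (<-trans a<k (≰⇒> (¬right a<k))) (N∸<n (n≢0⇒n>0 a≢0) (≤-trans a≤k k≤N)) (inj₁ (inj₂ (inj₂ (folded (≤-trans a≤k k≤N) , s)))))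

  module _ (m : Mono) where
    open Reduction n 2<n m hiding (N)
    open Identity n 2<n m

    reflection-count : ∀ {σ} → IsRef σ N → count (isoQ σ) (graphs n) ≡ length (trees (suc k))
    reflection-count {σ} σ-ref = code-count (trees (suc k)) (Sized.unique sized-trees (suc k)) (λ t → S (Arc t 0)) (λ t → S? (arc? t 0)) (isoQ σ)
      sound injective complete
      where
      famT : ∀ {t} → t ∈ trees (suc k) → Fam (Arc t 0) 0 (suc k)
      famT {t} t∈ = subst (Fam (Arc t 0) 0) (Sized.sound sized-trees {suc k} t∈) (fam t 0)
      topT : ∀ {t} → t ∈ trees (suc k) → Arc t 0 0 (suc k)
      topT {t} t∈ = subst (Arc t 0 0) (Sized.sound sized-trees {suc k} t∈) (arc-top t 0)
      σ-at : ∀ {x} → x ≤ N → lookup σ (pt x) ≡ pt (N ∸ x)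
      σ-at {x} x≤N = σ-ref x (N ∸ x) (≋-reflexive (folded x≤N))
      sound : ∀ {t} → t ∈ trees (suc k) → T (isoQ σ (gr (S? (arc? t 0))))
      sound {t} t∈ = ∧⁺ (std⁺ G std-A) (iso⁺ G G σ (λ i j → subst₂ (λ i j → adj G i j ≡ adj G (lookup σ i) (lookup σ j)) (pt-toℕ i) (pt-toℕ j) (eq (FP.toℕ<n i) (FP.toℕ<n j))))
        where
        open Family (arc? t 0) (famT t∈) (topT t∈) using (std-A; inv-half)
        G = gr (S? (arc? t 0))
        B = adj G
        inv-lt : ∀ {x y} → x < y → y < n → (B °) x y → (B °) (N ∸ x) (N ∸ y)
        inv-lt = inv-half
        both : ∀ {x y} → x < n → y < n → (B °) x y → (B °) (N ∸ x) (N ∸ y)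
        both {x} {y} x<n y<n t with <-cmp x y
        ... | tri< p _ _ = inv-lt p y<n t
        ... | tri> _ _ p = adj-sym° G {N ∸ y} {N ∸ x} (inv-lt p x<n (adj-sym° G {x} {y} t))
        ... | tri≈ _ refl _ = ⊥-elim (adj-irrefl (mk-∈ _) (pt x) t)
        -- The converse follows by reflecting once more; N - x may be n and is reduced first.
        back : ∀ {x y} → x < n → y < n → (B °) (N ∸ x) (N ∸ y) → (B °) x y
        back {x} {y} x<n y<n t = °-resp B (r x<n) (r y<n) (both (m%n<n (N ∸ x) n) (m%n<n (N ∸ y) n) (°-resp B (≋-sym (≋-% (N ∸ x))) (≋-sym (≋-% (N ∸ y))) t))
          where
          r : ∀ {x} → x < n → N ∸ (N ∸ x) % n ≋ x
          r {x} x<n = ≋-cancelʳ ((N ∸ x) % n) (≋-trans (≋-reflexive (m∸n+n≡m (≤-trans (m%n≤m (N ∸ x) n) (m∸n≤m N x))))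
            (≋-trans (≋-reflexive (sym (folded (<n⇒≤N x<n)))) (≋-+ (≋-refl {x}) (≋-sym (≋-% (N ∸ x))))))
        eq : ∀ {x y} → x < n → y < n → adj G (pt x) (pt y) ≡ adj G (lookup σ (pt x)) (lookup σ (pt y))
        eq {x} {y} x<n y<n = trans (T-ext (both x<n y<n) (back x<n y<n)) (cong₂ (adj G) (sym (σ-at (<n⇒≤N x<n))) (sym (σ-at (<n⇒≤N y<n))))
      injective : ∀ {t t′} → t ∈ trees (suc k) → t′ ∈ trees (suc k) → (∀ {x y} → x < y → y < n → iff (S (Arc t 0) x y) (S (Arc t′ 0) x y)) → t ≡ t′
      injective {t} {t′} t∈ t′∈ h = arc-injective t t′ 0 (λ {a} {b} →
        fold-injective (famT t∈) (famT t′∈) (topT t′∈) (λ p q → proj₁ (h p q)) , fold-injective (famT t′∈) (famT t∈) (topT t∈) (λ p q → proj₂ (h p q)))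
      complete : ∀ {G} → G ∈ graphs n → T (isoQ σ G) → ∃[ t ] (t ∈ trees (suc k) × (∀ {x y} → x < y → y < n → iff ((adj G °) x y) (S (Arc t 0) x y)))
      complete {G} G∈ q = let (st , is) = ∧⁻ {stdB G} q
                              s = std⁻ G st
                              iv : ∀ {x y} → x ≤ N → y ≤ N → (adj G °) x y → (adj G °) (N ∸ x) (N ∸ y)
                              iv {x} {y} x≤N y≤N t = subst T (trans (iso⁻ G G σ is (pt x) (pt y)) (cong₂ (adj G) (σ-at x≤N) (σ-at y≤N))) t
                              (t , e , ag) = Unfold.unfold-tree {adj G} s iv
                          in t , ∈-sized sized-trees e , (λ {x} {y} p p′ → Unfold.A⇒S {adj G} s iv {Arc t 0} ag p p′ , Unfold.S⇒A {adj G} s iv {Arc t 0} ag p p′)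

-- Exponents of monomials

exponent : Mono → ℕ → ℕ
exponent []      e       = 0
exponent (x ∷ m) zero    = x
exponent (x ∷ m) (suc e) = exponent m e

HasExponents : Mono → (ℕ → ℕ) → Set
HasExponents m f = ∀ e → exponent m e ≡ f e

allZero⁻ : ∀ m → T (allZero m) → ∀ e → exponent m e ≡ 0
allZero⁻ []         t e       = refl
allZero⁻ (zero ∷ m) t zero    = refl
allZero⁻ (zero ∷ m) t (suc e) = allZero⁻ m t e

allZero⁺ : ∀ m → (∀ e → exponent m e ≡ 0) → T (allZero m)
allZero⁺ []          h = tt
allZero⁺ (zero ∷ m)  h = allZero⁺ m (h ∘ suc)
allZero⁺ (suc x ∷ m) h with h 0
... | ()

sameMono⁻ : ∀ a b → T (sameMono a b) → HasExponents b (exponent a)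
sameMono⁻ []      b       t e       = allZero⁻ b t e
sameMono⁻ (x ∷ a) []      t e       = sym (allZero⁻ (x ∷ a) t e)
sameMono⁻ (x ∷ a) (y ∷ b) t zero    = sym (≡ᵇ⇒≡ x y (proj₁ (∧⁻ {x ≡ᵇ y} t)))
sameMono⁻ (x ∷ a) (y ∷ b) t (suc e) = sameMono⁻ a b (proj₂ (∧⁻ {x ≡ᵇ y} t)) e

sameMono⁺ : ∀ a b → HasExponents b (exponent a) → T (sameMono a b)
sameMono⁺ []      b       h = allZero⁺ b h
sameMono⁺ (x ∷ a) []      h = allZero⁺ (x ∷ a) (λ e → sym (h e))
sameMono⁺ (x ∷ a) (y ∷ b) h = ∧⁺ (≡⇒≡ᵇ x y (sym (h 0))) (sameMono⁺ a b (h ∘ suc))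

exponent-applyUpTo : ∀ (f g : ℕ → ℕ) n e → e < n → exponent (map f (applyUpTo g n)) e ≡ f (g e)
exponent-applyUpTo f g (suc n) zero    lt       = refl
exponent-applyUpTo f g (suc n) (suc e) (s≤s lt) = exponent-applyUpTo f (g ∘ suc) n e lt

exponent-beyond : ∀ (f g : ℕ → ℕ) n e → n ≤ e → exponent (map f (applyUpTo g n)) e ≡ 0
exponent-beyond f g zero    e       le       = refl
exponent-beyond f g (suc n) (suc e) (s≤s le) = exponent-beyond f (g ∘ suc) n e le

-- the exponents of s_D^g and of s_1^i s_2^j
power : ℕ → ℕ → ℕ → ℕ
power D g e = if suc e ≡ᵇ D then g else 0

two : ℕ → ℕ → ℕ → ℕ
two i j zero          = i
two i j (suc zero)    = j
two i j (suc (suc e)) = 0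

≡ᵇ-true : ∀ x y → x ≡ y → (x ≡ᵇ y) ≡ true
≡ᵇ-true x y e = Equivalence.to T-≡ (≡⇒≡ᵇ x y e)

≡ᵇ-false : ∀ x y → x ≢ y → (x ≡ᵇ y) ≡ false
≡ᵇ-false x y ne with x ≡ᵇ y in eq
... | false = refl
... | true  = ⊥-elim (ne (≡ᵇ⇒≡ x y (Equivalence.from T-≡ eq)))

power-yes : ∀ D g e → suc e ≡ D → power D g e ≡ g
power-yes D g e eq = cong (if_then g else 0) (≡ᵇ-true (suc e) D eq)

power-no : ∀ D g e → suc e ≢ D → power D g e ≡ 0
power-no D g e ne = cong (if_then g else 0) (≡ᵇ-false (suc e) D ne)

count-const : ∀ {A : Set} b (xs : List A) → count (λ _ → b) xs ≡ (if b then length xs else 0)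
count-const true  xs = count-all xs
count-const false xs = count-none _ xs (λ _ ())

count-complement : ∀ {A : Set} (p : A → Bool) xs → count p xs + count (not ∘ p) xs ≡ length xs
count-complement p []       = refl
count-complement p (x ∷ xs) with p x
... | true  = cong suc (count-complement p xs)
... | false = trans (+-suc _ _) (cong suc (count-complement p xs))

length-allFin : ∀ n → length (allFin n) ≡ n
length-allFin n = length-tabulate id

-- Cycle types of rotations and reflections.

module CycleTypes (n : ℕ) (2<n : 2 < n) where
  open Polygon n 2<n

  cycleType-at : ∀ σ e → e < n → exponent (cycleType {n} σ) e ≡ count (hasPeriod σ (suc e)) (allFin n) / suc e
  cycleType-at σ e lt = exponent-applyUpTo (λ e → numCycles σ (suc e)) id n e lt

  cycleType-beyond : ∀ σ e → n ≤ e → exponent (cycleType {n} σ) e ≡ 0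
  cycleType-beyond σ = exponent-beyond (λ e → numCycles σ (suc e)) id n

  iter-rot : ∀ a j x → iter (rot a) j (pt x) ≡ pt (x + j * a)
  iter-rot a zero    x = cong pt (sym (+-identityʳ x))
  iter-rot a (suc j) x = trans (cong (lookup (rot a)) (iter-rot a j x)) (trans (rot-at a (x + j * a)) (cong pt (trans (+-assoc x _ a) (cong (x +_) (+-comm (j * a) a)))))

  ≋-* : ∀ j {x y} → x ≋ y → j * x ≋ j * y
  ≋-* zero    e = ≋-refl
  ≋-* (suc j) e = ≋-+ e (≋-* j e)

  module _ {a g D : ℕ} (0<g : 0 < g) (n≡Dg : n ≡ D * g) (j j′ : ℕ) (e : a ≋ j * g) (e′ : g ≋ j′ * a) where

    0<D : 0 < D
    0<D = n≢0⇒n>0 (λ { refl → <⇒≢ 0<n (sym n≡Dg) })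

    D≤n : D ≤ n
    D≤n = subst₂ _≤_ (*-identityʳ D) (sym n≡Dg) (*-monoʳ-≤ D 0<g)

    period⁺ : ∀ i → D ∣ i → i * a ≋ 0
    period⁺ i (divides-refl c) = ≋-trans (≋-* (c * D) e) (≋-trans (≋-reflexive eq) (≋-kn 0 (c * j)))
      where
      eq : c * D * (j * g) ≡ c * j * n
      eq = trans (ℕS.solve 4 (λ c D j g → c ℕS.:* D ℕS.:* (j ℕS.:* g) ℕS.:= c ℕS.:* j ℕS.:* (D ℕS.:* g)) refl c D j g) (cong (c * j *_) (sym n≡Dg))

    -- Since `g` is a multiple of `a` modulo n, the product i g vanishes modulo n = D g as well.
    period⁻ : ∀ i → i * a ≋ 0 → D ∣ i
    period⁻ i h = *-cancelʳ-∣ g {{>-nonZero 0<g}} (subst (_∣ i * g) n≡Dg (m%n≡0⇒n∣m (i * g) n (trans (un≋ ig≋0) (m<n⇒m%n≡m 0<n))))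
      where
      ig≋0 : i * g ≋ 0
      ig≋0 = ≋-trans (≋-* i e′) (≋-trans (≋-reflexive (trans (sym (*-assoc i j′ a)) (trans (cong (_* a) (*-comm i j′)) (*-assoc j′ i a)))) (≋-trans (≋-* j′ h) (≋-reflexive (*-zeroʳ j′))))

    returns : ∀ i x → T (iter (rot a) i x == x) → D ∣ i
    returns i x t = period⁻ i (≋-cancelʳ (toℕ x) (≋-trans (≋-reflexive (+-comm (i * a) (toℕ x)))
      (pt-injective (trans (sym (iter-rot a i (toℕ x))) (trans (cong (iter (rot a) i) (pt-toℕ x)) (trans (==⁻ _ x t) (sym (pt-toℕ x))))))))

    returns⁺ : ∀ i x → D ∣ i → T (iter (rot a) i x == x)
    returns⁺ i x d = ==⁺ (trans (cong (iter (rot a) i) (sym (pt-toℕ x))) (trans (iter-rot a i (toℕ x))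
      (trans (pt-cong (≋-trans (≋-+ (≋-refl {toℕ x}) (period⁺ i d)) (≋-reflexive (+-identityʳ _)))) (pt-toℕ x))))

    hasPeriod-rot : ∀ i x → hasPeriod (rot a) (suc i) x ≡ (suc i ≡ᵇ D)
    hasPeriod-rot i x = T-ext to from
      where
      to : T (hasPeriod (rot a) (suc i) x) → T (suc i ≡ᵇ D)
      to t with ∧⁻ {iter (rot a) (suc i) x == x} t
      ... | t₁ , t₂ with m≤n⇒m<n∨m≡n (∣⇒≤ (returns (suc i) x t₁))
      ... | inj₂ eq = ≡⇒≡ᵇ (suc i) D (sym eq)
      ... | inj₁ lt = ⊥-elim (not⁻ (All.lookup (AllP.all⁺ _ (upTo i) t₂) (∈-upTo⁺ {i} {D ∸ 1} (≤-pred (subst (_≤ suc i) (cong suc (sym 1+D-1)) lt))))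
                          (returns⁺ (suc (D ∸ 1)) x (subst (D ∣_) (sym 1+D-1) ∣-refl)))
        where
        1+D-1 : suc (D ∸ 1) ≡ D
        1+D-1 = m+[n∸m]≡n 0<D
      from : T (suc i ≡ᵇ D) → T (hasPeriod (rot a) (suc i) x)
      from t with ≡ᵇ⇒≡ (suc i) D t
      ... | eq = ∧⁺ (returns⁺ (suc i) x (subst (D ∣_) (sym eq) ∣-refl)) (AllP.all⁻ _ (All.tabulate {xs = upTo i} (λ {i′} i′∈ → not⁺ (λ t′ →
              <⇒≱ (s≤s (∈-upTo⁻ i′∈)) (subst (_≤ suc i′) (sym eq) (∣⇒≤ (returns (suc i′) x t′)))))))

    -- Every vertex has least period `D`, so the D g vertices form `g` cycles of length `D` and
    -- there are no others.
    cycleType-rot : ∀ i → exponent (cycleType (rot a)) i ≡ power D g i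
    cycleType-rot i with i <? n
    ... | no i≮n = trans (cycleType-beyond (rot a) i (≮⇒≥ i≮n)) (sym (power-no D g i (λ eq → <⇒≱ (s≤s (≮⇒≥ i≮n)) (subst (_≤ n) (sym eq) D≤n))))
    ... | yes i<n = trans (cycleType-at (rot a) i i<n) (trans (cong (_/ suc i) (trans (count-cong (allFin n) (λ x _ → hasPeriod-rot i x)) (count-const (suc i ≡ᵇ D) (allFin n)))) (go (suc i ≟ D)))
      where
      go : Dec (suc i ≡ D) → (if suc i ≡ᵇ D then length (allFin n) else 0) / suc i ≡ power D g i
      go (yes eq) = trans (cong (λ b → (if b then length (allFin n) else 0) / suc i) (≡ᵇ-true (suc i) D eq))
        (trans (cong (_/ suc i) (trans (length-allFin n) (trans n≡Dg (trans (cong (_* g) (sym eq)) (*-comm (suc i) g))))) (trans (m*n/n≡m g (suc i)) (sym (power-yes D g i eq))))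
      go (no ne) = trans (cong (λ b → (if b then length (allFin n) else 0) / suc i) (≡ᵇ-false (suc i) D ne)) (trans (0/n≡0 (suc i)) (sym (power-no D g i ne)))

  module _ {σ : Perm {n}} (invol : ∀ x → lookup σ (lookup σ x) ≡ x) (i j : ℕ)
    (fixed# : count (λ x → lookup σ x == x) (allFin n) ≡ i) (n≡ : i + j * 2 ≡ n) where

    -- A least period above two is impossible because every point returns after two steps; the
    -- points of period two are those that are not fixed.
    cycleType-involution : ∀ e → exponent (cycleType σ) e ≡ two i j e
    cycleType-involution e with e <? n
    cycleType-involution zero          | no e≮n = ⊥-elim (e≮n 0<n)
    cycleType-involution (suc zero)    | no e≮n = ⊥-elim (e≮n (<-trans (s≤s (s≤s z≤n)) 2<n))
    cycleType-involution (suc (suc e)) | no e≮n = cycleType-beyond σ (suc (suc e)) (≮⇒≥ e≮n)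
    cycleType-involution zero          | yes e<n = trans (cycleType-at σ 0 e<n) (trans (n/1≡n _) (trans (count-cong (allFin n) (λ x _ → T-ext (λ t → proj₁ (∧⁻ {lookup σ x == x} t)) (λ t → ∧⁺ t tt))) fixed#))
    cycleType-involution (suc zero)    | yes e<n = trans (cycleType-at σ 1 e<n) (trans (cong (_/ 2) c) (m*n/n≡m j 2))
      where
      c : count (hasPeriod σ 2) (allFin n) ≡ j * 2
      c = trans (count-cong (allFin n) (λ x _ → T-ext
            (λ t → proj₁ (∧⁻ {not (lookup σ x == x)} (proj₂ (∧⁻ {iter σ 2 x == x} t)))) (λ t → ∧⁺ (==⁺ (invol x)) (∧⁺ {not (lookup σ x == x)} t tt))))
          (+-cancelˡ-≡ i _ _ (trans (cong (_+ count (λ x → not (lookup σ x == x)) (allFin n)) (sym fixed#)) (trans (count-complement (λ x → lookup σ x == x) (allFin n)) (trans (length-allFin n) (sym n≡)))))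
    cycleType-involution (suc (suc e)) | yes e<n = trans (cycleType-at σ (suc (suc e)) e<n) (trans (cong (_/ suc (suc (suc e))) (count-none _ (allFin n) (λ {x} _ t →
        not⁻ (All.lookup (AllP.all⁺ (λ k′ → not (iter σ (suc k′) x == x)) (upTo (suc (suc e))) (proj₂ (∧⁻ {iter σ (suc (suc (suc e))) x == x} t))) (∈-upTo⁺ {suc (suc e)} {1} (s≤s (s≤s z≤n)))) (==⁺ (invol x))))) (0/n≡0 (suc (suc (suc e)))))

  ref-involutive : ∀ {σ a} → IsRef σ a → ∀ x → lookup σ (lookup σ x) ≡ x
  ref-involutive {σ} {a} h x = trans (cong (lookup σ) (trans (cong (lookup σ) (sym (pt-toℕ x))) (h X Y (≋-trans (≋-reflexive (sym (+-assoc X (neg X) a))) (≋-+ (neg-≋ X) (≋-refl {a}))))))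
    (trans (h Y X (≋-trans (≋-reflexive (trans (+-comm Y X) (sym (+-assoc X (neg X) a)))) (≋-+ (neg-≋ X) (≋-refl {a})))) (pt-toℕ x))
    where
    X = toℕ x
    Y = neg X + a

  ref-fixed : ∀ {σ a} → IsRef σ a → (fs : List ℕ) → Unique fs → (∀ {x} → x ∈ fs → x < n × x + x ≋ a) → (∀ x → x < n → x + x ≋ a → x ∈ fs) →
    count (λ x → lookup σ x == x) (allFin n) ≡ length fs
  ref-fixed {σ} {a} h fs u sound complete = trans (count-bij {p = λ x → lookup σ x == x} {q = λ _ → true} (allFin n) fs (UP.allFin⁺ n) u toℕ pt
      (λ {x} _ t → complete (toℕ x) (FP.toℕ<n x) (fix⇒ x (==⁻ (lookup σ x) x t)) , tt , pt-toℕ x)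
      (λ {x} x∈ _ → ∈-allFin _ , ==⁺ (h x x (proj₂ (sound x∈))) , toℕ-pt-< (proj₁ (sound x∈)))) (count-all fs)
    where
    fix⇒ : ∀ x → lookup σ x ≡ x → toℕ x + toℕ x ≋ a
    fix⇒ x e = ≋-trans (≋-+ (≋-refl {X}) (pt-injective (trans (pt-toℕ x) (trans (sym e) (trans (cong (lookup σ) (sym (pt-toℕ x))) (h X (neg X + a) z))))) ) z
      where
      X = toℕ x
      z : X + (neg X + a) ≋ a
      z = ≋-trans (≋-reflexive (sym (+-assoc X (neg X) a))) (≋-+ (neg-≋ X) (≋-refl {a}))

-- Summing over the reflections by conjugacy.

module ReflectionSums (n : ℕ) (2<n : 2 < n) (m : Mono) where
  open Polygon n 2<n
  open Reduction n 2<n m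

  -- conjugation by a rotation of one step
  fixed-ref-2 : ∀ a → fixed (ref (2 + a)) ≡ fixed (ref a)
  fixed-ref-2 a = count-bij (graphs n) (graphs n) unique-graphs unique-graphs (act π) (act π⁻¹)
    (λ {G} G∈ t → let (st , au) = ∧⁻ {stdB G} t in act-∈ π G ,
      ∧⁺ (std⁺ (act π G) (std-act {G} {π} G∈ (std-rot {adj G} {π} (rot-at 1) (std⁻ G st)))) (subst (λ τ → T (autoB (act π G , τ))) conj₁ (auto-fwd {G} {ref (2 + a)} G∈ au)) , act-inv G∈)
    (λ {G} G∈ t → let (st , au) = ∧⁻ {stdB G} t in act-∈ π⁻¹ G ,
      ∧⁺ (std⁺ (act π⁻¹ G) (std-act {G} {π⁻¹} G∈ (std-rot {adj G} {π⁻¹} π⁻¹-rot (std⁻ G st)))) (subst (λ τ → T (autoB (act π⁻¹ G , τ))) conj₂ (auto-bwd {G} {ref a} G∈ au)) , act-inv′ G∈)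
    where
    π = rot 1
    open Conj π (rot-inj 1)
    π⁻¹-rot : IsRot π⁻¹ n-1
    π⁻¹-rot x = trans (cong (lookup π⁻¹) (trans (pt-cong (≋-sym (≋-n x))) (trans (cong (λ k → pt (x + k)) (trans (sym 1+n-1) (+-comm 1 n-1))) (trans (cong pt (sym (+-assoc x n-1 1))) (sym (rot-at 1 (x + n-1)))))))
      (inv-l π (rot-inj 1) (pt (x + n-1)))
    conj₁ : (π⁻¹ · ref (2 + a)) · π ≡ ref a
    conj₁ = isRef⇒≡ {(π⁻¹ · ref (2 + a)) · π} {a} {a} (λ x y e → inj (rot-inj 1) (trans (at-fwd (ref (2 + a)) (pt x)) (trans (cong (lookup (ref (2 + a))) (rot-at 1 x))
      (trans (ref-at (2 + a) (x + 1) (y + 1) (≋-trans (≋-reflexive (ℕS.solve 2 (λ x y → x ℕS.:+ ℕS.con 1 ℕS.:+ (y ℕS.:+ ℕS.con 1) ℕS.:= ℕS.con 2 ℕS.:+ (x ℕS.:+ y)) refl x y)) (≋-+ (≋-refl {2}) e))) (sym (rot-at 1 y)))))) ≋-refl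
    conj₂ : (π · ref a) · π⁻¹ ≡ ref (2 + a)
    conj₂ = isRef⇒≡ {(π · ref a) · π⁻¹} {2 + a} {2 + a} (λ x y e → trans (at-bwd (ref a) (pt x)) (trans (cong (λ i → lookup π (lookup (ref a) i)) (π⁻¹-rot x))
      (trans (cong (lookup π) (ref-at a (x + n-1) (y + n-1) (≋-pred (≋-pred (≋-trans (≋-reflexive (sh x y)) (≋-trans (≋-n (x + y + n)) (≋-trans (≋-n (x + y)) e)))))))
      (trans (rot-at 1 (y + n-1)) (pt-cong (≋-trans (≋-reflexive (trans (+-assoc y n-1 1) (cong (y +_) (trans (+-comm n-1 1) 1+n-1)))) (≋-n y))))))) ≋-refl
      where
      sh : ∀ x y → suc (suc (x + n-1 + (y + n-1))) ≡ x + y + n + n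
      sh x y = trans (ℕS.solve 3 (λ x y z → ℕS.con 2 ℕS.:+ (x ℕS.:+ z ℕS.:+ (y ℕS.:+ z)) ℕS.:= x ℕS.:+ y ℕS.:+ (ℕS.con 1 ℕS.:+ z) ℕS.:+ (ℕS.con 1 ℕS.:+ z)) refl x y n-1) (cong (λ k → x + y + k + k) 1+n-1)

  fixed-ref-n : ∀ a → fixed (ref (a + n)) ≡ fixed (ref a)
  fixed-ref-n a = cong fixed (isRef⇒≡ {ref (a + n)} (ref-at (a + n)) (≋-n a))

  sum-1⋯ : ∀ k (f : ℕ → ℕ) (g : ℕ → ℕ) → sumL f (map suc (applyUpTo g k)) ≡ sum (applyUpTo (λ i → f (suc (g i))) k)
  sum-1⋯ zero    f g = refl
  sum-1⋯ (suc k) f g = cong (f (suc (g 0)) +_) (sum-1⋯ k f (g ∘ suc))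

  sum-periodic : ∀ k (f : ℕ → ℕ) → (∀ a → f (2 + a) ≡ f a) → sum (applyUpTo f (k * 2)) ≡ k * (f 0 + f 1)
  sum-periodic zero    f h = refl
  sum-periodic (suc k) f h = trans (cong (λ s → f 0 + (f 1 + s)) (trans (sum-periodic k (λ i → f (2 + i)) (λ a → h (2 + a))) (cong (k *_) (cong₂ _+_ (h 0) (h 1))))) (sym (+-assoc (f 0) (f 1) _))

  periodic : ∀ (f : ℕ → ℕ) → (∀ a → f (2 + a) ≡ f a) → ∀ k a → f (k * 2 + a) ≡ f a
  periodic f h zero    a = refl
  periodic f h (suc k) a = trans (h (k * 2 + a)) (periodic f h k a)

  f : ℕ → ℕ
  f a = fixed (ref a)

  -- There are two classes according to the parity of the angle; n - 1 and n represent them because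
  -- these are the angles that `Folding` treats.
  ref-sum-even : ∀ k → n ≡ k * 2 → sumL (fixed ∘ ref) 1⋯n ≡ k * (fixed (ref n-1) + fixed (ref n))
  ref-sum-even zero    e = ⊥-elim (<⇒≢ 0<n (sym e))
  ref-sum-even (suc k) e = begin
    sumL f 1⋯n                                    ≡⟨ sum-1⋯ n f id ⟩
    sum (applyUpTo (f ∘ suc) n)                   ≡⟨ cong (λ z → sum (applyUpTo (f ∘ suc) z)) e ⟩
    sum (applyUpTo (f ∘ suc) (suc k * 2))         ≡⟨ sum-periodic (suc k) (f ∘ suc) (λ a → fixed-ref-2 (suc a)) ⟩
    suc k * (f 1 + f 2)                           ≡⟨ cong (suc k *_) (cong₂ _+_ (sym e₁) (sym e₂)) ⟩
    suc k * (f n-1 + f n) ∎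
    where
    open ≡-Reasoning
    e₂ : f n ≡ f 2
    e₂ = trans (cong f (trans e (+-comm 2 (k * 2)))) (periodic f fixed-ref-2 k 2)
    e₁ : f n-1 ≡ f 1
    e₁ = trans (cong f (suc-injective (trans 1+n-1 (trans e (cong suc (+-comm 1 (k * 2))))))) (periodic f fixed-ref-2 k 1)

  -- All reflections contribute equally: angles matter only modulo n, and adding the odd number n
  -- changes the parity.
  ref-sum-odd : ∀ k → n ≡ suc (k * 2) → sumL (fixed ∘ ref) 1⋯n ≡ n * fixed (ref n-1)
  ref-sum-odd k e = begin
    sumL f 1⋯n                                          ≡⟨ sum-1⋯ n f id ⟩
    sum (applyUpTo (f ∘ suc) n)                         ≡⟨ cong (λ z → sum (applyUpTo (f ∘ suc) z)) e ⟩
    f 1 + sum (applyUpTo (λ i → f (2 + i)) (k * 2))     ≡⟨ cong₂ _+_ 1≡0 (sum-periodic k (λ i → f (2 + i)) (λ a → fixed-ref-2 (2 + a))) ⟩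
    f 0 + k * (f 2 + f 3)                               ≡⟨ cong (λ z → f 0 + k * z) (cong₂ _+_ (fixed-ref-2 0) (trans (fixed-ref-2 1) 1≡0)) ⟩
    f 0 + k * (f 0 + f 0)                               ≡⟨ h (f 0) k ⟩
    suc (k * 2) * f 0                                   ≡⟨ cong₂ _*_ (sym e) (sym (trans (cong f (suc-injective (trans 1+n-1 (trans e (cong suc (sym (+-identityʳ (k * 2)))))))) (periodic f fixed-ref-2 k 0))) ⟩
    n * f n-1 ∎
    where
    open ≡-Reasoning
    1≡0 : f 1 ≡ f 0
    1≡0 = trans (sym (periodic f fixed-ref-2 k 1)) (trans (cong f (trans (+-comm (k * 2) 1) (sym e))) (fixed-ref-n 0))
    h : ∀ x k → x + k * (x + x) ≡ suc (k * 2) * x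
    h x k = ℕS.solve 2 (λ x k → x ℕS.:+ k ℕS.:* (x ℕS.:+ x) ℕS.:= (ℕS.con 1 ℕS.:+ k ℕS.:* ℕS.con 2) ℕS.:* x) refl x k

-- Coefficients of the target series

weightFrom-0 : ∀ i b → (∀ e → exponent b e ≡ 0) → weightFrom i b ≡ 0
weightFrom-0 i []      h = refl
weightFrom-0 i (y ∷ b) h = trans (cong₂ (λ p r → suc i * p + r) (h 0) (weightFrom-0 (suc i) b (h ∘ suc))) (cong (_+ 0) (*-zeroʳ (suc i)))

weightFrom-exponent : ∀ i a b → HasExponents b (exponent a) → weightFrom i b ≡ weightFrom i a
weightFrom-exponent i []      b       h = weightFrom-0 i b h
weightFrom-exponent i (x ∷ a) []      h = sym (weightFrom-0 i (x ∷ a) (λ e → sym (h e)))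
weightFrom-exponent i (x ∷ a) (y ∷ b) h = cong₂ (λ p r → suc i * p + r) (h 0) (weightFrom-exponent (suc i) a b (h ∘ suc))

weight-two : ∀ {m i j} → HasExponents m (two i j) → weight m ≡ i + j * 2
weight-two {m} {i} {j} h = trans (weightFrom-exponent 0 (i ∷ j ∷ []) m (λ e → trans (h e) (eq e)))
  (ℕS.solve 2 (λ i j → i ℕS.:+ ℕS.con 0 ℕS.:+ (j ℕS.:+ (j ℕS.:+ ℕS.con 0) ℕS.:+ ℕS.con 0) ℕS.:= i ℕS.:+ j ℕS.:* ℕS.con 2) refl i j)
  where
  eq : ∀ e → two i j e ≡ exponent (i ∷ j ∷ []) e
  eq zero          = refl
  eq (suc zero)    = refl
  eq (suc (suc e)) = refl

weight-power : ∀ {m e g} → HasExponents m (power (suc e) g) → weight m ≡ suc e * g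
weight-power {m} {e} {g} h = trans (weightFrom-exponent 0 (mon e) m (λ i → trans (h i) (sym (exp e i)))) (wt e 0)
  where
  mon : ℕ → Mono
  mon e = replicate e 0 ++ [ g ]
  exp : ∀ e i → exponent (mon e) i ≡ power (suc e) g i
  exp zero    zero    = refl
  exp zero    (suc i) = refl
  exp (suc e) zero    = refl
  exp (suc e) (suc i) = exp e i
  wt : ∀ e i → weightFrom i (mon e) ≡ suc (i + e) * g
  wt zero    i = trans (+-identityʳ _) (cong (λ k → suc k * g) (sym (+-identityʳ i)))
  wt (suc e) i = trans (cong (_+ weightFrom (suc i) (mon e)) (*-zeroʳ (suc i))) (trans (wt e (suc i)) (cong (λ k → suc k * g) (sym (+-suc i e))))

κ-yes : ∀ c m → (∀ e → exponent m e ≡ 0) → κ c m ≡ c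
κ-yes c []         h = κ-[] c
κ-yes c (x ∷ m)    h with h 0
... | refl = trans (κ-0∷ c m) (κ-yes c m (h ∘ suc))

κ-no : ∀ c m → ¬ (∀ e → exponent m e ≡ 0) → κ c m ≡ 0ℚ
κ-no c []          h = ⊥-elim (h (λ _ → refl))
κ-no c (zero ∷ m)  h = trans (κ-0∷ c m) (κ-no c m (λ z → h (λ { zero → refl ; (suc e) → z e })))
κ-no c (suc x ∷ m) h = κ-suc∷ c x m

ι-yes : ∀ e f m {k} → HasExponents m (power (suc e) k) → ι e f m ≡ f k
ι-yes zero    f []        h = cong f (h 0)
ι-yes (suc e) f []        h = cong f (trans (h (suc e)) (power-yes (suc (suc e)) _ (suc e) refl))
ι-yes zero    f (x ∷ m)     h = trans (κ-yes (f x) m (h ∘ suc)) (cong f (h 0))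
ι-yes (suc e) f (zero ∷ m)  h = ι-yes e f m (h ∘ suc)
ι-yes (suc e) f (suc x ∷ m) h with h 0
... | ()

ι-no : ∀ e f m → f 0 ≡ 0ℚ → (∀ k → ¬ HasExponents m (power (suc e) (suc k))) → ι e f m ≡ 0ℚ
ι-no e       f []        f0 h = f0
ι-no zero    f (zero ∷ m)  f0 h = trans (cong (λ c → κ c m) f0) (κ-0 m)
ι-no zero    f (suc x ∷ m) f0 h = κ-no (f (suc x)) m (λ z → h x (λ { zero → refl ; (suc i) → z i }))
ι-no (suc e) f (zero ∷ m)  f0 h = ι-no e f m f0 (λ k z → h k (λ { zero → refl ; (suc i) → z i }))
ι-no (suc e) f (suc x ∷ m) f0 h = refl

Σ<-single : ∀ n f e → e < n → (∀ i → i ≢ e → f i ≡ 0ℚ) → Σ< n f ≡ f e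
Σ<-single (suc n) f zero    lt       h = trans (Σ<-suc n f) (trans (cong (f 0 ℚ.+_) (Σ<-zero n (λ i _ → h (suc i) (λ ())))) (ℚP.+-identityʳ (f 0)))
Σ<-single (suc n) f (suc e) (s≤s lt) h = trans (Σ<-suc n f) (trans (cong₂ ℚ._+_ (h 0 (λ ())) (Σ<-single n (f ∘ suc) e lt (λ i ne → h (suc i) (λ eq → ne (suc-injective eq))))) (ℚP.+-identityˡ (f (suc e))))

x₁-[] : ∀ f → (Sch.x₁ ⊛ f) [] ≡ 0ℚ
x₁-[] f = trans (⊛-[] Sch.x₁ f) (ℚP.*-zeroˡ (f []))

x₁-0 : ∀ f m → (Sch.x₁ ⊛ f) (0 ∷ m) ≡ 0ℚ
x₁-0 f m = trans (⊛-∷ Sch.x₁ f 0 m) (Σ<-zero 1 (λ { zero _ → ⊛-zeroˡ _ _ κ-0 m ; (suc i) (s≤s ()) }))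

x₁-suc : ∀ f k m → (Sch.x₁ ⊛ f) (suc k ∷ m) ≡ f (k ∷ m)
x₁-suc f k m = trans (⊛-∷ Sch.x₁ f (suc k) m) (trans (Σ<-single (suc (suc k)) _ 1 (s≤s (s≤s z≤n)) h) (trans (κ-⊛ 1ℚ (f ∘ (k ∷_)) m) (ℚP.*-identityˡ (f (k ∷ m)))))
  where
  h : ∀ i → i ≢ 1 → ((Sch.x₁ ∘ (i ∷_)) ⊛ (f ∘ (suc k ∸ i ∷_))) m ≡ 0ℚ
  h zero          ne = ⊛-zeroˡ _ _ κ-0 m
  h (suc zero)    ne = ⊥-elim (ne refl)
  h (suc (suc i)) ne = ⊛-zeroˡ _ _ κ-0 m

¼ : ℚ
¼ = ℤ.+ 1 ℚ./ 4

-- The shares of the reflections and of the rotations, identity included. Multiplied by 2n they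
-- become the sums of fixed dissections `refSum` and `rotSum`.
refPart rotPart : Mono → ℚ
refPart m = ½ ℚ.* (Sch.x₁ ⊛ ι 1 Sch.R) m ℚ.+ (¼ ℚ.* (Sch.x₁ ⊛ (Sch.x₁ ⊛ ι 1 Sch.R′)) m ℚ.+ ¼ ℚ.* ι 1 (card trees) m)
rotPart m = Sch.logPart (length m) m ℚ.+ (ι 0 Sch.idc m ℚ.+ ℚ.- (½ ℚ.* ι 0 Sch.avg m))

target-parts : ∀ m → Sch.target m ≡ rotPart m ℚ.+ refPart m
target-parts m = trans (⊕-at _ _ m) (trans (cong (l ℚ.+_) (trans (⊕-at _ _ m) (cong₂ ℚ._+_
    (trans (⊕-at (ι 0 Sch.idc) (⊖ (κ ½ ⊛ ι 0 Sch.avg)) m) (cong (ι 0 Sch.idc m ℚ.+_) (trans (⊖-at (κ ½ ⊛ ι 0 Sch.avg) m) (cong ℚ.-_ (κ-⊛ ½ (ι 0 Sch.avg) m)))))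
    (trans (⊕-at _ _ m) (cong₂ ℚ._+_ (κ-⊛ ½ _ m) (trans (⊕-at _ _ m) (cong₂ ℚ._+_ (κ-⊛ ¼ _ m) (κ-⊛ ¼ (ι 1 (card trees)) m))))))))
  (sym (ℚP.+-assoc l (ι 0 Sch.idc m ℚ.+ ℚ.- (½ ℚ.* ι 0 Sch.avg m)) (refPart m))))
  where
  l = Sch.logPart (length m) m

refPart-[] : refPart [] ≡ 0ℚ
refPart-[] = cong₂ (λ a b → ½ ℚ.* a ℚ.+ b) (x₁-[] _) (cong₂ (λ a b → ¼ ℚ.* a ℚ.+ ¼ ℚ.* b) (x₁-[] _) (⟪⟫-def 0))

-- The head exponent is the number of vertices on the axis, and it selects one of the three
-- summands; above two, none is left.
refPart-0 : ∀ m → refPart (0 ∷ m) ≡ ¼ ℚ.* ι 0 (card trees) m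
refPart-0 m = trans (cong₂ (λ a b → ½ ℚ.* a ℚ.+ (¼ ℚ.* b ℚ.+ ¼ ℚ.* x)) (x₁-0 _ m) (x₁-0 _ m)) (solve 1 (λ x → con ½ :* con 0ℚ :+ (con ¼ :* con 0ℚ :+ con ¼ :* x) := con ¼ :* x) refl x)
  where
  open +-*-Solver
  x = ι 0 (card trees) m

refPart-1 : ∀ m → refPart (1 ∷ m) ≡ ½ ℚ.* ι 0 Sch.R m
refPart-1 m = trans (cong₂ (λ a b → ½ ℚ.* a ℚ.+ (¼ ℚ.* b ℚ.+ ¼ ℚ.* 0ℚ)) (x₁-suc _ 0 m) (trans (x₁-suc _ 0 m) (x₁-0 _ m)))
  (solve 1 (λ x → con ½ :* x :+ (con ¼ :* con 0ℚ :+ con ¼ :* con 0ℚ) := con ½ :* x) refl (ι 0 Sch.R m))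
  where open +-*-Solver

refPart-2 : ∀ m → refPart (2 ∷ m) ≡ ¼ ℚ.* ι 0 Sch.R′ m
refPart-2 m = trans (cong₂ (λ a b → ½ ℚ.* a ℚ.+ (¼ ℚ.* b ℚ.+ ¼ ℚ.* 0ℚ)) (x₁-suc _ 1 m) (trans (x₁-suc _ 1 m) (x₁-suc _ 0 m)))
  (solve 1 (λ x → con ½ :* con 0ℚ :+ (con ¼ :* x :+ con ¼ :* con 0ℚ) := con ¼ :* x) refl (ι 0 Sch.R′ m))
  where open +-*-Solver

refPart-3+ : ∀ i m → refPart (suc (suc (suc i)) ∷ m) ≡ 0ℚ
refPart-3+ i m = cong₂ (λ a b → ½ ℚ.* a ℚ.+ (¼ ℚ.* b ℚ.+ ¼ ℚ.* 0ℚ)) (x₁-suc _ (suc (suc i)) m) (trans (x₁-suc _ (suc (suc i)) m) (x₁-suc _ (suc i) m))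

ι0-no : ∀ f m → (∀ k → ¬ HasExponents m (power 1 k)) → ι 0 f m ≡ 0ℚ
ι0-no f []      h = ⊥-elim (h 0 (λ { zero → refl ; (suc e) → refl }))
ι0-no f (x ∷ m) h = κ-no (f x) m (λ z → h x (λ { zero → refl ; (suc e) → z e }))

two⁺ : ∀ {i j m} → HasExponents m (power 1 j) → HasExponents (i ∷ m) (two i j)
two⁺ h zero          = refl
two⁺ h (suc zero)    = h 0
two⁺ h (suc (suc e)) = h (suc e)

two⁻ : ∀ {i i′ j m} → HasExponents (i ∷ m) (two i′ j) → HasExponents m (power 1 j)
two⁻ h zero    = h 1
two⁻ h (suc e) = h (suc (suc e))

isPower₁? : ∀ m → (∃[ j ] HasExponents m (power 1 j)) ⊎ (∀ j → ¬ HasExponents m (power 1 j))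
isPower₁? []      = inj₁ (0 , λ { zero → refl ; (suc e) → refl })
isPower₁? (x ∷ m) with T? (allZero m)
... | yes t = inj₁ (x , λ { zero → refl ; (suc e) → allZero⁻ m t e })
... | no ¬t = inj₂ (λ j h → ¬t (allZero⁺ m (h ∘ suc)))

isPower? : ∀ m → (∃[ e ] ∃[ k ] (e < length m × HasExponents m (power (suc e) (suc k)))) ⊎ (∀ e k → ¬ HasExponents m (power (suc e) (suc k)))
isPower? [] = inj₂ (λ e k h → 0≢1+n (trans (h e) (power-yes (suc e) (suc k) e refl)))
isPower? (suc x ∷ m) with T? (allZero m)
... | yes t = inj₁ (0 , x , s≤s z≤n , λ { zero → refl ; (suc e) → allZero⁻ m t e })
... | no ¬t = inj₂ (λ { zero k h → ¬t (allZero⁺ m (h ∘ suc)) ; (suc e) k h → 1+n≢0 (h 0) })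
isPower? (zero ∷ m) with isPower? m
... | inj₁ (e , k , lt , h) = inj₁ (suc e , k , s≤s lt , λ { zero → refl ; (suc i) → h i })
... | inj₂ ¬h = inj₂ (λ { zero k h → 0≢1+n (h 0) ; (suc e) k h → ¬h e k (h ∘ suc) })

power-unique : ∀ {m e k e′ k′} → HasExponents m (power (suc e) (suc k)) → HasExponents m (power (suc e′) (suc k′)) → e ≡ e′ × k ≡ k′
power-unique {m} {e} {k} {e′} {k′} h h′ with e ≟ e′
... | yes refl = refl , suc-injective (trans (sym (power-yes (suc e) (suc k) e refl)) (trans (sym (h e)) (trans (h′ e) (power-yes (suc e) (suc k′) e refl))))
... | no ne = ⊥-elim (1+n≢0 (trans (sym (power-yes (suc e) (suc k) e refl)) (trans (sym (h e)) (trans (h′ e) (power-no (suc e′) (suc k′) e (λ eq → ne (suc-injective eq)))))))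

rotPart-no : ∀ m → (∀ e k → ¬ HasExponents m (power (suc e) (suc k))) → rotPart m ≡ 0ℚ
rotPart-no m h = trans (cong₂ (λ a b → a ℚ.+ b) (Σ<-zero (length m) (λ e _ → trans (cong (c e ℚ.*_) (ι-no e Sch.avg m refl (h e))) (ℚP.*-zeroʳ (c e))))
    (cong₂ (λ a b → a ℚ.+ ℚ.- (½ ℚ.* b)) (ι-no 0 Sch.idc m refl (h 0)) (ι-no 0 Sch.avg m refl (h 0)))) refl
  where
  c : ℕ → ℚ
  c e = ½ ℚ.* (ℤ.+ totient (suc e) ℚ./ suc e)

-- Here the term ½ `avg` from the logarithm for d = 1 cancels against the correction.
rotPart-1 : ∀ {m k} → 0 < length m → HasExponents m (power 1 (suc k)) → rotPart m ≡ Sch.idc (suc k)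
rotPart-1 {m} {k} lt h = trans (cong₂ ℚ._+_ (trans (Σ<-single (length m) _ 0 lt others) (cong (½ ℚ.* 1ℚ ℚ.*_) (ι-yes 0 Sch.avg m h)))
    (cong₂ (λ a b → a ℚ.+ ℚ.- (½ ℚ.* b)) (ι-yes 0 Sch.idc m h) (ι-yes 0 Sch.avg m h))) (solve 2 (λ a i → con ½ :* con 1ℚ :* a :+ (i :+ :- (con ½ :* a)) := i) refl (Sch.avg (suc k)) (Sch.idc (suc k)))
  where
  open +-*-Solver
  others : ∀ e → e ≢ 0 → (½ ℚ.* (ℤ.+ totient (suc e) ℚ./ suc e)) ℚ.* ι e Sch.avg m ≡ 0ℚ
  others e ne = trans (cong ((½ ℚ.* (ℤ.+ totient (suc e) ℚ./ suc e)) ℚ.*_) (ι-no e Sch.avg m refl (λ k′ h′ → ne (sym (proj₁ (power-unique {m} h h′)))))) (ℚP.*-zeroʳ (½ ℚ.* (ℤ.+ totient (suc e) ℚ./ suc e)))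

rotPart-2+ : ∀ {m e k} → suc e < length m → HasExponents m (power (suc (suc e)) (suc k)) →
  rotPart m ≡ (½ ℚ.* (ℤ.+ totient (suc (suc e)) ℚ./ suc (suc e))) ℚ.* Sch.avg (suc k)
rotPart-2+ {m} {e} {k} lt h = trans (cong₂ ℚ._+_ (trans (Σ<-single (length m) _ (suc e) lt others) (cong (c ℚ.*_) (ι-yes (suc e) Sch.avg m h)))
    (cong₂ (λ a b → a ℚ.+ ℚ.- (½ ℚ.* b)) (ι-no 0 Sch.idc m refl no₀) (ι-no 0 Sch.avg m refl no₀))) (ℚP.+-identityʳ (c ℚ.* Sch.avg (suc k)))
  where
  c = ½ ℚ.* (ℤ.+ totient (suc (suc e)) ℚ./ suc (suc e))
  others : ∀ e′ → e′ ≢ suc e → (½ ℚ.* (ℤ.+ totient (suc e′) ℚ./ suc e′)) ℚ.* ι e′ Sch.avg m ≡ 0ℚ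
  others e′ ne = trans (cong ((½ ℚ.* (ℤ.+ totient (suc e′) ℚ./ suc e′)) ℚ.*_) (ι-no e′ Sch.avg m refl (λ k′ h′ → ne (sym (proj₁ (power-unique {m} h h′)))))) (ℚP.*-zeroʳ (½ ℚ.* (ℤ.+ totient (suc e′) ℚ./ suc e′)))
  no₀ : ∀ k′ → ¬ HasExponents m (power 1 (suc k′))
  no₀ k′ h′ = 1+n≢0 (proj₁ (power-unique {m} h h′))

-- Summing over the dihedral group

identity-term : ∀ n-1 n K k → n ≡ suc n-1 → n ≡ K → K ≡ suc k → ⟪ n + n ⟫ ℚ.* Sch.idc K ≡ ⟪ length (trees n-1) ⟫
identity-term k n K k refl refl refl = trans (cong (ℚ._* Sch.idc (suc k)) (⟪⟫-+ (suc k) (suc k))) (value (length (trees k)))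
  where
  open +-*-Solver
  value : ∀ t → (⟪ suc k ⟫ ℚ.+ ⟪ suc k ⟫) ℚ.* (½ ℚ.* (⟪ t ⟫ ℚ.* (ℤ.+ 1 ℚ./ suc k))) ≡ ⟪ t ⟫
  value t = trans (solve 3 (λ K w r → (K :+ K) :* (con ½ :* (w :* r)) := K :* (w :* r)) refl ⟪ suc k ⟫ ⟪ t ⟫ (ℤ.+ 1 ℚ./ suc k)) (/-cancelˡ k ⟪ t ⟫)

-- The factor 2n = 2 D K is absorbed by ½, by the D under φ and by the K in `avg`, leaving φ(D)
-- rotations with `r` fixed dissections each.
rotation-term : ∀ φ e k r {n} → n ≡ suc (suc e) * suc k → ⟪ n + n ⟫ ℚ.* ((½ ℚ.* (ℤ.+ φ ℚ./ suc (suc e))) ℚ.* (r ℚ.* (ℤ.+ 1 ℚ./ suc k))) ≡ ⟪ φ ⟫ ℚ.* r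
rotation-term φ e k r {n} n≡ = trans (cong (ℚ._* ((½ ℚ.* φ/D) ℚ.* (r ℚ.* i))) (trans (⟪⟫-+ n n) (cong (λ x → x ℚ.+ x) (trans (cong ⟪_⟫ n≡) (⟪⟫-* D K)))))
  (trans (solve 5 (λ D K φ r i → (D :* K :+ D :* K) :* ((con ½ :* φ) :* (r :* i)) := (φ :* D) :* (K :* (r :* i))) refl ⟪ D ⟫ ⟪ K ⟫ φ/D r i)
    (cong₂ ℚ._*_ (trans (/-cancel (ℤ.+ φ) (suc e)) (sym (⟪⟫-def φ))) (/-cancelˡ k r)))
  where
  open +-*-Solver
  D = suc (suc e)
  K = suc k
  φ/D = ℤ.+ φ ℚ./ D
  i = ℤ.+ 1 ℚ./ K

module Coefficient (n : ℕ) (2<n : 2 < n) (m : Mono) where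
  open Polygon n 2<n
  open Reduction n 2<n m
  open Codes n 2<n using (iff)
  open Identity n 2<n m
  open CycleTypes n 2<n
  open ReflectionSums n 2<n m using (ref-sum-even; ref-sum-odd)

  fixed-value : ∀ σ (f : ℕ → ℕ) {c} → (∀ e → exponent (cycleType σ) e ≡ f e) → count (isoQ σ) (graphs n) ≡ c → HasExponents m f → fixed σ ≡ c
  fixed-value σ f h hc hm = trans (fixed-yes σ (sameMono⁺ (cycleType σ) m (λ e → trans (hm e) (sym (h e))))) hc

  fixed-zero : ∀ σ (f : ℕ → ℕ) → (∀ e → exponent (cycleType σ) e ≡ f e) → ¬ HasExponents m f → fixed σ ≡ 0
  fixed-zero σ f h hm = fixed-no σ (λ t → hm (λ e → trans (sameMono⁻ (cycleType σ) m t e) (h e)))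

  double : ∀ x → x + x ≡ 2 * x
  double x = cong (x +_) (sym (+-identityʳ x))

  -- 2x is less than 2n, so only two multiples of n can intervene. Used to solve 2x ≋ a for the
  -- vertices on an axis.
  double-≋ : ∀ {x a} → x < n → a < n → x + x ≋ a → x + x ≡ a ⊎ x + x ≡ n + a
  double-≋ {x} {a} x<n a<n e with x + x <? n
  ... | yes lt = inj₁ (≋-small lt a<n e)
  ... | no ¬lt with m≤n⇒∃[o]m+o≡n (≮⇒≥ ¬lt)
  ... | y , eq = inj₂ (trans (sym eq) (cong (n +_) (≋-small (+-cancelˡ-< n y n (subst (_< n + n) (sym eq) (+-mono-< x<n x<n))) a<n
          (≋-trans (≋-trans (≋-sym (≋-n y)) (≋-reflexive (trans (+-comm y n) eq))) e))))

  n-1<n : n-1 < n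
  n-1<n = ≤-reflexive 1+n-1

  module Odd (k : ℕ) (n≡ : n ≡ suc (k * 2)) where
    n-1≡ : n-1 ≡ k * 2
    n-1≡ = suc-injective (trans 1+n-1 n≡)

    k+k≡ : k + k ≡ n-1
    k+k≡ = trans (double k) (trans (*-comm 2 k) (sym n-1≡))

    points : count (λ x → lookup (ref n-1) x == x) (allFin n) ≡ 1
    points = ref-fixed {ref n-1} (ref-at n-1) [ k ] ([] ∷ [])
      (λ { (here refl) → ≤-<-trans (≤-trans (m≤m+n k k) (≤-reflexive k+k≡)) n-1<n , ≋-reflexive k+k≡ })
      (λ x x<n e → here (h x (double-≋ x<n n-1<n e)))
      where
      h : ∀ x → x + x ≡ n-1 ⊎ x + x ≡ n + n-1 → x ≡ k
      h x (inj₁ e) = *-cancelˡ-≡ x k 2 (trans (sym (double x)) (trans e (trans (sym k+k≡) (double k))))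
      h x (inj₂ e) = ⊥-elim (even≢odd x n-1 (trans (sym (double x)) (trans e (trans (cong (_+ n-1) (sym 1+n-1)) (cong suc (double n-1))))))

    types : ∀ e → exponent (cycleType (ref n-1)) e ≡ two 1 k e
    types = cycleType-involution {ref n-1} (ref-involutive {ref n-1} (ref-at n-1)) 1 k points (sym n≡)

    refs : count (isoQ (ref n-1)) (graphs n) ≡ length (trees (suc k))
    refs = Folding.reflection-count n 2<n n-1 k (≤-reflexive k+k≡) (≤-trans (≤-reflexive (sym k+k≡)) (n≤1+n _)) (inj₁ 1+n-1) m {ref n-1} (ref-at n-1)

  module Even (k : ℕ) (n≡ : n ≡ suc k * 2) where
    n-1≡ : n-1 ≡ suc (k * 2)
    n-1≡ = suc-injective (trans 1+n-1 n≡)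

    k+k≡ : suc (k + k) ≡ n-1
    k+k≡ = trans (cong suc (trans (double k) (*-comm 2 k))) (sym n-1≡)

    K+K≡ : suc k + suc k ≡ n
    K+K≡ = trans (double (suc k)) (trans (*-comm 2 (suc k)) (sym n≡))

    points-edge : count (λ x → lookup (ref n-1) x == x) (allFin n) ≡ 0
    points-edge = ref-fixed {ref n-1} (ref-at n-1) [] [] (λ ()) (λ x x<n e → ⊥-elim (h x (double-≋ x<n n-1<n e)))
      where
      h : ∀ x → ¬ (x + x ≡ n-1 ⊎ x + x ≡ n + n-1)
      h x (inj₁ e) = even≢odd x k (trans (sym (double x)) (trans e (trans (sym k+k≡) (cong suc (double k)))))
      h x (inj₂ e) = even≢odd x (suc k + k) (trans (sym (double x)) (trans e (trans (cong₂ _+_ (sym K+K≡) (sym k+k≡))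
        (ℕS.solve 1 (λ k → (ℕS.con 1 ℕS.:+ k ℕS.:+ (ℕS.con 1 ℕS.:+ k)) ℕS.:+ (ℕS.con 1 ℕS.:+ (k ℕS.:+ k)) ℕS.:= ℕS.con 1 ℕS.:+ ℕS.con 2 ℕS.:* (ℕS.con 1 ℕS.:+ k ℕS.:+ k)) refl k))))

    points-vertex : count (λ x → lookup (ref n) x == x) (allFin n) ≡ 2
    points-vertex = ref-fixed {ref n} (ref-at n) (0 ∷ suc k ∷ []) (((λ ()) ∷ []) ∷ ([] ∷ []))
      (λ { (here refl) → 0<n , ≋-sym (≋-n 0) ; (there (here refl)) → <-≤-trans (m<m+n (suc k) (s≤s z≤n)) (≤-reflexive K+K≡) , ≋-reflexive K+K≡ })
      (λ x x<n e → h x (double-≋ x<n 0<n (≋-trans e (≋-n 0))))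
      where
      h : ∀ x → x + x ≡ 0 ⊎ x + x ≡ n + 0 → x ∈ 0 ∷ suc k ∷ []
      h x (inj₁ e) = here (m+n≡0⇒m≡0 x e)
      h x (inj₂ e) = there (here (*-cancelˡ-≡ x (suc k) 2 (trans (sym (double x)) (trans e (trans (+-identityʳ n) (trans (sym K+K≡) (double (suc k))))))))

    types-edge : ∀ e → exponent (cycleType (ref n-1)) e ≡ two 0 (suc k) e
    types-edge = cycleType-involution {ref n-1} (ref-involutive {ref n-1} (ref-at n-1)) 0 (suc k) points-edge (sym n≡)

    types-vertex : ∀ e → exponent (cycleType (ref n)) e ≡ two 2 k e
    types-vertex = cycleType-involution {ref n} (ref-involutive {ref n} (ref-at n)) 2 k points-vertex (sym n≡)

    refs-edge : count (isoQ (ref n-1)) (graphs n) ≡ length (trees (suc k))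
    refs-edge = Folding.reflection-count n 2<n n-1 k (≤-trans (n≤1+n _) (≤-reflexive k+k≡)) (≤-reflexive (sym k+k≡)) (inj₁ 1+n-1) m {ref n-1} (ref-at n-1)

    refs-vertex : count (isoQ (ref n)) (graphs n) ≡ length (trees (suc (suc k)))
    refs-vertex = Folding.reflection-count n 2<n n (suc k) (≤-reflexive K+K≡) (≤-trans (≤-reflexive (sym K+K≡)) (n≤1+n _)) (inj₂ refl) m {ref n} (ref-at n)

  parity : (∃[ k ] n ≡ suc (k * 2)) ⊎ (∃[ k ] n ≡ suc k * 2)
  parity with go n
    where
    go : ∀ x → (∃[ k ] x ≡ suc (k * 2)) ⊎ (∃[ k ] x ≡ k * 2)
    go zero    = inj₂ (0 , refl)
    go (suc x) with go x
    ... | inj₁ (k , e) = inj₂ (suc k , cong suc e)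
    ... | inj₂ (k , e) = inj₁ (k , cong suc e)
  ... | inj₁ r = inj₁ r
  ... | inj₂ (zero  , e) = ⊥-elim (<⇒≢ 0<n (sym e))
  ... | inj₂ (suc k , e) = inj₂ (k , e)

  refSum : ℕ
  refSum = sumL (fixed ∘ ref) 1⋯n

  refSum-no : (∀ i j → i ≤ 2 → ¬ HasExponents m (two i j)) → refSum ≡ 0
  refSum-no h with parity
  ... | inj₁ (k , e) = trans (ref-sum-odd k e) (trans (cong (n *_) (fixed-zero (ref n-1) (two 1 k) (Odd.types k e) (h 1 k (s≤s z≤n)))) (*-zeroʳ n))
  ... | inj₂ (k , e) = trans (ref-sum-even (suc k) e) (trans (cong (suc k *_) (cong₂ _+_ (fixed-zero (ref n-1) (two 0 (suc k)) (Even.types-edge k e) (h 0 (suc k) z≤n))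
      (fixed-zero (ref n) (two 2 k) (Even.types-vertex k e) (h 2 k ≤-refl)))) (*-zeroʳ (suc k)))

  module _ (weight≡ : weight m ≡ n) where

    refSum-value : ⟪ n + n ⟫ ℚ.* refPart m ≡ ⟪ refSum ⟫
    refSum-value = go m refl
      where
      open +-*-Solver
      zero-value : refPart m ≡ 0ℚ → (∀ i j → i ≤ 2 → ¬ HasExponents m (two i j)) → ⟪ n + n ⟫ ℚ.* refPart m ≡ ⟪ refSum ⟫
      zero-value e h = trans (cong (⟪ n + n ⟫ ℚ.*_) e) (trans (ℚP.*-zeroʳ ⟪ n + n ⟫) (sym (trans (cong ⟪_⟫ (refSum-no h)) (⟪⟫-def 0))))
      quarter : ∀ K x → n ≡ K * 2 → ⟪ n + n ⟫ ℚ.* (¼ ℚ.* ⟪ x ⟫) ≡ ⟪ K * x ⟫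
      quarter K x e = trans (cong (λ z → ⟪ z ⟫ ℚ.* (¼ ℚ.* ⟪ x ⟫)) (trans (cong₂ _+_ e e) (ℕS.solve 1 (λ k → k ℕS.:* ℕS.con 2 ℕS.:+ k ℕS.:* ℕS.con 2 ℕS.:= ℕS.con 4 ℕS.:* k) refl K)))
        (trans (cong (ℚ._* (¼ ℚ.* ⟪ x ⟫)) (trans (⟪⟫-* 4 K) (cong (ℚ._* ⟪ K ⟫) (⟪⟫-def 4)))) (trans (solve 2 (λ k x → con (ℤ.+ 4 ℚ./ 1) :* k :* (con ¼ :* x) := k :* x) refl ⟪ K ⟫ ⟪ x ⟫) (sym (⟪⟫-* K x))))
      half : ∀ x → ⟪ n + n ⟫ ℚ.* (½ ℚ.* ⟪ x ⟫) ≡ ⟪ n * x ⟫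
      half x = trans (cong (ℚ._* (½ ℚ.* ⟪ x ⟫)) (⟪⟫-+ n n)) (trans (solve 2 (λ k x → (k :+ k) :* (con ½ :* x) := k :* x) refl ⟪ n ⟫ ⟪ x ⟫) (sym (⟪⟫-* n x)))
      go : ∀ m′ → m ≡ m′ → ⟪ n + n ⟫ ℚ.* refPart m ≡ ⟪ refSum ⟫
      go [] e = ⊥-elim (<⇒≢ 0<n (trans (cong weight (sym e)) weight≡))
      go (i ∷ m′) e with isPower₁? m′
      go (suc (suc (suc i)) ∷ m′) e | _ = zero-value (trans (cong refPart e) (refPart-3+ i m′)) (λ i′ j le h → <⇒≱ (s≤s (s≤s (s≤s z≤n))) (≤-trans (≤-reflexive (trans (cong (λ m → exponent m 0) (sym e)) (h 0))) le))
      go (i ∷ m′) e | inj₂ ¬h = zero-value (trans (cong refPart e) (v i)) (λ i′ j _ h → ¬h j (two⁻ {i} {i′} {j} (subst (λ m → HasExponents m (two i′ j)) e h)))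
        where
        v : ∀ i → refPart (i ∷ m′) ≡ 0ℚ
        v zero = trans (refPart-0 m′) (trans (cong (¼ ℚ.*_) (ι0-no (card trees) m′ ¬h)) (ℚP.*-zeroʳ ¼))
        v (suc zero) = trans (refPart-1 m′) (trans (cong (½ ℚ.*_) (ι0-no Sch.R m′ ¬h)) (ℚP.*-zeroʳ ½))
        v (suc (suc zero)) = trans (refPart-2 m′) (trans (cong (¼ ℚ.*_) (ι0-no Sch.R′ m′ ¬h)) (ℚP.*-zeroʳ ¼))
        v (suc (suc (suc i))) = refPart-3+ i m′
      go (zero ∷ m′) e | inj₁ (j , h) = even j refl
        where
        hm : HasExponents m (two 0 j)
        hm = subst (λ m → HasExponents m (two 0 j)) (sym e) (two⁺ {0} {j} h)
        n≡ : n ≡ j * 2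
        n≡ = trans (sym weight≡) (weight-two {m} hm)
        even : ∀ j′ → j ≡ j′ → ⟪ n + n ⟫ ℚ.* refPart m ≡ ⟪ refSum ⟫
        even zero    e′ = ⊥-elim (<⇒≢ 0<n (sym (trans n≡ (cong (_* 2) e′))))
        even (suc j′) refl = trans (cong (⟪ n + n ⟫ ℚ.*_) (trans (cong refPart e) (trans (refPart-0 m′) (cong (¼ ℚ.*_) (ι-yes 0 (card trees) m′ h)))))
          (trans (quarter (suc j′) (length (trees (suc j′))) n≡) (cong ⟪_⟫ (sym (trans (ref-sum-even (suc j′) n≡) (cong (suc j′ *_)
            (trans (cong₂ _+_ (fixed-value (ref n-1) (two 0 (suc j′)) (Even.types-edge j′ n≡) (Even.refs-edge j′ n≡) hm)
                              (fixed-zero (ref n) (two 2 j′) (Even.types-vertex j′ n≡) (λ h′ → 0≢1+n (trans (sym (hm 0)) (h′ 0))))) (+-identityʳ _)))))))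
      go (suc zero ∷ m′) e | inj₁ (j , h) = odd j refl
        where
        hm : HasExponents m (two 1 j)
        hm = subst (λ m → HasExponents m (two 1 j)) (sym e) (two⁺ {1} {j} h)
        n≡ : n ≡ suc (j * 2)
        n≡ = trans (sym weight≡) (weight-two {m} hm)
        odd : ∀ j′ → j ≡ j′ → ⟪ n + n ⟫ ℚ.* refPart m ≡ ⟪ refSum ⟫
        -- This would be n = 1. It is the case in which `Sch.R` has 0 instead of w₁.
        odd zero    e′ = ⊥-elim (<⇒≱ 2<n (≤-trans (≤-reflexive (trans n≡ (cong (λ j → suc (j * 2)) e′))) (s≤s z≤n)))
        odd (suc j′) refl = trans (cong (⟪ n + n ⟫ ℚ.*_) (trans (cong refPart e) (trans (refPart-1 m′) (cong (½ ℚ.*_) (ι-yes 0 Sch.R m′ h)))))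
          (trans (half (length (trees (suc (suc j′))))) (cong ⟪_⟫ (sym (trans (ref-sum-odd (suc j′) n≡) (cong (n *_)
            (fixed-value (ref n-1) (two 1 (suc j′)) (Odd.types (suc j′) n≡) (Odd.refs (suc j′) n≡) hm))))))
      go (suc (suc zero) ∷ m′) e | inj₁ (j , h) =
          trans (cong (⟪ n + n ⟫ ℚ.*_) (trans (cong refPart e) (trans (refPart-2 m′) (cong (¼ ℚ.*_) (ι-yes 0 Sch.R′ m′ h)))))
          (trans (quarter (suc j) (length (trees (suc (suc j)))) n≡) (cong ⟪_⟫ (sym (trans (ref-sum-even (suc j) n≡) (cong (suc j *_)
            (cong₂ _+_ (fixed-zero (ref n-1) (two 0 (suc j)) (Even.types-edge j n≡) (λ h′ → 1+n≢0 (trans (sym (hm 0)) (h′ 0))))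
                       (fixed-value (ref n) (two 2 j) (Even.types-vertex j n≡) (Even.refs-vertex j n≡) hm)))))))
        where
        hm : HasExponents m (two 2 j)
        hm = subst (λ m → HasExponents m (two 2 j)) (sym e) (two⁺ {2} {j} h)
        n≡ : n ≡ suc j * 2
        n≡ = trans (sym weight≡) (weight-two {m} hm)

  refSum-other : weight m ≢ n → refSum ≡ 0
  refSum-other ne with parity
  ... | inj₁ (k , e) = trans (ref-sum-odd k e) (trans (cong (n *_) (fixed-zero (ref n-1) (two 1 k) (Odd.types k e) (λ h → ne (trans (weight-two {m} h) (sym e))))) (*-zeroʳ n))
  ... | inj₂ (k , e) = trans (ref-sum-even (suc k) e) (trans (cong (suc k *_) (cong₂ _+_
      (fixed-zero (ref n-1) (two 0 (suc k)) (Even.types-edge k e) (λ h → ne (trans (weight-two {m} h) (sym e))))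
      (fixed-zero (ref n) (two 2 k) (Even.types-vertex k e) (λ h → ne (trans (weight-two {m} h) (sym e)))))) (*-zeroʳ (suc k)))

  -- Rotations, according to the greatest common divisor g of the angle a and n

  module Rot {a : ℕ} (a∈ : a ∈ 1⋯n) where
    g : ℕ
    g = gcd a n

    0<g : 0 < g
    0<g = n≢0⇒n>0 (λ e → <⇒≢ 0<n (sym (gcd[m,n]≡0⇒n≡0 a e)))

    d∣n : g ∣ n
    d∣n = gcd[m,n]∣n a n

    D j : ℕ
    D = quotient d∣n
    j = quotient (gcd[m,n]∣m a n)

    n≡Dg : n ≡ D * g
    n≡Dg = _∣_.equality d∣n

    a≋ : a ≋ j * g
    a≋ = ≋-reflexive (_∣_.equality (gcd[m,n]∣m a n))

    multiple : ∃[ j′ ] g ≋ j′ * a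
    multiple with Bézout.identity (gcd-GCD a n)
    ... | Bézout.+- x y eq = x , ≋-trans (≋-sym (≋-kn g y)) (≋-reflexive eq)
    -- Here g + x a is a multiple of n, so g ≋ -x a; the factor n - 1 plays the role of -1.
    ... | Bézout.-+ x y eq = x * n-1 , ≋-cancelʳ (x * a) (≋-trans (≋-reflexive eq) (≋-trans (≋-kn 0 y) (≋-sym (≋-trans (≋-reflexive e) (≋-kn 0 (x * a))))))
      where
      e : x * n-1 * a + x * a ≡ x * a * n
      e = trans (ℕS.solve 3 (λ x y a → x ℕS.:* y ℕS.:* a ℕS.:+ x ℕS.:* a ℕS.:= x ℕS.:* a ℕS.:* (ℕS.con 1 ℕS.:+ y)) refl x n-1 a) (cong (x * a *_) 1+n-1)

    types : ∀ e → exponent (cycleType (rot a)) e ≡ power D g e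
    types = cycleType-rot {a} {g} {D} 0<g n≡Dg j (proj₁ multiple) a≋ (proj₂ multiple)

    zero-unless : ¬ HasExponents m (power D g) → fixed (rot a) ≡ 0
    zero-unless = fixed-zero (rot a) (power D g) types

    identity-value : D ≡ 1 → HasExponents m (power D g) → fixed (rot a) ≡ length (trees n-1)
    identity-value D≡1 h = trans (cong (fixed ∘ rot) a≡n) (fixed-value (rot n) (power D g) (λ e → trans (cong (λ a → exponent (cycleType (rot a)) e) (sym a≡n)) (types e)) identity-count h)
      where
      g≡n : g ≡ n
      g≡n = sym (trans n≡Dg (trans (cong (_* g) D≡1) (+-identityʳ g)))
      a≡n : a ≡ n
      a≡n = ≤-antisym (proj₂ (∈-1⋯n⁻ a∈)) (subst (_≤ a) g≡n (∣⇒≤ {{>-nonZero (proj₁ (∈-1⋯n⁻ a∈))}} (gcd[m,n]∣m a n)))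

    rotation-value : ∀ d → D ≡ suc (suc d) → HasExponents m (power D g) → ⟪ fixed (rot a) ⟫ ≡ Sch.rot g
    rotation-value d D≡ h = trans (cong ⟪_⟫ (fixed-value (rot a) (power D g) types (RotationCount.rotation-count n 2<n g 0<g d n≡ m {a} j (proj₁ multiple) a≋ (proj₂ multiple)) h))
      (RotationCount.card-codes n 2<n g 0<g d n≡)
      where
      n≡ : n ≡ suc (suc d) * g
      n≡ = trans n≡Dg (cong (_* g) D≡)

  rotSum : ℕ
  rotSum = sumL (fixed ∘ rot) 1⋯n

  sumL-zero : ∀ {A : Set} (f : A → ℕ) xs → (∀ {x} → x ∈ xs → f x ≡ 0) → sumL f xs ≡ 0
  sumL-zero f []       h = refl
  sumL-zero f (x ∷ xs) h = cong₂ _+_ (h (here refl)) (sumL-zero f xs (λ p → h (there p)))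

  ⟪sumL⟫ : ∀ {A : Set} (f : A → ℕ) (p : A → Bool) c xs → (∀ {x} → x ∈ xs → T (p x) → ⟪ f x ⟫ ≡ c) → (∀ {x} → x ∈ xs → ¬ T (p x) → f x ≡ 0) →
    ⟪ sumL f xs ⟫ ≡ ⟪ count p xs ⟫ ℚ.* c
  ⟪sumL⟫ f p c []       h h′ = sym (trans (cong (ℚ._* c) (⟪⟫-def 0)) (trans (ℚP.*-zeroˡ c) (sym (⟪⟫-def 0))))
  ⟪sumL⟫ f p c (x ∷ xs) h h′ with p x in eq
  ... | true  = trans (⟪⟫-+ (f x) (sumL f xs)) (trans (cong₂ ℚ._+_ (h (here refl) (subst T (sym eq) tt)) (⟪sumL⟫ f p c xs (λ q → h (there q)) (λ q → h′ (there q))))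
      (sym (trans (cong (ℚ._* c) (trans (⟪⟫-+ 1 (count p xs)) (cong (ℚ._+ ⟪ count p xs ⟫) (⟪⟫-def 1)))) (trans (ℚP.*-distribʳ-+ c 1ℚ ⟪ count p xs ⟫) (cong (ℚ._+ ⟪ count p xs ⟫ ℚ.* c) (ℚP.*-identityˡ c))))))
  ... | false = trans (cong (λ z → ⟪ z + sumL f xs ⟫) (h′ (here refl) (λ t → subst T eq t))) (⟪sumL⟫ f p c xs (λ q → h (there q)) (λ q → h′ (there q)))

  rotSum-no : (∀ e k → ¬ HasExponents m (power (suc e) (suc k))) → rotSum ≡ 0
  rotSum-no h = sumL-zero (fixed ∘ rot) 1⋯n (λ {a} a∈ → Rot.zero-unless a∈ (λ h′ → h (Rot.D a∈ ∸ 1) (Rot.g a∈ ∸ 1) (subst₂ (λ D g → HasExponents m (power D g)) (sym (D≡ a∈)) (sym (m+[n∸m]≡n (Rot.0<g a∈))) h′)))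
    where
    D≡ : ∀ {a} (a∈ : a ∈ 1⋯n) → suc (Rot.D a∈ ∸ 1) ≡ Rot.D a∈
    D≡ a∈ = m+[n∸m]≡n (n≢0⇒n>0 (λ e → <⇒≢ 0<n (sym (trans (Rot.n≡Dg a∈) (cong (_* Rot.g a∈) e)))))

  rotSum-other : weight m ≢ n → rotSum ≡ 0
  rotSum-other ne = sumL-zero (fixed ∘ rot) 1⋯n (λ {a} a∈ → Rot.zero-unless a∈ (λ h → ne (w (Rot.D a∈) (Rot.n≡Dg a∈) h)))
    where
    w : ∀ D {g} → n ≡ D * g → HasExponents m (power D g) → weight m ≡ n
    w zero    e h = ⊥-elim (<⇒≢ 0<n (sym e))
    w (suc D) e h = trans (weight-power {m} h) (sym e)

  -- The angles with gcd(a, n) = g are the products c g with 1 ≤ c ≤ D and c coprime to D.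
  totient-count : ∀ D g → 0 < g → n ≡ D * g → count (λ a → gcd a n ≡ᵇ g) 1⋯n ≡ totient D
  totient-count D g 0<g n≡ = sym (count-bij {p = λ c → gcd c D ≡ᵇ 1} {q = λ a → gcd a n ≡ᵇ g} (map suc (upTo D)) 1⋯n (UP.map⁺ suc-injective (UP.upTo⁺ D)) unique-1⋯n (_* g) (λ a → _/_ a g {{>-nonZero 0<g}})
    (λ {c} c∈ t → let (c≥ , c≤) = bounds c∈ in ∈1⋯ (c * g) (≤-trans 0<g (m≤n*m g c {{>-nonZero c≥}})) (subst (c * g ≤_) (sym n≡) (*-monoˡ-≤ g c≤))
      , ≡⇒≡ᵇ _ _ (trans (scale c) (trans (cong (g *_) (≡ᵇ⇒≡ (gcd c D) 1 t)) (*-identityʳ g))) , m*n/n≡m c g {{>-nonZero 0<g}})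
    (λ {a} a∈ t → back a a∈ (≡ᵇ⇒≡ (gcd a n) g t)))
    where
    bounds : ∀ {c} → c ∈ map suc (upTo D) → 1 ≤ c × c ≤ D
    bounds c∈ with ∈-map⁻ suc c∈
    ... | x , x∈ , refl = s≤s z≤n , ∈-upTo⁻ x∈
    ∈1⋯′ : ∀ N x → 1 ≤ x → x ≤ N → x ∈ map suc (upTo N)
    ∈1⋯′ N (suc x) _ le = ∈-map⁺ suc (∈-upTo⁺ le)
    ∈1⋯ : ∀ x → 1 ≤ x → x ≤ n → x ∈ 1⋯n
    ∈1⋯ = ∈1⋯′ n
    scale : ∀ c → gcd (c * g) n ≡ g * gcd c D
    scale c = trans (cong₂ gcd (*-comm c g) (trans n≡ (*-comm D g))) (sym (c*gcd[m,n]≡gcd[cm,cn] g c D))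
    back : ∀ a → a ∈ 1⋯n → gcd a n ≡ g → (_/_ a g {{>-nonZero 0<g}}) ∈ map suc (upTo D) × T (gcd (_/_ a g {{>-nonZero 0<g}}) D ≡ᵇ 1) × (_/_ a g {{>-nonZero 0<g}}) * g ≡ a
    back a a∈ e = go (subst (_∣ a) e (gcd[m,n]∣m a n))
      where
      go : g ∣ a → _
      go (divides c refl) = subst (λ q → q ∈ map suc (upTo D) × T (gcd q D ≡ᵇ 1) × q * g ≡ c * g) (sym (m*n/n≡m c g {{>-nonZero 0<g}}))
        ( ∈1⋯′ D c (n≢0⇒n>0 (λ { refl → n≮0 (proj₁ (∈-1⋯n⁻ a∈)) })) (*-cancelʳ-≤ c D g {{>-nonZero 0<g}} (subst (c * g ≤_) n≡ (proj₂ (∈-1⋯n⁻ a∈))))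
        , ≡⇒≡ᵇ _ _ (*-cancelˡ-≡ (gcd c D) 1 g {{>-nonZero 0<g}} (trans (sym (scale c)) (trans e (sym (*-identityʳ g)))))
        , refl )

  module _ (weight≡ : weight m ≡ n) where

    rotSum-power : ∀ {e k c} → HasExponents m (power (suc e) (suc k)) →
      (∀ {a} (a∈ : a ∈ 1⋯n) → Rot.D a∈ ≡ suc e → Rot.g a∈ ≡ suc k → HasExponents m (power (Rot.D a∈) (Rot.g a∈)) → ⟪ fixed (rot a) ⟫ ≡ c) →
      ⟪ rotSum ⟫ ≡ ⟪ totient (suc e) ⟫ ℚ.* c
    rotSum-power {e} {k} {c} h hc = trans (⟪sumL⟫ (fixed ∘ rot) (λ a → gcd a n ≡ᵇ suc k) c 1⋯n yes-case no-case) (cong (λ z → ⟪ z ⟫ ℚ.* c) (totient-count (suc e) (suc k) (s≤s z≤n) n≡))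
      where
      n≡ : n ≡ suc e * suc k
      n≡ = trans (sym weight≡) (weight-power {m} h)
      yes-case : ∀ {a} → a ∈ 1⋯n → T (gcd a n ≡ᵇ suc k) → ⟪ fixed (rot a) ⟫ ≡ c
      yes-case {a} a∈ t = hc a∈ D≡ g≡ (subst₂ (λ D g → HasExponents m (power D g)) (sym D≡) (sym g≡) h)
        where
        g≡ : Rot.g a∈ ≡ suc k
        g≡ = ≡ᵇ⇒≡ (gcd a n) (suc k) t
        D≡ : Rot.D a∈ ≡ suc e
        D≡ = *-cancelʳ-≡ (Rot.D a∈) (suc e) (suc k) (trans (cong (Rot.D a∈ *_) (sym g≡)) (trans (sym (Rot.n≡Dg a∈)) n≡))
      no-case : ∀ {a} → a ∈ 1⋯n → ¬ T (gcd a n ≡ᵇ suc k) → fixed (rot a) ≡ 0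
      no-case {a} a∈ ¬t = Rot.zero-unless a∈ (λ h′ → ¬t (≡⇒≡ᵇ _ _ (eq (Rot.D a∈) (gcd a n) (Rot.0<g a∈) (Rot.n≡Dg a∈) h′)))
        where
        eq : ∀ D g → 0 < g → n ≡ D * g → HasExponents m (power D g) → g ≡ suc k
        eq zero    g       _ e′ h′ = ⊥-elim (<⇒≢ 0<n (sym e′))
        eq (suc D) (suc g) _ e′ h′ = cong suc (sym (proj₂ (power-unique {m} h h′)))

    rotSum-none : (∀ e k → ¬ HasExponents m (power (suc e) (suc k))) → ⟪ n + n ⟫ ℚ.* rotPart m ≡ ⟪ rotSum ⟫
    rotSum-none ¬h = trans (cong (⟪ n + n ⟫ ℚ.*_) (rotPart-no m ¬h)) (trans (ℚP.*-zeroʳ ⟪ n + n ⟫) (sym (trans (cong ⟪_⟫ (rotSum-no ¬h)) (⟪⟫-def 0))))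

    rotSum-one : ∀ k → 0 < length m → HasExponents m (power 1 (suc k)) → ⟪ n + n ⟫ ℚ.* rotPart m ≡ ⟪ rotSum ⟫
    rotSum-one k lt h = trans (cong (⟪ n + n ⟫ ℚ.*_) (rotPart-1 {m} {k} lt h)) (trans (identity-term n-1 n (suc k) k (sym 1+n-1) n≡ refl)
        (sym (trans (rotSum-power {0} {k} {⟪ length (trees n-1) ⟫} h (λ a∈ D≡ _ h′ → cong ⟪_⟫ (Rot.identity-value a∈ D≡ h′))) (trans (cong (ℚ._* ⟪ length (trees n-1) ⟫) (⟪⟫-def 1)) (ℚP.*-identityˡ ⟪ length (trees n-1) ⟫)))))
      where
      n≡ : n ≡ suc k
      n≡ = trans (sym weight≡) (trans (weight-power {m} {0} {suc k} h) (+-identityʳ (suc k)))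

    rotSum-many : ∀ e k → suc e < length m → HasExponents m (power (suc (suc e)) (suc k)) → ⟪ n + n ⟫ ℚ.* rotPart m ≡ ⟪ rotSum ⟫
    rotSum-many e k lt h = trans (cong (⟪ n + n ⟫ ℚ.*_) (rotPart-2+ {m} {e} {k} lt h)) (trans (rotation-term (totient (suc (suc e))) e k (Sch.rot (suc k)) (trans (sym weight≡) (weight-power {m} {suc e} {suc k} h)))
        (sym (rotSum-power {suc e} {k} {Sch.rot (suc k)} h (λ a∈ D≡ g≡ h′ → trans (Rot.rotation-value a∈ e D≡ h′) (cong Sch.rot g≡)))))

    rotSum-value : ⟪ n + n ⟫ ℚ.* rotPart m ≡ ⟪ rotSum ⟫
    rotSum-value = go (isPower? m)
      where
      go : (∃[ e ] ∃[ k ] (e < length m × HasExponents m (power (suc e) (suc k)))) ⊎ (∀ e k → ¬ HasExponents m (power (suc e) (suc k))) → ⟪ n + n ⟫ ℚ.* rotPart m ≡ ⟪ rotSum ⟫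
      go (inj₂ ¬h)                    = rotSum-none ¬h
      go (inj₁ (zero  , k , lt , h))  = rotSum-one k lt h
      go (inj₁ (suc e , k , lt , h))  = rotSum-many e k lt h

  total : ℚ
  total = ΣQ (map term (filterᵇ disB (graphs n)))

  ⟪⟫-cancel : ∀ N → 0 < N → ∀ {x y} → x ℚ.* ⟪ N ⟫ ≡ y ℚ.* ⟪ N ⟫ → x ≡ y
  ⟪⟫-cancel (suc N) _ = *-cancelʳ-⟪⟫ N

  total-value : weight m ≡ n → total ≡ Sch.target m
  total-value e = ⟪⟫-cancel (n + n) (≤-trans 0<n (m≤m+n n n)) (trans zd-dihedral (trans (⟪⟫-+ rotSum refSum) (trans (sym (cong₂ ℚ._+_ (rotSum-value e) (refSum-value e)))
    (trans (sym (ℚP.*-distribˡ-+ ⟪ n + n ⟫ (rotPart m) (refPart m))) (trans (ℚP.*-comm ⟪ n + n ⟫ (rotPart m ℚ.+ refPart m)) (cong (ℚ._* ⟪ n + n ⟫) (sym (target-parts m))))))))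

  -- The cycle type of a permutation of n points has weight n, so dissections with n vertices do not
  -- contribute to other monomials.
  total-other : weight m ≢ n → total ≡ 0ℚ
  total-other ne = ⟪⟫-cancel (n + n) (≤-trans 0<n (m≤m+n n n)) (trans zd-dihedral (trans (cong ⟪_⟫ (cong₂ _+_ (rotSum-other ne) (refSum-other ne))) (trans (⟪⟫-def 0) (sym (ℚP.*-zeroˡ ⟪ n + n ⟫)))))

-- The single edge

edge₂ : Graph 2
edge₂ = (F.zero , F.suc F.zero) ∷ []

swap₂ id₂ : Vec (Fin 2) 2
id₂   = F.zero Vec.∷ F.suc F.zero Vec.∷ Vec.[]
swap₂ = F.suc F.zero Vec.∷ F.zero Vec.∷ Vec.[]

summand : Mono → ℕ → ℚ
summand m n = ΣQ (map (λ G → cycleIndex G m ℚ.* frac 1 (classSize G)) (filterᵇ (isDissection n) (graphs n)))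

dissections₂ : filterᵇ (isDissection 2) (graphs 2) ≡ [ edge₂ ]
dissections₂ = refl

autos₂ : autos edge₂ ≡ id₂ ∷ swap₂ ∷ []
autos₂ = refl

classSize₂ : classSize edge₂ ≡ 1
classSize₂ = refl

types₂ : map cycleType (id₂ ∷ swap₂ ∷ []) ≡ (2 ∷ 0 ∷ []) ∷ (0 ∷ 1 ∷ []) ∷ []
types₂ = refl

summand₂ : ∀ m → summand m 2 ≡ frac (count (λ c → sameMono c m) ((2 ∷ 0 ∷ []) ∷ (0 ∷ 1 ∷ []) ∷ [])) 2
summand₂ m = begin
  summand m 2
    ≡⟨ cong (λ Gs → ΣQ (map (λ G → cycleIndex G m ℚ.* frac 1 (classSize G)) Gs)) dissections₂ ⟩
  cycleIndex edge₂ m ℚ.* frac 1 (classSize edge₂) ℚ.+ 0ℚ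
    ≡⟨ trans (ℚP.+-identityʳ (cycleIndex edge₂ m ℚ.* frac 1 (classSize edge₂))) (trans (cong (λ c → cycleIndex edge₂ m ℚ.* frac 1 c) classSize₂) (ℚP.*-identityʳ (cycleIndex edge₂ m))) ⟩
  cycleIndex edge₂ m
    ≡⟨ cong (λ as → frac (count (λ σ → sameMono (cycleType σ) m) as) (length as)) autos₂ ⟩
  frac (count (λ σ → sameMono (cycleType σ) m) (id₂ ∷ swap₂ ∷ [])) 2
    ≡⟨ cong (λ c → frac c 2) (trans (sym (count-map (λ c → sameMono c m) cycleType (id₂ ∷ swap₂ ∷ []))) (cong (count (λ c → sameMono c m)) types₂)) ⟩
  frac (count (λ c → sameMono c m) ((2 ∷ 0 ∷ []) ∷ (0 ∷ 1 ∷ []) ∷ [])) 2 ∎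
  where open ≡-Reasoning

count-∷ : ∀ {A : Set} (p : A → Bool) x xs → count p (x ∷ xs) ≡ (if p x then 1 else 0) + count p xs
count-∷ p x xs with p x
... | true  = refl
... | false = refl

count-two : ∀ {A : Set} (p : A → Bool) x y → count p (x ∷ y ∷ []) ≡ (if p x then 1 else 0) + (if p y then 1 else 0)
count-two p x y = trans (count-∷ p x (y ∷ [])) (cong ((if p x then 1 else 0) +_) (trans (count-∷ p y []) (+-identityʳ (if p y then 1 else 0))))

rot-1 : Sch.rot 1 ≡ 1ℚ
rot-1 = trans (Σ<-suc 1 _) (trans (cong₂ ℚ._+_ (cong₂ ℚ._*_ (⟪⟫-def 1) (cong₂ ℚ._*_ (⟪⟫-def 1) (⟪⟫-def 1)))
  (trans (Σ<-suc 0 _) (cong₂ ℚ._+_ (cong₂ ℚ._*_ (⟪⟫-def 1) (cong₂ ℚ._*_ (⟪⟫-def 0) (⟪⟫-def 0))) (Σ<-0 _)))) refl)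

weight-step : ∀ i x m → suc i ≤ weightFrom i (suc x ∷ m)
weight-step i x m = ≤-trans (≤-reflexive (sym (*-identityʳ (suc i)))) (≤-trans (*-monoʳ-≤ (suc i) (s≤s (z≤n {x}))) (m≤m+n (suc i * suc x) (weightFrom (suc i) m)))

weightFrom-0∷ : ∀ i m → weightFrom i (0 ∷ m) ≡ weightFrom (suc i) m
weightFrom-0∷ i m = cong (_+ weightFrom (suc i) m) (*-zeroʳ (suc i))

weight-tail : ∀ i m → weightFrom i m ≤ i → ∀ e → exponent m e ≡ 0
weight-tail i []          le e       = refl
weight-tail i (suc x ∷ m) le e       = ⊥-elim (<⇒≱ (weight-step i x m) le)
weight-tail i (zero ∷ m)  le zero    = refl
weight-tail i (zero ∷ m)  le (suc e) = weight-tail (suc i) m (≤-trans (≤-reflexive (sym (weightFrom-0∷ i m))) (m≤n⇒m≤1+n le)) e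

no-power : ∀ m → (∀ e → exponent m e ≡ 0) → ∀ e k → ¬ HasExponents m (power (suc e) (suc k))
no-power m h e k h′ = 0≢1+n (trans (sym (h e)) (trans (h′ e) (power-yes (suc e) (suc k) e refl)))

zeros : ∀ m → (∀ e → exponent m e ≡ 0) → HasExponents m (power 1 0)
zeros m h zero    = h 0
zeros m h (suc e) = h (suc e)

frac-0 : ½ ℚ.* (⟪ 0 ⟫ ℚ.* 1ℚ) ≡ 0ℚ
frac-0 = cong (λ z → ½ ℚ.* (z ℚ.* 1ℚ)) (⟪⟫-def 0)

-- At s₁ the identity would contribute ½ w₀ = 0 and the reflection ½ R₀ = 0, in accordance with the
-- exclusion of the single vertex.
target-light : ∀ m → weight m < 2 → Sch.target m ≡ 0ℚ
target-light m lt = trans (target-parts m) (go m lt)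
  where
  go : ∀ m → weight m < 2 → rotPart m ℚ.+ refPart m ≡ 0ℚ
  go [] lt = cong₂ ℚ._+_ (rotPart-no [] (no-power [] (λ _ → refl))) refPart-[]
  go (suc (suc i) ∷ m) lt = ⊥-elim (<⇒≱ lt (≤-trans (s≤s (s≤s z≤n)) (m≤m+n (suc (suc i) + 0) (weightFrom 1 m))))
  go (zero ∷ m) lt = cong₂ ℚ._+_ (rotPart-no (0 ∷ m) (no-power (0 ∷ m) (λ { zero → refl ; (suc e) → h e })))
      (trans (refPart-0 m) (trans (cong (¼ ℚ.*_) (trans (ι-yes 0 (card trees) m {0} (zeros m h)) (⟪⟫-def 0))) (ℚP.*-zeroʳ ¼)))
    where
    h : ∀ e → exponent m e ≡ 0
    h = weight-tail 1 m (s≤s⁻¹ lt)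
  go (suc zero ∷ m) lt = cong₂ ℚ._+_ (trans (rotPart-1 {1 ∷ m} {0} (s≤s z≤n) (λ { zero → refl ; (suc e) → h e })) frac-0)
      (trans (refPart-1 m) (trans (cong (½ ℚ.*_) (ι-yes 0 Sch.R m {0} (zeros m h))) (ℚP.*-zeroʳ ½)))
    where
    h : ∀ e → exponent m e ≡ 0
    h = weight-tail 1 m (≤-trans (s≤s⁻¹ (s≤s⁻¹ lt)) z≤n)

edge-types : Mono → ℕ
edge-types m = count (λ c → sameMono c m) ((2 ∷ 0 ∷ []) ∷ (0 ∷ 1 ∷ []) ∷ [])

indicator-yes : ∀ a m → T (sameMono a m) → (if sameMono a m then 1 else 0) ≡ 1
indicator-yes a m t = cong (if_then 1 else 0) (Equivalence.to T-≡ t)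

indicator-no : ∀ a m → ¬ T (sameMono a m) → (if sameMono a m then 1 else 0) ≡ 0
indicator-no a m ¬t = cong (if_then 1 else 0) (T-ext (λ t → ⊥-elim (¬t t)) (λ ()))

edge-s₁² : ∀ m → HasExponents m (exponent (2 ∷ 0 ∷ [])) → edge-types m ≡ 1
edge-s₁² m h = trans (count-two (λ c → sameMono c m) (2 ∷ 0 ∷ []) (0 ∷ 1 ∷ [])) (cong₂ _+_ (indicator-yes (2 ∷ 0 ∷ []) m (sameMono⁺ (2 ∷ 0 ∷ []) m h))
  (indicator-no (0 ∷ 1 ∷ []) m (λ t → 0≢1+n (trans (sym (sameMono⁻ (0 ∷ 1 ∷ []) m t 0)) (h 0)))))

edge-s₂ : ∀ m → HasExponents m (exponent (0 ∷ 1 ∷ [])) → edge-types m ≡ 1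
edge-s₂ m h = trans (count-two (λ c → sameMono c m) (2 ∷ 0 ∷ []) (0 ∷ 1 ∷ [])) (cong₂ _+_
  (indicator-no (2 ∷ 0 ∷ []) m (λ t → 1+n≢0 (trans (sym (sameMono⁻ (2 ∷ 0 ∷ []) m t 0)) (h 0)))) (indicator-yes (0 ∷ 1 ∷ []) m (sameMono⁺ (0 ∷ 1 ∷ []) m h)))

target-s₁² : ∀ m → (∀ e → exponent m e ≡ 0) → rotPart (2 ∷ m) ℚ.+ refPart (2 ∷ m) ≡ ½
target-s₁² m h = cong₂ ℚ._+_
  (trans (rotPart-1 {2 ∷ m} {1} (s≤s z≤n) (λ { zero → refl ; (suc e) → h e })) (cong (λ z → ½ ℚ.* (z ℚ.* (ℤ.+ 1 ℚ./ 2))) (⟪⟫-def 1)))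
  (trans (refPart-2 m) (cong (¼ ℚ.*_) (trans (ι-yes 0 Sch.R′ m {0} (zeros m h)) (⟪⟫-def 1))))

target-s₂ : ∀ m → (∀ e → exponent m e ≡ 0) → rotPart (0 ∷ 1 ∷ m) ℚ.+ refPart (0 ∷ 1 ∷ m) ≡ ½
target-s₂ m h = cong₂ ℚ._+_
  (trans (rotPart-2+ {0 ∷ 1 ∷ m} {0} {0} (s≤s (s≤s z≤n)) (λ { zero → refl ; (suc zero) → refl ; (suc (suc e)) → h e })) (cong (λ z → (½ ℚ.* (ℤ.+ 1 ℚ./ 2)) ℚ.* (z ℚ.* 1ℚ)) rot-1))
  (trans (refPart-0 (1 ∷ m)) (cong (¼ ℚ.*_) (trans (ι-yes 0 (card trees) (1 ∷ m) {1} (λ { zero → refl ; (suc e) → h e })) (⟪⟫-def 1))))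

-- Both s₁² and s₂ have coefficient ½. On the side of the formula it is ¼ from a rotation plus ¼
-- from a reflection: each of the two automorphisms of K₂ is counted twice, with 2n = 4.
target-2 : ∀ m → weight m ≡ 2 → summand m 2 ≡ Sch.target m
target-2 m w = trans (summand₂ m) (sym (trans (target-parts m) (go m w)))
  where
  half : ∀ {c x} → c ≡ 1 → x ≡ ½ → x ≡ frac c 2
  half refl refl = refl
  go : ∀ m → weight m ≡ 2 → rotPart m ℚ.+ refPart m ≡ frac (edge-types m) 2
  go []                        ()
  go (suc (suc (suc i)) ∷ m)   ()
  go (suc (suc zero) ∷ m)      w = half (edge-s₁² (2 ∷ m) (λ { zero → refl ; (suc zero) → h 0 ; (suc (suc e)) → h (suc e) })) (target-s₁² m h)
    where
    h : ∀ e → exponent m e ≡ 0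
    h = weight-tail 1 m (≤-trans (≤-reflexive (suc-injective (suc-injective w))) z≤n)
  go (suc zero ∷ [])           ()
  go (suc zero ∷ zero ∷ m)     w = ⊥-elim (1+n≢0 (trans (sym (suc-injective w)) (weightFrom-0 2 m (weight-tail 2 m (≤-trans (≤-reflexive (suc-injective w)) (s≤s z≤n))))))
  go (suc zero ∷ suc x ∷ m)    w = ⊥-elim (<⇒≱ (weight-step 1 x m) (≤-reflexive (suc-injective w)))
  go (zero ∷ [])               ()
  go (zero ∷ zero ∷ m)         w = ⊥-elim (1+n≢0 (trans (sym w) (weightFrom-0 2 m (weight-tail 2 m (≤-reflexive w)))))
  go (zero ∷ suc zero ∷ m)     w = half (edge-s₂ (0 ∷ 1 ∷ m) (λ { zero → refl ; (suc zero) → refl ; (suc (suc e)) → h e })) (target-s₂ m h)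
    where
    h : ∀ e → exponent m e ≡ 0
    h = weight-tail 2 m (≤-trans (≤-reflexive (suc-injective (suc-injective w))) z≤n)
  go (zero ∷ suc (suc x) ∷ m)  w = ⊥-elim (<⇒≢ (≤-trans (n≤1+n 3) (≤-trans (*-monoʳ-≤ 2 (s≤s (s≤s (z≤n {x})))) (m≤m+n (2 * suc (suc x)) (weightFrom 2 m)))) (sym w))

summand-small : ∀ m n → n < 2 → summand m n ≡ 0ℚ
summand-small m zero          lt = refl
summand-small m (suc zero)    lt = refl
summand-small m (suc (suc n)) (s≤s (s≤s ()))

summand-other : ∀ m n → weight m ≢ n → summand m n ≡ 0ℚ
summand-other m zero                ne = refl
summand-other m (suc zero)          ne = refl
summand-other m (suc (suc zero))    ne = trans (summand₂ m) (cong (λ c → frac c 2) (count-none (λ c → sameMono c m) ((2 ∷ 0 ∷ []) ∷ (0 ∷ 1 ∷ []) ∷ [])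
  (λ { (here refl) t → ne (weightFrom-exponent 0 (2 ∷ 0 ∷ []) m (sameMono⁻ (2 ∷ 0 ∷ []) m t)) ; (there (here refl)) t → ne (weightFrom-exponent 0 (0 ∷ 1 ∷ []) m (sameMono⁻ (0 ∷ 1 ∷ []) m t)) })))
summand-other m (suc (suc (suc n))) ne = Coefficient.total-other (suc (suc (suc n))) (s≤s (s≤s (s≤s z≤n))) m ne

summand-weight : ∀ m n → weight m ≡ n → summand m n ≡ Sch.target m
summand-weight m zero                e = trans (summand-small m 0 (s≤s z≤n)) (sym (target-light m (subst (_< 2) (sym e) (s≤s z≤n))))
summand-weight m (suc zero)          e = trans (summand-small m 1 (s≤s (s≤s z≤n))) (sym (target-light m (subst (_< 2) (sym e) (s≤s (s≤s z≤n)))))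
summand-weight m (suc (suc zero))    e = target-2 m e
summand-weight m (suc (suc (suc n))) e = Coefficient.total-value (suc (suc (suc n))) (s≤s (s≤s (s≤s z≤n))) m e

-- The two sides compared.

ZD≈target : ZD ≈ Sch.target
ZD≈target m = trans (sym (ΣL-def (upTo (suc (weight m))) (summand m))) (trans (ΣL-upTo (suc (weight m)) (summand m))
  (trans (Σ<-single (suc (weight m)) (summand m) (weight m) (n<1+n _) (λ n ne → summand-other m n (λ e → ne (sym e)))) (summand-weight m (weight m) refl)))

theorem9 : (m : Mono) → ∃[ N ] ((N′ : ℕ) → N ≤ N′ → lhsTimes16s2² m ≡ rhsTimes16s2² N′ m)
-- Variables beyond the length of `m` have exponent 0 in `m` and in all its divisors, so further
-- logarithms contribute nothing.
theorem9 m = length m , λ N′ le → trans (cong (q (ℤ.+ 16) ℚ.*_) (trans (mulS-≈ {powS s2 2} reflS ZD≈target m) (sym (mulS-≈ {powS s2 2} {powS s2 2} {Sch.target} {Sch.target} reflS reflS m)))) (Sch.target-identity m N′ le)
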